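{- Let $k$ be a positive integer. Suppose the real numbers $\sigma$ and $\delta$ are chosen according to one of the following alternatives: (1) $\sigma\geq \frac{\sqrt{2}+1}{\sqrt{3}}$ and $\delta=2+\sigma+\frac{1}{3\sigma}$; (2) $\sigma = \frac{1}{3}\sqrt{\frac{5}{2}}$ and $\delta = 2+\frac{11}{3}\sqrt{\frac{1}{10}}$; (3) $\sigma = 0.2$ and $\delta=3.109$. Then every finite graph $G$ with average degree $\frac{2|E(G)|}{|V(G)|}\geq \delta k-1$ has a $(k+1)$-connected subgraph on more than $(1+\sigma)k$ vertices.
   Context: Graphs are finite and simple. A graph is $(k+1)$-connected if it has more than $k+1$ vertices and remains connected after deleting any set of at most $k$ vertices. -}

module Defs where

open import Data.Nat as ℕ using (ℕ; zero; suc; _<ᵇ_)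
open import Data.Bool using (Bool; true; false; if_then_else_; _∧_)
open import Data.Fin using (Fin; zero; suc; toℕ)
open import Data.Fin.Subset using (Subset; _∈_; _∉_; ∣_∣)
open import Data.Product using (Σ; _×_; _,_; ∃)
open import Data.Sum using (_⊎_)
open import Data.Empty using (⊥)
open import Relation.Nullary using (¬_)
open import Relation.Binary.PropositionalEquality using (_≡_; _≢_)
open import Function.Definitions using (Injective)

-- The real numbers, axiomatised as a complete ordered field
-- (with a square-root operation on non-negative elements, which exists
-- in any complete ordered field).  Quantifying over all models of this
-- record is (classically) the same as speaking about ℝ, since complete
-- ordered fields are unique up to isomorphism.

record RealField : Set₁ where
  infixl 6 _+_
  infixl 7 _*_
  infix 4 _<_
  infix 8 _⁻¹
  infix 9 -_
  field
    Carrier : Set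
    0r 1r   : Carrier
    _+_ _*_ : Carrier → Carrier → Carrier
    -_      : Carrier → Carrier
    _⁻¹     : Carrier → Carrier
    _<_     : Carrier → Carrier → Set
    sqrt    : Carrier → Carrier
    +-assoc  : ∀ x y z → (x + y) + z ≡ x + (y + z)
    +-comm   : ∀ x y → x + y ≡ y + x
    +-identʳ : ∀ x → x + 0r ≡ x
    +-invʳ   : ∀ x → x + (- x) ≡ 0r
    *-assoc  : ∀ x y z → (x * y) * z ≡ x * (y * z)
    *-comm   : ∀ x y → x * y ≡ y * x
    *-identʳ : ∀ x → x * 1r ≡ x
    *-invʳ   : ∀ x → x ≢ 0r → x * (x ⁻¹) ≡ 1r
    distribˡ : ∀ x y z → x * (y + z) ≡ x * y + x * z
    0≢1      : 0r ≢ 1r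
    <-irrefl : ∀ x → ¬ (x < x)
    <-trans  : ∀ {x y z} → x < y → y < z → x < z
    <-tri    : ∀ x y → x < y ⊎ (x ≡ y ⊎ y < x)
    <-+      : ∀ {x y} z → x < y → x + z < y + z
    <-*      : ∀ {x y} → 0r < x → 0r < y → 0r < x * y
    lub : (P : Carrier → Set) → (∃ λ x → P x) →
          (∃ λ b → ∀ x → P x → (x < b ⊎ x ≡ b)) →
          ∃ λ s → (∀ x → P x → (x < s ⊎ x ≡ s)) ×
                  (∀ b → (∀ x → P x → (x < b ⊎ x ≡ b)) → (s < b ⊎ s ≡ b))
    sqrt-nonneg : ∀ x → (0r < x ⊎ 0r ≡ x) → (0r < sqrt x ⊎ 0r ≡ sqrt x)
    sqrt-sq     : ∀ x → (0r < x ⊎ 0r ≡ x) → sqrt x * sqrt x ≡ x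

module _ (R : RealField) where
  open RealField R

  infix 4 _≤r_
  infixl 6 _-r_
  _≤r_ : Carrier → Carrier → Set
  x ≤r y = x < y ⊎ x ≡ y

  _-r_ : Carrier → Carrier → Carrier
  x -r y = x + (- y)

  ι : ℕ → Carrier
  ι zero    = 0r
  ι (suc n) = 1r + ι n

  Alternatives : Carrier → Carrier → Set
  Alternatives σ δ =
      (((sqrt (ι 2) + 1r) * (sqrt (ι 3)) ⁻¹ ≤r σ) ×
         (δ ≡ ι 2 + σ + (ι 3 * σ) ⁻¹))
    ⊎ (
        (σ ≡ (ι 3) ⁻¹ * sqrt (ι 5 * (ι 2) ⁻¹)) ×
        (δ ≡ ι 2 + ι 11 * (ι 3) ⁻¹ * sqrt ((ι 10) ⁻¹))
    ⊎
        ((σ ≡ (ι 5) ⁻¹) × (δ ≡ ι 3109 * (ι 1000) ⁻¹)))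

  AvgDegreeAtLeast : ℕ → ℕ → Carrier → Set
  AvgDegreeAtLeast twoE nV bound = bound ≤r ι twoE * (ι nV) ⁻¹

record Graph (n : ℕ) : Set where
  field
    adj     : Fin n → Fin n → Bool
    sym     : ∀ i j → adj i j ≡ adj j i
    irrefl  : ∀ i → adj i i ≡ false

open Graph public

sumF : ∀ {n} → (Fin n → ℕ) → ℕ
sumF {zero}  f = 0
sumF {suc n} f = f zero ℕ.+ sumF (λ i → f (suc i))

countF : ∀ {n} → (Fin n → Bool) → ℕ
countF f = sumF (λ i → if f i then 1 else 0)

numEdges : ∀ {n} → Graph n → ℕ
numEdges G = sumF (λ i → countF (λ j → (toℕ i <ᵇ toℕ j) ∧ adj G i j))

SubgraphVia : ∀ {m n} → Graph m → Graph n → (Fin m → Fin n) → Set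
SubgraphVia H G f = Injective _≡_ _≡_ f ×
  (∀ i j → adj H i j ≡ true → adj G (f i) (f j) ≡ true)

data Reach {m} (H : Graph m) (X : Subset m) : Fin m → Fin m → Set where
  here : ∀ {u} → Reach H X u u
  step : ∀ {u w v} → adj H u w ≡ true → w ∉ X → Reach H X w v → Reach H X u v

Connected : ℕ → ∀ {m} → Graph m → Set
Connected c {m} H = (c ℕ.< m) ×
  (∀ (X : Subset m) → ∣ X ∣ ℕ.< c → ∀ u v → u ∉ X → v ∉ X → Reach H X u v)

{-# OPTIONS --safe #-}
module Submission where

-- Let f(X) = e(X) - δ k (∣X∣ - k), where e(X) counts the ordered pairs of equal or adjacent vertices of X.  If no
-- subgraph is as required, then every large X splits as A ∪ B with ∣A ∩ B∣ = k and no edge between A \ B and B \ A,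
-- so that f(X) ≤ f(A) + f(B) - e(A ∩ B).  An induction that bounds f alone loses e(A ∩ B), so a stronger claim is carried.
-- Alternatives (1) and (2): X has a partial colouring such that f stays small even when all pairs of equal colour are
-- counted as edges; by Cauchy-Schwarz the colour classes force many counted pairs inside every separator.
-- Alternative (3): f(X) ≤ e(S) / 2 + L + κ (1 - ∣S∣ / k) for all S ⊆ X with ∣S∣ ≤ k, where L and κ are piecewise linear
-- in ∣X∣ / k.  The numerical steps of (2) and (3) are Positivstellensatz certificates, checked by reflection.

open import Defs hiding (sym)
open import Data.Nat as ℕ using (ℕ; zero; suc; z≤n; s≤s)
import Data.Nat.Properties as ℕₚ
open import Data.Integer as ℤ using (ℤ; -[1+_]) renaming (+_ to pos)
import Data.Integer.Properties as ℤₚ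
import Data.Sign as Sign
open import Data.Bool using (Bool; true; false; if_then_else_; _∧_; _∨_; not; T)
open import Data.Fin using (Fin; zero; suc; toℕ)
import Data.Fin.Properties as Finₚ
open import Data.Fin.Subset using (Subset; _∈_; _∉_; ∣_∣)
open import Data.Vec using (Vec; []; _∷_; lookup; tabulate)
import Data.Vec.Properties as Vecₚ
open import Data.List using (List; []; _∷_; _++_; map; length)
import Data.List.Properties as Listₚ
import Data.Product.Properties as Productₚ
open import Data.List.Relation.Unary.All using (All; []; _∷_)
open import Data.Maybe using (Maybe; just; nothing)
open import Data.Product using (Σ; _×_; _,_; ∃; proj₁; proj₂)
open import Data.Sum using (_⊎_; inj₁; inj₂; [_,_]′)
open import Data.Empty using (⊥; ⊥-elim)
open import Data.Unit using (⊤; tt)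
open import Relation.Nullary using (¬_; Dec; yes; no)
open import Relation.Binary.PropositionalEquality
  using (_≡_; _≢_; refl; sym; trans; cong; cong₂; subst; subst₂; isEquivalence; module ≡-Reasoning)
open import Function using (_∘_; case_of_)
open import Algebra.Bundles using (CommutativeRing)
open import Algebra.Structures using (IsCommutativeRing)
import Algebra.Solver.Ring as RingSolver
open import Algebra.Solver.Ring.AlmostCommutativeRing
  using (AlmostCommutativeRing; fromCommutativeRing; _-Raw-AlmostCommutative⟶_)

-- The factor in the coloured claim is forced. With M colours and d uncoloured vertices it reads f ≤
-- c (k - d)² / M, where (k - d)² / M is the number of counted pairs that Cauchy-Schwarz guarantees
-- among any k vertices. Gluing two equal one-coloured sides needs 2c - 1 ≤ c / 2, so c = 2/3 is the
-- best constant. A complete set with |X| - k = a has f = k² - a ((δ - 2) k - a), which is at most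
-- 2k² / 3 exactly between the roots of a ((δ - 2) k - a) = k² / 3. For δ - 2 = σ + 1 / (3σ) the
-- roots are σ k and k / (3σ). In (1) the smaller root is k / (3σ), so a set between the roots needs
-- no separation and takes a single colour. In (2) the relation between σ and δ is the same, but σ²
-- = 5/18 makes σ k the smaller root: certificates start only at |X| - k = 2σ k and are assembled
-- from the pieces of a decomposition. In (3) the weight 1/2 lets the bounds of the two sides, both
-- taken at S = A ∩ B, use up e(A ∩ B) exactly; what remains is L(A) + L(B), negative for two large
-- sides. The escape f ≤ 0 stays beside every claim, and density makes f of the whole graph at least
-- δ k².

module Reals (R : RealField) where
  open RealField R public
    renaming (_+_ to infixl 6 _+_; _*_ to infixl 7 _*_; -_ to infix 9 -_; _<_ to infix 4 _<_)
    hiding (_⁻¹; *-invʳ)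
  open RealField R public using (_⁻¹; *-invʳ)

  infix 4 _≤_
  infixl 6 _-_
  _≤_ : Carrier → Carrier → Set
  _≤_ = _≤r_ R

  _-_ : Carrier → Carrier → Carrier
  _-_ = _-r_ R

  ⟦_⟧ : ℕ → Carrier
  ⟦_⟧ = ι R

  -- The real field as a commutative ring, with a solver over integer coefficients

  +-identˡ : ∀ x → 0r + x ≡ x
  +-identˡ x = trans (+-comm 0r x) (+-identʳ x)

  +-invˡ : ∀ x → - x + x ≡ 0r
  +-invˡ x = trans (+-comm (- x) x) (+-invʳ x)

  distribʳ : ∀ x y z → (y + z) * x ≡ y * x + z * x
  distribʳ x y z = trans (*-comm (y + z) x) (trans (distribˡ x y z) (cong₂ _+_ (*-comm x y) (*-comm x z)))

  isCommutativeRing : IsCommutativeRing _≡_ _+_ _*_ (λ x → - x) 0r 1r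
  isCommutativeRing = record
    { isRing = record
      { +-isAbelianGroup = record
        { isGroup = record
          { isMonoid = record
            { isSemigroup = record
              { isMagma = record { isEquivalence = isEquivalence ; ∙-cong = cong₂ _+_ }
              ; assoc = +-assoc }
            ; identity = +-identˡ , +-identʳ }
          ; inverse = +-invˡ , +-invʳ
          ; ⁻¹-cong = cong (λ t → - t) }
        ; comm = +-comm }
      ; *-cong = cong₂ _*_
      ; *-assoc = *-assoc
      ; *-identity = (λ x → trans (*-comm 1r x) (*-identʳ x)) , *-identʳ
      ; distrib = distribˡ , distribʳ }
    ; *-comm = *-comm }

  commutativeRing : CommutativeRing _ _
  commutativeRing = record { isCommutativeRing = isCommutativeRing }

  private
    module CR = CommutativeRing commutativeRing
  open import Algebra.Properties.Ring CR.ring using (-‿distribˡ-*; -‿distribʳ-*; -‿involutive; -‿+-comm; -0#≈0#)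

  zeroˡ : ∀ x → 0r * x ≡ 0r
  zeroˡ = CR.zeroˡ

  zeroʳ : ∀ x → x * 0r ≡ 0r
  zeroʳ = CR.zeroʳ

  *-identˡ : ∀ x → 1r * x ≡ x
  *-identˡ = CR.*-identityˡ

  ι-+ : ∀ m n → ⟦ m ℕ.+ n ⟧ ≡ ⟦ m ⟧ + ⟦ n ⟧
  ι-+ zero n = sym (+-identˡ _)
  ι-+ (suc m) n = trans (cong (1r +_) (ι-+ m n)) (sym (+-assoc _ _ _))

  ι-* : ∀ m n → ⟦ m ℕ.* n ⟧ ≡ ⟦ m ⟧ * ⟦ n ⟧
  ι-* zero n = sym (zeroˡ _)
  ι-* (suc m) n = trans (ι-+ n (m ℕ.* n))
    (trans (cong₂ _+_ (sym (CR.*-identityˡ _)) (ι-* m n)) (sym (distribʳ _ _ _)))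

  ι-1 : ⟦ 1 ⟧ ≡ 1r
  ι-1 = +-identʳ 1r

  ⟪_⟫ : ℤ → Carrier
  ⟪ pos n ⟫ = ⟦ n ⟧
  ⟪ -[1+ n ] ⟫ = - ⟦ suc n ⟧

  ⟪⟫-neg : ∀ z → ⟪ ℤ.- z ⟫ ≡ - ⟪ z ⟫
  ⟪⟫-neg (pos zero) = sym -0#≈0#
  ⟪⟫-neg (pos (suc n)) = refl
  ⟪⟫-neg -[1+ n ] = sym (-‿involutive _)

  ⟪⟫-⊖ : ∀ m n → ⟪ m ℤ.⊖ n ⟫ ≡ ⟦ m ⟧ + - ⟦ n ⟧
  ⟪⟫-⊖ m zero = sym (trans (cong (⟦ m ⟧ +_) -0#≈0#) (+-identʳ _))
  ⟪⟫-⊖ zero (suc n) = sym (+-identˡ _)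
  ⟪⟫-⊖ (suc m) (suc n) = trans (cong ⟪_⟫ (ℤₚ.[1+m]⊖[1+n]≡m⊖n m n)) (trans (⟪⟫-⊖ m n) (sym lem))
    where
    lem : (1r + ⟦ m ⟧) + - (1r + ⟦ n ⟧) ≡ ⟦ m ⟧ + - ⟦ n ⟧
    lem = begin
      (1r + ⟦ m ⟧) + - (1r + ⟦ n ⟧)          ≡⟨ cong₂ _+_ (+-comm 1r ⟦ m ⟧) (sym (-‿+-comm 1r ⟦ n ⟧)) ⟩
      (⟦ m ⟧ + 1r) + (- 1r + - ⟦ n ⟧)        ≡⟨ +-assoc _ _ _ ⟩
      ⟦ m ⟧ + (1r + (- 1r + - ⟦ n ⟧))        ≡⟨ cong (⟦ m ⟧ +_) (sym (+-assoc _ _ _)) ⟩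
      ⟦ m ⟧ + ((1r + - 1r) + - ⟦ n ⟧)        ≡⟨ cong (λ t → ⟦ m ⟧ + (t + - ⟦ n ⟧)) (+-invʳ 1r) ⟩
      ⟦ m ⟧ + (0r + - ⟦ n ⟧)                 ≡⟨ cong (⟦ m ⟧ +_) (+-identˡ _) ⟩
      ⟦ m ⟧ + - ⟦ n ⟧ ∎
      where open ≡-Reasoning

  ⟪⟫-+ : ∀ x y → ⟪ x ℤ.+ y ⟫ ≡ ⟪ x ⟫ + ⟪ y ⟫
  ⟪⟫-+ (pos m) (pos n) = ι-+ m n
  ⟪⟫-+ (pos m) -[1+ n ] = ⟪⟫-⊖ m (suc n)
  ⟪⟫-+ -[1+ m ] (pos n) = trans (⟪⟫-⊖ n (suc m)) (+-comm _ _)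
  ⟪⟫-+ -[1+ m ] -[1+ n ] = trans (cong (λ t → - ⟦ suc t ⟧) (sym (ℕₚ.+-suc m n)))
    (trans (cong (λ t → - t) (ι-+ (suc m) (suc n))) (sym (-‿+-comm _ _)))

  ⟪⟫-* : ∀ x y → ⟪ x ℤ.* y ⟫ ≡ ⟪ x ⟫ * ⟪ y ⟫
  ⟪⟫-* (pos m) (pos n) = trans (cong ⟪_⟫ (sym (ℤₚ.pos-* m n))) (ι-* m n)
  ⟪⟫-* (pos m) -[1+ n ] = begin
    ⟪ pos m ℤ.* -[1+ n ] ⟫          ≡⟨ cong ⟪_⟫ (sym (ℤₚ.neg-distribʳ-* (pos m) (pos (suc n)))) ⟩
    ⟪ ℤ.- (pos m ℤ.* pos (suc n)) ⟫     ≡⟨ ⟪⟫-neg (pos m ℤ.* pos (suc n)) ⟩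
    - ⟪ pos m ℤ.* pos (suc n) ⟫         ≡⟨ cong (λ t → - ⟪ t ⟫) (sym (ℤₚ.pos-* m (suc n))) ⟩
    - ⟦ m ℕ.* suc n ⟧             ≡⟨ cong (λ t → - t) (ι-* m (suc n)) ⟩
    - (⟦ m ⟧ * ⟦ suc n ⟧)         ≡⟨ -‿distribʳ-* _ _ ⟩
    ⟦ m ⟧ * - ⟦ suc n ⟧ ∎
    where open ≡-Reasoning
  ⟪⟫-* -[1+ m ] (pos n) = begin
    ⟪ -[1+ m ] ℤ.* pos n ⟫          ≡⟨ cong ⟪_⟫ (sym (ℤₚ.neg-distribˡ-* (pos (suc m)) (pos n))) ⟩
    ⟪ ℤ.- (pos (suc m) ℤ.* pos n) ⟫     ≡⟨ ⟪⟫-neg (pos (suc m) ℤ.* pos n) ⟩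
    - ⟪ pos (suc m) ℤ.* pos n ⟫         ≡⟨ cong (λ t → - ⟪ t ⟫) (sym (ℤₚ.pos-* (suc m) n)) ⟩
    - ⟦ suc m ℕ.* n ⟧             ≡⟨ cong (λ t → - t) (ι-* (suc m) n) ⟩
    - (⟦ suc m ⟧ * ⟦ n ⟧)         ≡⟨ -‿distribˡ-* _ _ ⟩
    - ⟦ suc m ⟧ * ⟦ n ⟧ ∎
    where open ≡-Reasoning
  ⟪⟫-* -[1+ m ] -[1+ n ] = begin
    ⟦ suc m ℕ.* suc n ⟧           ≡⟨ ι-* (suc m) (suc n) ⟩
    ⟦ suc m ⟧ * ⟦ suc n ⟧         ≡⟨ sym (-‿involutive _) ⟩
    - - (⟦ suc m ⟧ * ⟦ suc n ⟧)   ≡⟨ cong (λ t → - t) (-‿distribˡ-* _ _) ⟩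
    - (- ⟦ suc m ⟧ * ⟦ suc n ⟧)   ≡⟨ -‿distribʳ-* _ _ ⟩
    - ⟦ suc m ⟧ * - ⟦ suc n ⟧ ∎
    where open ≡-Reasoning

  almostRing : AlmostCommutativeRing _ _
  almostRing = fromCommutativeRing commutativeRing

  -- Integer coefficients have decidable equality, unlike elements of `Carrier`. Over them the
  -- solver cancels terms and evaluates numerals, so polynomial identities with large constants are
  -- closed by `refl`.
  ⟪⟫-morphism : CommutativeRing.rawRing ℤₚ.+-*-commutativeRing -Raw-AlmostCommutative⟶ almostRing
  ⟪⟫-morphism = record
    { ⟦_⟧ = ⟪_⟫ ; +-homo = ⟪⟫-+ ; *-homo = ⟪⟫-* ; -‿homo = ⟪⟫-neg ; 0-homo = refl ; 1-homo = ι-1 }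

  private
    _≟c_ : ∀ x y → Maybe (⟪ x ⟫ ≡ ⟪ y ⟫)
    x ≟c y with x ℤ.≟ y
    ... | yes eq = just (cong ⟪_⟫ eq)
    ... | no _ = nothing

  module Solve = RingSolver (CommutativeRing.rawRing ℤₚ.+-*-commutativeRing) almostRing ⟪⟫-morphism _≟c_
  open Solve public using (solve; _:=_; _:+_; _:*_; _:-_; :-_; con)

  -- Order, numerals and cancellation of positive factors

  ≤-refl : ∀ {x} → x ≤ x
  ≤-refl = inj₂ refl

  ≤-reflexive : ∀ {x y} → x ≡ y → x ≤ y
  ≤-reflexive = inj₂

  ≤-trans : ∀ {x y z} → x ≤ y → y ≤ z → x ≤ z
  ≤-trans (inj₁ p) (inj₁ q) = inj₁ (<-trans p q)
  ≤-trans (inj₁ p) (inj₂ refl) = inj₁ p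
  ≤-trans (inj₂ refl) q = q

  <-≤-trans : ∀ {x y z} → x < y → y ≤ z → x < z
  <-≤-trans p (inj₁ q) = <-trans p q
  <-≤-trans p (inj₂ refl) = p

  ≤-<-trans : ∀ {x y z} → x ≤ y → y < z → x < z
  ≤-<-trans (inj₁ p) q = <-trans p q
  ≤-<-trans (inj₂ refl) q = q

  <⇒≤ : ∀ {x y} → x < y → x ≤ y
  <⇒≤ = inj₁

  ≤⇒≯ : ∀ {x y} → x ≤ y → ¬ (y < x)
  ≤⇒≯ p q = <-irrefl _ (≤-<-trans p q)

  <-≤-connex : ∀ x y → x < y ⊎ y ≤ x
  <-≤-connex x y with <-tri x y
  ... | inj₁ p = inj₁ p
  ... | inj₂ (inj₁ refl) = inj₂ ≤-refl
  ... | inj₂ (inj₂ p) = inj₂ (inj₁ p)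

  ≤-total : ∀ x y → x ≤ y ⊎ y ≤ x
  ≤-total x y with <-≤-connex x y
  ... | inj₁ p = inj₁ (inj₁ p)
  ... | inj₂ p = inj₂ p

  +-monoʳ-≤ : ∀ z {x y} → x ≤ y → x + z ≤ y + z
  +-monoʳ-≤ z (inj₁ p) = inj₁ (<-+ z p)
  +-monoʳ-≤ z (inj₂ refl) = inj₂ refl

  +-mono-≤ : ∀ {w x y z} → w ≤ x → y ≤ z → w + y ≤ x + z
  +-mono-≤ {w} {x} {y} {z} p q = ≤-trans (+-monoʳ-≤ y p)
    (subst₂ _≤_ (+-comm y x) (+-comm z x) (+-monoʳ-≤ x q))

  0≤-+ : ∀ {x y} → 0r ≤ x → 0r ≤ y → 0r ≤ x + y
  0≤-+ {x} {y} p q = subst (_≤ x + y) (+-identʳ 0r) (+-mono-≤ p q)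

  0<-+-≤ : ∀ {x y} → 0r < x → 0r ≤ y → 0r < x + y
  0<-+-≤ {x} {y} p q = <-≤-trans p (subst (_≤ x + y) (+-identʳ x) (+-mono-≤ ≤-refl q))

  0≤-* : ∀ {x y} → 0r ≤ x → 0r ≤ y → 0r ≤ x * y
  0≤-* (inj₁ p) (inj₁ q) = inj₁ (<-* p q)
  0≤-* {x} (inj₁ p) (inj₂ refl) = inj₂ (sym (zeroʳ x))
  0≤-* {y = y} (inj₂ refl) q = inj₂ (sym (zeroˡ y))

  ≤⇒0≤- : ∀ {x y} → x ≤ y → 0r ≤ y - x
  ≤⇒0≤- {x} {y} p = subst (_≤ y - x) (+-invʳ x) (+-monoʳ-≤ (- x) p)

  0≤-⇒≤ : ∀ {x y} → 0r ≤ y - x → x ≤ y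
  0≤-⇒≤ {x} {y} p = subst₂ _≤_ (+-identˡ x) (solve 2 (λ x y → (y :- x) :+ x := y) refl x y) (+-monoʳ-≤ x p)

  <⇒0<- : ∀ {x y} → x < y → 0r < y - x
  <⇒0<- {x} {y} p = subst (_< y - x) (+-invʳ x) (<-+ (- x) p)

  0<-⇒< : ∀ {x y} → 0r < y - x → x < y
  0<-⇒< {x} {y} p = subst₂ _<_ (+-identˡ x) (solve 2 (λ x y → (y :- x) :+ x := y) refl x y) (<-+ x p)

  -- If 1 were negative, its negative would be positive, and so would the square of that, which is 1
  -- again.
  0<1 : 0r < 1r
  0<1 with <-tri 0r 1r
  ... | inj₁ p = p
  ... | inj₂ (inj₁ e) = ⊥-elim (0≢1 e)
  ... | inj₂ (inj₂ p) = ⊥-elim (<-irrefl _ (<-trans p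
    (subst (0r <_) (solve 1 (λ o → (con (pos 0) :- o) :* (con (pos 0) :- o) := o :* o) refl 1r ▹ *-identʳ 1r) (<-* (<⇒0<- p) (<⇒0<- p)))))
    where
    _▹_ = trans

  0<ι : ∀ n → 0r < ⟦ suc n ⟧
  0≤ι : ∀ n → 0r ≤ ⟦ n ⟧
  0<ι n = 0<-+-≤ 0<1 (0≤ι n)
  0≤ι zero = ≤-refl
  0≤ι (suc n) = <⇒≤ (0<ι n)

  ι-mono-≤ : ∀ {m n} → m ℕ.≤ n → ⟦ m ⟧ ≤ ⟦ n ⟧
  ι-mono-≤ {n = n} z≤n = 0≤ι n
  ι-mono-≤ (s≤s p) = +-mono-≤ ≤-refl (ι-mono-≤ p)

  ι-mono-< : ∀ {m n} → m ℕ.< n → ⟦ m ⟧ < ⟦ n ⟧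
  ι-mono-< {m} {suc n} (s≤s p) = ≤-<-trans (ι-mono-≤ p)
    (subst₂ _<_ (+-identˡ _) refl (<-+ ⟦ n ⟧ 0<1))

  ι-cancel-< : ∀ {m n} → ⟦ m ⟧ < ⟦ n ⟧ → m ℕ.< n
  ι-cancel-< {m} {n} p with n ℕ.≤? m
  ... | yes q = ⊥-elim (≤⇒≯ (ι-mono-≤ q) p)
  ... | no q = ℕₚ.≰⇒> q

  ι-cancel-≤ : ∀ {m n} → ⟦ m ⟧ ≤ ⟦ n ⟧ → m ℕ.≤ n
  ι-cancel-≤ {m} {n} p with m ℕ.≤? n
  ... | yes q = q
  ... | no q = ⊥-elim (≤⇒≯ p (ι-mono-< (ℕₚ.≰⇒> q)))

  ι-∸ : ∀ {m n} → n ℕ.≤ m → ⟦ m ℕ.∸ n ⟧ ≡ ⟦ m ⟧ - ⟦ n ⟧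
  ι-∸ {m} {n} p = begin
    ⟦ m ℕ.∸ n ⟧                     ≡⟨ solve 2 (λ x y → x := (x :+ y) :- y) refl ⟦ m ℕ.∸ n ⟧ ⟦ n ⟧ ⟩
    ⟦ m ℕ.∸ n ⟧ + ⟦ n ⟧ - ⟦ n ⟧     ≡⟨ cong (_- ⟦ n ⟧) (sym (ι-+ (m ℕ.∸ n) n)) ⟩
    ⟦ (m ℕ.∸ n) ℕ.+ n ⟧ - ⟦ n ⟧     ≡⟨ cong (λ t → ⟦ t ⟧ - ⟦ n ⟧) (ℕₚ.m∸n+n≡m p) ⟩
    ⟦ m ⟧ - ⟦ n ⟧ ∎
    where open ≡-Reasoning

  -- Many arguments below write a positive multiple of the goal as a sum of nonnegative products;
  -- this strips the multiplier. For negative x the nonnegative c * x and the positive c * (0 - x)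
  -- would add up to 0.
  0≤-*-cancel : ∀ {c x} → 0r < c → 0r ≤ c * x → 0r ≤ x
  0≤-*-cancel {c} {x} p q with <-≤-connex x 0r
  ... | inj₂ r = r
  ... | inj₁ r = ⊥-elim (<-irrefl _ (0<-+-≤ (<-* p (<⇒0<- r)) q ▹
      solve 2 (λ c x → c :* (con (pos 0) :- x) :+ c :* x := con (pos 0)) refl c x))
    where
    _▹_ : ∀ {a b} → 0r < a → a ≡ b → 0r < b
    p ▹ refl = p

-- Linear and quadratic forms, proof trees and the certificate checker

Linear : Set
Linear = List (ℤ × ℕ)

-- Only homogeneous forms occur: a term linear in an unknown is written as its product with variable
-- 0, whose value is 1 in every use.
Quadratic : Set
Quadratic = List (ℤ × ℕ × ℕ)

scaleBy : ℤ → Quadratic → Quadratic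
scaleBy c [] = []
scaleBy c ((d , ij) ∷ q) = (c ℤ.* d , ij) ∷ scaleBy c q

timesVar : ℤ → ℕ → Linear → Quadratic
timesVar c i [] = []
timesVar c i ((d , j) ∷ l) = (c ℤ.* d , i , j) ∷ timesVar c i l

_⊛_ : Linear → Linear → Quadratic
[] ⊛ l = []
((c , i) ∷ k) ⊛ l = timesVar c i l ++ (k ⊛ l)

insert : ℤ → ℕ → ℕ → Quadratic → Quadratic
insert c i j [] = (c , i , j) ∷ []
insert c i j ((d , i′ , j′) ∷ q) with (i ℕ.≡ᵇ i′) ∧ (j ℕ.≡ᵇ j′)
... | true = (c ℤ.+ d , i , j) ∷ q
... | false = (d , i′ , j′) ∷ insert c i j q

-- Each monomial gets a single representative with ordered indices, so that cancellations take
-- effect before signs are inspected.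
normalise : Quadratic → Quadratic
normalise [] = []
normalise ((c , i , j) ∷ q) with j ℕ.<ᵇ i
... | true = insert c j i (normalise q)
... | false = insert c i j (normalise q)

negative : ℤ → Bool
negative (pos _) = false
negative -[1+ _ ] = true

nonnegative : Quadratic → Bool
nonnegative [] = true
nonnegative ((c , _) ∷ q) = not (negative c) ∧ nonnegative q

data Term : Set where
  prod : ℕ → ℕ → ℕ → Term
  hyp  : ℕ → ℕ → Term

-- A proof by cases on the signs of linear forms.  A leaf writes N times the goal as a
-- combination of hypotheses, up to an error that is absorbed by the square of variable 1,
-- or, for the leaves that touch the face where variable 2 vanishes, by the product of both.
data Tree : Set where
  leaf  : Bool → ℕ → List ℕ → Tree
  split : Linear → Tree → Tree → Tree

-- The decimal digits of a term: the last two pairs are the indices, and 99 marks a hypothesis.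
decode : ℕ → Term
decode n with ((n ℕ./ 100) ℕ.% 100) ℕ.≡ᵇ 99
... | true = hyp (n ℕ./ 10000) (n ℕ.% 100)
... | false = prod (n ℕ./ 10000) ((n ℕ./ 100) ℕ.% 100) (n ℕ.% 100)

nth : {A : Set} → A → ℕ → List A → A
nth d n [] = d
nth d zero (x ∷ xs) = x
nth d (suc n) (x ∷ xs) = nth d n xs

-- The linear forms are guards: the quadratic form is known to be nonnegative only where all of them
-- are.
Conditional : Set
Conditional = List Linear × Quadratic

_≟L_ : (k l : Linear) → Dec (k ≡ l)
_≟L_ = Listₚ.≡-dec (Productₚ.≡-dec ℤ._≟_ ℕ._≟_)

-- Guards are compared literally with the assumptions collected along a branch, which is why splits
-- and guards use the same multipliers, 100 or 1000.
member : Linear → List Linear → Bool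
member l [] = false
member l (k ∷ ks) = Relation.Nullary.does (l ≟L k) ∨ member l ks
  where import Relation.Nullary

members : List Linear → List Linear → Bool
members [] ks = true
members (l ∷ ls) ks = member l ks ∧ members ls ks

-- Variables below 7 other than the constant 0 are lengths; unless the last flag is set,
-- variable 3 is not known to be bounded.
bounded : Bool → ℕ → Bool
bounded b 1 = true
bounded b 2 = true
bounded b 3 = b
bounded b 4 = true
bounded b 5 = true
bounded b 6 = true
bounded b _ = false

onFace : ℕ → Bool
onFace 2 = true
onFace 4 = true
onFace _ = false

-- Integer multipliers leave small negative coefficients on many monomials. Bounded variables are at
-- most twice variable 1, so each such product is charged to the square of variable 1 with factor 4.
-- Where the goal can be tight on the face, that square has no slack to offer; a product with a
-- factor below variable 2 is then charged to the product of variables 1 and 2, with factor 2.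
absorb : Bool → Bool → Quadratic → Quadratic
absorb b m [] = []
absorb b m ((c , i , j) ∷ q) with negative c ∧ (bounded b i ∧ bounded b j)
... | false = (c , i , j) ∷ absorb b m q
... | true with m ∧ (onFace i ∨ onFace j)
...   | false = (c ℤ.* pos 4 , 1 , 1) ∷ absorb b m q
...   | true = (c ℤ.* pos 2 , 1 , 2) ∷ absorb b m q

negate : Linear → Linear
negate [] = []
negate ((c , i) ∷ l) = (ℤ.- c , i) ∷ negate l

subtractTerms : List Conditional → List Linear → List Term → Quadratic → Quadratic
subtractTerms Q L [] r = r
subtractTerms Q L (prod c i j ∷ ts) r =
  scaleBy (ℤ.- pos c) (nth [] i L ⊛ nth [] j L) ++ subtractTerms Q L ts r
subtractTerms Q L (hyp c i ∷ ts) r =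
  scaleBy (ℤ.- pos c) (proj₂ (nth ([] , []) i Q)) ++ subtractTerms Q L ts r

applicable : List Conditional → List Linear → List Term → Bool
applicable Q L [] = true
applicable Q L (prod _ _ _ ∷ ts) = applicable Q L ts
applicable Q L (hyp c i ∷ ts) = members (proj₁ (nth ([] , []) i Q)) L ∧ applicable Q L ts

-- All variables will be nonnegative. A leaf therefore passes if the multiple of the goal, minus the
-- listed products of assumptions and hypotheses, has only nonnegative coefficients after
-- absorption.
check : Bool → Quadratic → List Conditional → List Linear → Tree → Bool
check b g Q L (leaf m N cs) = applicable Q L (map decode cs) ∧
  nonnegative (normalise (absorb b m (normalise (subtractTerms Q L (map decode cs) (scaleBy (pos (suc N)) g)))))
check b g Q L (split l t u) = check b g Q (l ∷ L) t ∧ check b g Q (negate l ∷ L) u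

∧-true : ∀ {a b} → a ∧ b ≡ true → a ≡ true × b ≡ true
∧-true {true} {true} _ = refl , refl

-- Soundness of the certificate checker over the real field

module Cert (R : RealField) where
  open Reals R

  evalL : (ℕ → Carrier) → Linear → Carrier
  evalL ρ [] = 0r
  evalL ρ ((c , i) ∷ l) = ⟪ c ⟫ * ρ i + evalL ρ l

  evalQ : (ℕ → Carrier) → Quadratic → Carrier
  evalQ ρ [] = 0r
  evalQ ρ ((c , i , j) ∷ q) = ⟪ c ⟫ * (ρ i * ρ j) + evalQ ρ q

  module _ (ρ : ℕ → Carrier) where
    evalQ-++ : ∀ p q → evalQ ρ (p ++ q) ≡ evalQ ρ p + evalQ ρ q
    evalQ-++ [] q = sym (+-identˡ _)
    evalQ-++ ((c , i , j) ∷ p) q = trans (cong (λ t → _ + t) (evalQ-++ p q)) (sym (+-assoc _ _ _))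

    evalL-++ : ∀ p q → evalL ρ (p ++ q) ≡ evalL ρ p + evalL ρ q
    evalL-++ [] q = sym (+-identˡ _)
    evalL-++ ((c , i) ∷ p) q = trans (cong (λ t → _ + t) (evalL-++ p q)) (sym (+-assoc _ _ _))

    evalQ-scaleBy : ∀ c q → evalQ ρ (scaleBy c q) ≡ ⟪ c ⟫ * evalQ ρ q
    evalQ-scaleBy c [] = sym (zeroʳ _)
    evalQ-scaleBy c ((d , i , j) ∷ q) = trans
      (cong₂ (λ s t → s * (ρ i * ρ j) + t) (⟪⟫-* c d) (evalQ-scaleBy c q))
      (solve 4 (λ c d v q → (c :* d) :* v :+ c :* q := c :* (d :* v :+ q)) refl ⟪ c ⟫ ⟪ d ⟫ (ρ i * ρ j) (evalQ ρ q))

    evalQ-timesVar : ∀ c i l → evalQ ρ (timesVar c i l) ≡ (⟪ c ⟫ * ρ i) * evalL ρ l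
    evalQ-timesVar c i [] = sym (zeroʳ _)
    evalQ-timesVar c i ((d , j) ∷ l) = trans
      (cong₂ (λ s t → s * (ρ i * ρ j) + t) (⟪⟫-* c d) (evalQ-timesVar c i l))
      (solve 5 (λ c d v w q → (c :* d) :* (v :* w) :+ (c :* v) :* q := (c :* v) :* (d :* w :+ q)) refl ⟪ c ⟫ ⟪ d ⟫ (ρ i) (ρ j) (evalL ρ l))

    evalQ-⊛ : ∀ k l → evalQ ρ (k ⊛ l) ≡ evalL ρ k * evalL ρ l
    evalQ-⊛ [] l = sym (zeroˡ _)
    evalQ-⊛ ((c , i) ∷ k) l = trans (evalQ-++ (timesVar c i l) (k ⊛ l))
      (trans (cong₂ _+_ (evalQ-timesVar c i l) (evalQ-⊛ k l)) (sym (distribʳ _ _ _)))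

    evalQ-insert : ∀ c i j q → evalQ ρ (insert c i j q) ≡ ⟪ c ⟫ * (ρ i * ρ j) + evalQ ρ q
    evalQ-insert c i j [] = refl
    evalQ-insert c i j ((d , i′ , j′) ∷ q) with i ℕ.≡ᵇ i′ in e₁ | j ℕ.≡ᵇ j′ in e₂
    ... | false | _ = trans (cong (λ t → _ + t) (evalQ-insert c i j q))
      (solve 3 (λ u v w → u :+ (v :+ w) := v :+ (u :+ w)) refl _ _ _)
    ... | true | false = trans (cong (λ t → _ + t) (evalQ-insert c i j q))
      (solve 3 (λ u v w → u :+ (v :+ w) := v :+ (u :+ w)) refl _ _ _)
    ... | true | true
      rewrite sym (ℕₚ.≡ᵇ⇒≡ i i′ (subst T (sym e₁) tt)) | sym (ℕₚ.≡ᵇ⇒≡ j j′ (subst T (sym e₂) tt)) = trans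
      (cong (λ t → t * (ρ i * ρ j) + evalQ ρ q) (⟪⟫-+ c d))
      (solve 4 (λ c d v q → (c :+ d) :* v :+ q := c :* v :+ (d :* v :+ q)) refl ⟪ c ⟫ ⟪ d ⟫ (ρ i * ρ j) (evalQ ρ q))

    evalQ-normalise : ∀ q → evalQ ρ (normalise q) ≡ evalQ ρ q
    evalQ-normalise [] = refl
    evalQ-normalise ((c , i , j) ∷ q) with j ℕ.<ᵇ i
    ... | true = trans (evalQ-insert c j i (normalise q))
      (cong₂ (λ s t → ⟪ c ⟫ * s + t) (*-comm _ _) (evalQ-normalise q))
    ... | false = trans (evalQ-insert c i j (normalise q)) (cong (λ t → _ + t) (evalQ-normalise q))

    evalL-negate : ∀ l → evalL ρ (negate l) ≡ 0r - evalL ρ l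
    evalL-negate [] = sym (+-invʳ 0r)
    evalL-negate ((c , i) ∷ l) = trans (cong₂ (λ s t → s * ρ i + t) (⟪⟫-neg c) (evalL-negate l))
      (solve 3 (λ c v l → (:- c) :* v :+ (con (pos 0) :- l) := con (pos 0) :- (c :* v :+ l)) refl ⟪ c ⟫ (ρ i) (evalL ρ l))

  Nonneg : (ℕ → Carrier) → Linear → Set
  Nonneg ρ l = 0r ≤ evalL ρ l

  Holds : (ℕ → Carrier) → Conditional → Set
  Holds ρ (ls , q) = All (Nonneg ρ) ls → 0r ≤ evalQ ρ q

  -- These are the inequalities that `absorb` spends, together with the nonnegativity behind the
  -- final inspection of signs.
  record Bounds (b : Bool) (ρ : ℕ → Carrier) : Set where
    field
      nonneg  : ∀ i → 0r ≤ ρ i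
      twice   : ∀ i → bounded b i ≡ true → ρ i ≤ ⟦ 2 ⟧ * ρ 1
      face    : ρ 4 ≤ ρ 2

  *-mono-≤ : ∀ {u v x y} → 0r ≤ u → 0r ≤ y → u ≤ v → x ≤ y → u * x ≤ v * y
  *-mono-≤ {u} {v} {x} {y} pu py p q = 0≤-⇒≤ (subst (0r ≤_)
    (solve 4 (λ u v x y → u :* (y :- x) :+ (v :- u) :* y := v :* y :- u :* x) refl u v x y)
    (0≤-+ (0≤-* pu (≤⇒0≤- q)) (0≤-* (≤⇒0≤- p) py)))

  negative-mono : ∀ n {x y} → x ≤ y → ⟪ -[1+ n ] ⟫ * y ≤ ⟪ -[1+ n ] ⟫ * x
  negative-mono n {x} {y} p = 0≤-⇒≤ (subst (0r ≤_)
    (solve 3 (λ c x y → c :* (y :- x) := (:- c) :* x :- (:- c) :* y) refl ⟦ suc n ⟧ x y)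
    (0≤-* (0≤ι (suc n)) (≤⇒0≤- p)))

  module _ {b ρ} (B : Bounds b ρ) where
    open Bounds B

    0≤2k : 0r ≤ ⟦ 2 ⟧ * ρ 1
    0≤2k = 0≤-* (0≤ι 2) (nonneg 1)

    nonnegative-sound : ∀ q → nonnegative q ≡ true → 0r ≤ evalQ ρ q
    nonnegative-sound [] _ = ≤-refl
    nonnegative-sound ((pos n , i , j) ∷ q) e =
      0≤-+ (0≤-* (0≤ι n) (0≤-* (nonneg i) (nonneg j))) (nonnegative-sound q e)

    product-bound : ∀ i j → bounded b i ≡ true → bounded b j ≡ true → ρ i * ρ j ≤ ⟦ 4 ⟧ * (ρ 1 * ρ 1)
    product-bound i j p q = subst (ρ i * ρ j ≤_)
      (solve 1 (λ k → (con (pos 2) :* k) :* (con (pos 2) :* k) := con (pos 4) :* (k :* k)) refl (ρ 1))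
      (*-mono-≤ (nonneg i) 0≤2k (twice i p) (twice j q))

    onFace-bound : ∀ i → onFace i ≡ true → ρ i ≤ ρ 2
    onFace-bound 2 _ = ≤-refl
    onFace-bound 4 _ = face

    face-bound : ∀ i j → bounded b i ≡ true → bounded b j ≡ true → onFace i ∨ onFace j ≡ true →
      ρ i * ρ j ≤ ⟦ 2 ⟧ * (ρ 1 * ρ 2)
    face-bound i j p q e with onFace i in eᵢ
    ... | true = subst (ρ i * ρ j ≤_)
      (solve 2 (λ k a → a :* (con (pos 2) :* k) := con (pos 2) :* (k :* a)) refl (ρ 1) (ρ 2))
      (*-mono-≤ (nonneg i) 0≤2k (onFace-bound i eᵢ) (twice j q))
    ... | false = subst (ρ i * ρ j ≤_)
      (solve 2 (λ k a → (con (pos 2) :* k) :* a := con (pos 2) :* (k :* a)) refl (ρ 1) (ρ 2))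
      (*-mono-≤ (nonneg i) (nonneg 2) (twice i p) (onFace-bound j e))

    -- Under a negative coefficient, replacing a product by an upper bound can only lower the form,
    -- which is the safe direction for proving the goal nonnegative.
    absorb-sound : ∀ m q → evalQ ρ (absorb b m q) ≤ evalQ ρ q
    absorb-sound m [] = ≤-refl
    absorb-sound m ((pos n , i , j) ∷ q) = +-mono-≤ ≤-refl (absorb-sound m q)
    absorb-sound m ((-[1+ n ] , i , j) ∷ q) with bounded b i in p | bounded b j in q′
    ... | false | _ = +-mono-≤ ≤-refl (absorb-sound m q)
    ... | true | false = +-mono-≤ ≤-refl (absorb-sound m q)
    ... | true | true with m ∧ (onFace i ∨ onFace j) in e
    ...   | false = +-mono-≤ (≤-trans (≤-reflexive (trans (cong (_* (ρ 1 * ρ 1)) (⟪⟫-* -[1+ n ] (pos 4)))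
              (*-assoc _ _ _))) (negative-mono n (product-bound i j p q′))) (absorb-sound m q)
    ...   | true = +-mono-≤ (≤-trans (≤-reflexive (trans (cong (_* (ρ 1 * ρ 2)) (⟪⟫-* -[1+ n ] (pos 2)))
              (*-assoc _ _ _))) (negative-mono n (face-bound i j p q′ (proj₂ (∧-true {m} e))))) (absorb-sound m q)

    nth-nonneg : ∀ i {L} → All (Nonneg ρ) L → 0r ≤ evalL ρ (nth [] i L)
    nth-nonneg i [] = ≤-refl
    nth-nonneg zero (p ∷ ps) = p
    nth-nonneg (suc i) (p ∷ ps) = nth-nonneg i ps

    nth-holds : ∀ i {Q} → All (Holds ρ) Q → Holds ρ (nth ([] , []) i Q)
    nth-holds i [] = λ _ → ≤-refl
    nth-holds zero (p ∷ ps) = p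
    nth-holds (suc i) (p ∷ ps) = nth-holds i ps

    member-sound : ∀ l {L} → All (Nonneg ρ) L → member l L ≡ true → Nonneg ρ l
    member-sound l {k ∷ L} (p ∷ ps) e with l ≟L k
    ... | yes refl = p
    ... | no _ = member-sound l ps e

    members-sound : ∀ ls {L} → All (Nonneg ρ) L → members ls L ≡ true → All (Nonneg ρ) ls
    members-sound [] ps e = []
    members-sound (l ∷ ls) ps e with ∧-true e
    ... | e₁ , e₂ = member-sound l ps e₁ ∷ members-sound ls ps e₂

    subtractTerms-sound : ∀ {Q L} → All (Holds ρ) Q → All (Nonneg ρ) L → ∀ ts r → applicable Q L ts ≡ true →
      evalQ ρ (subtractTerms Q L ts r) ≤ evalQ ρ r
    subtractTerms-sound HQ HL [] r e = ≤-refl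
    subtractTerms-sound {Q} {L} HQ HL (prod c i j ∷ ts) r e = subtract c (nth [] i L ⊛ nth [] j L)
        (subst (0r ≤_) (sym (evalQ-⊛ ρ (nth [] i L) (nth [] j L))) (0≤-* (nth-nonneg i HL) (nth-nonneg j HL)))
        (subtractTerms Q L ts r) (subtractTerms-sound HQ HL ts r e)
      where
      subtract : ∀ c h → 0r ≤ evalQ ρ h → ∀ s → evalQ ρ s ≤ evalQ ρ r →
        evalQ ρ (scaleBy (ℤ.- pos c) h ++ s) ≤ evalQ ρ r
      subtract c h p s q = ≤-trans (≤-reflexive (trans (evalQ-++ ρ (scaleBy (ℤ.- pos c) h) s)
          (cong (_+ evalQ ρ s) (trans (evalQ-scaleBy ρ (ℤ.- pos c) h) (cong (_* evalQ ρ h) (⟪⟫-neg (pos c)))))))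
        (≤-trans (0≤-⇒≤ (subst (0r ≤_) (solve 3 (λ c h s → c :* h := s :- ((:- c) :* h :+ s)) refl ⟦ c ⟧ (evalQ ρ h) (evalQ ρ s))
          (0≤-* (0≤ι c) p))) q)
    subtractTerms-sound {Q} {L} HQ HL (hyp c i ∷ ts) r e with ∧-true {members (proj₁ (nth ([] , []) i Q)) L} e
    ... | e₁ , e₂ = ≤-trans (≤-reflexive (trans (evalQ-++ ρ (scaleBy (ℤ.- pos c) h) s)
          (cong (_+ evalQ ρ s) (trans (evalQ-scaleBy ρ (ℤ.- pos c) h) (cong (_* evalQ ρ h) (⟪⟫-neg (pos c)))))))
        (≤-trans (0≤-⇒≤ (subst (0r ≤_) (solve 3 (λ c h s → c :* h := s :- ((:- c) :* h :+ s)) refl ⟦ c ⟧ (evalQ ρ h) (evalQ ρ s))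
          (0≤-* (0≤ι c) (nth-holds i HQ (members-sound _ HL e₁))))) (subtractTerms-sound HQ HL ts r e₂))
      where
      h = proj₂ (nth ([] , []) i Q)
      s = subtractTerms Q L ts r

    check-sound : ∀ g {Q L} → All (Holds ρ) Q → All (Nonneg ρ) L → ∀ t → check b g Q L t ≡ true → 0r ≤ evalQ ρ g
    check-sound g {Q} {L} HQ HL (leaf m N cs) e with ∧-true {applicable Q L (map decode cs)} e
    ... | e₁ , e₂ = 0≤-*-cancel (0<ι N) (subst (0r ≤_) (evalQ-scaleBy ρ (pos (suc N)) g)
      (≤-trans (nonnegative-sound (normalise (absorb b m (normalise p))) e₂) (≤-trans (≤-reflexive (evalQ-normalise ρ (absorb b m (normalise p))))
        (≤-trans (absorb-sound m (normalise p)) (≤-trans (≤-reflexive (evalQ-normalise ρ p))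
          (subtractTerms-sound HQ HL ts (scaleBy (pos (suc N)) g) e₁))))))
      where
      ts = map decode cs
      p = subtractTerms Q L ts (scaleBy (pos (suc N)) g)
    check-sound g {Q} {L} HQ HL (split l t u) e with ∧-true {check b g Q (l ∷ L) t} e | ≤-total 0r (evalL ρ l)
    ... | e₁ , e₂ | inj₁ p = check-sound g HQ (p ∷ HL) t e₁
    ... | e₁ , e₂ | inj₂ p = check-sound g HQ (subst (0r ≤_) (sym (evalL-negate ρ l)) (≤⇒0≤- p) ∷ HL) u e₂

-- Propositional reflection and counting of pairs

Pred : ℕ → Set
Pred zero = Bool
Pred (suc n) = Bool → Pred n

tautology : ∀ n → Pred n → Bool
tautology zero b = b
tautology (suc n) p = tautology n (p true) ∧ tautology n (p false)

Always : ∀ n → Pred n → Set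
Always zero b = b ≡ true
Always (suc n) p = ∀ b → Always n (p b)

-- An inequality between counts of pairs depends, at each pair, on a few membership and adjacency
-- bits. It is tested on all assignments of these bits and then summed.
decide : ∀ n (p : Pred n) → tautology n p ≡ true → Always n p
decide zero b e = e
decide (suc n) p e true = decide n (p true) (proj₁ (∧-true e))
decide (suc n) p e false = decide n (p false) (proj₂ (∧-true {tautology n (p true)} e))

infixr 3 _⟹_
_⟹_ : Bool → Bool → Bool
true ⟹ b = b
false ⟹ b = true

mp : ∀ {a b} → (a ⟹ b) ≡ true → a ≡ true → b ≡ true
mp {true} e _ = e

≤ᵇ-true : ∀ {m n} → (m ℕ.≤ᵇ n) ≡ true → m ℕ.≤ n
≤ᵇ-true {m} e = ℕₚ.≤ᵇ⇒≤ m _ (subst T (sym e) tt)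

∧-intro : ∀ {a b} → a ≡ true → b ≡ true → a ∧ b ≡ true
∧-intro refl refl = refl

imp : ∀ {a b} → (a ≡ true → b ≡ true) → (a ⟹ b) ≡ true
imp {true} f = f refl
imp {false} f = refl

bool-ext : ∀ {a b} → (a ≡ true → b ≡ true) → (b ≡ true → a ≡ true) → a ≡ b
bool-ext {true} f g = sym (f refl)
bool-ext {false} {true} f g = g refl
bool-ext {false} {false} f g = refl

[_]₀₁ : Bool → ℕ
[ b ]₀₁ = if b then 1 else 0

sumF-cong : ∀ {n} {f g : Fin n → ℕ} → (∀ i → f i ≡ g i) → sumF f ≡ sumF g
sumF-cong {zero} h = refl
sumF-cong {suc n} h = cong₂ ℕ._+_ (h zero) (sumF-cong (h ∘ suc))

sumF-mono : ∀ {n} {f g : Fin n → ℕ} → (∀ i → f i ℕ.≤ g i) → sumF f ℕ.≤ sumF g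
sumF-mono {zero} h = z≤n
sumF-mono {suc n} h = ℕₚ.+-mono-≤ (h zero) (sumF-mono (h ∘ suc))

+-interchange : ∀ a b c d → (a ℕ.+ b) ℕ.+ (c ℕ.+ d) ≡ (a ℕ.+ c) ℕ.+ (b ℕ.+ d)
+-interchange a b c d = trans (ℕₚ.+-assoc a b (c ℕ.+ d)) (trans (cong (a ℕ.+_)
  (trans (sym (ℕₚ.+-assoc b c d)) (trans (cong (ℕ._+ d) (ℕₚ.+-comm b c)) (ℕₚ.+-assoc c b d)))) (sym (ℕₚ.+-assoc a c (b ℕ.+ d))))

sumF-+ : ∀ {n} (f g : Fin n → ℕ) → sumF (λ i → f i ℕ.+ g i) ≡ sumF f ℕ.+ sumF g
sumF-+ {zero} f g = refl
sumF-+ {suc n} f g = trans (cong ((f zero ℕ.+ g zero) ℕ.+_) (sumF-+ (f ∘ suc) (g ∘ suc)))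
  (+-interchange (f zero) (g zero) (sumF (f ∘ suc)) (sumF (g ∘ suc)))

sumF-0 : ∀ n → sumF {n} (λ _ → 0) ≡ 0
sumF-0 zero = refl
sumF-0 (suc n) = sumF-0 n

sumF-1 : ∀ n → sumF {n} (λ _ → 1) ≡ n
sumF-1 zero = refl
sumF-1 (suc n) = cong suc (sumF-1 n)

sumF-*ˡ : ∀ {n} c (f : Fin n → ℕ) → sumF (λ i → c ℕ.* f i) ≡ c ℕ.* sumF f
sumF-*ˡ {zero} c f = sym (ℕₚ.*-zeroʳ c)
sumF-*ˡ {suc n} c f = trans (cong (c ℕ.* f zero ℕ.+_) (sumF-*ˡ c (f ∘ suc))) (sym (ℕₚ.*-distribˡ-+ c (f zero) _))

sumF-swap : ∀ {m n} (f : Fin m → Fin n → ℕ) → sumF (λ i → sumF (f i)) ≡ sumF (λ j → sumF (λ i → f i j))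
sumF-swap {zero} {n} f = sym (sumF-0 n)
sumF-swap {suc m} f = trans (cong (sumF (f zero) ℕ.+_) (sumF-swap (f ∘ suc))) (sym (sumF-+ (f zero) (λ j → sumF (λ i → f (suc i) j))))

Rel : ℕ → Set
Rel n = Fin n → Fin n → Bool

VSet : ℕ → Set
VSet n = Fin n → Bool

pairs : ∀ {n} → Rel n → ℕ
pairs f = sumF (λ i → countF (f i))

countF-cong : ∀ {n} {f g : VSet n} → (∀ i → f i ≡ g i) → countF f ≡ countF g
countF-cong h = sumF-cong (λ i → cong [_]₀₁ (h i))

countF-mono : ∀ {n} {f g : VSet n} → (∀ i → f i ≡ true → g i ≡ true) → countF f ℕ.≤ countF g
countF-mono {f = f} {g} h = sumF-mono (λ i → le (f i) (g i) (h i))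
  where
  le : ∀ a b → (a ≡ true → b ≡ true) → [ a ]₀₁ ℕ.≤ [ b ]₀₁
  le true b h = ℕₚ.≤-reflexive (sym (cong [_]₀₁ (h refl)))
  le false b h = z≤n

pairs-cong : ∀ {n} {f g : Rel n} → (∀ i j → f i j ≡ g i j) → pairs f ≡ pairs g
pairs-cong h = sumF-cong (λ i → countF-cong (h i))

pairs-mono : ∀ {n} {f g : Rel n} → (∀ i j → f i j ≡ true → g i j ≡ true) → pairs f ℕ.≤ pairs g
pairs-mono h = sumF-mono (λ i → countF-mono (h i))

countF-split₂ : ∀ {n} (f g h l : VSet n) → (∀ i → [ f i ]₀₁ ℕ.+ [ g i ]₀₁ ≡ [ h i ]₀₁ ℕ.+ [ l i ]₀₁) →
  countF f ℕ.+ countF g ≡ countF h ℕ.+ countF l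
countF-split₂ f g h l p = trans (sym (sumF-+ (λ i → [ f i ]₀₁) (λ i → [ g i ]₀₁)))
  (trans (sumF-cong p) (sumF-+ (λ i → [ h i ]₀₁) (λ i → [ l i ]₀₁)))

weights : ∀ {n} → List (Rel n) → Fin n → Fin n → ℕ
weights [] i j = 0
weights (f ∷ fs) i j = [ f i j ]₀₁ ℕ.+ weights fs i j

total : ∀ {n} → List (Rel n) → ℕ
total [] = 0
total (f ∷ fs) = pairs f ℕ.+ total fs

total-weights : ∀ {n} (fs : List (Rel n)) → sumF (λ i → sumF (weights fs i)) ≡ total fs
total-weights {n} [] = trans (sumF-cong {n} (λ _ → sumF-0 n)) (sumF-0 n)
total-weights (f ∷ fs) = trans (sumF-cong (λ i → sumF-+ _ (weights fs i)))
  (trans (sumF-+ (λ i → countF (f i)) (λ i → sumF (weights fs i))) (cong (pairs f ℕ.+_) (total-weights fs)))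

-- Double counting in one form: an inequality between sums of indicators at every ordered pair
-- passes to the numbers of pairs. The edge counts across a separation are instances whose pointwise
-- hypothesis is a tautology.
total-mono : ∀ {n} (fs gs : List (Rel n)) → (∀ i j → weights fs i j ℕ.≤ weights gs i j) → total fs ℕ.≤ total gs
total-mono fs gs h = subst₂ ℕ._≤_ (total-weights fs) (total-weights gs) (sumF-mono (λ i → sumF-mono (h i)))

square : ∀ {n} → VSet n → Rel n
square X i j = X i ∧ X j

countF-∧ˡ : ∀ {n} b (f : VSet n) → countF (λ j → b ∧ f j) ≡ [ b ]₀₁ ℕ.* countF f
countF-∧ˡ true f = sym (ℕₚ.+-identityʳ _)
countF-∧ˡ {n} false f = sumF-0 n

pairs-square : ∀ {n} (X : VSet n) → pairs (square X) ≡ countF X ℕ.* countF X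
pairs-square X = trans (sumF-cong (λ i → trans (countF-∧ˡ (X i) X) (ℕₚ.*-comm [ X i ]₀₁ (countF X))))
  (sumF-*ˡ (countF X) (λ i → [ X i ]₀₁))

_∩_ _∪_ _∖_ : ∀ {n} → VSet n → VSet n → VSet n
(X ∩ Y) i = X i ∧ Y i
(X ∪ Y) i = X i ∨ Y i
(X ∖ Y) i = X i ∧ not (Y i)

_⊆_ : ∀ {n} → VSet n → VSet n → Set
X ⊆ Y = ∀ i → X i ≡ true → Y i ≡ true

inside : ∀ {n} → Rel n → VSet n → Rel n
inside E X i j = X i ∧ (X j ∧ E i j)

within : ∀ {n} → Rel n → VSet n → ℕ
within E X = pairs (inside E X)

within-cong : ∀ {n} (E : Rel n) {X Y : VSet n} → (∀ i → X i ≡ Y i) → within E X ≡ within E Y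
within-cong E h = pairs-cong (λ i j → cong₂ (λ a b → a ∧ (b ∧ E i j)) (h i) (h j))

within≤square : ∀ {n} (E : Rel n) X → within E X ℕ.≤ countF X ℕ.* countF X
within≤square E X = ℕₚ.≤-trans (pairs-mono (λ i j → mp (decide 3 (λ a b e → (a ∧ (b ∧ e)) ⟹ (a ∧ b)) refl (X i) (X j) (E i j))))
  (ℕₚ.≤-reflexive (pairs-square X))

countF-∪ : ∀ {n} (A B : VSet n) → countF (A ∪ B) ℕ.+ countF (A ∩ B) ≡ countF A ℕ.+ countF B
countF-∪ A B = countF-split₂ (A ∪ B) (A ∩ B) A B (λ i → ℕₚ.≡ᵇ⇒≡ _ _
  (subst T (sym (decide 2 (λ a b → ([ a ∨ b ]₀₁ ℕ.+ [ a ∧ b ]₀₁) ℕ.≡ᵇ ([ a ]₀₁ ℕ.+ [ b ]₀₁)) refl (A i) (B i))) tt))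

countF-∖ : ∀ {n} (A B : VSet n) → countF (A ∖ B) ℕ.+ countF (A ∩ B) ≡ countF A
countF-∖ {n} A B = trans (countF-split₂ (A ∖ B) (A ∩ B) A (λ _ → false) (λ i → ℕₚ.≡ᵇ⇒≡ _ _
  (subst T (sym (decide 2 (λ a b → ([ a ∧ not b ]₀₁ ℕ.+ [ a ∧ b ]₀₁) ℕ.≡ᵇ ([ a ]₀₁ ℕ.+ 0)) refl (A i) (B i))) tt)))
  (trans (cong (countF A ℕ.+_) (sumF-0 n)) (ℕₚ.+-identityʳ _))

-- Separations of order exactly k and the edge counts across them

record Separation {n : ℕ} (E : Rel n) (k : ℕ) (X : VSet n) : Set where
  field
    A B      : VSet n
    covers   : ∀ i → X i ≡ A i ∨ B i
    order    : countF (A ∩ B) ≡ k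
    proper-A : countF A ℕ.< countF X
    proper-B : countF B ℕ.< countF X
    no-edge  : ∀ i j → A i ∧ (not (B i) ∧ (B j ∧ not (A j))) ≡ true → E i j ≡ false
    no-edge′ : ∀ i j → A j ∧ (not (B j) ∧ (B i ∧ not (A i))) ≡ true → E i j ≡ false

  size : countF X ℕ.+ k ≡ countF A ℕ.+ countF B
  size = trans (cong₂ ℕ._+_ (countF-cong covers) (sym order)) (countF-∪ A B)

  no-edge-bool : ∀ i j → not ((A i ∧ (not (B i) ∧ (B j ∧ not (A j)))) ∨ (A j ∧ (not (B j) ∧ (B i ∧ not (A i))))) ∨ not (E i j) ≡ true
  no-edge-bool i j with (A i ∧ (not (B i) ∧ (B j ∧ not (A j)))) in e
  ... | true = cong not (no-edge i j e)
  ... | false with (A j ∧ (not (B j) ∧ (B i ∧ not (A i)))) in e′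
  ...   | true = cong not (no-edge′ i j e′)
  ...   | false = refl

rotate : ∀ p q r s → p ∧ (q ∧ (r ∧ s)) ≡ true → r ∧ (s ∧ (p ∧ q)) ≡ true
rotate p q r s = mp (decide 4 (λ p q r s → p ∧ (q ∧ (r ∧ s)) ⟹ r ∧ (s ∧ (p ∧ q))) refl p q r s)

flip-sep : ∀ {n} {E : Rel n} {k X} → Separation E k X → Separation E k X
flip-sep s = record
  { A = B ; B = A
  ; covers = λ i → trans (covers i) (∨-comm (A i) (B i))
  ; order = trans (countF-cong (λ i → ∧-comm (B i) (A i))) order
  ; proper-A = proper-B ; proper-B = proper-A
  ; no-edge = λ i j p → no-edge′ i j (rotate (B i) (not (A i)) (A j) (not (B j)) p)
  ; no-edge′ = λ i j p → no-edge i j (rotate (B j) (not (A j)) (A i) (not (B i)) p) }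
  where
  open Separation s

  open import Data.Bool.Properties using (∨-comm; ∧-comm)

module _ {n : ℕ} {E : Rel n} {k : ℕ} {X : VSet n} (sep : Separation E k X) where
  open Separation sep

  -- No counted pair crosses, so each lies inside A or inside B, and the pairs of A ∩ B lie inside
  -- both.
  within-sep : within E X ℕ.+ within E (A ∩ B) ℕ.≤ within E A ℕ.+ within E B
  within-sep = subst (λ t → t ℕ.+ within E (A ∩ B) ℕ.≤ _) (within-cong E (λ i → sym (covers i)))
    (subst₂ ℕ._≤_ (cong (within E (A ∪ B) ℕ.+_) (ℕₚ.+-identityʳ _)) (cong (within E A ℕ.+_) (ℕₚ.+-identityʳ _))
      (total-mono (inside E (A ∪ B) ∷ inside E (A ∩ B) ∷ []) (inside E A ∷ inside E B ∷ []) (λ i j → ≤ᵇ-true (mp (decide 5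
        (λ a b c d e → (not ((a ∧ (not b ∧ (d ∧ not c))) ∨ (c ∧ (not d ∧ (b ∧ not a)))) ∨ not e) ⟹
          ([ (a ∨ b) ∧ ((c ∨ d) ∧ e) ]₀₁ ℕ.+ ([ (a ∧ b) ∧ ((c ∧ d) ∧ e) ]₀₁ ℕ.+ 0)) ℕ.≤ᵇ ([ a ∧ (c ∧ e) ]₀₁ ℕ.+ ([ b ∧ (d ∧ e) ]₀₁ ℕ.+ 0)))
        refl (A i) (B i) (A j) (B j) (E i j)) (no-edge-bool i j)))))

-- The non-adjacent pairs inside P and those inside Q are all non-adjacent pairs of A,
-- and only those inside both P and Q are counted twice.
within-union : ∀ {n} (E : Rel n) (A P Q : VSet n) → P ⊆ A → Q ⊆ A →
  within E A ℕ.+ (countF P ℕ.* countF P ℕ.+ (countF Q ℕ.* countF Q ℕ.+ within E (P ∩ Q)))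
    ℕ.≤ countF A ℕ.* countF A ℕ.+ (within E P ℕ.+ (within E Q ℕ.+ countF (P ∩ Q) ℕ.* countF (P ∩ Q)))
within-union E A P Q p q = subst₂ ℕ._≤_
  (cong (within E A ℕ.+_) (cong₂ ℕ._+_ (pairs-square P) (cong₂ ℕ._+_ (pairs-square Q) (ℕₚ.+-identityʳ _))))
  (cong₂ ℕ._+_ (pairs-square A) (cong (within E P ℕ.+_) (cong (within E Q ℕ.+_) (trans (ℕₚ.+-identityʳ _) (pairs-square (P ∩ Q))))))
  (total-mono (inside E A ∷ square P ∷ square Q ∷ inside E (P ∩ Q) ∷ [])
    (square A ∷ inside E P ∷ inside E Q ∷ square (P ∩ Q) ∷ [])
    (λ i j → ≤ᵇ-true (mp (decide 7 (λ a b p q r s e → (((p ⟹ a) ∧ (r ⟹ b)) ∧ ((q ⟹ a) ∧ (s ⟹ b))) ⟹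
      ([ a ∧ (b ∧ e) ]₀₁ ℕ.+ ([ p ∧ r ]₀₁ ℕ.+ ([ q ∧ s ]₀₁ ℕ.+ ([ (p ∧ q) ∧ ((r ∧ s) ∧ e) ]₀₁ ℕ.+ 0)))) ℕ.≤ᵇ
      ([ a ∧ b ]₀₁ ℕ.+ ([ p ∧ (r ∧ e) ]₀₁ ℕ.+ ([ q ∧ (s ∧ e) ]₀₁ ℕ.+ ([ (p ∧ q) ∧ (r ∧ s) ]₀₁ ℕ.+ 0)))))
      refl (A i) (A j) (P i) (Q i) (P j) (Q j) (E i j))
      (∧-intro (∧-intro (imp (p i)) (imp (p j))) (∧-intro (imp (q i)) (imp (q j)))))))

-- The pairs missing in P are also missing in Q.
within-gap : ∀ {n} (E : Rel n) (P Q : VSet n) → P ⊆ Q →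
  within E Q ℕ.+ countF P ℕ.* countF P ℕ.≤ countF Q ℕ.* countF Q ℕ.+ within E P
within-gap E P Q p = subst₂ ℕ._≤_
  (cong (within E Q ℕ.+_) (trans (ℕₚ.+-identityʳ _) (pairs-square P)))
  (cong₂ ℕ._+_ (pairs-square Q) (ℕₚ.+-identityʳ _))
  (total-mono (inside E Q ∷ square P ∷ []) (square Q ∷ inside E P ∷ [])
    (λ i j → ≤ᵇ-true (mp (decide 5 (λ p q r s e → ((p ⟹ q) ∧ (r ⟹ s)) ⟹
      ([ q ∧ (s ∧ e) ]₀₁ ℕ.+ ([ p ∧ r ]₀₁ ℕ.+ 0)) ℕ.≤ᵇ ([ q ∧ s ]₀₁ ℕ.+ ([ p ∧ (r ∧ e) ]₀₁ ℕ.+ 0)))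
      refl (P i) (Q i) (P j) (Q j) (E i j)) (∧-intro (imp (p i)) (imp (p j))))))

within-mono : ∀ {n} (E : Rel n) (P Q : VSet n) → P ⊆ Q → within E P ℕ.≤ within E Q
within-mono E P Q p = pairs-mono (λ i j h → mp (decide 5 (λ p q r s e → ((p ⟹ q) ∧ (r ⟹ s)) ∧ (p ∧ (r ∧ e)) ⟹ (q ∧ (s ∧ e)))
  refl (P i) (Q i) (P j) (Q j) (E i j)) (∧-intro (∧-intro (imp (p i)) (imp (p j))) h))

-- Supermodularity of the edge count.
within-overlap : ∀ {n} (E : Rel n) (P Q S : VSet n) → (∀ i → P i ∨ Q i ≡ S i) →
  within E P ℕ.+ within E Q ℕ.≤ within E S ℕ.+ within E (P ∩ Q)
within-overlap E P Q S c = subst (λ t → _ ℕ.≤ t ℕ.+ _) (within-cong E c)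
  (subst₂ ℕ._≤_ (cong (within E P ℕ.+_) (ℕₚ.+-identityʳ _)) (cong (within E (P ∪ Q) ℕ.+_) (ℕₚ.+-identityʳ _))
    (total-mono (inside E P ∷ inside E Q ∷ []) (inside E (P ∪ Q) ∷ inside E (P ∩ Q) ∷ []) (λ i j → ≤ᵇ-true (decide 5
      (λ p q r s e → ([ p ∧ (r ∧ e) ]₀₁ ℕ.+ ([ q ∧ (s ∧ e) ]₀₁ ℕ.+ 0)) ℕ.≤ᵇ
        ([ (p ∨ q) ∧ ((r ∨ s) ∧ e) ]₀₁ ℕ.+ ([ (p ∧ q) ∧ ((r ∧ s) ∧ e) ]₀₁ ℕ.+ 0))) refl (P i) (Q i) (P j) (Q j) (E i j)))))

-- Exhaustive search, enumeration of vertex sets and components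

searchFin : ∀ n {P Q : Fin n → Set} → (∀ i → P i ⊎ Q i) → (∃ P) ⊎ (∀ i → Q i)
searchFin zero h = inj₂ (λ ())
searchFin (suc n) h with h zero | searchFin n (h ∘ suc)
... | inj₁ p | _ = inj₁ (zero , p)
... | inj₂ q | inj₁ (i , p) = inj₁ (suc i , p)
... | inj₂ q | inj₂ qs = inj₂ (λ { zero → q ; (suc i) → qs i })

-- Replaces excluded middle for the existence of a separator and of a connected subgraph: a decision
-- on each vertex set is collected into one alternative.
searchSubset : ∀ n {P Q : Subset n → Set} → (∀ Y → P Y ⊎ Q Y) → (∃ P) ⊎ (∀ Y → Q Y)
searchSubset zero h with h []
... | inj₁ p = inj₁ ([] , p)
... | inj₂ q = inj₂ (λ { [] → q })
searchSubset (suc n) h with searchSubset n (λ Y → h (true ∷ Y)) | searchSubset n (λ Y → h (false ∷ Y))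
... | inj₁ (Y , p) | _ = inj₁ (true ∷ Y , p)
... | inj₂ q | inj₁ (Y , p) = inj₁ (false ∷ Y , p)
... | inj₂ q | inj₂ q′ = inj₂ (λ { (true ∷ Y) → q Y ; (false ∷ Y) → q′ Y })

∣∣≡countF : ∀ {n} (Y : Subset n) → ∣ Y ∣ ≡ countF (lookup Y)
∣∣≡countF [] = refl
∣∣≡countF (true ∷ Y) = cong suc (∣∣≡countF Y)
∣∣≡countF (false ∷ Y) = ∣∣≡countF Y

∉⇒false : ∀ {n} {Y : Subset n} {i} → i ∉ Y → lookup Y i ≡ false
∉⇒false {Y = Y} {i} h with lookup Y i in e
... | true = ⊥-elim (h (Vecₚ.lookup⇒[]= i Y e))
... | false = refl

false⇒∉ : ∀ {n} {Y : Subset n} {i} → lookup Y i ≡ false → i ∉ Y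
false⇒∉ {Y = Y} e h with trans (sym (Vecₚ.[]=⇒lookup h)) e
... | ()

-- A subgraph needs the vertex type `Fin m`, while X is only a predicate. `sums` carries every count
-- from one side to the other.
record Enumeration {n : ℕ} (X : VSet n) : Set where
  field
    m     : ℕ
    f     : Fin m → Fin n
    inj   : ∀ {i j} → f i ≡ f j → i ≡ j
    mem   : ∀ i → X (f i) ≡ true
    sur   : ∀ v → X v ≡ true → ∃ λ i → f i ≡ v
    sums  : ∀ (g : Fin n → ℕ) → sumF (λ v → [ X v ]₀₁ ℕ.* g v) ≡ sumF (g ∘ f)

  size : countF X ≡ m
  size = trans (sumF-cong {n} (λ v → sym (ℕₚ.*-identityʳ [ X v ]₀₁))) (trans (sums (λ _ → 1)) (sumF-1 m))

enumerate : ∀ {n} (X : VSet n) → Enumeration X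
enumerate {zero} X = record
  { m = 0 ; f = λ () ; inj = λ { {()} } ; mem = λ () ; sur = λ () ; sums = λ _ → refl }
enumerate {suc n} X with X zero in e | enumerate (X ∘ suc)
... | true | r = record
  { m = suc m ; f = λ { zero → zero ; (suc i) → suc (f i) }
  ; inj = λ { {zero} {zero} _ → refl ; {zero} {suc j} () ; {suc i} {zero} () ; {suc i} {suc j} p → cong suc (inj (Finₚ.suc-injective p)) }
  ; mem = λ { zero → e ; (suc i) → mem i }
  ; sur = λ { zero _ → zero , refl ; (suc v) p → let (i , q) = sur v p in suc i , cong suc q }
  ; sums = λ g → cong₂ ℕ._+_ (trans (cong (λ b → [ b ]₀₁ ℕ.* g zero) e) (ℕₚ.+-identityʳ _)) (sums (g ∘ suc)) }
  where open Enumeration r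
... | false | r = record
  { m = m ; f = suc ∘ f
  ; inj = λ p → inj (Finₚ.suc-injective p)
  ; mem = mem
  ; sur = λ { zero p → ⊥-elim (absurd (trans (sym p) e)) ; (suc v) p → let (i , q) = sur v p in i , cong suc q }
  ; sums = λ g → cong₂ ℕ._+_ (cong (λ b → [ b ]₀₁ ℕ.* g zero) e) (sums (g ∘ suc)) }
  where
  open Enumeration r
  absurd : true ≢ false
  absurd ()

countF-strict : ∀ {n} {f g : VSet n} → f ⊆ g → ∀ i → f i ≡ false → g i ≡ true → countF f ℕ.< countF g
countF-strict {f = f} {g} h zero p q rewrite p | q = s≤s (countF-mono (h ∘ suc))
countF-strict {suc n} {f} {g} h (suc i) p q = ℕₚ.+-mono-≤-< (le (f zero) (g zero) (h zero)) (countF-strict (h ∘ suc) i p q)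
  where
  le : ∀ a b → (a ≡ true → b ≡ true) → [ a ]₀₁ ℕ.≤ [ b ]₀₁
  le true b h = ℕₚ.≤-reflexive (sym (cong [_]₀₁ (h refl)))
  le false b h = z≤n

countF-pos : ∀ {n} {f : VSet n} i → f i ≡ true → 1 ℕ.≤ countF f
countF-pos {f = f} zero p rewrite p = s≤s z≤n
countF-pos {f = f} (suc i) p = ℕₚ.≤-trans (countF-pos {f = f ∘ suc} i p) (ℕₚ.m≤n+m _ _)

countF-witness : ∀ {n} (f : VSet n) → 1 ℕ.≤ countF f → ∃ λ i → f i ≡ true
countF-witness {suc n} f h with f zero in e
... | true = zero , e
... | false with countF-witness (f ∘ suc) h
...   | i , p = suc i , p

≡ᶠ : ∀ {n} → Fin n → Fin n → Bool
≡ᶠ i j = Relation.Nullary.does (i Finₚ.≟ j)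
  where import Relation.Nullary

≡ᶠ-refl : ∀ {n} (i : Fin n) → ≡ᶠ i i ≡ true
≡ᶠ-refl i with i Finₚ.≟ i
... | yes _ = refl
... | no h = ⊥-elim (h refl)

≡ᶠ-sound : ∀ {n} (i j : Fin n) → ≡ᶠ i j ≡ true → i ≡ j
≡ᶠ-sound i j e with i Finₚ.≟ j
≡ᶠ-sound i j e | yes p = p
≡ᶠ-sound i j () | no _

module Reachability {m : ℕ} (H : Graph m) (Y : Subset m) where
  extend : ∀ {u v w} → Reach H Y u v → adj H v w ≡ true → w ∉ Y → Reach H Y u w
  extend here e h = step e h here
  extend (step e h r) e′ h′ = step e h (extend r e′ h′)

  record Component (u : Fin m) : Set where
    field
      C       : VSet m
      start   : C u ≡ true
      free    : ∀ w → C w ≡ true → lookup Y w ≡ false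
      reached : ∀ w → C w ≡ true → Reach H Y u w
      closed  : ∀ v w → C v ≡ true → adj H v w ≡ true → lookup Y w ≡ false → C w ≡ true

  -- One free neighbour outside C is added at a time. The number of vertices outside C serves as
  -- fuel, so the growth ends at a closed set.
  component : ∀ u → lookup Y u ≡ false → Component u
  component u free₀ = grow m (≡ᶠ u) (ℕₚ.≤-trans (countF-mono {m} {not ∘ ≡ᶠ u} {λ _ → true} (λ _ _ → refl)) (ℕₚ.≤-reflexive (sumF-1 m))) (≡ᶠ-refl u)
      (λ w p → subst (λ t → lookup Y t ≡ false) (≡ᶠ-sound u w p) free₀)
      (λ w p → subst (Reach H Y u) (≡ᶠ-sound u w p) here)
    where
    grow : ∀ fuel (C : VSet m) → countF (not ∘ C) ℕ.≤ fuel → C u ≡ true → (∀ w → C w ≡ true → lookup Y w ≡ false) →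
      (∀ w → C w ≡ true → Reach H Y u w) → Component u
    grow fuel C bound cu cf cr with searchFin m {λ v → ∃ λ w → (C v ≡ true × adj H v w ≡ true) × (lookup Y w ≡ false × C w ≡ false)}
        {λ v → ∀ w → C v ≡ true → adj H v w ≡ true → lookup Y w ≡ false → C w ≡ true} (λ v → searchFin m (test v))
      where
      test : ∀ v w → ((C v ≡ true × adj H v w ≡ true) × (lookup Y w ≡ false × C w ≡ false)) ⊎
        (C v ≡ true → adj H v w ≡ true → lookup Y w ≡ false → C w ≡ true)
      test v w with C v | adj H v w | lookup Y w | C w
      ... | true | true | false | false = inj₁ ((refl , refl) , (refl , refl))
      ... | _ | _ | _ | true = inj₂ (λ _ _ _ → refl)
      ... | false | _ | _ | false = inj₂ (λ ())
      ... | true | false | _ | false = inj₂ (λ _ ())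
      ... | true | true | true | false = inj₂ (λ _ _ ())
    ... | inj₂ cl = record { C = C ; start = cu ; free = cf ; reached = cr ; closed = cl }
    grow zero C bound cu cf cr | inj₁ (v , w , _ , (_ , cw)) =
      ⊥-elim (ℕₚ.<⇒≱ (countF-pos {f = not ∘ C} w (cong not cw)) bound)
    grow (suc fuel) C bound cu cf cr | inj₁ (v , w , (cv , vw) , (yw , cw)) = grow fuel C′
        (ℕₚ.≤-pred (ℕₚ.≤-trans (countF-strict {f = not ∘ C′} {not ∘ C} shrink w (cong not (∨-true₂ (C w) (≡ᶠ-refl w))) (cong not cw)) bound))
        (cong (_∨ ≡ᶠ w u) cu) free′ reach′
      where
      C′ : VSet m
      C′ t = C t ∨ ≡ᶠ w t
      ∨-true₂ : ∀ a {b} → b ≡ true → a ∨ b ≡ true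
      ∨-true₂ true _ = refl
      ∨-true₂ false p = p
      shrink : (not ∘ C′) ⊆ (not ∘ C)
      shrink t = mp (decide 2 (λ a b → not (a ∨ b) ⟹ not a) refl (C t) (≡ᶠ w t))
      free′ : ∀ t → C′ t ≡ true → lookup Y t ≡ false
      free′ t p with C t in e
      ... | true = cf t e
      ... | false = subst (λ z → lookup Y z ≡ false) (≡ᶠ-sound w t p) yw
      reach′ : ∀ t → C′ t ≡ true → Reach H Y u t
      reach′ t p with C t in e
      ... | true = cr t e
      ... | false = subst (Reach H Y u) (≡ᶠ-sound w t p) (extend (cr v cv) vw (false⇒∉ {Y = Y} yw))

anyF : ∀ {n} → VSet n → Bool
anyF {zero} f = false
anyF {suc n} f = f zero ∨ anyF (f ∘ suc)

anyF-intro : ∀ {n} (f : VSet n) i → f i ≡ true → anyF f ≡ true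
anyF-intro f zero p rewrite p = refl
anyF-intro f (suc i) p with f zero
... | true = refl
... | false = anyF-intro (f ∘ suc) i p

anyF-elim : ∀ {n} (f : VSet n) → anyF f ≡ true → ∃ λ i → f i ≡ true
anyF-elim {suc n} f p with f zero in e
... | true = zero , e
... | false with anyF-elim (f ∘ suc) p
...   | i , q = suc i , q

induced : ∀ {n m} → Graph n → (f : Fin m → Fin n) → Graph m
induced G f = record
  { adj = λ i j → adj G (f i) (f j)
  ; sym = λ i j → Graph.sym G (f i) (f j)
  ; irrefl = λ i → irrefl G (f i) }

-- A separation whose order is at most k; its sides are measured by their private parts.
record WeakSeparation {n : ℕ} (E : Rel n) (X : VSet n) : Set where
  field
    A B      : VSet n
    covers   : ∀ i → X i ≡ A i ∨ B i
    left     : 1 ℕ.≤ countF (A ∖ B)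
    right    : 1 ℕ.≤ countF (B ∖ A)
    no-edge  : ∀ i j → A i ∧ (not (B i) ∧ (B j ∧ not (A j))) ≡ true → E i j ≡ false
    no-edge′ : ∀ i j → A j ∧ (not (B j) ∧ (B i ∧ not (A i))) ≡ true → E i j ≡ false

  parts : countF X ≡ countF (A ∖ B) ℕ.+ (countF (B ∖ A) ℕ.+ countF (A ∩ B))
  parts = trans (countF-cong covers) (trans (sym (ℕₚ.m+n∸n≡m (countF (A ∪ B)) (countF (A ∩ B))))
    (trans (cong (ℕ._∸ countF (A ∩ B)) (trans (countF-∪ A B) (cong₂ ℕ._+_ (sym (countF-∖ A B))
      (trans (sym (countF-∖ B A)) (cong (countF (B ∖ A) ℕ.+_) (countF-cong (λ i → ∧-comm (B i) (A i))))))))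
      (trans (cong (ℕ._∸ countF (A ∩ B)) (shuffle (countF (A ∖ B)) (countF (B ∖ A)) (countF (A ∩ B))))
        (ℕₚ.m+n∸n≡m (countF (A ∖ B) ℕ.+ (countF (B ∖ A) ℕ.+ countF (A ∩ B))) (countF (A ∩ B))))))
    where
    open import Data.Bool.Properties using (∧-comm)
    shuffle : ∀ a b c → (a ℕ.+ c) ℕ.+ (b ℕ.+ c) ≡ (a ℕ.+ (b ℕ.+ c)) ℕ.+ c
    shuffle a b c = trans (+-interchange a c b c) (trans (sym (ℕₚ.+-assoc (a ℕ.+ b) c c)) (cong (ℕ._+ c) (ℕₚ.+-assoc a b c)))

flip-weak : ∀ {n} {E : Rel n} {X} → WeakSeparation E X → WeakSeparation E X
flip-weak s = record
  { A = B ; B = A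
  ; covers = λ i → trans (covers i) (∨-comm (A i) (B i))
  ; left = right ; right = left
  ; no-edge = λ i j p → no-edge′ i j (rotate (B i) (not (A i)) (A j) (not (B j)) p)
  ; no-edge′ = λ i j p → no-edge i j (rotate (B j) (not (A j)) (A i) (not (B i)) p) }
  where
  open WeakSeparation s
  open import Data.Bool.Properties using (∨-comm)

module _ {n : ℕ} {E : Rel n} {X : VSet n} where
  weakOrder : WeakSeparation E X → ℕ
  weakOrder s = countF (WeakSeparation.A s ∩ WeakSeparation.B s)

  private
    insertion : (A B : VSet n) → ∀ v → A v ∧ not (B v) ≡ true →
      countF (A ∩ (λ t → B t ∨ ≡ᶠ v t)) ≡ suc (countF (A ∩ B)) × countF (A ∖ B) ≡ suc (countF (A ∖ (λ t → B t ∨ ≡ᶠ v t)))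
    insertion A B v p = first , ℕₚ.+-cancelʳ-≡ (countF (A ∩ B)) _ _ (trans (countF-∖ A B) (trans (sym (countF-∖ A B′))
        (trans (cong (countF (A ∖ B′) ℕ.+_) first) (ℕₚ.+-suc _ _))))
      where
      B′ : VSet n
      B′ t = B t ∨ ≡ᶠ v t
      av = proj₁ (∧-true {A v} p)
      bv : B v ≡ false
      bv = trans (sym (not-involutive (B v))) (cong not (proj₂ (∧-true {A v} p)))
        where open import Data.Bool.Properties using (not-involutive)
      single : ∀ {n} (v : Fin n) → countF (≡ᶠ v) ≡ 1
      single {suc n} zero = cong suc (sumF-0 n)
      single {suc n} (suc v) = trans (countF-cong {n} {λ i → ≡ᶠ (suc v) (suc i)} {≡ᶠ v} (λ i → refl)) (single v)
      pointwise : ∀ i → [ A i ∧ B′ i ]₀₁ ℕ.+ 0 ≡ [ ≡ᶠ v i ]₀₁ ℕ.+ [ A i ∧ B i ]₀₁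
      pointwise i with ≡ᶠ v i in e
      ... | true rewrite sym (≡ᶠ-sound v i e) | av | bv = refl
      pointwise i | false = ℕₚ.≡ᵇ⇒≡ _ _ (subst T (sym (decide 2 (λ a b → ([ a ∧ (b ∨ false) ]₀₁ ℕ.+ 0) ℕ.≡ᵇ [ a ∧ b ]₀₁) refl (A i) (B i))) tt)
      first : countF (A ∩ B′) ≡ suc (countF (A ∩ B))
      first = trans (sym (ℕₚ.+-identityʳ _)) (trans (cong (countF (A ∩ B′) ℕ.+_) (sym (sumF-0 n)))
        (trans (countF-split₂ (A ∩ B′) (λ _ → false) (≡ᶠ v) (A ∩ B) pointwise) (cong (ℕ._+ countF (A ∩ B)) (single v))))

  -- A private vertex of A is added to B as well. It then belongs to both sides, so no crossing pair
  -- is created; two private vertices are required so that one stays private.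
  enlarge : (s : WeakSeparation E X) → 2 ℕ.≤ countF (WeakSeparation.A s ∖ WeakSeparation.B s) →
    Σ (WeakSeparation E X) λ s′ → weakOrder s′ ≡ suc (weakOrder s)
  enlarge s two = record
      { A = A ; B = B′
      ; covers = covers′
      ; left = ℕₚ.≤-pred (subst (2 ℕ.≤_) (proj₂ (insertion A B v p)) two)
      ; right = ℕₚ.≤-trans right (countF-mono (λ t → mp (decide 3 (λ a b c → (b ∧ not a) ⟹ ((b ∨ c) ∧ not a)) refl (A t) (B t) (≡ᶠ v t))))
      ; no-edge = λ i j q → no-edge i j (weaken i j q)
      ; no-edge′ = λ i j q → no-edge′ i j (weaken j i q) } , proj₁ (insertion A B v p)
    where
    open WeakSeparation s
    witness = countF-witness (A ∖ B) (ℕₚ.≤-trans (s≤s z≤n) two)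
    v = proj₁ witness
    p = proj₂ witness
    B′ : VSet n
    B′ t = B t ∨ ≡ᶠ v t
    av = proj₁ (∧-true {A v} p)
    covers′ : ∀ i → X i ≡ A i ∨ B′ i
    covers′ i with ≡ᶠ v i in e
    ... | false = trans (covers i) (cong (A i ∨_) (sym (∨-identityʳ (B i))))
      where open import Data.Bool.Properties using (∨-identityʳ)
    ... | true rewrite sym (≡ᶠ-sound v i e) | covers v | av = refl
    weaken : ∀ i j → A i ∧ (not (B′ i) ∧ (B′ j ∧ not (A j))) ≡ true → A i ∧ (not (B i) ∧ (B j ∧ not (A j))) ≡ true
    weaken i j q with ≡ᶠ v j in e
    ... | false = mp (decide 5 (λ a b c d x → (a ∧ (not (b ∨ x) ∧ ((c ∨ false) ∧ not d))) ⟹ (a ∧ (not b ∧ (c ∧ not d)))) refl (A i) (B i) (B j) (A j) (≡ᶠ v i)) q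
    ... | true rewrite sym (≡ᶠ-sound v j e) | av = ⊥-elim (absurd (trans (sym q)
        (bool-ext {b = false} (mp (decide 4 (λ a b c x → (a ∧ (not (b ∨ x) ∧ ((c ∨ true) ∧ false))) ⟹ false) refl (A i) (B i) (B v) (≡ᶠ v i))) (λ ()))))
      where
      absurd : true ≢ false
      absurd ()

  -- The separator grows by private vertices until it has k elements. If both private parts were
  -- down to one vertex before that, X would have at most 2 + (k - 1) vertices.
  fill : ∀ k (s : WeakSeparation E X) → ∀ d → weakOrder s ℕ.+ d ≡ k → suc (suc k) ℕ.≤ countF X → Separation E k X
  fill k s zero e big = record
      { A = A ; B = B ; covers = covers ; order = trans (sym (ℕₚ.+-identityʳ _)) e
      ; proper-A = subst₂ ℕ._<_ (countF-∖ A B) (sym total≡) (ℕₚ.+-monoʳ-< (countF (A ∖ B)) (ℕₚ.+-monoˡ-≤ (countF (A ∩ B)) right))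
      ; proper-B = subst₂ ℕ._<_ (trans (cong (countF (B ∖ A) ℕ.+_) (countF-cong (λ i → ∧-comm (A i) (B i)))) (countF-∖ B A)) (sym total≡)
          (ℕₚ.+-monoˡ-≤ (countF (B ∖ A) ℕ.+ countF (A ∩ B)) left)
      ; no-edge = no-edge ; no-edge′ = no-edge′ }
    where
    open WeakSeparation s
    open import Data.Bool.Properties using (∧-comm)
    total≡ = parts
  fill k s (suc d) e big with 2 ℕ.≤? countF (WeakSeparation.A s ∖ WeakSeparation.B s) | 2 ℕ.≤? countF (WeakSeparation.B s ∖ WeakSeparation.A s)
  ... | yes two | _ with enlarge s two
  ...   | s′ , e′ = fill k s′ d (trans (cong (ℕ._+ d) e′) (trans (sym (ℕₚ.+-suc (weakOrder s) d)) e)) big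
  fill k s (suc d) e big | no _ | yes two with enlarge (flip-weak s) two
  ...   | s′ , e′ = fill k s′ d (trans (cong (ℕ._+ d) (trans e′ (cong suc (countF-cong (λ i → ∧-comm (WeakSeparation.B s i) (WeakSeparation.A s i))))))
            (trans (sym (ℕₚ.+-suc (weakOrder s) d)) e)) big
    where open import Data.Bool.Properties using (∧-comm)
  fill k s (suc d) e big | no l | no r = ⊥-elim (ℕₚ.<⇒≱ (ℕₚ.≤-trans (s≤s (s≤s (s≤s ℕₚ.≤-refl))) (ℕₚ.≤-trans (s≤s (s≤s (subst (suc (weakOrder s) ℕ.≤_) e
      (subst (suc (weakOrder s) ℕ.≤_) (sym (ℕₚ.+-suc (weakOrder s) d)) (s≤s (ℕₚ.m≤m+n _ d)))))) big))
      (subst (ℕ._≤ 2 ℕ.+ weakOrder s) (sym (WeakSeparation.parts s)) (ℕₚ.≤-trans (ℕₚ.+-mono-≤ (ℕₚ.≤-pred (ℕₚ.≰⇒> l)) (ℕₚ.+-monoˡ-≤ (weakOrder s) (ℕₚ.≤-pred (ℕₚ.≰⇒> r)))) ℕₚ.≤-refl)))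

-- If deleting at most k vertices Y disconnects the induced subgraph, let C be the component of some
-- u outside Y. The sides are C ∪ Y and the complement of C together with Y; they meet in Y, which
-- is then filled up to k vertices.
connected-or-separated : ∀ {n} (G : Graph n) (E : Rel n) → (∀ i j → i ≢ j → adj G i j ≡ false → E i j ≡ false) →
  ∀ k (X : VSet n) → suc (suc k) ℕ.≤ countF X →
  (Σ (Graph (Enumeration.m (enumerate X))) λ H → SubgraphVia H G (Enumeration.f (enumerate X)) × Connected (suc k) H) ⊎ Separation E k X
connected-or-separated {n} G E E-adj k X big
  with searchSubset m {λ Y → ∣ Y ∣ ℕ.< suc k × Obstruction Y} {λ Y → ∣ Y ∣ ℕ.< suc k → ∀ u v → u ∉ Y → v ∉ Y → Reach H Y u v} test
  where
  open Enumeration (enumerate X)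
  H = induced G f
  Obstruction : Subset m → Set
  Obstruction Y = ∃ λ u → Σ (Reachability.Component H Y u) λ K → ∃ λ v → lookup Y v ≡ false × Reachability.Component.C K v ≡ false
  from : ∀ Y u → Obstruction Y ⊎ (∀ v → u ∉ Y → v ∉ Y → Reach H Y u v)
  from Y u with lookup Y u in yu
  ... | true = inj₂ (λ v h _ → ⊥-elim (h (Vecₚ.lookup⇒[]= u Y yu)))
  ... | false with Reachability.component H Y u yu
  ...   | K with searchFin m {λ v → lookup Y v ≡ false × Reachability.Component.C K v ≡ false} {λ v → v ∉ Y → Reach H Y u v} to
    where
    to : ∀ v → (lookup Y v ≡ false × Reachability.Component.C K v ≡ false) ⊎ (v ∉ Y → Reach H Y u v)
    to v with Reachability.Component.C K v in c | lookup Y v in yv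
    ... | true | _ = inj₂ (λ _ → Reachability.Component.reached K v c)
    ... | false | true = inj₂ (λ h → ⊥-elim (h (Vecₚ.lookup⇒[]= v Y yv)))
    ... | false | false = inj₁ (refl , refl)
  ...     | inj₁ (v , p) = inj₁ (u , K , v , p)
  ...     | inj₂ all = inj₂ (λ v _ → all v)
  test : ∀ Y → (∣ Y ∣ ℕ.< suc k × Obstruction Y) ⊎ (∣ Y ∣ ℕ.< suc k → ∀ u v → u ∉ Y → v ∉ Y → Reach H Y u v)
  test Y with ∣ Y ∣ ℕ.<? suc k
  ... | no h = inj₂ (λ h′ → ⊥-elim (h h′))
  ... | yes h with searchFin m {λ _ → Obstruction Y} (from Y)
  ...   | inj₁ (_ , p) = inj₁ (h , p)
  ...   | inj₂ all = inj₂ (λ _ u v → all u v)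
... | inj₂ conn = inj₁ (induced G f , (inj , λ i j p → p) , subst (suc k ℕ.<_) size big , conn)
  where open Enumeration (enumerate X)
... | inj₁ (Y , small , u , K , v , yv , cv) = inj₂ (fill k weak (k ℕ.∸ weakOrder weak) (ℕₚ.m+[n∸m]≡n (ℕₚ.≤-pred (subst (ℕ._< suc k) order small))) big)
  where
  open Enumeration (enumerate X)
  open Reachability.Component K
  yu = free u start
  push : VSet m → VSet n
  push P t = anyF (λ i → ≡ᶠ (f i) t ∧ P i)
  push-f : ∀ P i → push P (f i) ≡ P i
  push-f P i = bool-ext to (λ p → anyF-intro _ i (∧-intro (≡ᶠ-refl (f i)) p))
    where
    to : push P (f i) ≡ true → P i ≡ true
    to p with anyF-elim _ p
    ... | j , q = subst (λ t → P t ≡ true) (inj (≡ᶠ-sound (f j) (f i) (proj₁ (∧-true q)))) (proj₂ (∧-true {≡ᶠ (f j) (f i)} q))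
  A B : VSet n
  A = push (λ i → C i ∨ lookup Y i)
  B = push (λ i → not (C i) ∨ lookup Y i)
  push-X : ∀ P t → push P t ≡ true → X t ≡ true
  push-X P t p with anyF-elim _ p
  ... | j , q = subst (λ t → X t ≡ true) (≡ᶠ-sound (f j) t (proj₁ (∧-true q))) (mem j)
  covers : ∀ t → X t ≡ A t ∨ B t
  covers t = bool-ext to from
    where
    to : X t ≡ true → A t ∨ B t ≡ true
    to p with sur t p
    ... | i , refl = trans (cong₂ _∨_ (push-f _ i) (push-f _ i)) (decide 2 (λ c y → (c ∨ y) ∨ (not c ∨ y)) refl (C i) (lookup Y i))
    from : A t ∨ B t ≡ true → X t ≡ true
    from p with A t in e
    ... | true = push-X _ t e
    ... | false = push-X _ t p
  at : ∀ (i : Fin m) (φ : Bool → Bool → Bool) → φ (A (f i)) (B (f i)) ≡ φ (C i ∨ lookup Y i) (not (C i) ∨ lookup Y i)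
  at i φ = cong₂ φ (push-f _ i) (push-f _ i)
  private-left : ∀ t → A t ∧ not (B t) ≡ true → ∃ λ i → f i ≡ t × C i ≡ true
  private-left t p with anyF-elim _ (proj₁ (∧-true p))
  ... | i , q with ≡ᶠ-sound (f i) t (proj₁ (∧-true q))
  ...   | refl = i , refl , mp (decide 2 (λ c y → ((c ∨ y) ∧ not (not c ∨ y)) ⟹ c) refl (C i) (lookup Y i)) (trans (sym (at i (λ a b → a ∧ not b))) p)
  private-right : ∀ t → B t ∧ not (A t) ≡ true → ∃ λ i → f i ≡ t × (C i ≡ false × lookup Y i ≡ false)
  private-right t p with anyF-elim _ (proj₁ (∧-true p))
  ... | i , q with ≡ᶠ-sound (f i) t (proj₁ (∧-true q))
  ...   | refl = i , refl , flag (C i) (lookup Y i) (trans (sym (at i (λ a b → b ∧ not a))) p)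
    where
    flag : ∀ c y → (not c ∨ y) ∧ not (c ∨ y) ≡ true → c ≡ false × y ≡ false
    flag false false _ = refl , refl
    flag false true ()
    flag true true ()
    flag true false ()
  crossing : ∀ s t → A s ∧ not (B s) ≡ true → B t ∧ not (A t) ≡ true → (E s t ≡ false) × (E t s ≡ false)
  crossing s t p q with private-left s p | private-right t q
  ... | i , refl , ci | j , refl , (cj , yj) = E-adj _ _ (λ e → absurd (trans (sym ci) (trans (cong C (inj e)) cj))) nonadj ,
      E-adj _ _ (λ e → absurd (trans (sym ci) (trans (cong C (sym (inj e))) cj))) (trans (Graph.sym G (f j) (f i)) nonadj)
    where
    absurd : true ≢ false
    absurd ()
    nonadj : adj G (f i) (f j) ≡ false
    nonadj with adj G (f i) (f j) in e
    ... | false = refl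
    ... | true = ⊥-elim (absurd (trans (sym (closed i j ci e yj)) cj))
  regroup : ∀ a b c d → a ∧ (b ∧ (c ∧ d)) ≡ true → (a ∧ b ≡ true) × (c ∧ d ≡ true)
  regroup true true c d p = refl , p
  order : ∣ Y ∣ ≡ countF (A ∩ B)
  order = trans (∣∣≡countF Y) (sym (trans (sumF-cong (λ t → restrict t)) (trans (sums (λ t → [ A t ∧ B t ]₀₁))
      (countF-cong (λ i → trans (at i _∧_) (bool-ext (both i) (λ p → subst (λ y → (C i ∨ y) ∧ (not (C i) ∨ y) ≡ true) (sym p) (decide 1 (λ c → (c ∨ true) ∧ (not c ∨ true)) refl (C i)))))))))
    where
    both : ∀ i → (C i ∨ lookup Y i) ∧ (not (C i) ∨ lookup Y i) ≡ true → lookup Y i ≡ true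
    both i = mp (decide 2 (λ c y → ((c ∨ y) ∧ (not c ∨ y)) ⟹ y) refl (C i) (lookup Y i))
    restrict : ∀ t → [ A t ∧ B t ]₀₁ ≡ [ X t ]₀₁ ℕ.* [ A t ∧ B t ]₀₁
    restrict t with X t in e
    ... | true = sym (ℕₚ.+-identityʳ _)
    ... | false = cong [_]₀₁ (bool-ext {b = false} (λ p → ⊥-elim (absurd (trans (sym (push-X _ t (proj₁ (∧-true p)))) e))) (λ ()))
      where
      absurd : true ≢ false
      absurd ()
  weak : WeakSeparation E X
  weak = record
    { A = A ; B = B ; covers = covers
    ; left = countF-pos {f = A ∖ B} (f u) (trans (at u (λ a b → a ∧ not b)) (subst₂ (λ c y → (c ∨ y) ∧ not (not c ∨ y) ≡ true) (sym start) (sym yu) refl))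
    ; right = countF-pos {f = B ∖ A} (f v) (trans (at v (λ a b → b ∧ not a)) (subst₂ (λ c y → (not c ∨ y) ∧ not (c ∨ y) ≡ true) (sym cv) (sym yv) refl))
    ; no-edge = λ i j p → let (q , r) = regroup (A i) (not (B i)) (B j) (not (A j)) p in proj₁ (crossing i j q r)
    ; no-edge′ = λ i j p → let (q , r) = regroup (A j) (not (B j)) (B i) (not (A i)) p in proj₂ (crossing j i q r) }

-- Partial colourings, their extension and their gluing

≡ᵇ-sound : ∀ m n → (m ℕ.≡ᵇ n) ≡ true → m ≡ n
≡ᵇ-sound m n e = ℕₚ.≡ᵇ⇒≡ m n (subst T (sym e) tt)

≡ᵇ-refl : ∀ m → (m ℕ.≡ᵇ m) ≡ true
≡ᵇ-refl zero = refl
≡ᵇ-refl (suc m) = ≡ᵇ-refl m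

-- Colour 0 means "not coloured".
Colouring : ℕ → Set
Colouring n = Fin n → ℕ

sameColour : ∀ {n} → Colouring n → Rel n
sameColour c i j = (c i ℕ.≡ᵇ c j) ∧ not (c i ℕ.≡ᵇ 0)

uncoloured : ∀ {n} → Colouring n → VSet n
uncoloured c i = c i ℕ.≡ᵇ 0

_⊔_ : ∀ {n} → Rel n → Colouring n → Rel n
(E ⊔ c) i j = E i j ∨ sameColour c i j

recolour : ∀ {n} → VSet n → Colouring n → Colouring n → Colouring n
recolour B c c′ i = if B i then c i else c′ i

-- Lifts all genuine colours above N and fixes 0: the colours of the two sides become disjoint and
-- uncoloured vertices stay uncoloured.
shift : ℕ → ℕ → ℕ
shift N zero = zero
shift N (suc x) = suc x ℕ.+ N

xor-bool : Bool → Bool → Bool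
xor-bool a b = (a ∧ not b) ∨ (b ∧ not a)

iff : Bool → Bool → Bool
iff a b = (a ⟹ b) ∧ (b ⟹ a)

module _ {n : ℕ} {E : Rel n} {k : ℕ} {X : VSet n} (sep : Separation E k X) where
  open Separation sep

  sameColour-mixed : ∀ {N} (cA cB : Colouring n) → (∀ i → cB i ℕ.≤ N) → (∀ i → cA i ≡ 0 ⊎ N ℕ.< cA i) → ∀ i j →
    xor-bool (B i) (B j) ≡ true → sameColour (recolour B cB cA) i j ≡ false
  sameColour-mixed {N} cA cB bound far i j h with B i | B j
  ... | true | false = bool-ext {b = false} (λ p → ⊥-elim (clash (far j) (≡ᵇ-sound (cB i) (cA j) (proj₁ (∧-true p))) (proj₂ (∧-true {cB i ℕ.≡ᵇ cA j} p)))) (λ ())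
    where
    clash : (cA j ≡ 0 ⊎ N ℕ.< cA j) → cB i ≡ cA j → not (cB i ℕ.≡ᵇ 0) ≡ true → ⊥
    clash (inj₁ z) e q rewrite e | z with q
    ... | ()
    clash (inj₂ l) e q = ℕₚ.<⇒≱ l (subst (ℕ._≤ N) e (bound i))
  ... | false | true = bool-ext {b = false} (λ p → ⊥-elim (clash (far i) (≡ᵇ-sound (cA i) (cB j) (proj₁ (∧-true p))) (proj₂ (∧-true {cA i ℕ.≡ᵇ cB j} p)))) (λ ())
    where
    clash : (cA i ≡ 0 ⊎ N ℕ.< cA i) → cA i ≡ cB j → not (cA i ℕ.≡ᵇ 0) ≡ true → ⊥
    clash (inj₁ z) e q rewrite z with q
    ... | ()
    clash (inj₂ l) e q = ℕₚ.<⇒≱ l (subst (ℕ._≤ N) (sym e) (bound j))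

  -- The colour γ is absent from B or means "uncoloured", so a counted pair outside B × B lies in A
  -- × A but not in the square of A ∩ B. There are |A|² - k² such places.
  within-extend : ∀ {N} (γ : ℕ) (c : Colouring n) → (∀ i → c i ℕ.≤ N) → (γ ≡ 0 ⊎ N ℕ.< γ) →
    within (E ⊔ recolour B c (λ _ → γ)) X ℕ.+ k ℕ.* k ℕ.≤ within (E ⊔ c) B ℕ.+ countF A ℕ.* countF A
  within-extend γ c bound far = subst₂ ℕ._≤_
      (cong₂ ℕ._+_ (within-cong (E ⊔ c′) (λ i → sym (covers i))) (trans (ℕₚ.+-identityʳ _) (trans (pairs-square (A ∩ B)) (cong₂ ℕ._*_ order order))))
      (cong (within (E ⊔ c) B ℕ.+_) (trans (ℕₚ.+-identityʳ _) (pairs-square A)))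
      (total-mono (inside (E ⊔ c′) (A ∪ B) ∷ square (A ∩ B) ∷ []) (inside (E ⊔ c) B ∷ square A ∷ []) (λ i j → ≤ᵇ-true (mp (decide 7
        (λ a b p q e s s′ → ((not ((a ∧ (not b ∧ (q ∧ not p))) ∨ (p ∧ (not q ∧ (b ∧ not a)))) ∨ not e) ∧ (((b ∧ q) ⟹ iff s′ s) ∧ (xor-bool b q ⟹ not s′))) ⟹
          (([ (a ∨ b) ∧ ((p ∨ q) ∧ (e ∨ s′)) ]₀₁ ℕ.+ ([ (a ∧ b) ∧ (p ∧ q) ]₀₁ ℕ.+ 0)) ℕ.≤ᵇ ([ b ∧ (q ∧ (e ∨ s)) ]₀₁ ℕ.+ ([ a ∧ p ]₀₁ ℕ.+ 0))))
        refl (A i) (B i) (A j) (B j) (E i j) (sameColour c i j) (sameColour c′ i j))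
        (∧-intro (no-edge-bool i j) (∧-intro (imp (agree i j)) (imp (λ h → cong not (sameColour-mixed (λ _ → γ) c bound (λ _ → far) i j h))))))))
    where
    c′ = recolour B c (λ _ → γ)
    agree : ∀ i j → B i ∧ B j ≡ true → iff (sameColour c′ i j) (sameColour c i j) ≡ true
    agree i j h with B i | B j
    ... | true | true = decide 1 (λ s → iff s s) refl (sameColour c i j)

  -- On the separator the colours of B win. The pairs that A counted there through its own colours
  -- are then free to be subtracted; this is the gain that a bound without colours would lose.
  within-glue : ∀ {N} (cA cB : Colouring n) → (∀ i → cB i ℕ.≤ N) →
    within (E ⊔ recolour B cB (shift N ∘ cA)) X ℕ.+ within (E ⊔ cA) (A ∩ B) ℕ.≤ within (E ⊔ cA) A ℕ.+ within (E ⊔ cB) B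
  within-glue {N} cA cB bound = subst₂ ℕ._≤_
      (cong₂ ℕ._+_ (within-cong (E ⊔ c′) (λ i → sym (covers i))) (ℕₚ.+-identityʳ _))
      (cong (within (E ⊔ cA) A ℕ.+_) (ℕₚ.+-identityʳ _))
      (total-mono (inside (E ⊔ c′) (A ∪ B) ∷ inside (E ⊔ cA) (A ∩ B) ∷ []) (inside (E ⊔ cA) A ∷ inside (E ⊔ cB) B ∷ []) (λ i j → ≤ᵇ-true (mp (decide 8
        (λ a b p q e s t s′ → ((not ((a ∧ (not b ∧ (q ∧ not p))) ∨ (p ∧ (not q ∧ (b ∧ not a)))) ∨ not e) ∧
            (((b ∧ q) ⟹ iff s′ t) ∧ ((xor-bool b q ⟹ not s′) ∧ ((not b ∧ not q) ⟹ (s′ ⟹ s))))) ⟹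
          (([ (a ∨ b) ∧ ((p ∨ q) ∧ (e ∨ s′)) ]₀₁ ℕ.+ ([ (a ∧ b) ∧ ((p ∧ q) ∧ (e ∨ s)) ]₀₁ ℕ.+ 0)) ℕ.≤ᵇ
            ([ a ∧ (p ∧ (e ∨ s)) ]₀₁ ℕ.+ ([ b ∧ (q ∧ (e ∨ t)) ]₀₁ ℕ.+ 0))))
        refl (A i) (B i) (A j) (B j) (E i j) (sameColour cA i j) (sameColour cB i j) (sameColour c′ i j))
        (∧-intro (no-edge-bool i j) (∧-intro (imp (agree i j)) (∧-intro
          (imp (λ h → cong not (sameColour-mixed (shift N ∘ cA) cB bound far i j h))) (imp (λ h → imp (outside i j h)))))))))
    where
    c′ = recolour B cB (shift N ∘ cA)
    far : ∀ i → shift N (cA i) ≡ 0 ⊎ N ℕ.< shift N (cA i)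
    far i with cA i
    ... | zero = inj₁ refl
    ... | suc x = inj₂ (s≤s (ℕₚ.m≤n+m N x))
    agree : ∀ i j → B i ∧ B j ≡ true → iff (sameColour c′ i j) (sameColour cB i j) ≡ true
    agree i j h with B i | B j
    ... | true | true = decide 1 (λ s → iff s s) refl (sameColour cB i j)
    same-shift : ∀ x y → (shift N x ℕ.≡ᵇ shift N y) ∧ not (shift N x ℕ.≡ᵇ 0) ≡ true → (x ℕ.≡ᵇ y) ∧ not (x ℕ.≡ᵇ 0) ≡ true
    same-shift (suc x) (suc y) p = ∧-intro (subst (λ z → (x ℕ.≡ᵇ z) ≡ true)
      (ℕₚ.+-cancelʳ-≡ N x y (≡ᵇ-sound (x ℕ.+ N) (y ℕ.+ N) (proj₁ (∧-true p)))) (≡ᵇ-refl x)) refl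
    same-shift (suc x) zero ()
    same-shift zero zero ()
    same-shift zero (suc y) ()
    outside : ∀ i j → not (B i) ∧ not (B j) ≡ true → sameColour c′ i j ≡ true → sameColour cA i j ≡ true
    outside i j h with B i | B j
    ... | false | false = same-shift (cA i) (cA j)

  -- Counts uncoloured vertices after gluing: B decides on the separator, so exactly the P-part of A
  -- ∩ B disappears from the sum.
  count-sides : ∀ (P Q : VSet n) → countF (X ∩ (λ i → if B i then Q i else P i)) ℕ.+ countF ((A ∩ B) ∩ P) ≡ countF (A ∩ P) ℕ.+ countF (B ∩ Q)
  count-sides P Q = trans (cong (ℕ._+ _) (countF-cong (λ i → cong (λ x → x ∧ (if B i then Q i else P i)) (covers i))))
    (countF-split₂ _ ((A ∩ B) ∩ P) (A ∩ P) (B ∩ Q) (λ i → ℕₚ.≡ᵇ⇒≡ _ _ (subst T (sym (decide 4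
      (λ a b p q → ([ (a ∨ b) ∧ (if b then q else p) ]₀₁ ℕ.+ [ (a ∧ b) ∧ p ]₀₁) ℕ.≡ᵇ ([ a ∧ p ]₀₁ ℕ.+ [ b ∧ q ]₀₁)) refl (A i) (B i) (P i) (Q i))) tt)))

uncoloured-recolour : ∀ {n} (B : VSet n) c c′ i → uncoloured (recolour B c c′) i ≡ (if B i then uncoloured c i else uncoloured c′ i)
uncoloured-recolour B c c′ i with B i
... | true = refl
... | false = refl

uncoloured-shift : ∀ N x → (shift N x ℕ.≡ᵇ 0) ≡ (x ℕ.≡ᵇ 0)
uncoloured-shift N zero = refl
uncoloured-shift N (suc x) = refl

colourClass : ∀ {n} → Colouring n → ℕ → VSet n
colourClass c x i = c i ℕ.≡ᵇ x

-- The part of S coloured 1, …, N, and the pairs of equally coloured vertices in it.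
upTo : ∀ {n} → Colouring n → ℕ → VSet n → VSet n
upTo c N S i = S i ∧ (not (c i ℕ.≡ᵇ 0) ∧ (c i ℕ.≤ᵇ N))

monochromatic : ∀ {n} → Colouring n → ℕ → VSet n → Rel n
monochromatic c N S i j = upTo c N S i ∧ (upTo c N S j ∧ (c i ℕ.≡ᵇ c j))

module _ {n : ℕ} (c : Colouring n) (S : VSet n) where
  private
    ≤ᵇ-suc : ∀ x N → (x ℕ.≤ᵇ suc N) ≡ (x ℕ.≤ᵇ N) ∨ (x ℕ.≡ᵇ suc N)
    ≤ᵇ-suc zero N = refl
    ≤ᵇ-suc (suc zero) zero = refl
    ≤ᵇ-suc (suc (suc x)) zero = refl
    ≤ᵇ-suc (suc x) (suc N) = step′ x N
      where
      step′ : ∀ x N → (x ℕ.<ᵇ suc (suc N)) ≡ (x ℕ.<ᵇ suc N) ∨ (x ℕ.≡ᵇ suc N)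
      step′ zero N = refl
      step′ (suc zero) zero = refl
      step′ (suc (suc x)) zero = refl
      step′ (suc x) (suc N) = step′ x N

    not-both : ∀ x N → (x ℕ.≤ᵇ N) ∧ (x ℕ.≡ᵇ suc N) ≡ false
    not-both x N = bool-ext {b = false} (λ p → ⊥-elim (ℕₚ.<⇒≱ (ℕₚ.≤-reflexive (sym (≡ᵇ-sound x (suc N) (proj₂ (∧-true {x ℕ.≤ᵇ N} p)))))
      (≤ᵇ-true {x} (proj₁ (∧-true p))))) (λ ())

    nonzero : ∀ x N → (x ℕ.≡ᵇ suc N) ≡ true → not (x ℕ.≡ᵇ 0) ≡ true
    nonzero (suc x) N p = refl

  upTo-suc : ∀ N → countF (upTo c (suc N) S) ≡ countF (upTo c N S) ℕ.+ countF (S ∩ colourClass c (suc N))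
  upTo-suc N = trans (sym (ℕₚ.+-identityʳ _)) (trans (cong (countF (upTo c (suc N) S) ℕ.+_) (sym (sumF-0 n)))
    (countF-split₂ (upTo c (suc N) S) (λ _ → false) (upTo c N S) (S ∩ colourClass c (suc N)) (λ i → ℕₚ.≡ᵇ⇒≡ _ _ (subst T (sym
      (subst (λ l → (([ S i ∧ (not (c i ℕ.≡ᵇ 0) ∧ l) ]₀₁ ℕ.+ 0) ℕ.≡ᵇ ([ S i ∧ (not (c i ℕ.≡ᵇ 0) ∧ (c i ℕ.≤ᵇ N)) ]₀₁ ℕ.+ [ S i ∧ (c i ℕ.≡ᵇ suc N) ]₀₁)) ≡ true) (sym (≤ᵇ-suc (c i) N))
        (mp (decide 4 (λ s z l e → (not (l ∧ e) ∧ (e ⟹ z)) ⟹ (([ s ∧ (z ∧ (l ∨ e)) ]₀₁ ℕ.+ 0) ℕ.≡ᵇ ([ s ∧ (z ∧ l) ]₀₁ ℕ.+ [ s ∧ e ]₀₁))) refl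
            (S i) (not (c i ℕ.≡ᵇ 0)) (c i ℕ.≤ᵇ N) (c i ℕ.≡ᵇ suc N))
          (∧-intro (cong not (not-both (c i) N)) (imp (nonzero (c i) N)))))) tt))))

  -- The class of colour N + 1 contributes its full square, and its pairs are disjoint from those of
  -- the earlier colours.
  monochromatic-suc : ∀ N → pairs (monochromatic c N S) ℕ.+ countF (S ∩ colourClass c (suc N)) ℕ.* countF (S ∩ colourClass c (suc N))
    ℕ.≤ pairs (monochromatic c (suc N) S)
  monochromatic-suc N = subst₂ ℕ._≤_ (cong (pairs (monochromatic c N S) ℕ.+_) (trans (ℕₚ.+-identityʳ _) (pairs-square (S ∩ colourClass c (suc N))))) (ℕₚ.+-identityʳ _)
    (total-mono (monochromatic c N S ∷ square (S ∩ colourClass c (suc N)) ∷ []) (monochromatic c (suc N) S ∷ []) (λ i j → ≤ᵇ-true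
      (subst₂ (λ l m → (([ (S i ∧ (not (c i ℕ.≡ᵇ 0) ∧ (c i ℕ.≤ᵇ N))) ∧ ((S j ∧ (not (c j ℕ.≡ᵇ 0) ∧ (c j ℕ.≤ᵇ N))) ∧ (c i ℕ.≡ᵇ c j)) ]₀₁ ℕ.+
            ([ (S i ∧ (c i ℕ.≡ᵇ suc N)) ∧ (S j ∧ (c j ℕ.≡ᵇ suc N)) ]₀₁ ℕ.+ 0)) ℕ.≤ᵇ
            ([ (S i ∧ (not (c i ℕ.≡ᵇ 0) ∧ l)) ∧ ((S j ∧ (not (c j ℕ.≡ᵇ 0) ∧ m)) ∧ (c i ℕ.≡ᵇ c j)) ]₀₁ ℕ.+ 0)) ≡ true)
          (sym (≤ᵇ-suc (c i) N)) (sym (≤ᵇ-suc (c j) N))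
        (mp (decide 9 (λ s z l e s′ z′ l′ e′ q → ((not (l ∧ e) ∧ (not (l′ ∧ e′))) ∧ (((e ⟹ z) ∧ (e′ ⟹ z′)) ∧ ((e ∧ e′) ⟹ q))) ⟹
            (([ (s ∧ (z ∧ l)) ∧ ((s′ ∧ (z′ ∧ l′)) ∧ q) ]₀₁ ℕ.+ ([ (s ∧ e) ∧ (s′ ∧ e′) ]₀₁ ℕ.+ 0)) ℕ.≤ᵇ
              ([ (s ∧ (z ∧ (l ∨ e))) ∧ ((s′ ∧ (z′ ∧ (l′ ∨ e′))) ∧ q) ]₀₁ ℕ.+ 0))) refl
            (S i) (not (c i ℕ.≡ᵇ 0)) (c i ℕ.≤ᵇ N) (c i ℕ.≡ᵇ suc N) (S j) (not (c j ℕ.≡ᵇ 0)) (c j ℕ.≤ᵇ N) (c j ℕ.≡ᵇ suc N) (c i ℕ.≡ᵇ c j))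
          (∧-intro (∧-intro (cong not (not-both (c i) N)) (cong not (not-both (c j) N)))
            (∧-intro (∧-intro (imp (nonzero (c i) N)) (imp (nonzero (c j) N))) (imp (equal (c i) (c j) N))))))))
    where
    equal : ∀ x y N → (x ℕ.≡ᵇ suc N) ∧ (y ℕ.≡ᵇ suc N) ≡ true → (x ℕ.≡ᵇ y) ≡ true
    equal x y N p = subst₂ (λ a b → (a ℕ.≡ᵇ b) ≡ true) (sym (≡ᵇ-sound x (suc N) (proj₁ (∧-true p))))
      (sym (≡ᵇ-sound y (suc N) (proj₂ (∧-true {x ℕ.≡ᵇ suc N} p)))) (≡ᵇ-refl N)

-- Cauchy-Schwarz for colour classes, gluing energies and certificates

module Energy (R : RealField) where
  open Reals R

  0≤-square : ∀ x → 0r ≤ x * x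
  0≤-square x with ≤-total 0r x
  ... | inj₁ p = 0≤-* p p
  ... | inj₂ p = subst (0r ≤_) (solve 1 (λ x → (con (pos 0) :- x) :* (con (pos 0) :- x) := x :* x) refl x) (0≤-* (≤⇒0≤- p) (≤⇒0≤- p))

  square-cancel-≤ : ∀ {x y} → 0r ≤ y → x * x ≤ y * y → x ≤ y
  square-cancel-≤ {x} {y} py h with <-≤-connex y x
  ... | inj₂ q = q
  ... | inj₁ q = ⊥-elim (≤⇒≯ h (0<-⇒< (subst (0r <_) (solve 2 (λ x y → (x :- y) :* (x :- y) :+ con (pos 2) :* (y :* (x :- y)) := x :* x :- y :* y) refl x y)
      (0<-+-≤ (<-* (<⇒0<- q) (<⇒0<- q)) (0≤-* (0≤ι 2) (0≤-* py (<⇒≤ (<⇒0<- q))))))))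

  by-difference : ∀ {x y z} → 0r ≤ z → z ≡ y - x → x ≤ y
  by-difference p refl = 0≤-⇒≤ p

  module _ {n : ℕ} (c : Colouring n) (S : VSet n) where
    -- Induction on the number of colours. From x² ≤ M P follows (x + y)² ≤ (M + 1) (P + y²),
    -- because M times the slack is (x - M y)² + (M + 1) (M P - x²). The first colour is separate,
    -- since M = 0 cannot be cancelled.
    cauchy-schwarz : ∀ N → ⟦ countF (upTo c N S) ⟧ * ⟦ countF (upTo c N S) ⟧ ≤ ⟦ N ⟧ * ⟦ pairs (monochromatic c N S) ⟧
    cauchy-schwarz zero = ≤-reflexive (trans (cong (λ t → ⟦ t ⟧ * ⟦ t ⟧) none) (trans (zeroˡ _) (sym (zeroˡ _))))
      where
      none : countF (upTo c 0 S) ≡ 0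
      none = trans (countF-cong {n} {upTo c 0 S} {λ _ → false} (λ i → empty (S i) (c i))) (sumF-0 n)
        where
        empty : ∀ s x → s ∧ (not (x ℕ.≡ᵇ 0) ∧ (x ℕ.≤ᵇ 0)) ≡ false
        empty true zero = refl
        empty true (suc x) = refl
        empty false x = refl
    cauchy-schwarz (suc N) = subst (λ t → t * t ≤ ⟦ suc N ⟧ * ⟦ pairs (monochromatic c (suc N) S) ⟧)
        (sym (trans (cong ⟦_⟧ (upTo-suc c S N)) (ι-+ (countF (upTo c N S)) q)))
        (≤-trans (goal N (cauchy-schwarz N)) (by-difference
          (0≤-* (0≤ι (suc N)) (≤⇒0≤- (ι-mono-≤ (monochromatic-suc c S N))))
          (trans (cong (λ t → ⟦ suc N ⟧ * (⟦ pairs (monochromatic c (suc N) S) ⟧ - t)) (trans (ι-+ p (q ℕ.* q)) (cong (⟦ p ⟧ +_) (ι-* q q))))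
            (solve 3 (λ a b c → a :* (b :- c) := a :* b :- a :* c) refl ⟦ suc N ⟧ ⟦ pairs (monochromatic c (suc N) S) ⟧ (⟦ p ⟧ + ⟦ q ⟧ * ⟦ q ⟧)))))
      where
      q = countF (S ∩ colourClass c (suc N))
      p = pairs (monochromatic c N S)
      goal : ∀ N → ⟦ countF (upTo c N S) ⟧ * ⟦ countF (upTo c N S) ⟧ ≤ ⟦ N ⟧ * ⟦ pairs (monochromatic c N S) ⟧ →
        (⟦ countF (upTo c N S) ⟧ + ⟦ q ⟧) * (⟦ countF (upTo c N S) ⟧ + ⟦ q ⟧) ≤ ⟦ suc N ⟧ * (⟦ pairs (monochromatic c N S) ⟧ + ⟦ q ⟧ * ⟦ q ⟧)
      goal zero h = by-difference {z = ⟦ pairs (monochromatic c 0 S) ⟧} (0≤ι (pairs (monochromatic c 0 S)))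
        (trans (sym (trans (cong (λ t → 1r * ⟦ pairs (monochromatic c 0 S) ⟧ + (1r * (⟦ q ⟧ * ⟦ q ⟧) - (t + ⟦ q ⟧) * (t + ⟦ q ⟧))) zero′)
            (trans (cong (λ o → o * ⟦ pairs (monochromatic c 0 S) ⟧ + (o * (⟦ q ⟧ * ⟦ q ⟧) - (0r + ⟦ q ⟧) * (0r + ⟦ q ⟧))) (sym ι-1))
              (solve 2 (λ p q → con (pos 1) :* p :+ (con (pos 1) :* (q :* q) :- (con (pos 0) :+ q) :* (con (pos 0) :+ q)) := p) refl ⟦ pairs (monochromatic c 0 S) ⟧ ⟦ q ⟧))))
          (trans (cong (λ o → o * ⟦ pairs (monochromatic c 0 S) ⟧ + (o * (⟦ q ⟧ * ⟦ q ⟧) - (x + ⟦ q ⟧) * (x + ⟦ q ⟧))) (sym ι-1))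
            (trans (solve 3 (λ p q x → con (pos 1) :* p :+ (con (pos 1) :* (q :* q) :- (x :+ q) :* (x :+ q)) := con (pos 1) :* (p :+ q :* q) :- (x :+ q) :* (x :+ q)) refl ⟦ pairs (monochromatic c 0 S) ⟧ ⟦ q ⟧ x)
              refl)))
        where
        x = ⟦ countF (upTo c 0 S) ⟧
        zero′ : x ≡ 0r
        zero′ with square-cancel-≤ {x} {0r} ≤-refl (≤-trans h (≤-reflexive (trans (zeroˡ _) (sym (zeroˡ _)))))
        ... | inj₂ e = e
        ... | inj₁ l = ⊥-elim (≤⇒≯ (0≤ι (countF (upTo c 0 S))) l)
      goal (suc N) h = 0≤-⇒≤ (0≤-*-cancel (0<ι N) (subst (0r ≤_)
          (trans (cong (λ o → (x - M * y) * (x - M * y) + (o + M) * (M * P - x * x)) (sym ι-1))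
            (trans (solve 4 (λ x y P M → (x :- M :* y) :* (x :- M :* y) :+ (con (pos 1) :+ M) :* (M :* P :- x :* x)
                := M :* ((con (pos 1) :+ M) :* (P :+ y :* y) :- (x :+ y) :* (x :+ y))) refl x y P M)
              (cong (λ o → M * ((o + M) * (P + y * y) - (x + y) * (x + y))) ι-1)))
          (0≤-+ (0≤-square (x - M * y)) (0≤-* (0≤ι (suc (suc N))) (≤⇒0≤- h)))))
        where
        x = ⟦ countF (upTo c (suc N) S) ⟧
        y = ⟦ q ⟧
        P = ⟦ pairs (monochromatic c (suc N) S) ⟧
        M = ⟦ suc N ⟧

    coloured-count : ∀ N → (∀ i → c i ℕ.≤ N) → countF (upTo c N S) ℕ.+ countF (S ∩ uncoloured c) ≡ countF S
    coloured-count N bound = trans (cong (ℕ._+ countF (S ∩ uncoloured c)) (countF-cong (λ i → cong (S i ∧_)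
        (trans (cong (not (c i ℕ.≡ᵇ 0) ∧_) (le i)) (∧-identityʳ (not (c i ℕ.≡ᵇ 0))))))) (countF-∖ S (uncoloured c))
      where
      open import Data.Bool.Properties using (∧-identityʳ)
      le : ∀ i → (c i ℕ.≤ᵇ N) ≡ true
      le i with c i ℕ.≤ᵇ N | ℕₚ.≤⇒≤ᵇ (bound i)
      ... | true | _ = refl

    coloured-pairs : ∀ (E : Rel n) N → pairs (monochromatic c N S) ℕ.≤ within (E ⊔ c) S
    coloured-pairs E N = pairs-mono (λ i j → mp (decide 8 (λ s z l s′ z′ l′ q e →
      ((s ∧ (z ∧ l)) ∧ ((s′ ∧ (z′ ∧ l′)) ∧ q)) ⟹ (s ∧ (s′ ∧ (e ∨ (q ∧ z))))) refl
      (S i) (not (c i ℕ.≡ᵇ 0)) (c i ℕ.≤ᵇ N) (S j) (not (c j ℕ.≡ᵇ 0)) (c j ℕ.≤ᵇ N) (c i ℕ.≡ᵇ c j) (E i j)))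

    colouring-bound : ∀ (E : Rel n) N → (∀ i → c i ℕ.≤ N) →
      (⟦ countF S ⟧ - ⟦ countF (S ∩ uncoloured c) ⟧) * (⟦ countF S ⟧ - ⟦ countF (S ∩ uncoloured c) ⟧) ≤ ⟦ N ⟧ * ⟦ within (E ⊔ c) S ⟧
    colouring-bound E N bound = subst (λ t → t * t ≤ ⟦ N ⟧ * ⟦ within (E ⊔ c) S ⟧) count
        (≤-trans (cauchy-schwarz N) (by-difference (0≤-* (0≤ι N) (≤⇒0≤- (ι-mono-≤ (coloured-pairs E N))))
          (solve 3 (λ a b c → a :* (b :- c) := a :* b :- a :* c) refl ⟦ N ⟧ ⟦ within (E ⊔ c) S ⟧ ⟦ pairs (monochromatic c N S) ⟧)))
      where
      count : ⟦ countF (upTo c N S) ⟧ ≡ ⟦ countF S ⟧ - ⟦ countF (S ∩ uncoloured c) ⟧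
      count = trans (solve 2 (λ x y → x := (x :+ y) :- y) refl ⟦ countF (upTo c N S) ⟧ ⟦ countF (S ∩ uncoloured c) ⟧)
        (cong (_- ⟦ countF (S ∩ uncoloured c) ⟧) (trans (sym (ι-+ (countF (upTo c N S)) _)) (cong ⟦_⟧ (coloured-count N bound))))

  -- Gluing along a separator that meets the first side in a set whose coloured part has
  -- measure v = u₁ + t.  The hypothesis (or the one with the roles exchanged) always holds by AM-GM.
  glue-inequality : ∀ {M N u w t} → 0r ≤ M → 0r ≤ N → 0r ≤ u → 0r ≤ w → 0r ≤ t →
    ⟦ 2 ⟧ * (M * M * (w * w)) ≤ N * (M + N) * (u * u) →
    ⟦ 2 ⟧ * (N * (M + N) * (u * u)) + ⟦ 2 ⟧ * (M * (M + N) * (w * w)) ≤ ⟦ 3 ⟧ * (N * (M + N) * ((u + t) * (u + t))) + ⟦ 2 ⟧ * (M * N * ((w - t) * (w - t)))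
  glue-inequality {M} {N} {u} {w} {t} pM pN pu pw pt h = by-difference
      (0≤-+ (≤⇒0≤- h) (0≤-+ (0≤-* (0≤-* (0≤ι 2) (0≤-* pN pt)) (≤⇒0≤- linear)) (0≤-* (0≤-* pt pt) (0≤-+ (0≤-* (0≤ι 2) (0≤-* pM pN)) (0≤-* (0≤ι 3) (0≤-* pN (0≤-+ pM pN)))))))
      (solve 5 (λ M N u w t → (N :* (M :+ N) :* (u :* u) :- con (pos 2) :* (M :* M :* (w :* w))) :+
          ((con (pos 2) :* (N :* t)) :* (con (pos 3) :* ((M :+ N) :* u) :- con (pos 2) :* (M :* w)) :+
            (t :* t) :* (con (pos 2) :* (M :* N) :+ con (pos 3) :* (N :* (M :+ N))))
          := (con (pos 3) :* (N :* (M :+ N) :* ((u :+ t) :* (u :+ t))) :+ con (pos 2) :* (M :* N :* ((w :- t) :* (w :- t)))) :-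
            (con (pos 2) :* (N :* (M :+ N) :* (u :* u)) :+ con (pos 2) :* (M :* (M :+ N) :* (w :* w)))) refl M N u w t)
    where
    -- Makes the coefficient of t nonnegative. The quadratic hypothesis gives 4 M² w² ≤ 2 N (M + N)
    -- u², well below 9 (M + N)² u².
    linear : ⟦ 2 ⟧ * (M * w) ≤ ⟦ 3 ⟧ * ((M + N) * u)
    linear = square-cancel-≤ (0≤-* (0≤ι 3) (0≤-* (0≤-+ pM pN) pu)) (by-difference
      (0≤-+ (0≤-* (0≤ι 2) (≤⇒0≤- h)) (0≤-+ (0≤-* (0≤ι 7) (0≤-square ((M + N) * u))) (0≤-* (0≤ι 2) (0≤-* (0≤-* pM (0≤-+ pM pN)) (0≤-* pu pu)))))
      (solve 4 (λ M N u w → con (pos 2) :* (N :* (M :+ N) :* (u :* u) :- con (pos 2) :* (M :* M :* (w :* w))) :+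
          (con (pos 7) :* (((M :+ N) :* u) :* ((M :+ N) :* u)) :+ con (pos 2) :* ((M :* (M :+ N)) :* (u :* u)))
        := (con (pos 3) :* ((M :+ N) :* u)) :* (con (pos 3) :* ((M :+ N) :* u)) :- (con (pos 2) :* (M :* w)) :* (con (pos 2) :* (M :* w))) refl M N u w))

  -- If both inequalities failed, eliminating w would leave M N u² (M - N)² < 0.
  glue-choice : ∀ {M N u w} → 0r < M → 0r < N →
    ⟦ 2 ⟧ * (M * M * (w * w)) ≤ N * (M + N) * (u * u) ⊎ ⟦ 2 ⟧ * (N * N * (u * u)) ≤ M * (N + M) * (w * w)
  glue-choice {M} {N} {u} {w} pM pN with <-≤-connex (N * (M + N) * (u * u)) (⟦ 2 ⟧ * (M * M * (w * w))) | <-≤-connex (M * (N + M) * (w * w)) (⟦ 2 ⟧ * (N * N * (u * u)))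
  ... | inj₂ p | _ = inj₁ p
  ... | inj₁ _ | inj₂ q = inj₂ q
  ... | inj₁ p | inj₁ q = ⊥-elim (<-irrefl 0r (<-≤-trans
      (0<-+-≤ (<-* (<-* pM (0<-+-≤ pM (<⇒≤ pN))) (<⇒0<- p)) (0≤-* (0≤-* (0≤ι 2) (0≤-square M)) (<⇒≤ (<⇒0<- q))))
      (by-difference (0≤-* (0≤-* (<⇒≤ pM) (<⇒≤ pN)) (0≤-* (0≤-square u) (0≤-square (M - N))))
        (solve 4 (λ M N u w → (M :* N) :* ((u :* u) :* ((M :- N) :* (M :- N))) := con (pos 0) :-
          ((M :* (M :+ N)) :* (con (pos 2) :* (M :* M :* (w :* w)) :- N :* (M :+ N) :* (u :* u)) :+
           (con (pos 2) :* (M :* M)) :* (con (pos 2) :* (N :* N :* (u :* u)) :- M :* (N :+ M) :* (w :* w)))) refl M N u w))))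

  -- Stated for every s ≤ t. With s = t it is the energy of the glued colouring; if that would leave
  -- more than k vertices uncoloured, then w ≤ t, and s = w makes the bound 0, so the union is flat.
  glue-energy : ∀ {M N u w s t x q a b} → 0r < M → 0r < N → 0r ≤ u → 0r ≤ w → 0r ≤ s → s ≤ t →
    ⟦ 2 ⟧ * (M * M * (w * w)) ≤ N * (M + N) * (u * u) →
    x + q ≤ a + b → ⟦ 3 ⟧ * (M * a) ≤ ⟦ 2 ⟧ * (u * u) → ⟦ 3 ⟧ * (N * b) ≤ ⟦ 2 ⟧ * (w * w) → (u + t) * (u + t) ≤ M * q →
    ⟦ 3 ⟧ * ((M + N) * x) ≤ ⟦ 2 ⟧ * ((w - s) * (w - s))
  glue-energy {M} {N} {u} {w} {s} {t} {x} {q} {a} {b} pM pN pu pw ps s≤t cond add ha hb hq = 0≤-⇒≤ (0≤-*-cancel (<-* pM pN) (subst (0r ≤_)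
      (solve 10 (λ M N u w s t x q a b →
          ((con (pos 3) :* (N :* (M :+ N) :* ((u :+ s) :* (u :+ s))) :+ con (pos 2) :* (M :* N :* ((w :- s) :* (w :- s)))) :-
            (con (pos 2) :* (N :* (M :+ N) :* (u :* u)) :+ con (pos 2) :* (M :* (M :+ N) :* (w :* w)))) :+
          ((N :* (M :+ N)) :* (con (pos 2) :* (u :* u) :- con (pos 3) :* (M :* a)) :+
          ((M :* (M :+ N)) :* (con (pos 2) :* (w :* w) :- con (pos 3) :* (N :* b)) :+
          ((con (pos 3) :* (M :* N :* (M :+ N))) :* ((a :+ b) :- (x :+ q)) :+
          ((con (pos 3) :* (N :* (M :+ N))) :* (M :* q :- (u :+ t) :* (u :+ t)) :+
           (con (pos 3) :* (N :* (M :+ N))) :* ((t :- s) :* (con (pos 2) :* u :+ (s :+ t)))))))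
        := (M :* N) :* (con (pos 2) :* ((w :- s) :* (w :- s)) :- con (pos 3) :* ((M :+ N) :* x))) refl M N u w s t x q a b)
      (0≤-+ (≤⇒0≤- (glue-inequality (<⇒≤ pM) (<⇒≤ pN) pu pw ps cond))
        (0≤-+ (0≤-* (0≤-* (<⇒≤ pN) pS) (≤⇒0≤- ha))
        (0≤-+ (0≤-* (0≤-* (<⇒≤ pM) pS) (≤⇒0≤- hb))
        (0≤-+ (0≤-* (0≤-* (0≤ι 3) (0≤-* (0≤-* (<⇒≤ pM) (<⇒≤ pN)) pS)) (≤⇒0≤- add))
        (0≤-+ (0≤-* (0≤-* (0≤ι 3) (0≤-* (<⇒≤ pN) pS)) (≤⇒0≤- hq))
          (0≤-* (0≤-* (0≤ι 3) (0≤-* (<⇒≤ pN) pS)) (0≤-* (≤⇒0≤- s≤t) (0≤-+ (0≤-* (0≤ι 2) pu) (0≤-+ ps (≤-trans ps s≤t))))))))))))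
    where
    pS : 0r ≤ M + N
    pS = 0≤-+ (<⇒≤ pM) (<⇒≤ pN)

  module Certificates {n : ℕ} (E : Rel n) (k : ℕ) (D : Carrier) where
    K : Carrier
    K = ⟦ k ⟧

    -- `D` is δ - 2. The 2 matches the mixed term of |X|² = (k + a)², so a complete set has excess
    -- K² - a (D K - a).
    excess : ℕ → ℕ → Carrier
    excess e m = ⟦ e ⟧ - (⟦ 2 ⟧ + D) * K * (⟦ m ⟧ - K)

    -- Any k vertices of X include at least `u` coloured ones and hence span at least u² / M counted
    -- pairs, where M = N + 1. `energy` keeps the excess below two thirds of this guarantee.
    record Coloured (X : VSet n) : Set where
      field
        N      : ℕ
        c      : Colouring n
        bound  : ∀ i → c i ℕ.≤ suc N
        d≤k    : countF (X ∩ uncoloured c) ℕ.≤ k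
        energy : ⟦ 3 ⟧ * (⟦ suc N ⟧ * excess (within (E ⊔ c) X) (countF X)) ≤
          ⟦ 2 ⟧ * ((K - ⟦ countF (X ∩ uncoloured c) ⟧) * (K - ⟦ countF (X ∩ uncoloured c) ⟧))

      u : Carrier
      u = K - ⟦ countF (X ∩ uncoloured c) ⟧

      0≤u : 0r ≤ u
      0≤u = ≤⇒0≤- (ι-mono-≤ d≤k)

    Flat : VSet n → Set
    Flat X = excess (within E X) (countF X) ≤ 0r

    excess-mono : ∀ {e e′} m → e ℕ.≤ e′ → excess e m ≤ excess e′ m
    excess-mono m p = +-monoʳ-≤ _ (ι-mono-≤ p)

    within≤ : ∀ c X → within E X ℕ.≤ within (E ⊔ c) X
    within≤ c X = pairs-mono (λ i j → mp (decide 4 (λ a b e s → (a ∧ (b ∧ e)) ⟹ (a ∧ (b ∧ (e ∨ s)))) refl (X i) (X j) (E i j) (sameColour c i j)))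

    flat-from : ∀ c X → excess (within (E ⊔ c) X) (countF X) ≤ 0r → Flat X
    flat-from c X p = ≤-trans (excess-mono (countF X) (within≤ c X)) p

    nonpositive : ∀ N {x} → ⟦ 3 ⟧ * (⟦ suc N ⟧ * x) ≤ 0r → x ≤ 0r
    nonpositive N {x} p = 0≤-⇒≤ (0≤-*-cancel (<-* (0<ι 2) (0<ι N)) (subst (0r ≤_)
      (solve 2 (λ N x → con (pos 0) :- con (pos 3) :* (N :* x) := (con (pos 3) :* N) :* (con (pos 0) :- x)) refl ⟦ suc N ⟧ x) (≤⇒0≤- p)))

    module _ {X : VSet n} (sep : Separation E k X) where
      open Separation sep

      size-R : ⟦ countF X ⟧ ≡ ⟦ countF A ⟧ + ⟦ countF B ⟧ - K
      size-R = trans (solve 2 (λ x y → x := (x :+ y) :- y) refl ⟦ countF X ⟧ K)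
        (cong (_- K) (trans (sym (ι-+ (countF X) k)) (trans (cong ⟦_⟧ size) (ι-+ (countF A) (countF B)))))

      -- The linear terms cancel, since |A| + |B| = |X| + k: an inequality between pair counts
      -- becomes one between excesses unchanged.
      excess-add : ∀ x s p q → x ℕ.+ s ℕ.≤ p ℕ.+ q →
        excess x (countF X) + ⟦ s ⟧ ≤ excess p (countF A) + excess q (countF B)
      excess-add x s p q h = subst (λ t → ⟦ x ⟧ - (⟦ 2 ⟧ + D) * K * (t - K) + ⟦ s ⟧ ≤ excess p (countF A) + excess q (countF B)) (sym size-R)
        (by-difference (≤⇒0≤- (subst₂ _≤_ (ι-+ x s) (ι-+ p q) (ι-mono-≤ h)))
          (solve 8 (λ x s p q D K a b → (p :+ q) :- (x :+ s) :=
              ((p :- (con (pos 2) :+ D) :* K :* (a :- K)) :+ (q :- (con (pos 2) :+ D) :* K :* (b :- K))) :-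
              ((x :- (con (pos 2) :+ D) :* K :* (((a :+ b) :- K) :- K)) :+ s))
            refl ⟦ x ⟧ ⟦ s ⟧ ⟦ p ⟧ ⟦ q ⟧ D K ⟦ countF A ⟧ ⟦ countF B ⟧))

      flat-flat : Flat A → Flat B → Flat X
      flat-flat p q = ≤-trans (by-difference (0≤ι (within E (A ∩ B))) (solve 2 (λ x s → s := (x :+ s) :- x) refl (excess (within E X) (countF X)) ⟦ within E (A ∩ B) ⟧))
        (≤-trans (excess-add (within E X) (within E (A ∩ B)) (within E A) (within E B) (within-sep sep)) (subst (excess (within E A) (countF A) + excess (within E B) (countF B) ≤_) (+-identʳ 0r) (+-mono-≤ p q)))

      -- Of the k vertices of A ∩ B all but the hidden uncoloured ones carry one of N + 1 colours,
      -- so Cauchy-Schwarz applies.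
      separator-bound : (C : Coloured A) → let open Coloured C in
        (K - ⟦ countF ((A ∩ B) ∩ uncoloured c) ⟧) * (K - ⟦ countF ((A ∩ B) ∩ uncoloured c) ⟧) ≤ ⟦ suc N ⟧ * ⟦ within (E ⊔ c) (A ∩ B) ⟧
      separator-bound C = subst (λ t → (⟦ t ⟧ - y) * (⟦ t ⟧ - y) ≤ ⟦ suc N ⟧ * ⟦ within (E ⊔ c) (A ∩ B) ⟧) order
        (colouring-bound c (A ∩ B) E (suc N) bound)
        where
        open Coloured C
        y = ⟦ countF ((A ∩ B) ∩ uncoloured c) ⟧

      hidden-≤ : (c : Colouring n) → countF ((A ∩ B) ∩ uncoloured c) ℕ.≤ countF (A ∩ uncoloured c)
      hidden-≤ c = countF-mono (λ i → mp (decide 3 (λ a b u → ((a ∧ b) ∧ u) ⟹ (a ∧ u)) refl (A i) (B i) (uncoloured c i)))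

      -- B dictates the colours of the separator, and A gives up at least (u + t)² / M pairs there,
      -- with its own u and M. Here t counts the uncoloured vertices of A outside the separator;
      -- they remain uncoloured and reduce the u of the result to that of B minus t.
      glue-side : (C₁ : Coloured A) (C₂ : Coloured B) → let open Coloured in
        ⟦ 2 ⟧ * (⟦ suc (N C₁) ⟧ * ⟦ suc (N C₁) ⟧ * (u C₂ * u C₂)) ≤ ⟦ suc (N C₂) ⟧ * (⟦ suc (N C₁) ⟧ + ⟦ suc (N C₂) ⟧) * (u C₁ * u C₁) →
        Flat X ⊎ Σ (Coloured X) λ C → N C ≡ N C₁ ℕ.+ suc (N C₂)
      glue-side C₁ C₂ cond = result (countF (X ∩ uncoloured c′) ℕ.≤? k)
        where
        module C₁ = Coloured C₁
        module C₂ = Coloured C₂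
        c′ = recolour B C₂.c (shift (suc C₂.N) ∘ C₁.c)
        x = excess (within (E ⊔ c′) X) (countF X)
        hid = countF ((A ∩ B) ∩ uncoloured C₁.c)
        dA = countF (A ∩ uncoloured C₁.c)
        dB = countF (B ∩ uncoloured C₂.c)
        t = ⟦ dA ⟧ - ⟦ hid ⟧
        0≤t : 0r ≤ t
        0≤t = ≤⇒0≤- (ι-mono-≤ (hidden-≤ C₁.c))
        bound′ : ∀ i → c′ i ℕ.≤ suc (C₁.N ℕ.+ suc C₂.N)
        bound′ i with B i
        ... | true = ℕₚ.≤-trans (C₂.bound i) (ℕₚ.≤-trans (ℕₚ.m≤n+m (suc C₂.N) C₁.N) (ℕₚ.n≤1+n _))
        ... | false with C₁.c i | C₁.bound i
        ...   | zero | _ = z≤n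
        ...   | suc y | le = ℕₚ.+-monoˡ-≤ (suc C₂.N) le
        d′ : countF (X ∩ uncoloured c′) ℕ.+ hid ≡ dA ℕ.+ dB
        d′ = trans (cong (ℕ._+ hid) (countF-cong (λ i → cong (X i ∧_) (trans (uncoloured-recolour B C₂.c (shift (suc C₂.N) ∘ C₁.c) i)
            (cong (λ z → if B i then uncoloured C₂.c i else z) (uncoloured-shift (suc C₂.N) (C₁.c i)))))))
          (count-sides sep (uncoloured C₁.c) (uncoloured C₂.c))
        w-t : C₂.u - t ≡ K - ⟦ countF (X ∩ uncoloured c′) ⟧
        w-t = trans (solve 4 (λ K a b h → (K :- b) :- (a :- h) := K :- ((a :+ b) :- h)) refl K ⟦ dA ⟧ ⟦ dB ⟧ ⟦ hid ⟧)
          (cong (λ z → K - z) (trans (cong (_- ⟦ hid ⟧) (trans (sym (ι-+ dA dB)) (trans (cong ⟦_⟧ (sym d′)) (ι-+ (countF (X ∩ uncoloured c′)) hid))))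
            (solve 2 (λ a h → (a :+ h) :- h := a) refl ⟦ countF (X ∩ uncoloured c′) ⟧ ⟦ hid ⟧)))
        main : ∀ {s} → 0r ≤ s → s ≤ t → ⟦ 3 ⟧ * ((⟦ suc C₁.N ⟧ + ⟦ suc C₂.N ⟧) * x) ≤ ⟦ 2 ⟧ * ((C₂.u - s) * (C₂.u - s))
        main ps s≤t = glue-energy (0<ι C₁.N) (0<ι C₂.N) C₁.0≤u C₂.0≤u ps s≤t cond
          (excess-add (within (E ⊔ c′) X) (within (E ⊔ C₁.c) (A ∩ B)) (within (E ⊔ C₁.c) A) (within (E ⊔ C₂.c) B) (within-glue sep C₁.c C₂.c C₂.bound)) C₁.energy C₂.energy
          (subst (λ z → z * z ≤ ⟦ suc C₁.N ⟧ * ⟦ within (E ⊔ C₁.c) (A ∩ B) ⟧)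
            (solve 3 (λ K a h → K :- h := (K :- a) :+ (a :- h)) refl K ⟦ dA ⟧ ⟦ hid ⟧) (separator-bound C₁))
        result : Dec (countF (X ∩ uncoloured c′) ℕ.≤ k) → Flat X ⊎ Σ (Coloured X) λ C → Coloured.N C ≡ C₁.N ℕ.+ suc C₂.N
        result (yes d≤k) = inj₂ (record
          { N = C₁.N ℕ.+ suc C₂.N ; c = c′ ; bound = bound′ ; d≤k = d≤k
          ; energy = subst₂ (λ M z → ⟦ 3 ⟧ * (M * x) ≤ ⟦ 2 ⟧ * (z * z)) (sym (ι-+ (suc C₁.N) (suc C₂.N))) w-t (main 0≤t ≤-refl) } , refl)
        result (no d>k) = inj₁ (flat-from c′ X (nonpositive (C₁.N ℕ.+ suc C₂.N)
          (subst₂ (λ M z → ⟦ 3 ⟧ * (M * x) ≤ z) (sym (ι-+ (suc C₁.N) (suc C₂.N)))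
            (solve 1 (λ w → con (pos 2) :* ((w :- w) :* (w :- w)) := con (pos 0)) refl C₂.u) (main C₂.0≤u w≤t))))
          where
          w≤t : C₂.u ≤ t
          w≤t = 0≤-⇒≤ (subst (0r ≤_) (trans (solve 2 (λ a b → b :- a := con (pos 0) :- (a :- b)) refl K ⟦ countF (X ∩ uncoloured c′) ⟧)
            (trans (cong (λ z → 0r - z) (sym w-t)) (solve 2 (λ w t → con (pos 0) :- (w :- t) := t :- w) refl C₂.u t)))
            (≤⇒0≤- (ι-mono-≤ (ℕₚ.<⇒≤ (ℕₚ.≰⇒> d>k)))))

      -- A flat side contributes at most 0, so f(X) ≤ 2u² / (3M) - v² / M, where v counts the
      -- coloured vertices of the separator. This is at most 0 because v ≥ u.
      coloured-flat : Coloured A → Flat B → Flat X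
      coloured-flat C h = flat-from c′ X (nonpositive C.N (≤-trans (by-difference
          (0≤-+ (0≤-* (0≤-* (0≤ι 3) (0≤ι (suc C.N))) (≤⇒0≤- (≤-trans (excess-add (within (E ⊔ c′) X) (within (E ⊔ C.c) (A ∩ B)) (within (E ⊔ C.c) A) (within (E ⊔ (λ _ → 0)) B) (within-glue sep C.c (λ _ → 0) (λ _ → z≤n))) (+-mono-≤ ≤-refl b≤0))))
            (0≤-+ (≤⇒0≤- C.energy) (0≤-+ (0≤-* (0≤ι 3) (≤⇒0≤- (separator-bound C))) (0≤-+ (0≤-* (0≤-* (0≤ι 3) v-u) u+v) (0≤-square C.u)))))
          (solve 7 (λ M x q a u v z → (con (pos 3) :* M) :* ((a :+ con (pos 0)) :- (x :+ q)) :+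
              ((con (pos 2) :* (u :* u) :- con (pos 3) :* (M :* a)) :+ (con (pos 3) :* (M :* q :- v :* v) :+ ((con (pos 3) :* (v :- u)) :* (v :+ u) :+ u :* u)))
              := con (pos 0) :- con (pos 3) :* (M :* x)) refl ⟦ suc C.N ⟧ (excess (within (E ⊔ c′) X) (countF X)) ⟦ within (E ⊔ C.c) (A ∩ B) ⟧
              (excess (within (E ⊔ C.c) A) (countF A)) C.u v K)) ≤-refl))
        where
        module C = Coloured C
        c′ = recolour B (λ _ → 0) (shift 0 ∘ C.c)
        v = K - ⟦ countF ((A ∩ B) ∩ uncoloured C.c) ⟧
        v-u : 0r ≤ v - C.u
        v-u = subst (0r ≤_) (solve 3 (λ K a h → a :- h := (K :- h) :- (K :- a)) refl K ⟦ countF (A ∩ uncoloured C.c) ⟧ ⟦ countF ((A ∩ B) ∩ uncoloured C.c) ⟧)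
          (≤⇒0≤- (ι-mono-≤ (hidden-≤ C.c)))
        u+v : 0r ≤ v + C.u
        u+v = 0≤-+ (≤-trans C.0≤u (0≤-⇒≤ v-u)) C.0≤u
        b≤0 : excess (within (E ⊔ (λ _ → 0)) B) (countF B) ≤ 0r
        b≤0 = ≤-trans (excess-mono (countF B) (pairs-mono (λ i j → mp (decide 3 (λ a b e → (a ∧ (b ∧ (e ∨ false))) ⟹ (a ∧ (b ∧ e))) refl (B i) (B j) (E i j))))) h

      a : Carrier
      a = ⟦ countF A ⟧ - K

      -- Attaching the a vertices of A ∖ B creates at most |A|² - k² = a² + 2ka counted pairs,
      -- against a cost of δ k a. The difference is what f surely drops by.
      gain : Carrier
      gain = a * (D * K - a)

      excess-extend : ∀ {N} γ (c : Colouring n) → (∀ i → c i ℕ.≤ N) → (γ ≡ 0 ⊎ N ℕ.< γ) →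
        excess (within (E ⊔ recolour B c (λ _ → γ)) X) (countF X) ≤ excess (within (E ⊔ c) B) (countF B) - gain
      excess-extend γ c bound far = by-difference (≤⇒0≤- (excess-add (within (E ⊔ recolour B c (λ _ → γ)) X) (k ℕ.* k) (countF A ℕ.* countF A) (within (E ⊔ c) B) (within-extend′ γ c bound far)))
        (trans (cong (λ z → (z - (⟦ 2 ⟧ + D) * K * (⟦ countF A ⟧ - K)) + y - (x + ⟦ k ℕ.* k ⟧)) (ι-* (countF A) (countF A)))
          (trans (cong (λ z → (⟦ countF A ⟧ * ⟦ countF A ⟧ - (⟦ 2 ⟧ + D) * K * (⟦ countF A ⟧ - K)) + y - (x + z)) (ι-* k k))
            (solve 5 (λ A K D x y → (A :* A :- (con (pos 2) :+ D) :* K :* (A :- K)) :+ y :- (x :+ K :* K) := (y :- (A :- K) :* (D :* K :- (A :- K))) :- x)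
              refl ⟦ countF A ⟧ K D x y)))
        where
        x = excess (within (E ⊔ recolour B c (λ _ → γ)) X) (countF X)
        y = excess (within (E ⊔ c) B) (countF B)
        within-extend′ : ∀ {N} γ (c : Colouring n) → (∀ i → c i ℕ.≤ N) → (γ ≡ 0 ⊎ N ℕ.< γ) →
          within (E ⊔ recolour B c (λ _ → γ)) X ℕ.+ k ℕ.* k ℕ.≤ countF A ℕ.* countF A ℕ.+ within (E ⊔ c) B
        within-extend′ γ c bound far = subst (within (E ⊔ recolour B c (λ _ → γ)) X ℕ.+ k ℕ.* k ℕ.≤_) (ℕₚ.+-comm (within (E ⊔ c) B) (countF A ℕ.* countF A)) (within-extend sep γ c bound far)

      excess-prune : excess (within E X) (countF X) ≤ excess (within E B) (countF B) - gain
      excess-prune = ≤-trans (excess-mono (countF X) (within≤ (recolour B (λ _ → 0) (λ _ → 0)) X)) (≤-trans (excess-extend {0} 0 (λ _ → 0) (λ _ → z≤n) (inj₁ refl))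
        (+-monoʳ-≤ (- gain) (excess-mono (countF B) (pairs-mono (λ i j → mp (decide 3 (λ a b e → (a ∧ (b ∧ (e ∨ false))) ⟹ (a ∧ (b ∧ e))) refl (B i) (B j) (E i j)))))))

      flat-extend : 0r ≤ gain → Flat B → Flat X
      flat-extend p h = ≤-trans excess-prune (≤-trans (by-difference p (solve 2 (λ x g → g := x :- (x :- g)) refl (excess (within E B) (countF B)) gain)) h)

      unhidden : ∀ c → countF (X ∩ uncoloured (recolour B c (λ _ → 0))) ℕ.+ k ≡ countF A ℕ.+ countF (B ∩ uncoloured c)
      unhidden c = trans (cong₂ ℕ._+_ (countF-cong (λ i → cong (X i ∧_) (uncoloured-recolour B c (λ _ → 0) i)))
          (trans (sym order) (countF-cong {n} {A ∩ B} {(A ∩ B) ∩ (λ _ → true)} (λ i → sym (∧-identityʳ ((A ∩ B) i))))))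
        (trans (count-sides sep (λ _ → true) (uncoloured c)) (cong (ℕ._+ countF (B ∩ uncoloured c)) (countF-cong {n} {A ∩ (λ _ → true)} {A} (λ i → ∧-identityʳ (A i)))))
        where open import Data.Bool.Properties using (∧-identityʳ)

      unhidden-R : ∀ c → ⟦ countF (X ∩ uncoloured (recolour B c (λ _ → 0))) ⟧ ≡ a + ⟦ countF (B ∩ uncoloured c) ⟧
      unhidden-R c = trans (solve 2 (λ x k → x := (x :+ k) :- k) refl ⟦ countF (X ∩ uncoloured (recolour B c (λ _ → 0))) ⟧ K) (trans (cong (_- K) (trans (sym (ι-+ (countF (X ∩ uncoloured (recolour B c (λ _ → 0)))) k)) (trans (cong ⟦_⟧ (unhidden c)) (ι-+ (countF A) (countF (B ∩ uncoloured c))))))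
        (solve 3 (λ a b k → (a :+ b) :- k := (a :- k) :+ b) refl ⟦ countF A ⟧ ⟦ countF (B ∩ uncoloured c) ⟧ K))

      -- Leaving a further vertices uncoloured lowers the allowance 2u² to 2(u - a)², a loss of less
      -- than 4au for a > 0, and the gain pays for 4au. If more than k vertices would be uncoloured,
      -- then a ≥ u and 2u² - 4au is already at most 0.
      extend-uncoloured : (C : Coloured B) → let open Coloured C in 0r ≤ a → ⟦ 4 ⟧ * (a * u) ≤ ⟦ 3 ⟧ * (⟦ suc N ⟧ * gain) →
        Flat X ⊎ Σ (Coloured X) λ C′ → (Coloured.N C′ ≡ N) × (Coloured.u C′ ≡ u - a)
      extend-uncoloured C pa h = result (countF (X ∩ uncoloured c′) ℕ.≤? k)
        where
        open Coloured C
        c′ = recolour B c (λ _ → 0)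
        x = excess (within (E ⊔ c′) X) (countF X)
        y = excess (within (E ⊔ c) B) (countF B)
        u′ : K - ⟦ countF (X ∩ uncoloured c′) ⟧ ≡ u - a
        u′ = trans (cong (λ z → K - z) (unhidden-R c)) (solve 3 (λ K a d → K :- (a :+ d) := (K :- d) :- a) refl K a ⟦ countF (B ∩ uncoloured c) ⟧)
        drop : ⟦ 3 ⟧ * (⟦ suc N ⟧ * x) ≤ ⟦ 2 ⟧ * (u * u) - ⟦ 4 ⟧ * (a * u)
        drop = by-difference (0≤-+ (0≤-* (0≤-* (0≤ι 3) (0≤ι (suc N))) (≤⇒0≤- (excess-extend 0 c bound (inj₁ refl)))) (0≤-+ (≤⇒0≤- energy) (≤⇒0≤- h)))
          (solve 6 (λ N x y g u a → (con (pos 3) :* N) :* ((y :- g) :- x) :+ ((con (pos 2) :* (u :* u) :- con (pos 3) :* (N :* y)) :+ (con (pos 3) :* (N :* g) :- con (pos 4) :* (a :* u)))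
            := (con (pos 2) :* (u :* u) :- con (pos 4) :* (a :* u)) :- con (pos 3) :* (N :* x)) refl ⟦ suc N ⟧ x y gain u a)
        bound′ : ∀ i → c′ i ℕ.≤ suc N
        bound′ i with B i
        ... | true = bound i
        ... | false = z≤n
        result : Dec (countF (X ∩ uncoloured c′) ℕ.≤ k) → Flat X ⊎ Σ (Coloured X) λ C′ → (Coloured.N C′ ≡ N) × (Coloured.u C′ ≡ u - a)
        result (yes d≤k′) = inj₂ (record { N = N ; c = c′ ; bound = bound′ ; d≤k = d≤k′
          ; energy = subst (λ z → ⟦ 3 ⟧ * (⟦ suc N ⟧ * x) ≤ ⟦ 2 ⟧ * (z * z)) (sym u′) (≤-trans drop (by-difference (0≤-* (0≤ι 2) (0≤-square a))
              (solve 2 (λ u a → con (pos 2) :* (a :* a) := con (pos 2) :* ((u :- a) :* (u :- a)) :- (con (pos 2) :* (u :* u) :- con (pos 4) :* (a :* u))) refl u a))) } , refl , u′)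
        result (no d>k) = inj₁ (flat-from c′ X (nonpositive N (≤-trans drop (by-difference (0≤-+ (0≤-* (0≤-* (0≤ι 2) 0≤u) a-u) (0≤-* (0≤-* (0≤ι 2) 0≤u) pa))
            (solve 2 (λ u a → (con (pos 2) :* u) :* (a :- u) :+ (con (pos 2) :* u) :* a := con (pos 0) :- (con (pos 2) :* (u :* u) :- con (pos 4) :* (a :* u))) refl u a)))))
          where
          a-u : 0r ≤ a - u
          a-u = subst (0r ≤_) (trans (solve 2 (λ K d → d :- K := con (pos 0) :- (K :- d)) refl K ⟦ countF (X ∩ uncoloured c′) ⟧)
            (trans (cong (λ z → 0r - z) u′) (solve 2 (λ u a → con (pos 0) :- (u :- a) := a :- u) refl u a))) (≤⇒0≤- (ι-mono-≤ (ℕₚ.<⇒≤ (ℕₚ.≰⇒> d>k))))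

      extend-coloured : ∀ {N} (c : Colouring n) → (∀ i → c i ℕ.≤ N) → Σ (Colouring n) λ c′ → (∀ i → c′ i ℕ.≤ suc N) ×
        (countF (X ∩ uncoloured c′) ≡ countF (B ∩ uncoloured c)) ×
        (excess (within (E ⊔ c′) X) (countF X) ≤ excess (within (E ⊔ c) B) (countF B) - gain)
      extend-coloured {N} c bound = c′ , bound′ , count , excess-extend (suc N) c bound (inj₂ ℕₚ.≤-refl)
        where
        c′ = recolour B c (λ _ → suc N)
        bound′ : ∀ i → c′ i ℕ.≤ suc N
        bound′ i with B i
        ... | true = ℕₚ.m≤n⇒m≤1+n (bound i)
        ... | false = ℕₚ.≤-refl
        count : countF (X ∩ uncoloured c′) ≡ countF (B ∩ uncoloured c)
        count = trans (sym (ℕₚ.+-identityʳ (countF (X ∩ uncoloured c′)))) (trans (cong₂ ℕ._+_ (countF-cong {n} {X ∩ uncoloured c′} (λ i → cong (X i ∧_) (uncoloured-recolour B c (λ _ → suc N) i)))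
            (sym (trans (countF-cong {n} {(A ∩ B) ∩ (λ _ → false)} {λ _ → false} (λ i → ∧-zeroʳ ((A ∩ B) i))) (sumF-0 n))))
          (trans (count-sides sep (λ _ → false) (uncoloured c)) (cong (ℕ._+ countF (B ∩ uncoloured c)) (trans (countF-cong {n} {A ∩ (λ _ → false)} {λ _ → false} (λ i → ∧-zeroʳ (A i))) (sumF-0 n)))))
          where open import Data.Bool.Properties using (∧-zeroʳ)

    -- Of the two directions of gluing the affordable one is taken. The result has at least two
    -- colours, which is all that the extra condition of alternative (2) asks for.
    glue : ∀ {X} (sep : Separation E k X) → (C₁ : Coloured (Separation.A sep)) (C₂ : Coloured (Separation.B sep)) →
      Flat X ⊎ Σ (Coloured X) λ C → 1 ℕ.≤ Coloured.N C
    glue sep C₁ C₂ with glue-choice {u = Coloured.u C₁} {Coloured.u C₂} (0<ι (Coloured.N C₁)) (0<ι (Coloured.N C₂))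
    ... | inj₁ p with glue-side sep C₁ C₂ p
    ...   | inj₁ f = inj₁ f
    ...   | inj₂ (C , e) = inj₂ (C , subst (1 ℕ.≤_) (sym e) (ℕₚ.≤-trans (s≤s z≤n) (ℕₚ.m≤n+m _ (Coloured.N C₁))))
    glue sep C₁ C₂ | inj₂ p with glue-side (flip-sep sep) C₂ C₁ p
    ...   | inj₁ f = inj₁ f
    ...   | inj₂ (C , e) = inj₂ (C , subst (1 ℕ.≤_) (sym e) (ℕₚ.≤-trans (s≤s z≤n) (ℕₚ.m≤n+m _ (Coloured.N C₂))))

-- Alternative (1): one-coloured sets, pruning and gluing

module One (R : RealField) where
  open Reals R
  open Energy R

  module _ {n : ℕ} (E : Rel n) (k : ℕ) where
    everything : VSet n
    everything _ = true

    module _ (D : Carrier) where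
      open Certificates E k D

      0≤a : ∀ {X} (sep : Separation E k X) → 0r ≤ a sep
      0≤a sep = ≤⇒0≤- (ι-mono-≤ (subst (ℕ._≤ countF A) order (countF-mono {n} {A ∩ B} {A} (λ i p → proj₁ (∧-true {A i} p)))))
        where open Separation sep

      -- A single colour on all of X makes every pair counted, so the energy is that of a complete
      -- set.
      colour-leaf : ∀ X → ⟦ 3 ⟧ * (⟦ countF X ⟧ * ⟦ countF X ⟧ - (⟦ 2 ⟧ + D) * K * (⟦ countF X ⟧ - K)) ≤ ⟦ 2 ⟧ * (K * K) → Coloured X
      colour-leaf X h = record
        { N = 0 ; c = λ _ → 1 ; bound = λ _ → s≤s z≤n ; d≤k = subst (ℕ._≤ k) (sym none) z≤n
        ; energy = subst (λ d → ⟦ 3 ⟧ * (⟦ 1 ⟧ * excess w (countF X)) ≤ ⟦ 2 ⟧ * ((K - ⟦ d ⟧) * (K - ⟦ d ⟧))) (sym none)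
            (by-difference (0≤-+ (≤⇒0≤- h) (0≤-* (0≤ι 3) (≤⇒0≤- (≤-trans (ι-mono-≤ (within≤square (E ⊔ (λ _ → 1)) X)) (≤-reflexive (ι-* (countF X) (countF X)))))))
              (solve 4 (λ K D s w → (con (pos 2) :* (K :* K) :- con (pos 3) :* (s :* s :- (con (pos 2) :+ D) :* K :* (s :- K))) :+ con (pos 3) :* (s :* s :- w)
                  := con (pos 2) :* ((K :- con (pos 0)) :* (K :- con (pos 0))) :- con (pos 3) :* (con (pos 1) :* (w :- (con (pos 2) :+ D) :* K :* (s :- K)))) refl K D s ⟦ w ⟧)) }
        where
        w = within (E ⊔ (λ _ → 1)) X
        s = ⟦ countF X ⟧
        none : countF (X ∩ uncoloured (λ _ → 1)) ≡ 0
        none = trans (countF-cong {n} {X ∩ uncoloured (λ _ → 1)} {λ _ → false} (λ i → ∧-zeroʳ (X i))) (sumF-0 n)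
          where open import Data.Bool.Properties using (∧-zeroʳ)

      -- Density puts f of the whole graph at (2 + D) k² or more, whereas a certificate allows at
      -- most 2k² / 3 and flatness allows 0.
      no-certificate : 0r < K → 0r ≤ D → (⟦ 2 ⟧ + D) * K * ⟦ n ⟧ ≤ ⟦ within E everything ⟧ → ¬ (Flat everything ⊎ Coloured everything)
      no-certificate pK pD h cert = <-irrefl 0r (<-≤-trans positive (nonpos cert))
        where
        e = within E everything
        total-size : countF everything ≡ n
        total-size = sumF-1 n
        x = excess e (countF everything)
        low : (⟦ 2 ⟧ + D) * (K * K) ≤ x
        low = subst (λ m → (⟦ 2 ⟧ + D) * (K * K) ≤ ⟦ e ⟧ - (⟦ 2 ⟧ + D) * K * (⟦ m ⟧ - K)) (sym total-size)
          (by-difference (≤⇒0≤- h) (solve 4 (λ D K n e → e :- (con (pos 2) :+ D) :* K :* n :=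
            (e :- (con (pos 2) :+ D) :* K :* (n :- K)) :- (con (pos 2) :+ D) :* (K :* K)) refl D K ⟦ n ⟧ ⟦ e ⟧))
        positive : 0r < ⟦ 4 ⟧ * (K * K)
        positive = <-* (0<ι 3) (<-* pK pK)
        scale : ∀ N {y} → x ≤ y → 0r ≤ y - x → ⟦ 3 ⟧ * x ≤ ⟦ 3 ⟧ * (⟦ suc N ⟧ * y)
        scale N {y} p q = by-difference (0≤-+ (0≤-* (0≤ι 3) q) (0≤-* (0≤ι 3) (0≤-* (0≤ι N) (≤-trans (≤-trans 0≤low low) p))))
          (trans (solve 3 (λ x y N → con (pos 3) :* (y :- x) :+ con (pos 3) :* (N :* y) := con (pos 3) :* ((con (pos 1) :+ N) :* y) :- con (pos 3) :* x) refl x y ⟦ N ⟧)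
            (cong (λ o → ⟦ 3 ⟧ * ((o + ⟦ N ⟧) * y) - ⟦ 3 ⟧ * x) ι-1))
          where
          0≤low : 0r ≤ (⟦ 2 ⟧ + D) * (K * K)
          0≤low = 0≤-* (0≤-+ (0≤ι 2) pD) (0≤-square K)
        finish : ∀ {u} → 0r ≤ u → u ≤ K → ⟦ 3 ⟧ * x ≤ ⟦ 2 ⟧ * (u * u) → ⟦ 4 ⟧ * (K * K) ≤ 0r
        finish {u} pu q r = by-difference (0≤-+ (≤⇒0≤- r) (0≤-+ (0≤-* (0≤ι 3) (≤⇒0≤- low)) (0≤-+ (0≤-* (0≤-* (0≤ι 3) pD) (0≤-square K)) (0≤-* (0≤-* (0≤ι 2) (≤⇒0≤- q)) (0≤-+ (<⇒≤ pK) pu)))))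
          (solve 4 (λ D K u x → (con (pos 2) :* (u :* u) :- con (pos 3) :* x) :+ (con (pos 3) :* (x :- (con (pos 2) :+ D) :* (K :* K)) :+ ((con (pos 3) :* D) :* (K :* K) :+ (con (pos 2) :* (K :- u)) :* (K :+ u)))
            := con (pos 0) :- con (pos 4) :* (K :* K)) refl D K u x)
        nonpos : Flat everything ⊎ Coloured everything → ⟦ 4 ⟧ * (K * K) ≤ 0r
        nonpos (inj₁ f) = finish ≤-refl (<⇒≤ pK) (by-difference (0≤-* (0≤ι 3) (≤⇒0≤- f)) (solve 1 (λ x → con (pos 3) :* (con (pos 0) :- x) := con (pos 2) :* (con (pos 0) :* con (pos 0)) :- con (pos 3) :* x) refl x))
        nonpos (inj₂ C) = finish 0≤u (by-difference (0≤ι (countF (everything ∩ uncoloured c))) (solve 2 (λ K d → d := K :- (K :- d)) refl K ⟦ countF (everything ∩ uncoloured c) ⟧))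
          (≤-trans (scale N {excess (within (E ⊔ c) everything) (countF everything)} p (≤⇒0≤- p)) energy)
          where
          open Coloured C
          p = excess-mono (countF everything) (within≤ c everything)

      -- The hypothesis makes the gain at least 4aK / 3, and 4aK covers the loss 4au because u ≤ K.
      prune : ∀ {X} (sep : Separation E k X) → ⟦ 4 ⟧ * K ≤ ⟦ 3 ⟧ * (D * K - a sep) →
        Flat (Separation.B sep) ⊎ Coloured (Separation.B sep) → Flat X ⊎ Coloured X
      prune sep h (inj₁ f) = inj₁ (flat-extend sep (0≤-* (0≤a sep) (0≤-*-cancel (0<ι 2) (≤-trans (0≤-* (0≤ι 4) (0≤ι k)) h))) f)
      prune sep h (inj₂ C) = [ inj₁ , (λ C′ → inj₂ (proj₁ C′)) ]′ (extend-uncoloured sep C (0≤a sep) enough)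
        where
        open Coloured C
        d = countF (Separation.B sep ∩ uncoloured c)
        pg : 0r ≤ gain sep
        pg = 0≤-* (0≤a sep) (0≤-*-cancel (0<ι 2) (≤-trans (0≤-* (0≤ι 4) (0≤ι k)) h))
        enough : ⟦ 4 ⟧ * (a sep * u) ≤ ⟦ 3 ⟧ * (⟦ suc N ⟧ * gain sep)
        enough = by-difference
          (0≤-+ (0≤-* (0≤a sep) (≤⇒0≤- h)) (0≤-+ (0≤-* (0≤-* (0≤ι 4) (0≤a sep)) (0≤ι d)) (0≤-* (0≤-* (0≤ι 3) (0≤ι N)) pg)))
          (trans (solve 5 (λ a K D d N → a :* (con (pos 3) :* (D :* K :- a) :- con (pos 4) :* K) :+ ((con (pos 4) :* a) :* d :+ (con (pos 3) :* N) :* (a :* (D :* K :- a)))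
              := con (pos 3) :* ((con (pos 1) :+ N) :* (a :* (D :* K :- a))) :- con (pos 4) :* (a :* (K :- d))) refl (a sep) K D ⟦ d ⟧ ⟦ N ⟧)
            (cong (λ o → ⟦ 3 ⟧ * ((o + ⟦ N ⟧) * gain sep) - ⟦ 4 ⟧ * (a sep * u)) ι-1))

      join : ∀ {X} (sep : Separation E k X) → Flat (Separation.A sep) ⊎ Coloured (Separation.A sep) →
        Flat (Separation.B sep) ⊎ Coloured (Separation.B sep) → Flat X ⊎ Coloured X
      join sep (inj₁ f) (inj₁ g) = inj₁ (flat-flat sep f g)
      join sep (inj₁ f) (inj₂ C) = inj₁ (coloured-flat (flip-sep sep) C f)
      join sep (inj₂ C) (inj₁ g) = inj₁ (coloured-flat sep C g)
      join sep (inj₂ C) (inj₂ C′) with glue sep C C′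
      ... | inj₁ f = inj₁ f
      ... | inj₂ (C″ , _) = inj₂ C″

    module _ {σ e : Carrier} (σ-large : ⟦ 4 ⟧ ≤ ⟦ 3 ⟧ * σ) (σe : ⟦ 3 ⟧ * (σ * e) ≡ 1r) where
      open Certificates E k (σ + e)

      private
        0≤σ : 0r ≤ σ
        0≤σ = 0≤-*-cancel (0<ι 2) (≤-trans (0≤ι 4) σ-large)

        0≤σ³ : 0r ≤ ⟦ 3 ⟧ * σ
        0≤σ³ = 0≤-* (0≤ι 3) 0≤σ

        0<σ³ : 0r < ⟦ 3 ⟧ * σ
        0<σ³ = <-≤-trans (0<ι 3) σ-large

        0≤e : 0r ≤ e
        0≤e = 0≤-*-cancel 0<σ³ (subst (0r ≤_) (trans (sym σe) (sym (*-assoc _ _ _))) (<⇒≤ 0<1))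

        -- Two sides with fewer than (1 + e) k vertices each unite to fewer than (1 + 2e) k, hence
        -- to no more than (1 + σ) k, where no separation is taken.
        2e≤σ : 0r ≤ σ - ⟦ 2 ⟧ * e
        2e≤σ = 0≤-*-cancel 0<σ³ (subst (0r ≤_)
          (trans (trans (solve 2 (λ s o → (s :- con (pos 1)) :* (con (pos 3) :* s :- con (pos 4)) :+ (con (pos 2) :+ con (pos 2) :* (con (pos 3) :* s :- con (pos 4)) :+ s :+ (con (pos 2) :- con (pos 2) :* o)) := (con (pos 3) :* s) :* s :- con (pos 2) :* o) refl σ 1r)
              (cong (λ o → (⟦ 3 ⟧ * σ) * σ - ⟦ 2 ⟧ * o) (sym σe)))
            (solve 2 (λ s e → (con (pos 3) :* s) :* s :- con (pos 2) :* (con (pos 3) :* (s :* e)) := (con (pos 3) :* s) :* (s :- con (pos 2) :* e)) refl σ e))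
          (0≤-+ (0≤-* 0≤σ-1 (≤⇒0≤- σ-large)) (0≤-+ (0≤-+ (0≤-+ (0≤ι 2) (0≤-* (0≤ι 2) (≤⇒0≤- σ-large))) 0≤σ) (≤-reflexive (trans (solve 0 (con (pos 0) := con (pos 2) :- con (pos 2) :* con (pos 1)) refl) (cong (λ o → ⟦ 2 ⟧ - ⟦ 2 ⟧ * o) ι-1))))))
          where
          0≤σ-1 : 0r ≤ σ - ⟦ 1 ⟧
          0≤σ-1 = 0≤-*-cancel (0<ι 2) (subst (0r ≤_) (solve 1 (λ s → (con (pos 3) :* s :- con (pos 4)) :+ con (pos 1) := con (pos 3) :* (s :- con (pos 1))) refl σ) (0≤-+ (≤⇒0≤- σ-large) (0≤ι 1)))

      module _ (separate : ∀ X → (1r + σ) * K < ⟦ countF X ⟧ → Separation E k X) where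
        prune-small : ∀ {X} (sep : Separation E k X) → a sep ≤ e * K → Flat (Separation.B sep) ⊎ Coloured (Separation.B sep) → Flat X ⊎ Coloured X
        prune-small sep h = prune (σ + e) sep (by-difference (0≤-+ (0≤-* (≤⇒0≤- σ-large) (0≤ι k)) (0≤-* (0≤ι 3) (≤⇒0≤- h)))
          (solve 4 (λ s e K a → (con (pos 3) :* s :- con (pos 4)) :* K :+ con (pos 3) :* (e :* K :- a) := con (pos 3) :* ((s :+ e) :* K :- a) :- con (pos 4) :* K) refl σ e K (a sep)))

        -- Nothing is claimed below (1 + e) k, where a one-coloured complete set would have too
        -- large an excess. A side below this threshold has a ≤ e k and is pruned; two sides above
        -- it are joined.
        certificate : ∀ s X → countF X ℕ.< s → (1r + e) * K ≤ ⟦ countF X ⟧ → Flat X ⊎ Coloured X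
        certificate (suc s) X (s≤s lt) big with <-≤-connex ((1r + σ) * K) ⟦ countF X ⟧
        -- With a = |X| - k, the slack of the leaf condition is 3 (σ k - a) (a - e k), because 3σe =
        -- 1 turns the product of the roots into k² / 3.
        ... | inj₂ small = inj₂ (colour-leaf (σ + e) X (by-difference (0≤-* (0≤ι 3) (0≤-* (≤⇒0≤- small) (≤⇒0≤- big)))
          (trans (cong (λ o → ⟦ 3 ⟧ * (((o + σ) * K - x) * (x - (o + e) * K))) (sym ι-1))
            (trans (solve 4 (λ s e K x → con (pos 3) :* (((con (pos 1) :+ s) :* K :- x) :* (x :- (con (pos 1) :+ e) :* K)) :=
              (con (pos 3) :* (con (pos 1) :* (K :* K)) :- con (pos 3) :* (s :* e) :* (K :* K)) :- con (pos 3) :* (x :* x :- (con (pos 2) :+ (s :+ e)) :* K :* (x :- K))) refl σ e K x)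
            (trans (cong (λ t → (⟦ 3 ⟧ * (⟦ 1 ⟧ * (K * K)) - t * (K * K)) - ⟦ 3 ⟧ * (x * x - (⟦ 2 ⟧ + (σ + e)) * K * (x - K))) (trans σe (sym ι-1)))
              (solve 2 (λ y z → (con (pos 3) :* (con (pos 1) :* y) :- con (pos 1) :* y) :- con (pos 3) :* z := con (pos 2) :* y :- con (pos 3) :* z) refl (K * K) (x * x - (⟦ 2 ⟧ + (σ + e)) * K * (x - K))))))))
          where x = ⟦ countF X ⟧
        ... | inj₁ large with separate X large
        ...   | sep with <-≤-connex ⟦ countF A ⟧ ((1r + e) * K) | <-≤-connex ⟦ countF B ⟧ ((1r + e) * K)
          where open Separation sep
        ...     | inj₁ p | inj₁ q = ⊥-elim (<-irrefl _ (<-trans large (≤-<-trans (≤-reflexive (size-R sep)) (0<-⇒< (subst (0r <_)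
              (trans (cong (λ o → ((o + e) * K - x) + (((o + e) * K - y) + (σ - ⟦ 2 ⟧ * e) * K)) (sym ι-1))
                (trans (solve 5 (λ s e K x y → ((con (pos 1) :+ e) :* K :- x) :+ (((con (pos 1) :+ e) :* K :- y) :+ (s :- con (pos 2) :* e) :* K) := (con (pos 1) :+ s) :* K :- ((x :+ y) :- K)) refl σ e K x y)
                  (cong (λ o → (o + σ) * K - (x + y - K)) ι-1)))
              (0<-+-≤ (<⇒0<- p) (0≤-+ (≤⇒0≤- (<⇒≤ q)) (0≤-* 2e≤σ (0≤ι k)))))))))
          where
          x = ⟦ countF (Separation.A sep) ⟧
          y = ⟦ countF (Separation.B sep) ⟧
        ...     | inj₁ p | inj₂ q = prune-small sep (small-side p) (certificate s B (ℕₚ.<-≤-trans proper-B lt) q)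
          where
          open Separation sep
          small-side : ∀ {x} → x < (1r + e) * K → x - K ≤ e * K
          small-side {x} p = by-difference (≤⇒0≤- (<⇒≤ p)) (trans (cong (λ o → (o + e) * K - x) (sym ι-1))
            (solve 3 (λ e K x → (con (pos 1) :+ e) :* K :- x := e :* K :- (x :- K)) refl e K x))
        ...     | inj₂ p | inj₁ q = prune-small (flip-sep sep) (small-side q) (certificate s A (ℕₚ.<-≤-trans proper-A lt) p)
          where
          open Separation sep
          small-side : ∀ {x} → x < (1r + e) * K → x - K ≤ e * K
          small-side {x} p = by-difference (≤⇒0≤- (<⇒≤ p)) (trans (cong (λ o → (o + e) * K - x) (sym ι-1))
            (solve 3 (λ e K x → (con (pos 1) :+ e) :* K :- x := e :* K :- (x :- K)) refl e K x))
        ...     | inj₂ p | inj₂ q = join (σ + e) sep (certificate s A (ℕₚ.<-≤-trans proper-A lt) p) (certificate s B (ℕₚ.<-≤-trans proper-B lt) q)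
          where open Separation sep

        alternative-one : 0r < K → 1 ℕ.≤ n → ¬ ((⟦ 2 ⟧ + (σ + e)) * K * ⟦ n ⟧ ≤ ⟦ within E everything ⟧)
        alternative-one pK pn h with <-≤-connex ⟦ n ⟧ ((1r + e) * K)
        ... | inj₂ q = no-certificate (σ + e) pK (0≤-+ 0≤σ 0≤e) h (certificate (suc n) everything (s≤s (ℕₚ.≤-reflexive (sumF-1 n)))
            (subst (λ m → (1r + e) * K ≤ ⟦ m ⟧) (sym (sumF-1 n)) q))
        -- With n < (1 + e) k even the complete graph has only n² < (2 + σ + e) k n counted pairs.
        ... | inj₁ q = <-irrefl _ (<-≤-trans (0<-+-≤ (<-* 0<n (<⇒0<- q)) (0≤-+ (≤⇒0≤- (≤-trans h (≤-trans (ι-mono-≤ (within≤square E everything))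
              (≤-reflexive (trans (ι-* (countF everything) (countF everything)) (cong (λ m → ⟦ m ⟧ * ⟦ m ⟧) (sumF-1 n))))))) (0≤-* (0≤-+ 0≤σ (0≤ι 1)) (0≤-* (0≤ι k) (0≤ι n)))))
            (≤-reflexive (trans (cong (λ o → ⟦ n ⟧ * ((o + e) * K - ⟦ n ⟧) + (⟦ n ⟧ * ⟦ n ⟧ - (⟦ 2 ⟧ + (σ + e)) * K * ⟦ n ⟧ + (σ + ⟦ 1 ⟧) * (K * ⟦ n ⟧))) (sym ι-1))
              (solve 4 (λ s e K n → n :* ((con (pos 1) :+ e) :* K :- n) :+ (n :* n :- (con (pos 2) :+ (s :+ e)) :* K :* n :+ (s :+ con (pos 1)) :* (K :* n)) := con (pos 0)) refl σ e K ⟦ n ⟧))))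
          where
          0<n : 0r < ⟦ n ⟧
          0<n = ι-mono-< pn

-- Alternative (3): piecewise linear weights and their certificates

-- On lo ≤ 100 m (and 100 m ≤ hi), with m = (∣X∣ - k) / k, a set S ⊆ X of s k ≤ k vertices satisfies
-- f(X) ≤ e(S) / 2 + L + κ (1 - s), where 10⁴ (L + κ) = u₀ - u₁ m and 10⁴ κ = κ₀ - κ₁ m.
record Zone : Set where
  constructor zone
  field
    lo : ℕ
    hi : Maybe ℕ
    u₀ u₁ κ₀ κ₁ : ℕ

-- The function 10⁴ L is 3870 - 3660m, 3735 - 3480m, 3405 - 3150m and finally the constant -280.
-- Both L and κ are continuous at 0.75 and at 1; at 1.17 κ agrees and L rises by half of 10⁻⁴. The
-- negative final value is what rules out two large sides.
zones : List Zone
zones = zone 50 (just 75) 10870 5660 7000 2000 ∷ zone 75 (just 100) 10435 5080 6700 1600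
  ∷ zone 100 (just 117) 12005 6650 8600 3500 ∷ zone 117 nothing 4225 0 4505 0 ∷ []

variables : List ℕ → Linear
variables = map (λ i → (pos 1 , i))

atLeast atMost : ℕ → List ℕ → Linear
atLeast c v = map (λ i → (pos 100 , i)) v ++ ((ℤ.- pos c , 1) ∷ [])
atMost c v = negate (atLeast c v)

inZone : Zone → List ℕ → List Linear
inZone (zone lo nothing _ _ _ _) v = atLeast lo v ∷ []
inZone (zone lo (just hi) _ _ _ _) v = atLeast lo v ∷ atMost hi v ∷ []

bound-by-zone : Zone → Linear → Linear → Quadratic
bound-by-zone (zone _ _ u₀ u₁ κ₀ κ₁) m s = (((pos u₀ , 1) ∷ []) ⊛ k) ++ (((ℤ.- pos u₁ , 1) ∷ []) ⊛ m)
  ++ (((ℤ.- pos κ₀ , 1) ∷ []) ⊛ s) ++ scaleBy (pos κ₁) (m ⊛ s)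
  where
  k : Linear
  k = variables (1 ∷ [])

-- Coefficients of k², k a and a² in four upper bounds for 10⁴ f.
profile : List (ℕ × ℕ × ℕ)
profile = (10000 , 11090 , 10000) ∷ (10800 , 15090 , 10000) ∷ (10800 , 13090 , 5000) ∷ (10800 , 12090 , 3750) ∷ []

scale : ℕ
scale = 10000

-- The variables are 1 = k, 2 = ∣A∣ - k, 3 = ∣B∣ - k, 4, 5, 6 = the parts of S in A \ B, B \ A and A ∩ B,
-- 7, 8 = f(A), f(B), 9 = e(A ∩ B), 12 = e(S ∩ A ∩ B), and 10, 11 = e(S ∩ A), e(S ∩ B) minus the latter.
module _ (v x f p : ℕ) where
  profileRow : ℕ × ℕ × ℕ → Conditional
  profileRow (c₀ , c₁ , c₂) = [] , (ℤ.- pos scale , 0 , f) ∷ (pos c₀ , 1 , 1) ∷ (ℤ.- pos c₁ , 1 , v) ∷ (pos c₂ , v , v) ∷ []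

  -- In every zone the bound for a side is used with two test sets: the trace of S on the side, and
  -- the whole separator, for which the κ-term vanishes.
  zoneRows : List Zone → List Conditional
  zoneRows [] = []
  zoneRows (z ∷ zs) =
    (inZone z (v ∷ []) , (ℤ.- pos scale , 0 , f) ∷ (pos 5000 , 0 , p) ∷ (pos 5000 , 0 , 12) ∷ bound-by-zone z (variables (v ∷ [])) (variables (x ∷ 6 ∷ []))) ∷
    (inZone z (v ∷ []) , (ℤ.- pos scale , 0 , f) ∷ (pos 5000 , 0 , 9) ∷ bound-by-zone z (variables (v ∷ [])) (variables (1 ∷ []))) ∷ zoneRows zs

  sideRows : List Conditional
  sideRows = map profileRow profile ++
    ([] , (ℤ.- pos scale , 0 , f) ∷ (pos scale , 0 , 9) ∷ (pos scale , 0 , p) ∷ (ℤ.- pos 11090 , 1 , v) ∷ (pos scale , v , v)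
      ∷ (ℤ.- pos scale , x , x) ∷ (ℤ.- pos (2 ℕ.* scale) , x , 6) ∷ []) ∷
    zoneRows zones ++ ([] , (ℤ.- pos scale , 0 , p) ∷ (pos scale , x , x) ∷ (pos (2 ℕ.* scale) , x , 6) ∷ []) ∷ []

-- The last row says e(A ∩ B) ≤ f(A) + f(B). It expresses that only sets with f(X) ≥ 0 need to be
-- treated, the others being flat.
separatorRows : List Conditional
separatorRows = ([] , (ℤ.- pos scale , 0 , 12) ∷ (pos scale , 6 , 6) ∷ []) ∷
  ([] , (ℤ.- pos scale , 0 , 9) ∷ (pos scale , 1 , 1) ∷ []) ∷
  ([] , (ℤ.- pos scale , 0 , 12) ∷ (pos scale , 0 , 9) ∷ []) ∷
  ([] , (ℤ.- pos scale , 0 , 9) ∷ (pos scale , 0 , 12) ∷ (pos scale , 1 , 1) ∷ (ℤ.- pos scale , 6 , 6) ∷ []) ∷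
  ([] , (ℤ.- pos scale , 0 , 9) ∷ (pos scale , 0 , 7) ∷ (pos scale , 0 , 8) ∷ []) ∷ []

rows : List Conditional
rows = sideRows 2 4 7 10 ++ sideRows 3 5 8 11 ++ separatorRows

-- The weighted bound for X, with f(X) replaced by its upper bound f(A) + f(B) - e(A ∩ B) and e(S)
-- by the pairs that lie inside a common side.
goal : Zone → Quadratic
goal z = (ℤ.- pos scale , 0 , 7) ∷ (ℤ.- pos scale , 0 , 8) ∷ (pos scale , 0 , 9) ∷ (pos 5000 , 0 , 10) ∷ (pos 5000 , 0 , 11) ∷ (pos 5000 , 0 , 12)
  ∷ bound-by-zone z (variables (2 ∷ 3 ∷ [])) (variables (4 ∷ 5 ∷ 6 ∷ []))

common : List Linear
common = ((pos 100 , 1) ∷ []) ∷ ((pos 100 , 2) ∷ []) ∷ ((pos 100 , 3) ∷ []) ∷ ((pos 100 , 4) ∷ []) ∷ ((pos 100 , 5) ∷ []) ∷ ((pos 100 , 6) ∷ [])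
  ∷ ((pos 100 , 2) ∷ (-[1+ 99 ] , 4) ∷ []) ∷ ((pos 100 , 3) ∷ (-[1+ 99 ] , 5) ∷ [])
  ∷ ((-[1+ 99 ] , 4) ∷ (-[1+ 99 ] , 5) ∷ (-[1+ 99 ] , 6) ∷ (pos 100 , 1) ∷ []) ∷ ((-[1+ 99 ] , 2) ∷ (pos 100 , 3) ∷ []) ∷ []

bounds : ℕ → ℕ → ℕ → List Linear
bounds lo hi half = atLeast lo (2 ∷ 3 ∷ []) ∷ atMost hi (3 ∷ []) ∷ atMost hi (2 ∷ []) ∷ atLeast half (3 ∷ []) ∷ []

-- The first three belong to X in the first three zones. In the last zone `base₃` has both sides up
-- to 1.17 k, and `base₄` has the larger side beyond, where it is no longer bounded.
base₀ base₁ base₂ base₃ base₄ : List Linear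
base₀ = bounds 50 75 25 ++ atMost 75 (2 ∷ 3 ∷ []) ∷ common
base₁ = bounds 75 100 25 ++ atMost 100 (2 ∷ 3 ∷ []) ∷ common
base₂ = bounds 100 117 50 ++ atMost 117 (2 ∷ 3 ∷ []) ∷ common
base₃ = bounds 117 117 50 ++ common
base₄ = atLeast 117 (3 ∷ []) ∷ atMost 117 (2 ∷ []) ∷ common

-- The outer splits sit at borders of zones, so that the guarded rows of the two sides become
-- available; the inner ones cut by the parts of S and refine the sizes of the sides.
tree₀ : Tree
tree₀ =
  (split ((pos 100 , 3) ∷ (-[1+ 49 ] , 1) ∷ [])
   (split ((pos 100 , 2) ∷ (-[1+ 49 ] , 1) ∷ [])
    (leaf false 999 (2001516 ∷ 6860607 ∷ 5650816 ∷ 181212 ∷ 2220712 ∷ 3160615 ∷ 1061313 ∷ 2830206 ∷ 2511014 ∷ 3161116 ∷ 5281216 ∷ 190212 ∷ 4631415 ∷ 2121015 ∷ 7060616 ∷ 2321114 ∷ 2961016 ∷ 13970007 ∷ 1419913 ∷ 359904 ∷ 9659905 ∷ 9829918 ∷ 189931 ∷ 189917 ∷ 7519927 ∷ 19928 ∷ []))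
    (split ((pos 100 , 4) ∷ (pos 100 , 5) ∷ (pos 100 , 6) ∷ (-[1+ 29 ] , 1) ∷ [])
     (split ((pos 100 , 4) ∷ (pos 100 , 5) ∷ (pos 100 , 6) ∷ (-[1+ 78 ] , 1) ∷ [])
      (leaf true 999 (7000312 ∷ 10001517 ∷ 1000915 ∷ 5001518 ∷ 12000010 ∷ 15000812 ∷ 5000815 ∷ 10001216 ∷ 5001215 ∷ 5009913 ∷ 10009904 ∷ 10009919 ∷ []))
      (split ((pos 100 , 3) ∷ (-[1+ 67 ] , 1) ∷ [])
       (leaf true 9999 (7751316 ∷ 85000916 ∷ 42251315 ∷ 50000913 ∷ 37751618 ∷ 57751115 ∷ 20000213 ∷ 15001619 ∷ 57751416 ∷ 70000011 ∷ 100009919 ∷ 100009904 ∷ 50009913 ∷ []))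
       (split ((pos 100 , 4) ∷ (pos 100 , 5) ∷ (pos 100 , 6) ∷ (-[1+ 44 ] , 1) ∷ [])
        (split ((pos 100 , 6) ∷ (-[1+ 69 ] , 1) ∷ [])
         (leaf true 999 (5001321 ∷ 3001113 ∷ 2001718 ∷ 2001118 ∷ 2001316 ∷ 7860015 ∷ 2931515 ∷ 7079913 ∷ 10009904 ∷ 10009919 ∷ []))
         (split ((pos 100 , 6) ∷ (-[1+ 20 ] , 1) ∷ [])
          (leaf true 999 (9310016 ∷ 6311219 ∷ 690216 ∷ 3691214 ∷ 5690714 ∷ 4311922 ∷ 691719 ∷ 4311919 ∷ 2000014 ∷ 1311417 ∷ 10009919 ∷ 10009904 ∷ 5009913 ∷ []))
          (split ((pos 100 , 6) ∷ (-[1+ 9 ] , 1) ∷ [])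
           (leaf true 999 (2501320 ∷ 7000817 ∷ 7502023 ∷ 2000315 ∷ 5001315 ∷ 5002020 ∷ 631420 ∷ 10000017 ∷ 5009913 ∷ 10009904 ∷ 10009919 ∷ []))
           (split ((pos 100 , 5) ∷ (-[1+ 33 ] , 1) ∷ [])
            (split ((pos 100 , 5) ∷ (-[1+ 57 ] , 1) ∷ [])
             (leaf true 999 (7000017 ∷ 12001721 ∷ 5000222 ∷ 5001923 ∷ 3001517 ∷ 2001522 ∷ 5002224 ∷ 5002225 ∷ 5009913 ∷ 10009904 ∷ 10009919 ∷ []))
             (split ((pos 100 , 6) ∷ (-[1+ 6 ] , 1) ∷ [])
              (leaf true 999 (5001118 ∷ 2000018 ∷ 10001623 ∷ 5002326 ∷ 5002323 ∷ 10000020 ∷ 2000218 ∷ 3001620 ∷ 1051723 ∷ 5009913 ∷ 10009904 ∷ 10009919 ∷ []))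
              (split ((pos 100 , 2) ∷ (-[1+ 24 ] , 1) ∷ [])
               (leaf false 9999 (54050723 ∷ 1981824 ∷ 93950026 ∷ 47460124 ∷ 6051925 ∷ 118491726 ∷ 51512424 ∷ 70261317 ∷ 37500027 ∷ 39830018 ∷ 96982427 ∷ 48492525 ∷ 93950112 ∷ 1512526 ∷ 41410117 ∷ 44430125 ∷ 56121218 ∷ 54050123 ∷ 1510724 ∷ 53231727 ∷ 50009916 ∷ 50009901 ∷ 50009904 ∷ 50009918 ∷ []))
               (split ((pos 100 , 4) ∷ (pos 100 , 5) ∷ (-[1+ 29 ] , 1) ∷ [])
                (split ((pos 100 , 4) ∷ (pos 100 , 5) ∷ (-[1+ 78 ] , 1) ∷ [])
                 (leaf false 999 (12501920 ∷ 1230220 ∷ 1671929 ∷ 21710020 ∷ 11672127 ∷ 13671928 ∷ 11672626 ∷ 11671519 ∷ 11672629 ∷ 5832727 ∷ 11671925 ∷ 2752828 ∷ 7500405 ∷ 3920024 ∷ 16762027 ∷ 9421123 ∷ 20402026 ∷ 13922325 ∷ 4502425 ∷ 5009916 ∷ 2259901 ∷ 2759913 ∷ 2759931 ∷ 7759904 ∷ 5009918 ∷ []))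
                 (split ((pos 100 , 2) ∷ (-[1+ 16 ] , 1) ∷ [])
                  (split ((pos 100 , 4) ∷ (pos 100 , 5) ∷ (pos 100 , 6) ∷ (-[1+ 68 ] , 1) ∷ [])
                   (split ((pos 100 , 2) ∷ (-[1+ 18 ] , 1) ∷ [])
                    (leaf false 99999 (1012832229 ∷ 750000017 ∷ 96732528 ∷ 179502226 ∷ 1083330628 ∷ 175002329 ∷ 416673030 ∷ 583332929 ∷ 166670129 ∷ 133330122 ∷ 1000000030 ∷ 500002932 ∷ 166672830 ∷ 1000000128 ∷ 96730028 ∷ 83330101 ∷ 1166672230 ∷ 69940622 ∷ 70500022 ∷ 500009916 ∷ 137509901 ∷ 362509929 ∷ 862509904 ∷ 500009918 ∷ 362509913 ∷ []))
                    (leaf false 99999 (517832929 ∷ 648302230 ∷ 580650001 ∷ 166470628 ∷ 1045700022 ∷ 147040829 ∷ 326860128 ∷ 160393030 ∷ 197400122 ∷ 343392628 ∷ 321441828 ∷ 5452223 ∷ 6072830 ∷ 164870101 ∷ 182710429 ∷ 656610228 ∷ 1114202229 ∷ 732530002 ∷ 716802932 ∷ 325279916 ∷ 325279931 ∷ 1000009904 ∷ 325279918 ∷ 500009913 ∷ 349469919 ∷ [])))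
                   (leaf false 99999 (580482128 ∷ 321690627 ∷ 25652131 ∷ 553840001 ∷ 562091621 ∷ 232960000 ∷ 678310728 ∷ 267042828 ∷ 80301721 ∷ 321690527 ∷ 744540116 ∷ 75530021 ∷ 534091127 ∷ 678310127 ∷ 102620012 ∷ 73300428 ∷ 212400006 ∷ 558622831 ∷ 445369916 ∷ 445369931 ∷ 1000009904 ∷ 445369918 ∷ 500009913 ∷ 109299919 ∷ 19927 ∷ 19928 ∷ [])))
                  (split ((pos 100 , 2) ∷ (-[1+ 4 ] , 1) ∷ [])
                   (split ((pos 100 , 2) ∷ (-[1+ 10 ] , 1) ∷ [])
                    (split ((pos 100 , 5) ∷ (-[1+ 45 ] , 1) ∷ [])
                     (leaf false 99999 (383752729 ∷ 123540308 ∷ 206010118 ∷ 60871829 ∷ 304361329 ∷ 522260103 ∷ 222260323 ∷ 136590000 ∷ 151811823 ∷ 152180729 ∷ 15590831 ∷ 243123032 ∷ 76462331 ∷ 243120530 ∷ 68760730 ∷ 700002330 ∷ 500003030 ∷ 511880129 ∷ 500003033 ∷ 152189916 ∷ 152189931 ∷ 152189918 ∷ 1000009904 ∷ 500009913 ∷ 695649919 ∷ []))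
                     (leaf false 9999 (12940023 ∷ 46281823 ∷ 31280118 ∷ 35000323 ∷ 8230000 ∷ 69633030 ∷ 19630530 ∷ 19630015 ∷ 79812330 ∷ 59813033 ∷ 12570025 ∷ 36080007 ∷ 12941829 ∷ 100000730 ∷ 65000103 ∷ 960024 ∷ 120000129 ∷ 36869916 ∷ 27869931 ∷ 27869928 ∷ 100009904 ∷ 27869918 ∷ 50009913 ∷ 35299919 ∷ [])))
                    (leaf false 99999 (151050728 ∷ 163340117 ∷ 18712230 ∷ 937530128 ∷ 346360001 ∷ 453642929 ∷ 92710829 ∷ 51251317 ∷ 653642229 ∷ 737530629 ∷ 88570007 ∷ 453642932 ∷ 46361212 ∷ 55370013 ∷ 169760628 ∷ 18712830 ∷ 147942329 ∷ 169761228 ∷ 47219916 ∷ 46369931 ∷ 1000009904 ∷ 46369918 ∷ 500009913 ∷ 906439919 ∷ [])))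
                   (leaf true 999 (1002628 ∷ 1002830 ∷ 7002831 ∷ 7002128 ∷ 2001625 ∷ 2001123 ∷ 4002828 ∷ 5000025 ∷ 10002527 ∷ 1002728 ∷ 10009904 ∷ 5009913 ∷ 10009919 ∷ [])))))
                (leaf false 999 (6250819 ∷ 1752528 ∷ 11030219 ∷ 2871424 ∷ 1750226 ∷ 421925 ∷ 3621418 ∷ 5502028 ∷ 870828 ∷ 872626 ∷ 872525 ∷ 10680019 ∷ 870423 ∷ 3120913 ∷ 2870018 ∷ 951920 ∷ 1750824 ∷ 8259916 ∷ 1759931 ∷ 10009904 ∷ 1759918 ∷ 9139913 ∷ []))))))
            (leaf false 9999 (44240114 ∷ 43930409 ∷ 11470015 ∷ 3040424 ∷ 2710621 ∷ 55761421 ∷ 45410420 ∷ 11522121 ∷ 26960414 ∷ 65380509 ∷ 59620014 ∷ 16110123 ∷ 35772123 ∷ 55762124 ∷ 38480018 ∷ 44240124 ∷ 30760022 ∷ 30760120 ∷ 28860024 ∷ 69249916 ∷ 30769931 ∷ 100009904 ∷ 30769918 ∷ 50009913 ∷ []))))))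
        (leaf false 9999 (65380105 ∷ 34621012 ∷ 9651114 ∷ 20000010 ∷ 34621420 ∷ 61520014 ∷ 30761017 ∷ 30761717 ∷ 10400011 ∷ 65381720 ∷ 14271117 ∷ 30760019 ∷ 30769931 ∷ 69249916 ∷ 100009904 ∷ 30769918 ∷ 100009913 ∷ [])))))
     (leaf false 999 (4320917 ∷ 2100208 ∷ 1761414 ∷ 3920307 ∷ 3511115 ∷ 3511417 ∷ 4220008 ∷ 2020811 ∷ 1360014 ∷ 3490007 ∷ 1621416 ∷ 1490017 ∷ 6491113 ∷ 270000 ∷ 9739917 ∷ 10009904 ∷ 5009913 ∷ 279918 ∷ 279931 ∷ []))))
   (split ((pos 100 , 2) ∷ (-[1+ 49 ] , 1) ∷ [])
    (leaf false 999 (6090607 ∷ 7680816 ∷ 400612 ∷ 2820712 ∷ 1960615 ∷ 1561313 ∷ 3840206 ∷ 2321014 ∷ 5671116 ∷ 6081216 ∷ 5631516 ∷ 2771515 ∷ 3131015 ∷ 4430616 ∷ 91113 ∷ 3351016 ∷ 15200007 ∷ 4339913 ∷ 5539904 ∷ 4479905 ∷ 7239918 ∷ 2779931 ∷ 2779917 ∷ 4479927 ∷ 19928 ∷ []))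
    (split ((pos 100 , 4) ∷ (pos 100 , 5) ∷ (pos 100 , 6) ∷ (-[1+ 49 ] , 1) ∷ [])
     (split ((pos 100 , 4) ∷ (pos 100 , 5) ∷ (pos 100 , 6) ∷ (-[1+ 84 ] , 1) ∷ [])
      (leaf false 9999 (44930318 ∷ 2161316 ∷ 4890813 ∷ 44931518 ∷ 20271016 ∷ 2741318 ∷ 55070408 ∷ 29410013 ∷ 2161215 ∷ 20000004 ∷ 22750000 ∷ 27901315 ∷ 76421216 ∷ 7801218 ∷ 29410012 ∷ 39290812 ∷ 25800915 ∷ 25090014 ∷ 47849931 ∷ 50009915 ∷ 47849913 ∷ 2169901 ∷ 97849904 ∷ 50009918 ∷ []))
      (split ((pos 100 , 4) ∷ (pos 100 , 5) ∷ (-[1+ 69 ] , 1) ∷ [])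
       (leaf false 9999 (87500917 ∷ 37500419 ∷ 31250019 ∷ 93310015 ∷ 37501117 ∷ 1250005 ∷ 50001616 ∷ 1080410 ∷ 17811016 ∷ 20000515 ∷ 68750916 ∷ 3751017 ∷ 81251619 ∷ 6690215 ∷ 50001717 ∷ 8661015 ∷ 6699913 ∷ 6699931 ∷ 43319901 ∷ 56699904 ∷ 50009918 ∷ 50009916 ∷ []))
       (split ((pos 100 , 4) ∷ (-[1+ 34 ] , 1) ∷ [])
        (leaf false 999 (2501018 ∷ 2751516 ∷ 7501020 ∷ 2000616 ∷ 2750016 ∷ 10001717 ∷ 500106 ∷ 3801220 ∷ 41116 ∷ 11201720 ∷ 2911117 ∷ 1200020 ∷ 7250102 ∷ 2250115 ∷ 12501017 ∷ 12250001 ∷ 3410011 ∷ 5009915 ∷ 5009904 ∷ 5009918 ∷ 5009901 ∷ []))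
        (split ((pos 100 , 6) ∷ (-[1+ 69 ] , 1) ∷ [])
         (leaf false 999 (4070621 ∷ 4291616 ∷ 2000407 ∷ 3951215 ∷ 1110712 ∷ 3570016 ∷ 4401818 ∷ 3430711 ∷ 2181321 ∷ 4701821 ∷ 4101118 ∷ 601519 ∷ 600415 ∷ 4400015 ∷ 5000004 ∷ 5009931 ∷ 719927 ∷ 10009904 ∷ 5009918 ∷ 5009916 ∷ 5009913 ∷ []))
         (split ((pos 100 , 4) ∷ (-[1+ 16 ] , 1) ∷ [])
          (split ((pos 100 , 6) ∷ (-[1+ 20 ] , 1) ∷ [])
           (leaf false 9999 (33950821 ∷ 24921320 ∷ 42050121 ∷ 30580521 ∷ 20470823 ∷ 3290023 ∷ 30580320 ∷ 12520913 ∷ 12000623 ∷ 27371820 ∷ 30660009 ∷ 10810606 ∷ 8610505 ∷ 29530123 ∷ 4630609 ∷ 30580006 ∷ 33060809 ∷ 62562023 ∷ 30580001 ∷ 50009931 ∷ 50009915 ∷ 100009904 ∷ 50009918 ∷ 50009913 ∷ []))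
           (split ((pos 100 , 4) ∷ (pos 100 , 5) ∷ (-[1+ 48 ] , 1) ∷ [])
            (split ((pos 100 , 4) ∷ (pos 100 , 5) ∷ (-[1+ 58 ] , 1) ∷ [])
             (leaf false 99999 (107621622 ∷ 925001522 ∷ 62500610 ∷ 112501025 ∷ 196252324 ∷ 133132121 ∷ 737502222 ∷ 900001023 ∷ 41250623 ∷ 812502225 ∷ 262502323 ∷ 262500325 ∷ 200000822 ∷ 1200000021 ∷ 37500306 ∷ 8001621 ∷ 396252123 ∷ 133139913 ∷ 500009916 ∷ 133139931 ∷ 633139904 ∷ 500009918 ∷ 366879901 ∷ []))
             (split ((pos 100 , 6) ∷ (-[1+ 9 ] , 1) ∷ [])
              (leaf false 99999 (1850202 ∷ 504680012 ∷ 498150124 ∷ 233630223 ∷ 347221126 ∷ 695320002 ∷ 152780426 ∷ 537331124 ∷ 51851216 ∷ 468390000 ∷ 384112326 ∷ 63591624 ∷ 564041623 ∷ 268220424 ∷ 731780623 ∷ 97220226 ∷ 304680324 ∷ 304680323 ∷ 31610303 ∷ 500009931 ∷ 500009913 ∷ 1000009904 ∷ 500009918 ∷ 500009915 ∷ []))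
              (leaf false 99999 (796210001 ∷ 908621623 ∷ 301720412 ∷ 200001222 ∷ 446550426 ∷ 855172323 ∷ 37931112 ∷ 144830424 ∷ 855171124 ∷ 946552326 ∷ 151900000 ∷ 355170023 ∷ 355170923 ∷ 155170112 ∷ 203790222 ∷ 7711723 ∷ 500000124 ∷ 213799916 ∷ 286219915 ∷ 151909931 ∷ 151909913 ∷ 651909904 ∷ 500009918 ∷ 348109901 ∷ []))))
            (leaf false 9999 (64870002 ∷ 67620910 ∷ 116252124 ∷ 76670001 ∷ 43252121 ∷ 27001014 ∷ 44620224 ∷ 36490210 ∷ 26190101 ∷ 35130222 ∷ 23330023 ∷ 20000710 ∷ 5380924 ∷ 26670000 ∷ 21620421 ∷ 26199913 ∷ 23819901 ∷ 26199931 ∷ 50009915 ∷ 76199904 ∷ 50009918 ∷ []))))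
          (split ((pos 100 , 4) ∷ (pos 100 , 5) ∷ (pos 100 , 6) ∷ (-[1+ 59 ] , 1) ∷ [])
           (leaf false 9999 (350109 ∷ 49690809 ∷ 14511820 ∷ 14510919 ∷ 70900115 ∷ 80001721 ∷ 8750913 ∷ 5491719 ∷ 5490508 ∷ 5490020 ∷ 14510821 ∷ 2050823 ∷ 13061320 ∷ 5490120 ∷ 50000000 ∷ 78192023 ∷ 50009916 ∷ 50009931 ∷ 100009904 ∷ 50009918 ∷ 50009913 ∷ []))
           (leaf false 9999 (2780017 ∷ 8370009 ∷ 12320823 ∷ 28370919 ∷ 60992023 ∷ 28371820 ∷ 68851721 ∷ 18500913 ∷ 50350115 ∷ 15810809 ∷ 28370821 ∷ 2781719 ∷ 2780120 ∷ 20501320 ∷ 50000000 ∷ 50009916 ∷ 50009931 ∷ 100009904 ∷ 50009918 ∷ 50009913 ∷ []))))))))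
     (leaf false 99999 (96190917 ∷ 145140215 ∷ 145140313 ∷ 379620307 ∷ 475811115 ∷ 524191214 ∷ 427431417 ∷ 86290008 ∷ 379050913 ∷ 54860007 ∷ 379050009 ∷ 332380217 ∷ 96760714 ∷ 500000000 ∷ 500009913 ∷ 285719916 ∷ 1000009904 ∷ 214299915 ∷ 500009918 ∷ 500009931 ∷ [])))))

tree₁ : Tree
tree₁ =
  (split ((pos 100 , 3) ∷ (-[1+ 74 ] , 1) ∷ [])
   (split ((pos 100 , 2) ∷ (-[1+ 74 ] , 1) ∷ [])
    (leaf false 999 (6780009 ∷ 3270816 ∷ 1700611 ∷ 1701116 ∷ 1700712 ∷ 1600615 ∷ 851313 ∷ 5880206 ∷ 3401113 ∷ 1701316 ∷ 1701014 ∷ 3401515 ∷ 1701015 ∷ 2670607 ∷ 5740107 ∷ 6609917 ∷ 10009904 ∷ 3409931 ∷ 3409918 ∷ 7459913 ∷ []))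
    (split ((pos 100 , 2) ∷ (-[1+ 49 ] , 1) ∷ [])
     (leaf false 999 (5370708 ∷ 4540712 ∷ 4540713 ∷ 9320208 ∷ 6140716 ∷ 3970307 ∷ 3401214 ∷ 7941417 ∷ 1910717 ∷ 3401115 ∷ 3401616 ∷ 3400913 ∷ 9080013 ∷ 9080012 ∷ 12480016 ∷ 6609917 ∷ 10009904 ∷ 3409931 ∷ 3409918 ∷ 6609913 ∷ []))
     (split ((pos 100 , 4) ∷ (pos 100 , 5) ∷ (pos 100 , 6) ∷ (-[1+ 49 ] , 1) ∷ [])
      (leaf true 999 (6600310 ∷ 3401014 ∷ 1600012 ∷ 1801517 ∷ 5000812 ∷ 3401315 ∷ 9100815 ∷ 1601515 ∷ 2501518 ∷ 6601214 ∷ 10009904 ∷ 10009921 ∷ 5009913 ∷ []))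
      (leaf false 999 (1600000 ∷ 1601315 ∷ 6671018 ∷ 1601415 ∷ 980912 ∷ 180915 ∷ 3330408 ∷ 1600005 ∷ 60309 ∷ 1670305 ∷ 4300009 ∷ 1601215 ∷ 1600014 ∷ 1600013 ∷ 10009916 ∷ 10009904 ∷ 10009913 ∷ [])))))
   (split ((pos 100 , 3) ∷ (-[1+ 49 ] , 1) ∷ [])
    (split ((pos 100 , 2) ∷ (-[1+ 74 ] , 1) ∷ [])
     (leaf false 999 (18100010 ∷ 6470817 ∷ 100712 ∷ 5001217 ∷ 100815 ∷ 1600716 ∷ 9050307 ∷ 5101214 ∷ 280717 ∷ 2551616 ∷ 990708 ∷ 2451515 ∷ 4901213 ∷ 5009917 ∷ 7559904 ∷ 2559931 ∷ 5009918 ∷ 2459902 ∷ 5009913 ∷ []))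
     (split ((pos 100 , 2) ∷ (-[1+ 49 ] , 1) ∷ [])
      (split ((pos 100 , 4) ∷ (pos 100 , 5) ∷ (-[1+ 29 ] , 1) ∷ [])
       (split ((pos 100 , 4) ∷ (-[1+ 37 ] , 1) ∷ [])
        (leaf false 999 (7021516 ∷ 1691017 ∷ 2911011 ∷ 2111016 ∷ 2601819 ∷ 5011019 ∷ 5001717 ∷ 4710610 ∷ 2400018 ∷ 4901720 ∷ 5001020 ∷ 3611520 ∷ 10000016 ∷ 6211220 ∷ 201517 ∷ 10010211 ∷ 2211818 ∷ 1301620 ∷ 5009904 ∷ 5009916 ∷ 199927 ∷ 5009918 ∷ 5009902 ∷ []))
        (leaf false 99999 (343191011 ∷ 17571515 ∷ 275470000 ∷ 173360015 ∷ 122191019 ∷ 222700610 ∷ 517491720 ∷ 210721820 ∷ 173360019 ∷ 354811018 ∷ 344571818 ∷ 890050211 ∷ 27571017 ∷ 521000520 ∷ 724290116 ∷ 545060120 ∷ 17341920 ∷ 362149916 ∷ 189049913 ∷ 259799902 ∷ 102359905 ∷ 275719919 ∷ 637869904 ∷ 362149918 ∷ 19914 ∷ [])))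
       (leaf false 999 (4500013 ∷ 9090112 ∷ 1481119 ∷ 2380919 ∷ 900918 ∷ 1500014 ∷ 5150509 ∷ 3000018 ∷ 1300910 ∷ 421319 ∷ 150913 ∷ 271719 ∷ 3001313 ∷ 420009 ∷ 151519 ∷ 3009902 ∷ 4259905 ∷ 2759904 ∷ 7259918 ∷ 1259913 ∷ 5759927 ∷ 2759919 ∷ [])))
      (split ((pos 100 , 6) ∷ (-[1+ 29 ] , 1) ∷ [])
       (leaf true 999 (2101619 ∷ 3951119 ∷ 10000013 ∷ 460519 ∷ 1600011 ∷ 400004 ∷ 2101616 ∷ 460509 ∷ 2901313 ∷ 1601114 ∷ 400414 ∷ 1430911 ∷ 3700916 ∷ 10009919 ∷ 10009904 ∷ 5009913 ∷ []))
       (split ((pos 100 , 4) ∷ (pos 100 , 5) ∷ (pos 100 , 6) ∷ (-[1+ 49 ] , 1) ∷ [])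
        (split ((pos 100 , 4) ∷ (pos 100 , 5) ∷ (-[1+ 29 ] , 1) ∷ [])
         (split ((pos 100 , 5) ∷ (-[1+ 21 ] , 1) ∷ [])
          (split ((pos 100 , 6) ∷ (-[1+ 20 ] , 1) ∷ [])
           (leaf true 9999 (16000120 ∷ 28722020 ∷ 5281717 ∷ 100000017 ∷ 44721320 ∷ 4080913 ∷ 35641523 ∷ 4000108 ∷ 16000217 ∷ 4080923 ∷ 11481315 ∷ 16000015 ∷ 28722023 ∷ 4000008 ∷ 50009913 ∷ 100009904 ∷ 100009919 ∷ []))
           (split ((pos 100 , 4) ∷ (-[1+ 14 ] , 1) ∷ [])
            (split ((pos 100 , 4) ∷ (-[1+ 38 ] , 1) ∷ [])
             (leaf false 9999 (28100025 ∷ 21120009 ∷ 39622324 ∷ 79240023 ∷ 55621523 ∷ 10382222 ∷ 15821522 ∷ 29270021 ∷ 88662225 ∷ 55621121 ∷ 39622224 ∷ 6050303 ∷ 17210915 ∷ 20620321 ∷ 1001622 ∷ 31100421 ∷ 11809902 ∷ 4339913 ∷ 54339916 ∷ 54339904 ∷ 45679918 ∷ 33879901 ∷ []))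
             (split ((pos 100 , 3) ∷ (-[1+ 67 ] , 1) ∷ [])
              (leaf false 9999 (6591625 ∷ 27301822 ∷ 14100023 ∷ 9211922 ∷ 39750018 ∷ 9411624 ∷ 13460011 ∷ 50002323 ∷ 40590216 ∷ 18090024 ∷ 19660002 ∷ 17891622 ∷ 97221623 ∷ 52782326 ∷ 100000222 ∷ 100009904 ∷ 50009913 ∷ 9579916 ∷ 90439919 ∷ []))
              (split ((pos 100 , 5) ∷ (-[1+ 35 ] , 1) ∷ [])
               (split ((pos 100 , 2) ∷ (-[1+ 34 ] , 1) ∷ [])
                (leaf false 99999 (251501826 ∷ 66292428 ∷ 245771825 ∷ 132590008 ∷ 247391218 ∷ 93711424 ∷ 425740125 ∷ 16992525 ∷ 243311418 ∷ 649830026 ∷ 85772528 ∷ 53541828 ∷ 45752626 ∷ 212872727 ∷ 241380101 ∷ 495690028 ∷ 270140325 ∷ 574260724 ∷ 212870524 ∷ 500009916 ∷ 500009901 ∷ 500009904 ∷ 500009918 ∷ []))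
                (split ((pos 100 , 3) ∷ (-[1+ 54 ] , 1) ∷ [])
                 (split ((pos 100 , 4) ∷ (pos 100 , 5) ∷ (pos 100 , 6) ∷ (-[1+ 84 ] , 1) ∷ [])
                  (leaf false 99999 (1000000626 ∷ 329390204 ∷ 4622326 ∷ 457782730 ∷ 18152026 ∷ 75550001 ∷ 57850027 ∷ 755050527 ∷ 13530128 ∷ 244950228 ∷ 396110104 ∷ 263092226 ∷ 142800002 ∷ 255050726 ∷ 255050000 ∷ 18112127 ∷ 542222027 ∷ 452260005 ∷ 255059916 ∷ 255059901 ∷ 744959904 ∷ 255059918 ∷ 244959913 ∷ 489899919 ∷ 19914 ∷ []))
                  (split ((pos 100 , 4) ∷ (-[1+ 28 ] , 1) ∷ [])
                   (leaf false 9999 (8000021 ∷ 20542227 ∷ 35870003 ∷ 53822831 ∷ 6292728 ∷ 32500328 ∷ 40132828 ∷ 9711727 ∷ 24000029 ∷ 66290027 ∷ 16000428 ∷ 39630205 ∷ 53822128 ∷ 9710529 ∷ 30130101 ∷ 20260001 ∷ 30130827 ∷ 38439916 ∷ 31449919 ∷ 30139901 ∷ 69879904 ∷ 30139918 ∷ 19879913 ∷ []))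
                   (split ((pos 100 , 4) ∷ (pos 100 , 5) ∷ (pos 100 , 6) ∷ (-[1+ 59 ] , 1) ∷ [])
                    (split ((pos 100 , 2) ∷ (-[1+ 16 ] , 1) ∷ [])
                     (split ((pos 100 , 4) ∷ (pos 100 , 5) ∷ (-[1+ 64 ] , 1) ∷ [])
                      (split ((pos 100 , 5) ∷ (-[1+ 45 ] , 1) ∷ [])
                       (split ((pos 100 , 2) ∷ (-[1+ 21 ] , 1) ∷ [])
                        (leaf false 99999 (229610432 ∷ 602842832 ∷ 340000005 ∷ 517970133 ∷ 1000000833 ∷ 179980101 ∷ 122061232 ∷ 29500107 ∷ 177971033 ∷ 17970634 ∷ 142030001 ∷ 148330232 ∷ 269280710 ∷ 500003335 ∷ 27661034 ∷ 57162232 ∷ 177970007 ∷ 12052733 ∷ 229611332 ∷ 197969916 ∷ 197969901 ∷ 802049904 ∷ 197969918 ∷ 302049913 ∷ 604099919 ∷ 19927 ∷ []))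
                        (split ((pos 100 , 3) ∷ (-[1+ 58 ] , 1) ∷ [])
                         (leaf false 9999 (12850004 ∷ 2003335 ∷ 16003334 ∷ 65003434 ∷ 34000104 ∷ 14122833 ∷ 2000003 ∷ 22500011 ∷ 15000334 ∷ 15000203 ∷ 64902734 ∷ 116001333 ∷ 1000204 ∷ 52053437 ∷ 32000233 ∷ 1150031 ∷ 14050134 ∷ 15009916 ∷ 6609900 ∷ 85009904 ∷ 8409901 ∷ 35009913 ∷ 15009918 ∷ 70009919 ∷ []))
                         (split ((pos 100 , 5) ∷ (-[1+ 52 ] , 1) ∷ [])
                          (leaf false 99999 (160000024 ∷ 500003538 ∷ 10002935 ∷ 500003535 ∷ 108863034 ∷ 79250001 ∷ 160000509 ∷ 301890000 ∷ 396231434 ∷ 600029 ∷ 340000205 ∷ 660002835 ∷ 603770634 ∷ 14813438 ∷ 452830109 ∷ 65952434 ∷ 373891534 ∷ 301899916 ∷ 72009901 ∷ 229899931 ∷ 301899918 ∷ 928009904 ∷ 428009913 ∷ 396239919 ∷ 19927 ∷ []))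
                          (leaf false 99999 (95852434 ∷ 4680335 ∷ 516133538 ∷ 679250434 ∷ 532263535 ∷ 302690000 ∷ 509430109 ∷ 64153034 ∷ 32260435 ∷ 123060002 ∷ 320753234 ∷ 67922934 ∷ 36940304 ∷ 95850001 ∷ 340000205 ∷ 160000102 ∷ 676132835 ∷ 339629916 ∷ 62469901 ∷ 660389904 ∷ 339629918 ∷ 160389913 ∷ 320759919 ∷ 277169900 ∷ 19914 ∷ [])))))
                       (leaf false 9999 (34000104 ∷ 52650032 ∷ 643234 ∷ 101920131 ∷ 16000106 ∷ 50003235 ∷ 33680025 ∷ 16650031 ∷ 61690609 ∷ 50002532 ∷ 52280000 ∷ 14082131 ∷ 19290003 ∷ 35610035 ∷ 2563132 ∷ 83360432 ∷ 57409916 ∷ 17659901 ∷ 82359904 ∷ 32999918 ∷ 15349929 ∷ 32359913 ∷ 9619919 ∷ [])))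
                      (leaf false 99999 (925850001 ∷ 4540025 ∷ 262030107 ∷ 4053134 ∷ 769911030 ∷ 85853034 ∷ 245853031 ∷ 737970731 ∷ 507770105 ∷ 262030003 ∷ 2472530 ∷ 237970230 ∷ 237970004 ∷ 78202431 ∷ 85850024 ∷ 917750631 ∷ 433620820 ∷ 237979931 ∷ 370739919 ∷ 1000009904 ∷ 237979918 ∷ 391299916 ∷ 500009913 ∷ 19914 ∷ [])))
                     (leaf false 99999 (304330025 ∷ 610390630 ∷ 406710009 ∷ 64940001 ∷ 8930030 ∷ 225950719 ∷ 43352429 ∷ 261070919 ∷ 389610929 ∷ 426163033 ∷ 610392529 ∷ 260582330 ∷ 389610330 ∷ 110390101 ∷ 64520119 ∷ 60361931 ∷ 60362329 ∷ 110399916 ∷ 110399931 ∷ 1000009904 ∷ 110399918 ∷ 500009913 ∷ 779229919 ∷ [])))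
                    (leaf false 9999 (30000832 ∷ 63330029 ∷ 16670429 ∷ 15002328 ∷ 13330829 ∷ 47670022 ∷ 40000308 ∷ 133330329 ∷ 63330830 ∷ 66671822 ∷ 31670032 ∷ 36670828 ∷ 28830023 ∷ 16671832 ∷ 5531823 ∷ 50009913 ∷ 100009904 ∷ 100009916 ∷ [])))))
                 (leaf false 9999 (85910025 ∷ 100000225 ∷ 50002727 ∷ 51090626 ∷ 96001525 ∷ 2900020 ∷ 18751519 ∷ 5910028 ∷ 28910226 ∷ 37500029 ∷ 25341529 ∷ 94090027 ∷ 77000126 ∷ 21092626 ∷ 28912628 ∷ 20000525 ∷ 10090515 ∷ 16000215 ∷ 50009916 ∷ 50009901 ∷ 50009904 ∷ 50009918 ∷ []))))
               (leaf false 9999 (2860027 ∷ 59400004 ∷ 5712324 ∷ 8180417 ∷ 12650311 ∷ 4031317 ∷ 11400327 ∷ 105710323 ∷ 29700000 ∷ 13140017 ∷ 18570203 ∷ 52012427 ∷ 46540111 ∷ 43961724 ∷ 2101323 ∷ 68570224 ∷ 29709901 ∷ 41739916 ∷ 70309904 ∷ 29709918 ∷ 20309913 ∷ 28579919 ∷ [])))))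
            (split ((pos 100 , 3) ∷ (-[1+ 67 ] , 1) ∷ [])
             (leaf true 29999 (119862225 ∷ 48000517 ∷ 300001921 ∷ 74290122 ∷ 75712222 ∷ 74000110 ∷ 12000510 ∷ 255861522 ∷ 136000017 ∷ 150000111 ∷ 300009904 ∷ 150009913 ∷ 300009919 ∷ []))
             (leaf false 9999 (7990005 ∷ 16320111 ∷ 4650522 ∷ 6551121 ∷ 6550021 ∷ 54650122 ∷ 12261115 ∷ 26501522 ∷ 96511921 ∷ 10231125 ∷ 6550322 ∷ 8140102 ∷ 11200123 ∷ 4800511 ∷ 71220001 ∷ 51022225 ∷ 4079916 ∷ 100009904 ∷ 50009913 ∷ 95939919 ∷ [])))))
          (leaf false 9999 (77680016 ∷ 2310102 ∷ 24630319 ∷ 23810322 ∷ 2310018 ∷ 22321921 ∷ 39150312 ∷ 3220106 ∷ 16300812 ∷ 44740607 ∷ 58151922 ∷ 58480022 ∷ 45380122 ∷ 25551219 ∷ 2310017 ∷ 25220012 ∷ 25370202 ∷ 11160013 ∷ 25379931 ∷ 50009913 ∷ 71359916 ∷ 100009904 ∷ 25379918 ∷ 3289919 ∷ [])))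
         (leaf true 999 (5000015 ∷ 1501821 ∷ 5000007 ∷ 10000115 ∷ 5000006 ∷ 380711 ∷ 3501321 ∷ 2000106 ∷ 741113 ∷ 5001618 ∷ 3501118 ∷ 380721 ∷ 1600107 ∷ 10009904 ∷ 5009913 ∷ 10009919 ∷ [])))
        (leaf false 999 (501117 ∷ 2501014 ∷ 5000016 ∷ 2501220 ∷ 5000412 ∷ 60611 ∷ 5000015 ∷ 1600010 ∷ 5000610 ∷ 2501720 ∷ 5001416 ∷ 5001418 ∷ 2600011 ∷ 501114 ∷ 5000000 ∷ 10009904 ∷ 10009916 ∷ 5009913 ∷ []))))))
    (split ((pos 100 , 2) ∷ (-[1+ 74 ] , 1) ∷ [])
     (leaf false 999 (18100010 ∷ 6470817 ∷ 100712 ∷ 5001217 ∷ 100815 ∷ 1600716 ∷ 9050307 ∷ 5101214 ∷ 280717 ∷ 2551616 ∷ 990708 ∷ 2451515 ∷ 4901213 ∷ 5009917 ∷ 7559904 ∷ 2559931 ∷ 5009918 ∷ 2459902 ∷ 5009913 ∷ []))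
     (split ((pos 100 , 2) ∷ (-[1+ 49 ] , 1) ∷ [])
      (split ((pos 100 , 4) ∷ (pos 100 , 5) ∷ (-[1+ 49 ] , 1) ∷ [])
       (leaf false 999 (3580910 ∷ 5000915 ∷ 101018 ∷ 5001419 ∷ 6600918 ∷ 5001616 ∷ 6250509 ∷ 12500110 ∷ 5001619 ∷ 6250919 ∷ 5001717 ∷ 7501119 ∷ 10000015 ∷ 5009916 ∷ 5009904 ∷ 5009918 ∷ 5009902 ∷ []))
       (split ((pos 100 , 5) ∷ (-[1+ 14 ] , 1) ∷ [])
        (leaf false 999 (9980213 ∷ 1881014 ∷ 441220 ∷ 3890000 ∷ 2670001 ∷ 1601019 ∷ 6220016 ∷ 5770610 ∷ 381620 ∷ 1121720 ∷ 3281020 ∷ 3001418 ∷ 381016 ∷ 1890114 ∷ 401011 ∷ 3780119 ∷ 1899916 ∷ 4319902 ∷ 3119927 ∷ 3809905 ∷ 1899904 ∷ 8119918 ∷ []))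
        (leaf false 999 (4651011 ∷ 711420 ∷ 5721220 ∷ 891019 ∷ 2860610 ∷ 710010 ∷ 1050000 ∷ 711620 ∷ 6791020 ∷ 700119 ∷ 3250019 ∷ 701416 ∷ 6051516 ∷ 10020211 ∷ 4650014 ∷ 709916 ∷ 4309927 ∷ 709904 ∷ 9309918 ∷ 2209902 ∷ 7119905 ∷ []))))
      (split ((pos 100 , 6) ∷ (-[1+ 29 ] , 1) ∷ [])
       (leaf false 99999 (168640000 ∷ 258771313 ∷ 53251419 ∷ 668930319 ∷ 428460509 ∷ 205691416 ∷ 347390519 ∷ 187981619 ∷ 152440005 ∷ 241231317 ∷ 223461818 ∷ 99180003 ∷ 276541414 ∷ 7560918 ∷ 17771616 ∷ 99180318 ∷ 553080013 ∷ 553080014 ∷ 107899902 ∷ 892119904 ∷ 500009916 ∷ 392119931 ∷ 500009918 ∷ 392119913 ∷ []))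
       (split ((pos 100 , 4) ∷ (pos 100 , 5) ∷ (-[1+ 49 ] , 1) ∷ [])
        (leaf false 9999 (360118 ∷ 93660418 ∷ 9120006 ∷ 86950016 ∷ 16360616 ∷ 47361017 ∷ 43661717 ∷ 18220610 ∷ 43661818 ∷ 46831720 ∷ 37500420 ∷ 6341418 ∷ 6341919 ∷ 6341517 ∷ 4780116 ∷ 531018 ∷ 360117 ∷ 31250620 ∷ 51569904 ∷ 1569913 ∷ 48449901 ∷ 1569931 ∷ 50009918 ∷ 50009916 ∷ []))
        (leaf false 999 (3481517 ∷ 360413 ∷ 5200420 ∷ 1600616 ∷ 4030620 ∷ 830101 ∷ 1450006 ∷ 2920610 ∷ 1631720 ∷ 3370000 ∷ 3261418 ∷ 3480418 ∷ 1631515 ∷ 430618 ∷ 1421017 ∷ 1631414 ∷ 10000001 ∷ 5009916 ∷ 839931 ∷ 4179901 ∷ 5839904 ∷ 5009918 ∷ 839913 ∷ []))))))))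

tree₂ : Tree
tree₂ =
  (split ((pos 100 , 3) ∷ (-[1+ 99 ] , 1) ∷ [])
   (split ((pos 100 , 2) ∷ (-[1+ 74 ] , 1) ∷ [])
    (leaf false 999 (420713 ∷ 4690612 ∷ 1511010 ∷ 10001012 ∷ 4690611 ∷ 1201516 ∷ 6990615 ∷ 3491313 ∷ 2281316 ∷ 10230016 ∷ 7820609 ∷ 4690116 ∷ 1561212 ∷ 10390107 ∷ 8449904 ∷ 6889923 ∷ 3129927 ∷ 3129918 ∷ 1569931 ∷ 1569903 ∷ 3449913 ∷ []))
    (split ((pos 100 , 2) ∷ (-[1+ 49 ] , 1) ∷ [])
     (leaf false 999 (2680713 ∷ 1370814 ∷ 10001113 ∷ 1960712 ∷ 3500413 ∷ 6180716 ∷ 2681414 ∷ 6340709 ∷ 4930215 ∷ 2681417 ∷ 721217 ∷ 3660017 ∷ 1910210 ∷ 6850204 ∷ 2321111 ∷ 10009904 ∷ 10009923 ∷ 5009913 ∷ []))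
     (split ((pos 100 , 4) ∷ (pos 100 , 5) ∷ (pos 100 , 6) ∷ (-[1+ 49 ] , 1) ∷ [])
      (leaf true 999 (5001214 ∷ 7590315 ∷ 3500012 ∷ 5001014 ∷ 1501517 ∷ 5001315 ∷ 5000810 ∷ 1201518 ∷ 8500312 ∷ 3800815 ∷ 10009904 ∷ 5009913 ∷ 10009923 ∷ []))
      (leaf false 999 (5001018 ∷ 4500009 ∷ 1900817 ∷ 1600008 ∷ 1290910 ∷ 3750305 ∷ 5000810 ∷ 10009904 ∷ 10009917 ∷ 10009913 ∷ [])))))
   (split ((pos 100 , 3) ∷ (-[1+ 74 ] , 1) ∷ [])
    (split ((pos 100 , 2) ∷ (-[1+ 74 ] , 1) ∷ [])
     (leaf false 999 (1520711 ∷ 3100008 ∷ 1151111 ∷ 10001113 ∷ 7240712 ∷ 801617 ∷ 8870716 ∷ 3851414 ∷ 6930709 ∷ 1080912 ∷ 1260813 ∷ 3051417 ∷ 3870017 ∷ 6170713 ∷ 1081012 ∷ 9400108 ∷ 10009904 ∷ 10009921 ∷ 5009913 ∷ []))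
     (split ((pos 100 , 2) ∷ (-[1+ 49 ] , 1) ∷ [])
      (leaf false 999 (7920009 ∷ 10001214 ∷ 9700813 ∷ 631718 ∷ 12580817 ∷ 5001515 ∷ 9940810 ∷ 301518 ∷ 3670018 ∷ 9700814 ∷ 1090408 ∷ 8150215 ∷ 11600209 ∷ 10009904 ∷ 7829921 ∷ 2189916 ∷ 5009913 ∷ []))
      (split ((pos 100 , 4) ∷ (pos 100 , 5) ∷ (pos 100 , 6) ∷ (-[1+ 49 ] , 1) ∷ [])
       (split ((pos 100 , 2) ∷ (-[1+ 14 ] , 1) ∷ [])
        (split ((pos 100 , 2) ∷ (-[1+ 31 ] , 1) ∷ [])
         (split ((pos 100 , 5) ∷ (-[1+ 49 ] , 1) ∷ [])
          (split ((pos 100 , 2) ∷ (-[1+ 40 ] , 1) ∷ [])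
           (leaf false 99999 (91081322 ∷ 314542022 ∷ 5341420 ∷ 185462020 ∷ 171951619 ∷ 685461719 ∷ 305310713 ∷ 171950107 ∷ 164010013 ∷ 314540120 ∷ 258920001 ∷ 308300119 ∷ 573460019 ∷ 685460720 ∷ 154150101 ∷ 728240007 ∷ 944371320 ∷ 154159918 ∷ 302329916 ∷ 543539921 ∷ 845859904 ∷ 345859913 ∷ 154159902 ∷ []))
           (leaf false 99999 (162351320 ∷ 87270708 ∷ 969721719 ∷ 7571419 ∷ 24511420 ∷ 100000008 ∷ 350000022 ∷ 500000002 ∷ 30281820 ∷ 30280919 ∷ 469722020 ∷ 807370020 ∷ 30282022 ∷ 62350207 ∷ 187650407 ∷ 30280107 ∷ 1000009904 ∷ 825459921 ∷ 174559916 ∷ 500009913 ∷ [])))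
          (leaf false 9999 (64720112 ∷ 2241719 ∷ 17400607 ∷ 49721221 ∷ 25150621 ∷ 45060106 ∷ 21890016 ∷ 24131921 ∷ 9410118 ∷ 7170006 ∷ 80820619 ∷ 25871919 ∷ 7170012 ∷ 75871618 ∷ 30100616 ∷ 61151219 ∷ 65199921 ∷ 100009904 ∷ 34819916 ∷ 50009913 ∷ [])))
         (leaf false 9999 (100001517 ∷ 15760020 ∷ 29351821 ∷ 13840207 ∷ 43601118 ∷ 5391120 ∷ 27050018 ∷ 50000001 ∷ 4100506 ∷ 14250105 ∷ 1520205 ∷ 50001818 ∷ 100009904 ∷ 10959917 ∷ 50009913 ∷ 89059921 ∷ [])))
        (leaf true 669999 (3350000012 ∷ 1452000114 ∷ 3008240017 ∷ 1072000005 ∷ 1898001717 ∷ 380000510 ∷ 380000518 ∷ 1452001517 ∷ 893000106 ∷ 1072001216 ∷ 2239761720 ∷ 5248001416 ∷ 380000616 ∷ 3691760517 ∷ 6700009904 ∷ 3350009913 ∷ 6700009921 ∷ [])))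
       (leaf false 999 (4421119 ∷ 810419 ∷ 3300311 ∷ 4500010 ∷ 3500009 ∷ 5580509 ∷ 2640409 ∷ 10009904 ∷ 10009917 ∷ 10009913 ∷ [])))))
    (split ((pos 100 , 2) ∷ (-[1+ 74 ] , 1) ∷ [])
     (leaf false 999 (7020817 ∷ 1151111 ∷ 10001113 ∷ 771617 ∷ 2730716 ∷ 3851414 ∷ 9430709 ∷ 4420117 ∷ 3081417 ∷ 4620714 ∷ 9500008 ∷ 3280707 ∷ 5009913 ∷ 10009904 ∷ 7739919 ∷ 2279916 ∷ []))
     (split ((pos 100 , 2) ∷ (-[1+ 49 ] , 1) ∷ [])
      (split ((pos 100 , 6) ∷ (-[1+ 29 ] , 1) ∷ [])
       (leaf false 9999 (5910915 ∷ 1531819 ∷ 21831313 ∷ 50050013 ∷ 2630914 ∷ 8620913 ∷ 33950918 ∷ 30601414 ∷ 29970919 ∷ 28800509 ∷ 6380018 ∷ 10621317 ∷ 6381818 ∷ 67580014 ∷ 57600119 ∷ 3291519 ∷ 2141416 ∷ 581319 ∷ 56439904 ∷ 26049919 ∷ 43579918 ∷ 43579905 ∷ 6599927 ∷ 28229913 ∷ 30399916 ∷ []))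
       (split ((pos 100 , 4) ∷ (pos 100 , 5) ∷ (-[1+ 49 ] , 1) ∷ [])
        (split ((pos 100 , 5) ∷ (-[1+ 37 ] , 1) ∷ [])
         (split ((pos 100 , 2) ∷ (-[1+ 56 ] , 1) ∷ [])
          (leaf false 9999 (33980101 ∷ 11451616 ∷ 32050020 ∷ 100000218 ∷ 16022020 ∷ 67051221 ∷ 49390022 ∷ 23690812 ∷ 4951318 ∷ 4821219 ∷ 3350016 ∷ 67331222 ∷ 66100012 ∷ 32051218 ∷ 36871922 ∷ 38551919 ∷ 50009904 ∷ 50009918 ∷ 50009902 ∷ 50009916 ∷ []))
          (leaf false 99999 (378450101 ∷ 243100420 ∷ 88891616 ∷ 1000000218 ∷ 49501318 ∷ 358331221 ∷ 1226800004 ∷ 4160812 ∷ 234781220 ∷ 8331216 ∷ 259460416 ∷ 121552020 ∷ 562750019 ∷ 632611222 ∷ 8331218 ∷ 411111919 ∷ 500009916 ∷ 500009904 ∷ 500009918 ∷ 500009902 ∷ [])))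
         (leaf false 999 (3901118 ∷ 1380717 ∷ 10000117 ∷ 4761121 ∷ 1220101 ∷ 2121120 ∷ 3781818 ∷ 3780000 ∷ 2510103 ∷ 2531821 ∷ 2430015 ∷ 1680003 ∷ 830013 ∷ 6860321 ∷ 1380011 ∷ 2740711 ∷ 261217 ∷ 5009916 ∷ 5009904 ∷ 5009918 ∷ 5009902 ∷ [])))
        (leaf false 9999 (90100001 ∷ 8510213 ∷ 18020011 ∷ 7321019 ∷ 45051414 ∷ 45051515 ∷ 27680110 ∷ 32901020 ∷ 70740220 ∷ 39630610 ∷ 27680010 ∷ 54959916 ∷ 45059902 ∷ 45059918 ∷ 54959904 ∷ 9909913 ∷ []))))
      (split ((pos 100 , 4) ∷ (-[1+ 14 ] , 1) ∷ [])
       (split ((pos 100 , 4) ∷ (pos 100 , 5) ∷ (-[1+ 49 ] , 1) ∷ [])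
        (split ((pos 100 , 5) ∷ (-[1+ 21 ] , 1) ∷ [])
         (split ((pos 100 , 4) ∷ (pos 100 , 5) ∷ (-[1+ 64 ] , 1) ∷ [])
          (split ((pos 100 , 5) ∷ (-[1+ 37 ] , 1) ∷ [])
           (split ((pos 100 , 4) ∷ (pos 100 , 5) ∷ (pos 100 , 6) ∷ (-[1+ 69 ] , 1) ∷ [])
            (split ((pos 100 , 3) ∷ (-[1+ 61 ] , 1) ∷ [])
             (split ((pos 100 , 5) ∷ (-[1+ 63 ] , 1) ∷ [])
              (leaf false 9999 (19811224 ∷ 50002325 ∷ 51670010 ∷ 4560810 ∷ 85001822 ∷ 43731024 ∷ 15360018 ∷ 75620823 ∷ 25621025 ∷ 15000812 ∷ 4251022 ∷ 15950002 ∷ 65950023 ∷ 3391722 ∷ 9381623 ∷ 34050722 ∷ 15950422 ∷ 23500012 ∷ 15959916 ∷ 15959918 ∷ 15959901 ∷ 84059904 ∷ 34059913 ∷ 68109919 ∷ []))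
              (split ((pos 100 , 3) ∷ (-[1+ 65 ] , 1) ∷ [])
               (split ((pos 100 , 5) ∷ (-[1+ 45 ] , 1) ∷ [])
                (split ((pos 100 , 4) ∷ (pos 100 , 5) ∷ (-[1+ 75 ] , 1) ∷ [])
                 (split ((pos 100 , 4) ∷ (pos 100 , 5) ∷ (-[1+ 92 ] , 1) ∷ [])
                  (leaf false 99999 (72880414 ∷ 263071214 ∷ 389952526 ∷ 267392627 ∷ 56970004 ∷ 56872730 ∷ 768320227 ∷ 325290000 ∷ 319942027 ∷ 257331626 ∷ 174712729 ∷ 402480314 ∷ 146690026 ∷ 97520420 ∷ 214030030 ∷ 127100020 ∷ 945991126 ∷ 489031227 ∷ 268329902 ∷ 268329916 ∷ 268329918 ∷ 731689904 ∷ 231689913 ∷ 463379919 ∷ 19927 ∷ []))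
                  (split ((pos 100 , 3) ∷ (-[1+ 68 ] , 1) ∷ [])
                   (split ((pos 100 , 2) ∷ (-[1+ 34 ] , 1) ∷ [])
                    (split ((pos 100 , 2) ∷ (-[1+ 41 ] , 1) ∷ [])
                     (leaf false 9999 (36010033 ∷ 15542429 ∷ 61000530 ∷ 30500303 ∷ 11490223 ∷ 52301929 ∷ 39000014 ∷ 19503030 ∷ 15150505 ∷ 8702931 ∷ 380024 ∷ 332333 ∷ 36490002 ∷ 100000429 ∷ 8700029 ∷ 61002330 ∷ 26000923 ∷ 61001731 ∷ 4359913 ∷ 45659902 ∷ 54359904 ∷ 45659918 ∷ 54359916 ∷ []))
                     (split ((pos 100 , 3) ∷ (-[1+ 71 ] , 1) ∷ [])
                      (split ((pos 100 , 5) ∷ (-[1+ 50 ] , 1) ∷ [])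
                       (split ((pos 100 , 2) ∷ (-[1+ 36 ] , 1) ∷ [])
                        (split ((pos 100 , 2) ∷ (-[1+ 39 ] , 1) ∷ [])
                         (leaf false 99999 (368000233 ∷ 144392833 ∷ 500000434 ∷ 58000004 ∷ 332190003 ∷ 435713436 ∷ 249170203 ∷ 536550033 ∷ 64290734 ∷ 367810002 ∷ 17810035 ∷ 249172333 ∷ 500000234 ∷ 564293133 ∷ 184000202 ∷ 339920321 ∷ 350002734 ∷ 184009902 ∷ 184009918 ∷ 504179919 ∷ 316009913 ∷ 311839916 ∷ 816009904 ∷ []))
                         (leaf false 99999 (350000021 ∷ 911973133 ∷ 4550234 ∷ 183910202 ∷ 83483234 ∷ 189020133 ∷ 411973434 ∷ 338720007 ∷ 367820233 ∷ 88033436 ∷ 11280102 ∷ 249012333 ∷ 249010203 ∷ 488720001 ∷ 339480321 ∷ 573250034 ∷ 350002734 ∷ 183919918 ∷ 183919901 ∷ 504959919 ∷ 316099913 ∷ 311149916 ∷ 816099904 ∷ [])))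
                        (leaf false 99999 (25140106 ∷ 41582732 ∷ 299300132 ∷ 1000003032 ∷ 165280035 ∷ 441000033 ∷ 350000020 ∷ 197292232 ∷ 474863333 ∷ 184293336 ∷ 25140633 ∷ 43590127 ∷ 315280004 ∷ 174800101 ∷ 12573236 ∷ 209860122 ∷ 224480220 ∷ 534292633 ∷ 149659901 ∷ 700709919 ∷ 350359913 ∷ 149659916 ∷ 850359904 ∷ 149659918 ∷ [])))
                       (leaf false 99999 (9452631 ∷ 163830103 ∷ 619270119 ∷ 850790232 ∷ 350002131 ∷ 223820035 ∷ 36963235 ∷ 500000000 ∷ 73200026 ∷ 261463234 ∷ 387640025 ∷ 738540631 ∷ 186170519 ∷ 200792532 ∷ 261460331 ∷ 238543232 ∷ 150000203 ∷ 261460011 ∷ 238549918 ∷ 238549901 ∷ 261469913 ∷ 761469904 ∷ 761469916 ∷ [])))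
                      (leaf false 99999 (315110102 ∷ 164502530 ∷ 365163032 ∷ 19790206 ∷ 399120003 ∷ 85570001 ∷ 165110404 ∷ 751530131 ∷ 152213131 ∷ 182693133 ∷ 100722430 ∷ 817310530 ∷ 633410230 ∷ 60970606 ∷ 85572431 ∷ 264430004 ∷ 512900631 ∷ 226089901 ∷ 273929913 ∷ 773929904 ∷ 226089918 ∷ 427849919 ∷ 346089916 ∷ []))))
                    (leaf false 99999 (239240116 ∷ 113912328 ∷ 142540404 ∷ 150000018 ∷ 643001628 ∷ 350002229 ∷ 860191828 ∷ 141590006 ∷ 208410418 ∷ 500000029 ∷ 285070428 ∷ 489812628 ∷ 10192629 ∷ 500000016 ∷ 8780104 ∷ 510192931 ∷ 510190429 ∷ 142549901 ∷ 664069919 ∷ 357469913 ∷ 142549918 ∷ 857469904 ∷ 193409916 ∷ [])))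
                   (leaf false 99999 (7230005 ∷ 212352227 ∷ 276990001 ∷ 353010027 ∷ 605461328 ∷ 350001727 ∷ 328470128 ∷ 6950317 ∷ 68900101 ∷ 321531721 ∷ 294172729 ∷ 181390303 ∷ 102630202 ∷ 207840004 ∷ 73012128 ∷ 716070013 ∷ 1000000227 ∷ 671530328 ∷ 147099913 ∷ 294179919 ∷ 647099904 ∷ 352919918 ∷ 352919916 ∷ 352919901 ∷ 19914 ∷ []))))
                 (leaf false 9999 (8871126 ∷ 77901113 ∷ 6840113 ∷ 41480019 ∷ 55210101 ∷ 91131115 ∷ 13220215 ∷ 21830026 ∷ 6130024 ∷ 35001525 ∷ 6480029 ∷ 28170028 ∷ 53160213 ∷ 8870126 ∷ 63160001 ∷ 71831025 ∷ 6841325 ∷ 35929913 ∷ 14089901 ∷ 34219919 ∷ 85929904 ∷ 14089918 ∷ 51709916 ∷ 19914 ∷ [])))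
                (leaf false 99999 (350001825 ∷ 383311012 ∷ 500000624 ∷ 113930406 ∷ 238360000 ∷ 90660004 ∷ 285820010 ∷ 389920018 ∷ 386071025 ∷ 406481224 ∷ 386072527 ∷ 133121014 ∷ 679600112 ∷ 99800114 ∷ 736071424 ∷ 60330028 ∷ 523270009 ∷ 238369913 ∷ 636319916 ∷ 102059919 ∷ 261649918 ∷ 738369904 ∷ 261649902 ∷ [])))
               (leaf false 9999 (30000913 ∷ 1332626 ∷ 45000002 ∷ 15002326 ∷ 30000027 ∷ 30000424 ∷ 35000023 ∷ 105000924 ∷ 10380404 ∷ 5000413 ∷ 11051823 ∷ 35002424 ∷ 13670303 ∷ 24620101 ∷ 3000018 ∷ 85000523 ∷ 35001323 ∷ 5000004 ∷ 35000026 ∷ 50009916 ∷ 50009918 ∷ 50009904 ∷ 50009901 ∷ []))))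
             (leaf false 9999 (25342323 ∷ 1742124 ∷ 49320023 ∷ 30160111 ∷ 3490222 ∷ 37320025 ∷ 101360722 ∷ 4840024 ∷ 37320711 ∷ 4842122 ∷ 1360211 ∷ 13501621 ∷ 48262222 ∷ 1742424 ∷ 22920202 ∷ 4840621 ∷ 98260321 ∷ 13700018 ∷ 30839901 ∷ 50009916 ∷ 50009918 ∷ 50009904 ∷ 19179902 ∷ [])))
            (leaf false 9999 (72800824 ∷ 15190019 ∷ 41720101 ∷ 42590210 ∷ 23291520 ∷ 90470610 ∷ 16571820 ∷ 34810505 ∷ 42591020 ∷ 15190021 ∷ 9531024 ∷ 7590024 ∷ 17670608 ∷ 22330015 ∷ 68250220 ∷ 73479904 ∷ 26539918 ∷ 73479916 ∷ 23479913 ∷ 26539901 ∷ [])))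
           (leaf false 9999 (33940019 ∷ 23100109 ∷ 100000119 ∷ 21410014 ∷ 50002020 ∷ 35000919 ∷ 112030520 ∷ 6010123 ∷ 6950709 ∷ 17910013 ∷ 12030021 ∷ 5881320 ∷ 15570913 ∷ 1101419 ∷ 43990723 ∷ 21000000 ∷ 66979904 ∷ 66979916 ∷ 33039902 ∷ 33039918 ∷ 16979913 ∷ [])))
          (leaf false 9999 (50420318 ∷ 6850218 ∷ 32280419 ∷ 38060303 ∷ 43120622 ∷ 36730119 ∷ 4450308 ∷ 20360406 ∷ 8150812 ∷ 12850003 ∷ 35000818 ∷ 42730021 ∷ 1730008 ∷ 17940002 ∷ 32280006 ∷ 47170408 ∷ 4450618 ∷ 52969916 ∷ 22259919 ∷ 75219904 ∷ 24799918 ∷ 25219913 ∷ 24799902 ∷ [])))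
         (leaf false 999 (1410320 ∷ 2420001 ∷ 290018 ∷ 4560019 ∷ 390012 ∷ 61120 ∷ 3381818 ∷ 3140717 ∷ 11180305 ∷ 6470318 ∷ 4260005 ∷ 8890117 ∷ 510101 ∷ 3440107 ∷ 5590711 ∷ 1111820 ∷ 3600017 ∷ 5899916 ∷ 7369904 ∷ 2649918 ∷ 1479919 ∷ 2649902 ∷ 2369913 ∷ [])))
        (leaf false 999 (12920204 ∷ 830219 ∷ 2670616 ∷ 1681515 ∷ 1321517 ∷ 460004 ∷ 1740001 ∷ 3260015 ∷ 3710610 ∷ 3580101 ∷ 1080106 ∷ 6840116 ∷ 1780010 ∷ 431520 ∷ 5500206 ∷ 190120 ∷ 3160019 ∷ 1589902 ∷ 1589918 ∷ 8429904 ∷ 3429913 ∷ 4269916 ∷ 4169919 ∷ [])))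
       (leaf false 9999 (12830917 ∷ 95650105 ∷ 65901315 ∷ 36590009 ∷ 13440118 ∷ 114010103 ∷ 21560515 ∷ 1581419 ∷ 34100018 ∷ 10310514 ∷ 15030113 ∷ 1581717 ∷ 4761415 ∷ 15900000 ∷ 2760509 ∷ 1591718 ∷ 35690014 ∷ 96839904 ∷ 75159919 ∷ 3179918 ∷ 3179902 ∷ 21689916 ∷ 46839913 ∷ [])))))))

tree₃ : Tree
tree₃ =
  (split ((pos 100 , 3) ∷ (-[1+ 99 ] , 1) ∷ [])
   (split ((pos 100 , 2) ∷ (-[1+ 74 ] , 1) ∷ [])
    (split ((pos 100 , 2) ∷ (-[1+ 99 ] , 1) ∷ [])
     (split ((pos 100 , 5) ∷ (-[1+ 49 ] , 1) ∷ [])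
      (leaf false 999 (4501316 ∷ 4501113 ∷ 4510117 ∷ 8600517 ∷ 8770000 ∷ 13770013 ∷ 740005 ∷ 2750813 ∷ 4501616 ∷ 13070105 ∷ 740017 ∷ 31017 ∷ 740014 ∷ 8270016 ∷ 5009918 ∷ 9559932 ∷ 4519904 ∷ 15049910 ∷ 5049924 ∷ 9509917 ∷ 19914 ∷ []))
      (split ((pos 100 , 4) ∷ (-[1+ 29 ] , 1) ∷ [])
       (leaf false 9999 (66270014 ∷ 64360001 ∷ 110860206 ∷ 30621314 ∷ 33731417 ∷ 3111317 ∷ 33430218 ∷ 16270000 ∷ 8560914 ∷ 16571018 ∷ 33731717 ∷ 60860618 ∷ 65829932 ∷ 50009904 ∷ 54589924 ∷ 80629917 ∷ 115829910 ∷ 30629918 ∷ []))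
       (split ((pos 100 , 6) ∷ (-[1+ 49 ] , 1) ∷ [])
        (split ((pos 100 , 2) ∷ (-[1+ 107 ] , 1) ∷ [])
         (leaf false 99999 (934650008 ∷ 308370015 ∷ 474860020 ∷ 469170820 ∷ 459791515 ∷ 9381820 ∷ 327130019 ∷ 919570115 ∷ 9380715 ∷ 1160079932 ∷ 474869904 ∷ 1700299924 ∷ 459799918 ∷ 750579910 ∷ 474869913 ∷ 934659909 ∷ 19929 ∷ []))
         (leaf false 99999 (265570420 ∷ 233640015 ∷ 201750820 ∷ 358131420 ∷ 467320007 ∷ 233641920 ∷ 128751515 ∷ 397451414 ∷ 257490115 ∷ 31011417 ∷ 286100001 ∷ 124490814 ∷ 41030016 ∷ 732890114 ∷ 201759918 ∷ 73019927 ∷ 732899904 ∷ 130719924 ∷ 667549923 ∷ 366459913 ∷ 267119909 ∷ [])))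
        (leaf false 999 (310318 ∷ 2180319 ∷ 3490507 ∷ 350518 ∷ 351319 ∷ 130101 ∷ 410002 ∷ 410218 ∷ 310219 ∷ 310315 ∷ 2041818 ∷ 270001 ∷ 4490114 ∷ 2040015 ∷ 2180307 ∷ 310005 ∷ 650313 ∷ 2929924 ∷ 2769917 ∷ 2189904 ∷ 7829910 ∷ 2459918 ∷ 1879923 ∷ [])))))
     (split ((pos 100 , 4) ∷ (-[1+ 29 ] , 1) ∷ [])
      (leaf false 999 (21017 ∷ 4950305 ∷ 2140016 ∷ 100310 ∷ 7140000 ∷ 2141213 ∷ 2510217 ∷ 7140013 ∷ 5001113 ∷ 2490104 ∷ 431216 ∷ 2571516 ∷ 2570516 ∷ 5009908 ∷ 5009904 ∷ 2149918 ∷ 7149917 ∷ 719924 ∷ 19914 ∷ []))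
      (split ((pos 100 , 4) ∷ (-[1+ 8 ] , 1) ∷ [])
       (leaf false 9999 (25590406 ∷ 14851314 ∷ 16650004 ∷ 10740411 ∷ 43320203 ∷ 14851417 ∷ 25580101 ∷ 3600209 ∷ 66010014 ∷ 16650417 ∷ 29700113 ∷ 14851717 ∷ 14859918 ∷ 40439904 ∷ 51859908 ∷ 37589924 ∷ 47569923 ∷ 7729903 ∷ 19914 ∷ []))
       (leaf false 999 (1490416 ∷ 1870406 ∷ 3550318 ∷ 2620417 ∷ 3440017 ∷ 1130412 ∷ 1490214 ∷ 381717 ∷ 1491318 ∷ 381314 ∷ 3821214 ∷ 1491218 ∷ 381417 ∷ 1490217 ∷ 3550205 ∷ 4200013 ∷ 3299913 ∷ 389918 ∷ 2149924 ∷ 7119904 ∷ 7499923 ∷ 2899908 ∷ 19929 ∷ [])))))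
    (split ((pos 100 , 2) ∷ (-[1+ 49 ] , 1) ∷ [])
     (leaf false 999 (8500204 ∷ 2001010 ∷ 10001012 ∷ 3090215 ∷ 28500001 ∷ 3001313 ∷ 3090210 ∷ 11740207 ∷ 6010113 ∷ 5190107 ∷ 21519932 ∷ 22679917 ∷ 31519904 ∷ 8839923 ∷ 26519913 ∷ 19914 ∷ []))
     (split ((pos 100 , 4) ∷ (pos 100 , 5) ∷ (pos 100 , 6) ∷ (-[1+ 49 ] , 1) ∷ [])
      (leaf true 169999 (850000304 ∷ 407500513 ∷ 989211113 ∷ 407840011 ∷ 340001 ∷ 581710114 ∷ 407500415 ∷ 303290913 ∷ 1257500104 ∷ 302951416 ∷ 186500005 ∷ 187500311 ∷ 710791214 ∷ 1000316 ∷ 139211414 ∷ 1257500305 ∷ 1700009923 ∷ 850009913 ∷ 1700009904 ∷ []))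
      (leaf false 999 (6550517 ∷ 650311 ∷ 5110410 ∷ 3850005 ∷ 650314 ∷ 3850010 ∷ 10000104 ∷ 2310405 ∷ 10009904 ∷ 10009917 ∷ 10009913 ∷ [])))))
   (split ((pos 100 , 3) ∷ (-[1+ 74 ] , 1) ∷ [])
    (split ((pos 100 , 2) ∷ (-[1+ 74 ] , 1) ∷ [])
     (split ((pos 100 , 2) ∷ (-[1+ 99 ] , 1) ∷ [])
      (split ((pos 100 , 4) ∷ (-[1+ 29 ] , 1) ∷ [])
       (leaf false 9999 (21431617 ∷ 50001214 ∷ 30050114 ∷ 71430014 ∷ 71430000 ∷ 8621718 ∷ 6481118 ∷ 50690518 ∷ 30050001 ∷ 30050416 ∷ 30051418 ∷ 8621017 ∷ 56590405 ∷ 30050018 ∷ 18061018 ∷ 21430017 ∷ 21431314 ∷ 45010111 ∷ 21439918 ∷ 50009904 ∷ 50009903 ∷ 57149922 ∷ 21439917 ∷ []))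
       (split ((pos 100 , 4) ∷ (-[1+ 8 ] , 1) ∷ [])
        (leaf false 9999 (13300506 ∷ 25580101 ∷ 9170519 ∷ 39190105 ∷ 29700114 ∷ 7610515 ∷ 14851518 ∷ 23050210 ∷ 39191619 ∷ 39191719 ∷ 4130219 ∷ 14851818 ∷ 66010015 ∷ 31580517 ∷ 14851415 ∷ 39190218 ∷ 39190215 ∷ 7729903 ∷ 40439904 ∷ 14859918 ∷ 51859910 ∷ 37589922 ∷ 47569921 ∷ 19914 ∷ []))
        (leaf false 999 (4340506 ∷ 1190210 ∷ 5060519 ∷ 1200217 ∷ 3440018 ∷ 721419 ∷ 1911719 ∷ 4200014 ∷ 3821315 ∷ 7110619 ∷ 381518 ∷ 381818 ∷ 1200515 ∷ 381415 ∷ 7119904 ∷ 3299913 ∷ 389918 ∷ 7499921 ∷ 2149922 ∷ 2899910 ∷ 19929 ∷ []))))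
      (split ((pos 100 , 4) ∷ (-[1+ 29 ] , 1) ∷ [])
       (split ((pos 100 , 2) ∷ (-[1+ 81 ] , 1) ∷ [])
        (leaf false 9999 (21430118 ∷ 2301118 ∷ 50820219 ∷ 121430115 ∷ 6320516 ∷ 12381015 ∷ 100590002 ∷ 3160615 ∷ 23730518 ∷ 2301619 ∷ 27751415 ∷ 27751718 ∷ 871519 ∷ 71430101 ∷ 63280519 ∷ 8431219 ∷ 6321416 ∷ 4031419 ∷ 27759918 ∷ 44499908 ∷ 50009904 ∷ 5519903 ∷ 72259917 ∷ []))
        (leaf false 999 (7060003 ∷ 6800004 ∷ 1611315 ∷ 1770016 ∷ 1170318 ∷ 6020118 ∷ 1171516 ∷ 3591415 ∷ 650103 ∷ 3591818 ∷ 3591518 ∷ 6800519 ∷ 621616 ∷ 6800101 ∷ 1171416 ∷ 11980115 ∷ 3599918 ∷ 6419904 ∷ 3599902 ∷ 6419916 ∷ 1419913 ∷ [])))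
       (split ((pos 100 , 4) ∷ (-[1+ 14 ] , 1) ∷ [])
        (leaf false 9999 (40650519 ∷ 4411019 ∷ 35350114 ∷ 109400305 ∷ 2921718 ∷ 20971818 ∷ 45191415 ∷ 35610000 ∷ 20971518 ∷ 6580018 ∷ 10651414 ∷ 85610015 ∷ 2920017 ∷ 68750319 ∷ 34549918 ∷ 16299917 ∷ 30929922 ∷ 50009904 ∷ 18259921 ∷ 50009903 ∷ []))
        (leaf false 9999 (23160519 ∷ 10821319 ∷ 72161315 ∷ 32750014 ∷ 5911819 ∷ 4911718 ∷ 52080319 ∷ 4911415 ∷ 27840018 ∷ 10820002 ∷ 11891019 ∷ 75240305 ∷ 5910318 ∷ 22160000 ∷ 23169918 ∷ 50009904 ∷ 67629921 ∷ 44469908 ∷ 18259927 ∷ 9229922 ∷ 5549903 ∷ [])))))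
     (split ((pos 100 , 2) ∷ (-[1+ 49 ] , 1) ∷ [])
      (split ((pos 100 , 4) ∷ (-[1+ 21 ] , 1) ∷ [])
       (split ((pos 100 , 2) ∷ (-[1+ 56 ] , 1) ∷ [])
        (leaf false 9999 (18751616 ∷ 17740316 ∷ 2180018 ∷ 540314 ∷ 64780405 ∷ 21950304 ∷ 104880115 ∷ 34430118 ∷ 29551415 ∷ 29551818 ∷ 29551518 ∷ 2721416 ∷ 21950117 ∷ 36130101 ∷ 21951619 ∷ 64290003 ∷ 2180015 ∷ 29559918 ∷ 70459904 ∷ 70459916 ∷ 29559902 ∷ 20459913 ∷ []))
        (leaf false 9999 (62350405 ∷ 123990002 ∷ 88960115 ∷ 560515 ∷ 27931415 ∷ 38961616 ∷ 27371518 ∷ 281717 ∷ 27371818 ∷ 1150016 ∷ 38410004 ∷ 38410416 ∷ 38410117 ∷ 91015 ∷ 76770102 ∷ 16330118 ∷ 22359913 ∷ 68849916 ∷ 72359904 ∷ 27659902 ∷ 27659918 ∷ 3519921 ∷ [])))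
       (leaf false 999 (1660418 ∷ 2090309 ∷ 480304 ∷ 661314 ∷ 661617 ∷ 1020312 ∷ 360317 ∷ 5670205 ∷ 4000118 ∷ 7681214 ∷ 2680000 ∷ 2320017 ∷ 2980013 ∷ 669918 ∷ 4349913 ∷ 9349904 ∷ 6379921 ∷ 2989916 ∷ 669902 ∷ [])))
      (split ((pos 100 , 4) ∷ (-[1+ 34 ] , 1) ∷ [])
       (split ((pos 100 , 5) ∷ (-[1+ 49 ] , 1) ∷ [])
        (split ((pos 100 , 4) ∷ (-[1+ 38 ] , 1) ∷ [])
         (leaf false 99999 (604910007 ∷ 92421720 ∷ 1529640517 ∷ 91360519 ∷ 282710607 ∷ 500001717 ∷ 1000000016 ∷ 1339360307 ∷ 136440101 ∷ 302670714 ∷ 805850005 ∷ 390001116 ∷ 272880116 ∷ 292549916 ∷ 863569904 ∷ 136449918 ∷ 363569913 ∷ 571029921 ∷ 136449902 ∷ []))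
         (leaf false 9999 (65000002 ∷ 10250519 ∷ 117970517 ∷ 19630116 ∷ 22880607 ∷ 13220205 ∷ 115000017 ∷ 9820101 ∷ 95090307 ∷ 115000207 ∷ 15060711 ∷ 100001416 ∷ 40189913 ∷ 9829902 ∷ 90189904 ∷ 9829918 ∷ 64069921 ∷ 26129916 ∷ [])))
        (leaf false 999 (1480018 ∷ 4300405 ∷ 11890416 ∷ 6190106 ∷ 3810418 ∷ 740014 ∷ 1191616 ∷ 1260005 ∷ 3811618 ∷ 5290013 ∷ 6190115 ∷ 10820206 ∷ 2550614 ∷ 1070506 ∷ 3810615 ∷ 9510104 ∷ 640010 ∷ 1260002 ∷ 749918 ∷ 4269913 ∷ 9269916 ∷ 9269904 ∷ 749902 ∷ [])))
       (leaf false 9999 (13110317 ∷ 48170304 ∷ 24650004 ∷ 670013 ∷ 39130305 ∷ 49330015 ∷ 670017 ∷ 99331214 ∷ 100000105 ∷ 1630509 ∷ 49330512 ∷ 60870315 ∷ 230914 ∷ 50009913 ∷ 18099916 ∷ 100009904 ∷ 81919921 ∷ [])))))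
    (split ((pos 100 , 2) ∷ (-[1+ 74 ] , 1) ∷ [])
     (split ((pos 100 , 2) ∷ (-[1+ 99 ] , 1) ∷ [])
      (leaf false 999 (590416 ∷ 6230208 ∷ 2220004 ∷ 831117 ∷ 1821316 ∷ 3061217 ∷ 621212 ∷ 911114 ∷ 8280008 ∷ 5961213 ∷ 1821616 ∷ 3651214 ∷ 151317 ∷ 9240204 ∷ 1451515 ∷ 6790917 ∷ 230414 ∷ 5669903 ∷ 7799918 ∷ 2219904 ∷ 2219919 ∷ 1309913 ∷ 3909927 ∷ 2129909 ∷ 19900 ∷ []))
      (split ((pos 100 , 4) ∷ (-[1+ 29 ] , 1) ∷ [])
       (leaf false 999 (8580218 ∷ 2150216 ∷ 7650014 ∷ 6760000 ∷ 5670017 ∷ 3670918 ∷ 4101214 ∷ 3911417 ∷ 3911717 ∷ 8570305 ∷ 2900209 ∷ 1081818 ∷ 3911314 ∷ 2151315 ∷ 5009918 ∷ 5009904 ∷ 5009902 ∷ 5009916 ∷ 1099927 ∷ []))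
       (leaf false 9999 (87220218 ∷ 13100214 ∷ 13100315 ∷ 34950000 ∷ 8600017 ∷ 6451314 ∷ 13101618 ∷ 36830918 ∷ 84951214 ∷ 6451417 ∷ 6451717 ∷ 52080305 ∷ 21500013 ∷ 13100217 ∷ 31170209 ∷ 4471818 ∷ 13100018 ∷ 13100314 ∷ 34519918 ∷ 65499904 ∷ 15499913 ∷ 65499919 ∷ 34519902 ∷ 28069927 ∷ []))))
     (split ((pos 100 , 2) ∷ (-[1+ 49 ] , 1) ∷ [])
      (split ((pos 100 , 4) ∷ (-[1+ 37 ] , 1) ∷ [])
       (leaf false 9999 (34320118 ∷ 69030305 ∷ 39431214 ∷ 11131515 ∷ 25030014 ∷ 7980509 ∷ 841318 ∷ 24410515 ∷ 840513 ∷ 37221314 ∷ 71080016 ∷ 35541717 ∷ 841616 ∷ 36370205 ∷ 46671518 ∷ 3330000 ∷ 35541417 ∷ 36389918 ∷ 63629904 ∷ 36389902 ∷ 13629913 ∷ 63629916 ∷ []))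
       (split ((pos 100 , 6) ∷ (-[1+ 29 ] , 1) ∷ [])
        (leaf false 9999 (55680219 ∷ 40540406 ∷ 10130610 ∷ 27121313 ∷ 5320613 ∷ 75910013 ∷ 7731319 ∷ 5321819 ∷ 46820014 ∷ 2411519 ∷ 2410614 ∷ 7730618 ∷ 23411414 ∷ 15140306 ∷ 10830101 ∷ 34279918 ∷ 65739904 ∷ 10189902 ∷ 12559916 ∷ 53189919 ∷ 27789913 ∷ 10869927 ∷ 24099905 ∷ []))
        (split ((pos 100 , 5) ∷ (-[1+ 37 ] , 1) ∷ [])
         (leaf false 999 (7500320 ∷ 7500507 ∷ 3530202 ∷ 1270711 ∷ 581620 ∷ 1470116 ∷ 580107 ∷ 8221416 ∷ 1471919 ∷ 3530000 ∷ 7060016 ∷ 1280311 ∷ 2940002 ∷ 1151617 ∷ 5009918 ∷ 5009916 ∷ 5009904 ∷ 5009902 ∷ []))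
         (leaf false 9999 (75000320 ∷ 70940507 ∷ 20780711 ∷ 34790102 ∷ 45540202 ∷ 15671515 ∷ 4060407 ∷ 26210000 ∷ 56291416 ∷ 83760001 ∷ 41889918 ∷ 58129916 ∷ 58129904 ∷ 41889902 ∷ 12589913 ∷ [])))))
      (split ((pos 100 , 4) ∷ (-[1+ 14 ] , 1) ∷ [])
       (split ((pos 100 , 5) ∷ (-[1+ 37 ] , 1) ∷ [])
        (split ((pos 100 , 5) ∷ (-[1+ 48 ] , 1) ∷ [])
         (leaf false 9999 (61560520 ∷ 38750305 ∷ 38130317 ∷ 50001717 ∷ 100001416 ∷ 19250711 ∷ 91940016 ∷ 88890307 ∷ 61870714 ∷ 11420507 ∷ 45970000 ∷ 61870205 ∷ 4039913 ∷ 54039904 ∷ 45979902 ∷ 45979918 ∷ 54039916 ∷ []))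
         (leaf false 9999 (1630019 ∷ 38130317 ∷ 61870205 ∷ 76980116 ∷ 37670000 ∷ 1630002 ∷ 24130711 ∷ 61870207 ∷ 100000216 ∷ 5950011 ∷ 92220307 ∷ 161870305 ∷ 69650507 ∷ 50001717 ∷ 10709913 ∷ 60709904 ∷ 39309902 ∷ 60709916 ∷ 39309918 ∷ [])))
        (leaf false 9999 (11360014 ∷ 3030106 ∷ 48100406 ∷ 46480610 ∷ 3030618 ∷ 36651618 ∷ 39680218 ∷ 19620210 ∷ 22730018 ∷ 3030213 ∷ 63350115 ∷ 94320206 ∷ 142410204 ∷ 13350101 ∷ 59370001 ∷ 38649913 ∷ 88649904 ∷ 11369918 ∷ 15179919 ∷ 73469916 ∷ 11369902 ∷ 19914 ∷ [])))
       (leaf false 999 (2080305 ∷ 1400117 ∷ 1400517 ∷ 3430509 ∷ 1400112 ∷ 401616 ∷ 791314 ∷ 1400512 ∷ 1280109 ∷ 3540017 ∷ 6461214 ∷ 790513 ∷ 9800105 ∷ 790113 ∷ 11880103 ∷ 1460000 ∷ 3540013 ∷ 4609913 ∷ 409918 ∷ 9609904 ∷ 409902 ∷ 2589916 ∷ 7029919 ∷ [])))))))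

tree₄ : Tree
tree₄ =
  (split ((pos 100 , 2) ∷ (-[1+ 74 ] , 1) ∷ [])
   (split ((pos 100 , 2) ∷ (-[1+ 99 ] , 1) ∷ [])
    (leaf false 999 (3850312 ∷ 84000003 ∷ 3850512 ∷ 84000005 ∷ 302009932 ∷ 312009910 ∷ 312009926 ∷ []))
    (split ((pos 100 , 4) ∷ (-[1+ 29 ] , 1) ∷ [])
     (leaf false 999 (5000000 ∷ 1500113 ∷ 6660102 ∷ 1500613 ∷ 10000810 ∷ 12279908 ∷ 6669925 ∷ 6669904 ∷ 1669913 ∷ 8939932 ∷ 12279926 ∷ []))
     (leaf false 999 (7850810 ∷ 2150013 ∷ 650510 ∷ 2150009 ∷ 10000102 ∷ 2850000 ∷ 18429932 ∷ 10009925 ∷ 10009904 ∷ 18429908 ∷ 18429926 ∷ 5009913 ∷ []))))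
   (leaf true 999 (7430004 ∷ 2570608 ∷ 2570408 ∷ 2570709 ∷ 2570009 ∷ 2570911 ∷ 10009925 ∷ 10009904 ∷ 7439913 ∷ [])))

nthZone : ℕ → Zone
nthZone i = nth (zone 0 nothing 0 0 0 0) i zones

sound₀ : check true (goal (nthZone 0)) rows base₀ tree₀ ≡ true
sound₀ = refl

sound₁ : check true (goal (nthZone 1)) rows base₁ tree₁ ≡ true
sound₁ = refl

sound₂ : check true (goal (nthZone 2)) rows base₂ tree₂ ≡ true
sound₂ = refl

sound₃ : check true (goal (nthZone 3)) rows base₃ tree₃ ≡ true
sound₃ = refl

-- The flag is `false` because the larger side is unbounded here: no error on a product with
-- variable 3 may be absorbed.
sound₄ : check false (goal (nthZone 3)) rows base₄ tree₄ ≡ true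
sound₄ = refl

-- Alternative (3): quadratic profiles and the rows assumed by the certificates

module Three (R : RealField) where
  open Reals R
  open Cert R
  open Energy R

  module Weighted {n : ℕ} (E : Rel n) (k : ℕ) (D : Carrier) (D-value : ⟦ 1000 ⟧ * D ≡ ⟦ 1109 ⟧) where
    open Certificates E k D

    size : VSet n → Carrier
    size X = ⟦ countF X ⟧ - K

    f : VSet n → Carrier
    f X = excess (within E X) (countF X)

    gain-value : ∀ a → ⟦ scale ⟧ * (a * (D * K - a)) ≡ ⟦ 11090 ⟧ * (K * a) - ⟦ scale ⟧ * (a * a)
    gain-value a = trans (solve 3 (λ a K D → con (pos 10000) :* (a :* (D :* K :- a)) := con (pos 10) :* ((con (pos 1000) :* D) :* (K :* a)) :- con (pos 10000) :* (a :* a)) refl a K D)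
      (trans (cong (λ t → ⟦ 10 ⟧ * (t * (K * a)) - ⟦ scale ⟧ * (a * a)) D-value)
        (solve 2 (λ y z → con (pos 10) :* (con (pos 1109) :* y) :- con (pos 10000) :* z := con (pos 11090) :* y :- con (pos 10000) :* z) refl (K * a) (a * a)))

    margin : ℕ × ℕ × ℕ → Carrier → Carrier → Carrier
    margin (c₀ , c₁ , c₂) m x = ⟦ c₀ ⟧ * (K * K) - ⟦ c₁ ⟧ * (K * m) + ⟦ c₂ ⟧ * (m * m) - ⟦ scale ⟧ * x

    Profile : Carrier → Carrier → Set
    Profile m x = All (λ c → 0r ≤ margin c m x) profile

    0≤K : 0r ≤ K
    0≤K = 0≤ι k

    -- Up to m = k / 5 no separation is available, but there the other three profiles are weaker
    -- than the complete bound.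
    profile-small : ∀ {m x} → 0r ≤ m → ⟦ 5 ⟧ * m ≤ K → x ≤ K * K - m * (D * K - m) → Profile m x
    profile-small {m} {x} pm small h = c₀ ∷
        subst (0r ≤_) (solve 3 (λ K m x → (con (pos 10000) :* (K :* K) :- con (pos 11090) :* (K :* m) :+ con (pos 10000) :* (m :* m) :- con (pos 10000) :* x) :+ con (pos 800) :* (K :* (K :- con (pos 5) :* m))
          := con (pos 10800) :* (K :* K) :- con (pos 15090) :* (K :* m) :+ con (pos 10000) :* (m :* m) :- con (pos 10000) :* x) refl K m x)
          (0≤-+ c₀ (0≤-* (0≤ι 800) (0≤-* 0≤K (≤⇒0≤- small)))) ∷
        subst (0r ≤_) (solve 3 (λ K m x → (con (pos 10000) :* (K :* K) :- con (pos 11090) :* (K :* m) :+ con (pos 10000) :* (m :* m) :- con (pos 10000) :* x) :+ ((K :- con (pos 5) :* m) :* (con (pos 800) :* K :+ con (pos 2000) :* m) :+ con (pos 5000) :* (m :* m))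
          := con (pos 10800) :* (K :* K) :- con (pos 13090) :* (K :* m) :+ con (pos 5000) :* (m :* m) :- con (pos 10000) :* x) refl K m x)
          (0≤-+ c₀ (0≤-+ (0≤-* (≤⇒0≤- small) (0≤-+ (0≤-* (0≤ι 800) 0≤K) (0≤-* (0≤ι 2000) pm))) (0≤-* (0≤ι 5000) (0≤-square m)))) ∷
        subst (0r ≤_) (solve 3 (λ K m x → (con (pos 10000) :* (K :* K) :- con (pos 11090) :* (K :* m) :+ con (pos 10000) :* (m :* m) :- con (pos 10000) :* x) :+ ((K :- con (pos 5) :* m) :* (con (pos 800) :* K :+ con (pos 3000) :* m) :+ con (pos 8750) :* (m :* m))
          := con (pos 10800) :* (K :* K) :- con (pos 12090) :* (K :* m) :+ con (pos 3750) :* (m :* m) :- con (pos 10000) :* x) refl K m x)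
          (0≤-+ c₀ (0≤-+ (0≤-* (≤⇒0≤- small) (0≤-+ (0≤-* (0≤ι 800) 0≤K) (0≤-* (0≤ι 3000) pm))) (0≤-* (0≤ι 8750) (0≤-square m)))) ∷ []
      where
      c₀ : 0r ≤ ⟦ 10000 ⟧ * (K * K) - ⟦ 11090 ⟧ * (K * m) + ⟦ 10000 ⟧ * (m * m) - ⟦ 10000 ⟧ * x
      c₀ = subst (0r ≤_) (trans (solve 3 (λ K g x → con (pos 10000) :* ((K :* K :- g) :- x) := con (pos 10000) :* (K :* K) :- con (pos 10000) :* g :- con (pos 10000) :* x) refl K (m * (D * K - m)) x)
        (trans (cong (λ t → ⟦ 10000 ⟧ * (K * K) - t - ⟦ 10000 ⟧ * x) (gain-value m))
          (solve 4 (λ a b c d → a :- (b :- c) :- d := a :- b :+ c :- d) refl (⟦ 10000 ⟧ * (K * K)) (⟦ 11090 ⟧ * (K * m)) (⟦ 10000 ⟧ * (m * m)) (⟦ 10000 ⟧ * x))))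
        (0≤-* (0≤ι 10000) (≤⇒0≤- h))

    -- The missing edges between the two sides: at least 2ab of them, besides those inside the larger side.
    profile-step : ∀ {a b x y} → 0r ≤ a → a ≤ b → y ≤ x - a * (D * K - a) → Profile b x → y ≤ K * K - (a + b) * (D * K - (a + b)) → Profile (a + b) y
    profile-step {a} {b} {x} {y} pa ab h (p₀ ∷ p₁ ∷ p₂ ∷ p₃ ∷ []) h₀ =
        c₀ ∷ c₁ (≤-total K (⟦ 5 ⟧ * b)) ∷ c₂ (≤-total (⟦ 5 ⟧ * (b - a)) (⟦ 2 ⟧ * K)) ∷ c₃ (≤-total (⟦ 5 ⟧ * (b - a)) (⟦ 20 ⟧ * a + ⟦ 4 ⟧ * K)) ∷ []
      where
      pb : 0r ≤ b
      pb = ≤-trans pa ab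
      d : 0r ≤ b - a
      d = ≤⇒0≤- ab
      g : 0r ≤ ⟦ 10000 ⟧ * x - (⟦ 11090 ⟧ * (K * a) - ⟦ 10000 ⟧ * (a * a)) - ⟦ 10000 ⟧ * y
      g = subst (0r ≤_) (trans (solve 3 (λ x g y → con (pos 10000) :* ((x :- g) :- y) := con (pos 10000) :* x :- con (pos 10000) :* g :- con (pos 10000) :* y) refl x (a * (D * K - a)) y)
        (cong (λ t → ⟦ 10000 ⟧ * x - t - ⟦ 10000 ⟧ * y) (gain-value a))) (0≤-* (0≤ι 10000) (≤⇒0≤- h))
      c₀ : 0r ≤ ⟦ 10000 ⟧ * (K * K) - ⟦ 11090 ⟧ * (K * (a + b)) + ⟦ 10000 ⟧ * ((a + b) * (a + b)) - ⟦ 10000 ⟧ * y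
      c₀ = subst (0r ≤_) (trans (solve 3 (λ K g x → con (pos 10000) :* ((K :* K :- g) :- x) := con (pos 10000) :* (K :* K) :- con (pos 10000) :* g :- con (pos 10000) :* x) refl K ((a + b) * (D * K - (a + b))) y)
        (trans (cong (λ t → ⟦ 10000 ⟧ * (K * K) - t - ⟦ 10000 ⟧ * y) (gain-value (a + b)))
          (solve 4 (λ a b c d → a :- (b :- c) :- d := a :- b :+ c :- d) refl (⟦ 10000 ⟧ * (K * K)) (⟦ 11090 ⟧ * (K * (a + b))) (⟦ 10000 ⟧ * ((a + b) * (a + b))) (⟦ 10000 ⟧ * y))))
        (0≤-* (0≤ι 10000) (≤⇒0≤- h₀))
      -- In units of k², this profile asks for 0.4 (m - 0.2) missing pairs. From b to a + b this
      -- grows by 0.4a, at most 2ab once b ≥ 0.2. For smaller b the new pairs alone suffice, by 2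
      -- (0.2 - a) (0.2 - b) ≥ 0.
      c₁ : K ≤ ⟦ 5 ⟧ * b ⊎ ⟦ 5 ⟧ * b ≤ K → 0r ≤ margin (10800 , 15090 , 10000) (a + b) y
      c₁ (inj₁ q) = subst (0r ≤_) (solve 5 (λ K a b x y → (con (pos 10800) :* (K :* K) :- con (pos 15090) :* (K :* b) :+ con (pos 10000) :* (b :* b) :- con (pos 10000) :* x) :+
          ((con (pos 10000) :* x :- (con (pos 11090) :* (K :* a) :- con (pos 10000) :* (a :* a)) :- con (pos 10000) :* y) :+ con (pos 4000) :* (a :* (con (pos 5) :* b :- K)))
          := con (pos 10800) :* (K :* K) :- con (pos 15090) :* (K :* (a :+ b)) :+ con (pos 10000) :* ((a :+ b) :* (a :+ b)) :- con (pos 10000) :* y) refl K a b x y)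
        (0≤-+ p₁ (0≤-+ g (0≤-* (0≤ι 4000) (0≤-* pa (≤⇒0≤- q)))))
      c₁ (inj₂ q) = subst (0r ≤_) (solve 5 (λ K a b x y → (con (pos 10000) :* (K :* K) :- con (pos 11090) :* (K :* b) :+ con (pos 10000) :* (b :* b) :- con (pos 10000) :* x) :+
          ((con (pos 10000) :* x :- (con (pos 11090) :* (K :* a) :- con (pos 10000) :* (a :* a)) :- con (pos 10000) :* y) :+
            con (pos 800) :* (((K :- con (pos 5) :* b) :+ con (pos 5) :* (b :- a)) :* (K :- con (pos 5) :* b)))
          := con (pos 10800) :* (K :* K) :- con (pos 15090) :* (K :* (a :+ b)) :+ con (pos 10000) :* ((a :+ b) :* (a :+ b)) :- con (pos 10000) :* y) refl K a b x y)
        (0≤-+ p₀ (0≤-+ g (0≤-* (0≤ι 800) (0≤-* (0≤-+ (≤⇒0≤- q) (0≤-* (0≤ι 5) d)) (≤⇒0≤- q)))))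
      -- When b - a is small the preceding profile of the larger side yields this one; otherwise its
      -- own induction hypothesis does. The last profile is obtained in the same way.
      c₂ : ⟦ 5 ⟧ * (b - a) ≤ ⟦ 2 ⟧ * K ⊎ ⟦ 2 ⟧ * K ≤ ⟦ 5 ⟧ * (b - a) → 0r ≤ margin (10800 , 13090 , 5000) (a + b) y
      c₂ (inj₁ q) = subst (0r ≤_) (solve 5 (λ K a b x y → (con (pos 10800) :* (K :* K) :- con (pos 15090) :* (K :* b) :+ con (pos 10000) :* (b :* b) :- con (pos 10000) :* x) :+
          ((con (pos 10000) :* x :- (con (pos 11090) :* (K :* a) :- con (pos 10000) :* (a :* a)) :- con (pos 10000) :* y) :+ con (pos 1000) :* ((b :- a) :* (con (pos 2) :* K :- con (pos 5) :* (b :- a))))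
          := con (pos 10800) :* (K :* K) :- con (pos 13090) :* (K :* (a :+ b)) :+ con (pos 5000) :* ((a :+ b) :* (a :+ b)) :- con (pos 10000) :* y) refl K a b x y)
        (0≤-+ p₁ (0≤-+ g (0≤-* (0≤ι 1000) (0≤-* d (≤⇒0≤- q)))))
      c₂ (inj₂ q) = subst (0r ≤_) (solve 5 (λ K a b x y → (con (pos 10800) :* (K :* K) :- con (pos 13090) :* (K :* b) :+ con (pos 5000) :* (b :* b) :- con (pos 10000) :* x) :+
          ((con (pos 10000) :* x :- (con (pos 11090) :* (K :* a) :- con (pos 10000) :* (a :* a)) :- con (pos 10000) :* y) :+ con (pos 1000) :* (a :* ((con (pos 5) :* (b :- a) :- con (pos 2) :* K) :+ con (pos 5) :* b)))
          := con (pos 10800) :* (K :* K) :- con (pos 13090) :* (K :* (a :+ b)) :+ con (pos 5000) :* ((a :+ b) :* (a :+ b)) :- con (pos 10000) :* y) refl K a b x y)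
        (0≤-+ p₂ (0≤-+ g (0≤-* (0≤ι 1000) (0≤-* pa (0≤-+ (≤⇒0≤- q) (0≤-* (0≤ι 5) pb))))))
      c₃ : ⟦ 5 ⟧ * (b - a) ≤ ⟦ 20 ⟧ * a + ⟦ 4 ⟧ * K ⊎ ⟦ 20 ⟧ * a + ⟦ 4 ⟧ * K ≤ ⟦ 5 ⟧ * (b - a) → 0r ≤ margin (10800 , 12090 , 3750) (a + b) y
      c₃ (inj₁ q) = subst (0r ≤_) (solve 5 (λ K a b x y → (con (pos 10800) :* (K :* K) :- con (pos 13090) :* (K :* b) :+ con (pos 5000) :* (b :* b) :- con (pos 10000) :* x) :+
          ((con (pos 10000) :* x :- (con (pos 11090) :* (K :* a) :- con (pos 10000) :* (a :* a)) :- con (pos 10000) :* y) :+ con (pos 250) :* ((b :- a) :* (con (pos 20) :* a :+ con (pos 4) :* K :- con (pos 5) :* (b :- a))))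
          := con (pos 10800) :* (K :* K) :- con (pos 12090) :* (K :* (a :+ b)) :+ con (pos 3750) :* ((a :+ b) :* (a :+ b)) :- con (pos 10000) :* y) refl K a b x y)
        (0≤-+ p₂ (0≤-+ g (0≤-* (0≤ι 250) (0≤-* d (≤⇒0≤- q)))))
      c₃ (inj₂ q) = subst (0r ≤_) (solve 5 (λ K a b x y → (con (pos 10800) :* (K :* K) :- con (pos 12090) :* (K :* b) :+ con (pos 3750) :* (b :* b) :- con (pos 10000) :* x) :+
          ((con (pos 10000) :* x :- (con (pos 11090) :* (K :* a) :- con (pos 10000) :* (a :* a)) :- con (pos 10000) :* y) :+
            con (pos 250) :* (a :* (con (pos 6) :* (con (pos 5) :* (b :- a) :- (con (pos 20) :* a :+ con (pos 4) :* K)) :+ (con (pos 125) :* a :+ con (pos 20) :* K))))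
          := con (pos 10800) :* (K :* K) :- con (pos 12090) :* (K :* (a :+ b)) :+ con (pos 3750) :* ((a :+ b) :* (a :+ b)) :- con (pos 10000) :* y) refl K a b x y)
        (0≤-+ p₃ (0≤-+ g (0≤-* (0≤ι 250) (0≤-* pa (0≤-+ (0≤-* (0≤ι 6) (≤⇒0≤- q)) (0≤-+ (0≤-* (0≤ι 125) pa) (0≤-* (0≤ι 20) 0≤K)))))))

    base-bound : ∀ X → f X ≤ K * K - size X * (D * K - size X)
    base-bound X = by-difference (≤⇒0≤- (≤-trans (ι-mono-≤ (within≤square E X)) (≤-reflexive (ι-* (countF X) (countF X)))))
      (solve 4 (λ s w K D → s :* s :- w := (K :* K :- (s :- K) :* (D :* K :- (s :- K))) :- (w :- (con (pos 2) :+ D) :* K :* (s :- K)))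
        refl ⟦ countF X ⟧ ⟦ within E X ⟧ K D)

    InZone : Zone → Carrier → Set
    InZone (zone lo nothing _ _ _ _) m = ⟦ lo ⟧ * K ≤ ⟦ 100 ⟧ * m
    InZone (zone lo (just hi) _ _ _ _) m = (⟦ lo ⟧ * K ≤ ⟦ 100 ⟧ * m) × (⟦ 100 ⟧ * m ≤ ⟦ hi ⟧ * K)

    boundR : Zone → Carrier → Carrier → Carrier
    boundR (zone _ _ u₀ u₁ κ₀ κ₁) m s = ⟦ u₀ ⟧ * (K * K) - ⟦ u₁ ⟧ * (K * m) - ⟦ κ₀ ⟧ * (K * s) + ⟦ κ₁ ⟧ * (m * s)

    Weight : Zone → VSet n → Set
    Weight z X = InZone z (size X) → ∀ S → S ⊆ X → countF S ℕ.≤ k →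
      ⟦ scale ⟧ * f X ≤ ⟦ 5000 ⟧ * ⟦ within E S ⟧ + boundR z (size X) ⟦ countF S ⟧

    -- What the certificates assume of one side A with separator T: a = |A| - k, x and z are the
    -- parts of S in A ∖ T and in T, y = f(A), p = e(S ∩ A) - e(S ∩ T), q = e(T) and w = e(S ∩ T).
    record Side (a x z y p q w : Carrier) : Set where
      field
        profiled : Profile a y
        coupled  : 0r ≤ ⟦ scale ⟧ * q + ⟦ scale ⟧ * p - ⟦ 11090 ⟧ * (K * a) + ⟦ scale ⟧ * (a * a) - ⟦ scale ⟧ * (x * x) - ⟦ 2 ℕ.* scale ⟧ * (x * z) - ⟦ scale ⟧ * y
        weighted : All (λ ζ → InZone ζ a → (⟦ scale ⟧ * y ≤ ⟦ 5000 ⟧ * (p + w) + boundR ζ a (x + z)) × (⟦ scale ⟧ * y ≤ ⟦ 5000 ⟧ * q + boundR ζ a K)) zones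
        gapped   : p ≤ x * x + ⟦ 2 ⟧ * (x * z)

    module _ (A T S : VSet n) (T⊆A : T ⊆ A) (order : countF T ≡ k) (small : countF S ℕ.≤ k)
      (profile-A : Profile (size A) (f A)) (weight-A : All (λ z → Weight z A) zones) where
      private
        SA⊆A : (S ∩ A) ⊆ A
        SA⊆A i p = proj₂ (∧-true {S i} p)
        trace : ∀ i → ((S ∩ A) ∩ T) i ≡ (S ∩ T) i
        trace i = bool-ext (λ p → ∧-intro (proj₁ (∧-true (proj₁ (∧-true {S i ∧ A i} p)))) (proj₂ (∧-true {S i ∧ A i} p)))
          (λ p → ∧-intro (∧-intro (proj₁ (∧-true p)) (T⊆A i (proj₂ (∧-true {S i} p)))) (proj₂ (∧-true {S i} p)))
        ST⊆SA : (S ∩ T) ⊆ (S ∩ A)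
        ST⊆SA i p = ∧-intro (proj₁ (∧-true p)) (T⊆A i (proj₂ (∧-true {S i} p)))
        s = ⟦ countF (S ∩ A) ⟧
        z = ⟦ countF (S ∩ T) ⟧
        P = ⟦ within E (S ∩ A) ⟧
        w = ⟦ within E (S ∩ T) ⟧
        q = ⟦ within E T ⟧
        α = ⟦ countF A ⟧
        union : ⟦ within E A ⟧ + (s * s + (K * K + w)) ≤ α * α + (P + (q + z * z))
        union = subst₂ _≤_
          (trans (ι-+ (within E A) _) (cong (⟦ within E A ⟧ +_) (trans (ι-+ (countF (S ∩ A) ℕ.* countF (S ∩ A)) _) (cong₂ _+_ (ι-* (countF (S ∩ A)) (countF (S ∩ A)))
            (trans (ι-+ (countF T ℕ.* countF T) _) (cong₂ _+_ (trans (ι-* (countF T) (countF T)) (cong (λ t → ⟦ t ⟧ * ⟦ t ⟧) order)) (cong ⟦_⟧ (within-cong E trace))))))))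
          (trans (ι-+ (countF A ℕ.* countF A) _) (cong₂ _+_ (ι-* (countF A) (countF A)) (trans (ι-+ (within E (S ∩ A)) _) (cong (P +_)
            (trans (ι-+ (within E T) _) (cong (q +_) (trans (ι-* (countF ((S ∩ A) ∩ T)) (countF ((S ∩ A) ∩ T))) (cong (λ t → ⟦ t ⟧ * ⟦ t ⟧) (countF-cong trace)))))))))
          (ι-mono-≤ (within-union E A (S ∩ A) T SA⊆A T⊆A))
        s≤k : countF (S ∩ A) ℕ.≤ k
        s≤k = ℕₚ.≤-trans (countF-mono {n} {S ∩ A} {S} (λ i p → proj₁ (∧-true {S i} p))) small

        weighted-by : ∀ zs → All (λ z → Weight z A) zs → All (λ ζ → InZone ζ (size A) →
          (⟦ scale ⟧ * f A ≤ ⟦ 5000 ⟧ * ((P - w) + w) + boundR ζ (size A) ((s - z) + z)) × (⟦ scale ⟧ * f A ≤ ⟦ 5000 ⟧ * q + boundR ζ (size A) K)) zs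
        weighted-by [] [] = []
        weighted-by (ζ ∷ zs) (h ∷ hs) = (λ i →
            subst₂ (λ t u → ⟦ scale ⟧ * f A ≤ ⟦ 5000 ⟧ * t + boundR ζ (size A) u) (cancel P w) (cancel s z) (h i (S ∩ A) SA⊆A s≤k) ,
            subst (λ t → ⟦ scale ⟧ * f A ≤ ⟦ 5000 ⟧ * q + boundR ζ (size A) ⟦ t ⟧) order (h i T T⊆A (ℕₚ.≤-reflexive order))) ∷ weighted-by zs hs
          where
          cancel : ∀ x y → x ≡ (x - y) + y
          cancel = solve 2 (λ x y → x := (x :- y) :+ y) refl

      part-nonneg : 0r ≤ ⟦ countF (S ∩ A) ⟧ - ⟦ countF (S ∩ T) ⟧
      part-nonneg = ≤⇒0≤- (ι-mono-≤ (countF-mono {n} {S ∩ T} {S ∩ A} ST⊆SA))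

      pairs-nonneg : 0r ≤ ⟦ within E (S ∩ A) ⟧ - ⟦ within E (S ∩ T) ⟧
      pairs-nonneg = ≤⇒0≤- (ι-mono-≤ (within-mono E (S ∩ T) (S ∩ A) ST⊆SA))

      -- S ∩ A and T both lie in A and meet in S ∩ T, so the part of S outside T fits into the |A| -
      -- k vertices there.
      part≤size : ⟦ countF (S ∩ A) ⟧ - ⟦ countF (S ∩ T) ⟧ ≤ size A
      part≤size = by-difference (≤⇒0≤- (subst₂ _≤_ (ι-+ (countF (S ∩ A)) (countF T)) (ι-+ (countF A) (countF (S ∩ T)))
          (ι-mono-≤ (subst (ℕ._≤ countF A ℕ.+ countF (S ∩ T)) (countF-∪ (S ∩ A) T) (ℕₚ.+-mono-≤
            (countF-mono {n} {(S ∩ A) ∪ T} {A} (λ i → mp (mp (decide 3 (λ s a t → (t ⟹ a) ⟹ ((s ∧ a) ∨ t) ⟹ a) refl (S i) (A i) (T i)) (imp (T⊆A i)))))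
            (ℕₚ.≤-reflexive (countF-cong trace)))))))
        (trans (solve 4 (λ α z s t → (α :+ z) :- (s :+ t) := (α :- t) :- (s :- z)) refl α z s ⟦ countF T ⟧) (cong (λ t → (α - ⟦ t ⟧) - (s - z)) order))

      side : Side (size A) (⟦ countF (S ∩ A) ⟧ - ⟦ countF (S ∩ T) ⟧) ⟦ countF (S ∩ T) ⟧ (f A)
        (⟦ within E (S ∩ A) ⟧ - ⟦ within E (S ∩ T) ⟧) ⟦ within E T ⟧ ⟦ within E (S ∩ T) ⟧
      side = record
        { profiled = profile-A
        ; coupled = subst (0r ≤_) (trans (solve 9 (λ α e s K w P q z D →
              con (pos 10000) :* ((α :* α :+ (P :+ (q :+ z :* z))) :- (e :+ (s :* s :+ (K :* K :+ w)))) :=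
              con (pos 10000) :* q :+ con (pos 10000) :* (P :- w) :- con (pos 10000) :* ((α :- K) :* (D :* K :- (α :- K))) :- con (pos 10000) :* ((s :- z) :* (s :- z))
                :- con (pos 20000) :* ((s :- z) :* z) :- con (pos 10000) :* (e :- (con (pos 2) :+ D) :* K :* (α :- K))) refl α ⟦ within E A ⟧ s K w P q z D)
            (trans (cong (λ t → ⟦ 10000 ⟧ * q + ⟦ 10000 ⟧ * (P - w) - t - ⟦ 10000 ⟧ * ((s - z) * (s - z)) - ⟦ 20000 ⟧ * ((s - z) * z) - ⟦ 10000 ⟧ * f A) (gain-value (size A)))
              (solve 7 (λ a b c d e g h → a :+ b :- (c :- d) :- e :- g :- h := a :+ b :- c :+ d :- e :- g :- h) refl
                (⟦ 10000 ⟧ * q) (⟦ 10000 ⟧ * (P - w)) (⟦ 11090 ⟧ * (K * size A)) (⟦ 10000 ⟧ * (size A * size A)) (⟦ 10000 ⟧ * ((s - z) * (s - z))) (⟦ 20000 ⟧ * ((s - z) * z)) (⟦ 10000 ⟧ * f A))))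
            (0≤-* (0≤ι 10000) (≤⇒0≤- union))
        ; weighted = weighted-by zones weight-A
        ; gapped = by-difference (≤⇒0≤- (subst₂ _≤_
              (trans (ι-+ (within E (S ∩ A)) _) (cong (P +_) (ι-* (countF (S ∩ T)) (countF (S ∩ T)))))
              (trans (ι-+ (countF (S ∩ A) ℕ.* countF (S ∩ A)) _) (cong (_+ w) (ι-* (countF (S ∩ A)) (countF (S ∩ A)))))
              (ι-mono-≤ (within-gap E (S ∩ T) (S ∩ A) ST⊆SA))))
            (solve 4 (λ P z s w → (s :* s :+ w) :- (P :+ z :* z) := ((s :- z) :* (s :- z) :+ con (pos 2) :* ((s :- z) :* z)) :- (P :- w)) refl P z s w)
        }

    module _ (ρ : ℕ → Carrier) (ρ₀ : ρ 0 ≡ 1r) (ρ₁ : ρ 1 ≡ K) where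
      eval-variables : ∀ i v → evalL ρ (variables (i ∷ v)) ≡ ρ i + evalL ρ (variables v)
      eval-variables i v = cong (_+ evalL ρ (variables v)) (trans (cong (_* ρ i) ι-1) (*-identˡ (ρ i)))

      eval-atLeast : ∀ c v → evalL ρ (atLeast c v) ≡ ⟦ 100 ⟧ * evalL ρ (variables v) - ⟦ c ⟧ * K
      eval-atLeast c [] rewrite ⟪⟫-neg (pos c) | ρ₁ = solve 2 (λ c K → (:- c) :* K :+ con (pos 0) := con (pos 100) :* con (pos 0) :- c :* K) refl ⟦ c ⟧ K
      eval-atLeast c (i ∷ v) = trans (cong (⟦ 100 ⟧ * ρ i +_) (eval-atLeast c v)) (trans
        (solve 4 (λ x y c K → con (pos 100) :* x :+ (con (pos 100) :* y :- c :* K) := con (pos 100) :* (x :+ y) :- c :* K) refl (ρ i) (evalL ρ (variables v)) ⟦ c ⟧ K)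
        (cong (λ t → ⟦ 100 ⟧ * t - ⟦ c ⟧ * K) (sym (eval-variables i v))))

      atLeast-intro : ∀ {c v m} → evalL ρ (variables v) ≡ m → ⟦ c ⟧ * K ≤ ⟦ 100 ⟧ * m → Nonneg ρ (atLeast c v)
      atLeast-intro {c} {v} refl p = subst (0r ≤_) (sym (eval-atLeast c v)) (≤⇒0≤- p)

      atMost-intro : ∀ {c v m} → evalL ρ (variables v) ≡ m → ⟦ 100 ⟧ * m ≤ ⟦ c ⟧ * K → Nonneg ρ (atMost c v)
      atMost-intro {c} {v} {m} refl p = subst (0r ≤_) (sym (trans (evalL-negate ρ (atLeast c v)) (trans (cong (λ t → 0r - t) (eval-atLeast c v))
        (solve 2 (λ x y → con (pos 0) :- (x :- y) := y :- x) refl (⟦ 100 ⟧ * m) (⟦ c ⟧ * K))))) (≤⇒0≤- p)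

      inZone-elim : ∀ z {v m} → evalL ρ (variables v) ≡ m → All (Nonneg ρ) (inZone z v) → InZone z m
      inZone-elim (zone lo nothing _ _ _ _) {v} refl (p ∷ []) = 0≤-⇒≤ (subst (0r ≤_) (eval-atLeast lo v) p)
      inZone-elim (zone lo (just hi) _ _ _ _) {v} {m} refl (p ∷ q ∷ []) = 0≤-⇒≤ (subst (0r ≤_) (eval-atLeast lo v) p) ,
        0≤-⇒≤ (subst (0r ≤_) (trans (evalL-negate ρ (atLeast hi v)) (trans (cong (λ t → 0r - t) (eval-atLeast hi v))
          (solve 2 (λ x y → con (pos 0) :- (x :- y) := y :- x) refl (⟦ 100 ⟧ * m) (⟦ hi ⟧ * K)))) q)

      eval-bound : ∀ z v s {m t} → evalL ρ v ≡ m → evalL ρ s ≡ t → evalQ ρ (bound-by-zone z v s) ≡ boundR z m t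
      eval-bound (zone _ _ u₀ u₁ κ₀ κ₁) v s refl refl
        rewrite evalQ-++ ρ (((pos u₀ , 1) ∷ []) ⊛ variables (1 ∷ [])) ((((ℤ.- pos u₁ , 1) ∷ []) ⊛ v) ++ (((ℤ.- pos κ₀ , 1) ∷ []) ⊛ s) ++ scaleBy (pos κ₁) (v ⊛ s))
        | evalQ-++ ρ (((ℤ.- pos u₁ , 1) ∷ []) ⊛ v) ((((ℤ.- pos κ₀ , 1) ∷ []) ⊛ s) ++ scaleBy (pos κ₁) (v ⊛ s))
        | evalQ-++ ρ (((ℤ.- pos κ₀ , 1) ∷ []) ⊛ s) (scaleBy (pos κ₁) (v ⊛ s))
        | evalQ-⊛ ρ ((pos u₀ , 1) ∷ []) (variables (1 ∷ [])) | evalQ-⊛ ρ ((ℤ.- pos u₁ , 1) ∷ []) v | evalQ-⊛ ρ ((ℤ.- pos κ₀ , 1) ∷ []) s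
        | evalQ-scaleBy ρ (pos κ₁) (v ⊛ s) | evalQ-⊛ ρ v s | ⟪⟫-neg (pos u₁) | ⟪⟫-neg (pos κ₀) | ρ₁ =
        solve 7 (λ a b c d K m s → (a :* K :+ con (pos 0)) :* (con (pos 1) :* K :+ con (pos 0)) :+ (((:- b) :* K :+ con (pos 0)) :* m :+ (((:- c) :* K :+ con (pos 0)) :* s :+ d :* (m :* s)))
          := a :* (K :* K) :- b :* (K :* m) :- c :* (K :* s) :+ d :* (m :* s)) refl ⟦ u₀ ⟧ ⟦ u₁ ⟧ ⟦ κ₀ ⟧ ⟦ κ₁ ⟧ K (evalL ρ v) (evalL ρ s)

      single : ∀ v → evalL ρ (variables (v ∷ [])) ≡ ρ v
      single v = trans (eval-variables v []) (+-identʳ (ρ v))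

      pair : ∀ v w → evalL ρ (variables (v ∷ w ∷ [])) ≡ ρ v + ρ w
      pair v w = trans (eval-variables v (w ∷ [])) (cong (ρ v +_) (single w))

      triple : ∀ u v w → evalL ρ (variables (u ∷ v ∷ w ∷ [])) ≡ ρ u + (ρ v + ρ w)
      triple u v w = trans (eval-variables u (v ∷ w ∷ [])) (cong (ρ u +_) (pair v w))

      eval-negative : ∀ s i j r → evalQ ρ ((ℤ.- pos s , i , j) ∷ r) ≡ evalQ ρ r - ⟦ s ⟧ * (ρ i * ρ j)
      eval-negative s i j r rewrite ⟪⟫-neg (pos s) = solve 3 (λ s v r → (:- s) :* v :+ r := r :- s :* v) refl ⟦ s ⟧ (ρ i * ρ j) (evalQ ρ r)

      atom : ∀ i → ρ 0 * ρ i ≡ ρ i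
      atom i = trans (cong (_* ρ i) ρ₀) (*-identˡ (ρ i))

      eval-negative₀ : ∀ s i r → evalQ ρ ((ℤ.- pos s , 0 , i) ∷ r) ≡ evalQ ρ r - ⟦ s ⟧ * ρ i
      eval-negative₀ s i r = trans (eval-negative s 0 i r) (cong (λ t → evalQ ρ r - ⟦ s ⟧ * t) (atom i))

      eval-positive₀ : ∀ s i r → evalQ ρ ((pos s , 0 , i) ∷ r) ≡ ⟦ s ⟧ * ρ i + evalQ ρ r
      eval-positive₀ s i r = cong (λ t → ⟦ s ⟧ * t + evalQ ρ r) (atom i)

      module _ {v x y p : ℕ} (S : Side (ρ v) (ρ x) (ρ 6) (ρ y) (ρ p) (ρ 9) (ρ 12)) where
        open Side S

        profileRow-eval : ∀ s c₀ c₁ c₂ → evalQ ρ ((ℤ.- pos s , 0 , y) ∷ (pos c₀ , 1 , 1) ∷ (ℤ.- pos c₁ , 1 , v) ∷ (pos c₂ , v , v) ∷ []) ≡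
          ⟦ c₀ ⟧ * (K * K) - ⟦ c₁ ⟧ * (K * ρ v) + ⟦ c₂ ⟧ * (ρ v * ρ v) - ⟦ s ⟧ * ρ y
        profileRow-eval s c₀ c₁ c₂ = trans (eval-negative₀ s y ((pos c₀ , 1 , 1) ∷ (ℤ.- pos c₁ , 1 , v) ∷ (pos c₂ , v , v) ∷ []))
          (cong (_- ⟦ s ⟧ * ρ y) (trans (cong (⟦ c₀ ⟧ * (ρ 1 * ρ 1) +_) (eval-negative c₁ 1 v ((pos c₂ , v , v) ∷ [])))
            (trans (cong (λ κ → ⟦ c₀ ⟧ * (κ * κ) + (⟦ c₂ ⟧ * (ρ v * ρ v) + 0r - ⟦ c₁ ⟧ * (κ * ρ v))) ρ₁)
              (solve 3 (λ a b c → a :+ (c :+ con (pos 0) :- b) := a :- b :+ c) refl (⟦ c₀ ⟧ * (K * K)) (⟦ c₁ ⟧ * (K * ρ v)) (⟦ c₂ ⟧ * (ρ v * ρ v))))))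

        profileRows-hold : ∀ {cs} → All (λ c → 0r ≤ margin c (ρ v) (ρ y)) cs → All (Holds ρ) (map (profileRow v x y p) cs)
        profileRows-hold [] = []
        profileRows-hold {(c₀ , c₁ , c₂) ∷ _} (h ∷ hs) = (λ _ → subst (0r ≤_) (sym (profileRow-eval scale c₀ c₁ c₂)) h) ∷ profileRows-hold hs

        weight-eval : ∀ s h z → evalQ ρ ((ℤ.- pos s , 0 , y) ∷ (pos h , 0 , p) ∷ (pos h , 0 , 12) ∷ bound-by-zone z (variables (v ∷ [])) (variables (x ∷ 6 ∷ []))) ≡
          (⟦ h ⟧ * (ρ p + ρ 12) + boundR z (ρ v) (ρ x + ρ 6)) - ⟦ s ⟧ * ρ y
        weight-eval s h z = trans (eval-negative₀ s y ((pos h , 0 , p) ∷ (pos h , 0 , 12) ∷ b)) (cong (_- ⟦ s ⟧ * ρ y)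
          (trans (eval-positive₀ h p ((pos h , 0 , 12) ∷ b)) (trans (cong (⟦ h ⟧ * ρ p +_) (trans (eval-positive₀ h 12 b) (cong (⟦ h ⟧ * ρ 12 +_) (eval-bound z (variables (v ∷ [])) (variables (x ∷ 6 ∷ [])) (single v) (pair x 6)))))
            (solve 4 (λ h a c d → h :* a :+ (h :* c :+ d) := h :* (a :+ c) :+ d) refl ⟦ h ⟧ (ρ p) (ρ 12) (boundR z (ρ v) (ρ x + ρ 6))))))
          where b = bound-by-zone z (variables (v ∷ [])) (variables (x ∷ 6 ∷ []))

        weight-eval′ : ∀ s h z → evalQ ρ ((ℤ.- pos s , 0 , y) ∷ (pos h , 0 , 9) ∷ bound-by-zone z (variables (v ∷ [])) (variables (1 ∷ []))) ≡
          (⟦ h ⟧ * ρ 9 + boundR z (ρ v) K) - ⟦ s ⟧ * ρ y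
        weight-eval′ s h z = trans (eval-negative₀ s y ((pos h , 0 , 9) ∷ b)) (cong (_- ⟦ s ⟧ * ρ y)
          (trans (eval-positive₀ h 9 b) (cong (⟦ h ⟧ * ρ 9 +_) (eval-bound z (variables (v ∷ [])) (variables (1 ∷ [])) (single v) (trans (single 1) ρ₁)))))
          where b = bound-by-zone z (variables (v ∷ [])) (variables (1 ∷ []))

        zoneRows-hold : ∀ {zs} → All (λ ζ → InZone ζ (ρ v) → (⟦ scale ⟧ * ρ y ≤ ⟦ 5000 ⟧ * (ρ p + ρ 12) + boundR ζ (ρ v) (ρ x + ρ 6)) × (⟦ scale ⟧ * ρ y ≤ ⟦ 5000 ⟧ * ρ 9 + boundR ζ (ρ v) K)) zs →
          All (Holds ρ) (zoneRows v x y p zs)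
        zoneRows-hold [] = []
        zoneRows-hold {z ∷ zs} (h ∷ hs) =
          (λ i → subst (0r ≤_) (sym (weight-eval scale 5000 z)) (≤⇒0≤- (proj₁ (h (inZone-elim z (single v) i))))) ∷
          (λ i → subst (0r ≤_) (sym (weight-eval′ scale 5000 z)) (≤⇒0≤- (proj₂ (h (inZone-elim z (single v) i))))) ∷ zoneRows-hold hs

        coupled-eval : ∀ s c t → evalQ ρ ((ℤ.- pos s , 0 , y) ∷ (pos s , 0 , 9) ∷ (pos s , 0 , p) ∷ (ℤ.- pos c , 1 , v) ∷ (pos s , v , v) ∷ (ℤ.- pos s , x , x) ∷ (ℤ.- pos t , x , 6) ∷ []) ≡
          ⟦ s ⟧ * ρ 9 + ⟦ s ⟧ * ρ p - ⟦ c ⟧ * (K * ρ v) + ⟦ s ⟧ * (ρ v * ρ v) - ⟦ s ⟧ * (ρ x * ρ x) - ⟦ t ⟧ * (ρ x * ρ 6) - ⟦ s ⟧ * ρ y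
        coupled-eval s c t = trans (eval-negative₀ s y ((pos s , 0 , 9) ∷ (pos s , 0 , p) ∷ r₁)) (cong (_- ⟦ s ⟧ * ρ y)
          (trans (eval-positive₀ s 9 ((pos s , 0 , p) ∷ r₁)) (trans (cong (⟦ s ⟧ * ρ 9 +_) (trans (eval-positive₀ s p r₁) (cong (⟦ s ⟧ * ρ p +_)
              (trans (eval-negative c 1 v ((pos s , v , v) ∷ r₂)) (cong₂ (λ e κ → ⟦ s ⟧ * (ρ v * ρ v) + e - ⟦ c ⟧ * (κ * ρ v)) (trans (eval-negative s x x ((ℤ.- pos t , x , 6) ∷ []))
                (cong (_- ⟦ s ⟧ * (ρ x * ρ x)) (eval-negative t x 6 []))) ρ₁)))))
            (solve 6 (λ a b c d e g → a :+ (b :+ ((d :+ ((con (pos 0) :- g) :- e)) :- c)) := a :+ b :- c :+ d :- e :- g) refl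
              (⟦ s ⟧ * ρ 9) (⟦ s ⟧ * ρ p) (⟦ c ⟧ * (K * ρ v)) (⟦ s ⟧ * (ρ v * ρ v)) (⟦ s ⟧ * (ρ x * ρ x)) (⟦ t ⟧ * (ρ x * ρ 6))))))
          where
          r₂ = (ℤ.- pos s , x , x) ∷ (ℤ.- pos t , x , 6) ∷ []
          r₁ = (ℤ.- pos c , 1 , v) ∷ (pos s , v , v) ∷ r₂

        gap-eval : ∀ s t → evalQ ρ ((ℤ.- pos s , 0 , p) ∷ (pos s , x , x) ∷ (pos t , x , 6) ∷ []) ≡ (⟦ s ⟧ * (ρ x * ρ x) + (⟦ t ⟧ * (ρ x * ρ 6) + 0r)) - ⟦ s ⟧ * ρ p
        gap-eval s t = eval-negative₀ s p ((pos s , x , x) ∷ (pos t , x , 6) ∷ [])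

        sideRows-hold : All (Holds ρ) (sideRows v x y p)
        sideRows-hold = ++⁺ (profileRows-hold profiled) ((λ _ → subst (0r ≤_) (sym (coupled-eval scale 11090 (2 ℕ.* scale))) coupled) ∷
          ++⁺ (zoneRows-hold weighted) ((λ _ → subst (0r ≤_) (trans (solve 3 (λ x z p → con (pos 10000) :* ((x :+ con (pos 2) :* z) :- p) :=
              (con (pos 10000) :* x :+ (con (pos 20000) :* z :+ con (pos 0))) :- con (pos 10000) :* p) refl (ρ x * ρ x) (ρ x * ρ 6) (ρ p)) (sym (gap-eval scale (2 ℕ.* scale))))
              (0≤-* (0≤ι 10000) (≤⇒0≤- gapped))) ∷ []))
          where open import Data.List.Relation.Unary.All.Properties using (++⁺)

      difference-eval : ∀ s i j k → evalQ ρ ((ℤ.- pos s , 0 , i) ∷ (pos s , j , k) ∷ []) ≡ ⟦ s ⟧ * (ρ j * ρ k - ρ i)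
      difference-eval s i j k = trans (eval-negative₀ s i ((pos s , j , k) ∷ [])) (solve 3 (λ s a b → (s :* a :+ con (pos 0)) :- s :* b := s :* (a :- b)) refl ⟦ s ⟧ (ρ j * ρ k) (ρ i))

      separatorRows-hold : ρ 12 ≤ ρ 6 * ρ 6 → ρ 9 ≤ K * K → ρ 12 ≤ ρ 9 → ρ 9 + ρ 6 * ρ 6 ≤ K * K + ρ 12 → ρ 9 ≤ ρ 7 + ρ 8 → All (Holds ρ) separatorRows
      separatorRows-hold p₁ p₂ p₃ p₄ p₅ =
        (λ _ → subst (0r ≤_) (sym (difference-eval scale 12 6 6)) (0≤-* (0≤ι 10000) (≤⇒0≤- p₁))) ∷
        (λ _ → subst (0r ≤_) (sym (difference-eval scale 9 1 1)) (0≤-* (0≤ι 10000) (subst (λ κ → 0r ≤ κ * κ - ρ 9) (sym ρ₁) (≤⇒0≤- p₂)))) ∷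
        (λ _ → subst (0r ≤_) (sym (difference-eval scale 12 0 9)) (0≤-* (0≤ι 10000) (subst (λ t → 0r ≤ t - ρ 12) (sym (atom 9)) (≤⇒0≤- p₃)))) ∷
        (λ _ → subst (0r ≤_) (sym (four scale)) (0≤-* (0≤ι 10000) (≤⇒0≤- p₄))) ∷
        (λ _ → subst (0r ≤_) (sym (three scale)) (0≤-* (0≤ι 10000) (≤⇒0≤- p₅))) ∷ []
        where
        four : ∀ s → evalQ ρ ((ℤ.- pos s , 0 , 9) ∷ (pos s , 0 , 12) ∷ (pos s , 1 , 1) ∷ (ℤ.- pos s , 6 , 6) ∷ []) ≡ ⟦ s ⟧ * ((K * K + ρ 12) - (ρ 9 + ρ 6 * ρ 6))
        four s = trans (eval-negative₀ s 9 ((pos s , 0 , 12) ∷ (pos s , 1 , 1) ∷ (ℤ.- pos s , 6 , 6) ∷ [])) (trans (cong (_- ⟦ s ⟧ * ρ 9)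
          (trans (eval-positive₀ s 12 ((pos s , 1 , 1) ∷ (ℤ.- pos s , 6 , 6) ∷ [])) (cong₂ (λ κ e → ⟦ s ⟧ * ρ 12 + (⟦ s ⟧ * (κ * κ) + e)) ρ₁ (eval-negative s 6 6 []))))
          (solve 5 (λ s K w q z → (s :* w :+ (s :* (K :* K) :+ (con (pos 0) :- s :* z))) :- s :* q := s :* ((K :* K :+ w) :- (q :+ z))) refl ⟦ s ⟧ K (ρ 12) (ρ 9) (ρ 6 * ρ 6)))
        three : ∀ s → evalQ ρ ((ℤ.- pos s , 0 , 9) ∷ (pos s , 0 , 7) ∷ (pos s , 0 , 8) ∷ []) ≡ ⟦ s ⟧ * ((ρ 7 + ρ 8) - ρ 9)
        three s = trans (eval-negative₀ s 9 ((pos s , 0 , 7) ∷ (pos s , 0 , 8) ∷ [])) (trans (cong (_- ⟦ s ⟧ * ρ 9)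
          (trans (eval-positive₀ s 7 ((pos s , 0 , 8) ∷ [])) (cong (⟦ s ⟧ * ρ 7 +_) (eval-positive₀ s 8 []))))
          (solve 4 (λ s a b q → (s :* a :+ (s :* b :+ con (pos 0))) :- s :* q := s :* ((a :+ b) :- q)) refl ⟦ s ⟧ (ρ 7) (ρ 8) (ρ 9)))

      goal-eval : ∀ z → evalQ ρ (goal z) ≡ ⟦ 5000 ⟧ * (ρ 10 + ρ 11 + ρ 12) + boundR z (ρ 2 + ρ 3) (ρ 4 + (ρ 5 + ρ 6)) - ⟦ scale ⟧ * (ρ 7 + ρ 8 - ρ 9)
      goal-eval z = general scale 5000
        where
        b = bound-by-zone z (variables (2 ∷ 3 ∷ [])) (variables (4 ∷ 5 ∷ 6 ∷ []))
        general : ∀ s h → evalQ ρ ((ℤ.- pos s , 0 , 7) ∷ (ℤ.- pos s , 0 , 8) ∷ (pos s , 0 , 9) ∷ (pos h , 0 , 10) ∷ (pos h , 0 , 11) ∷ (pos h , 0 , 12) ∷ b) ≡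
          ⟦ h ⟧ * (ρ 10 + ρ 11 + ρ 12) + boundR z (ρ 2 + ρ 3) (ρ 4 + (ρ 5 + ρ 6)) - ⟦ s ⟧ * (ρ 7 + ρ 8 - ρ 9)
        general s h = trans (eval-negative₀ s 7 ((ℤ.- pos s , 0 , 8) ∷ r₁)) (trans (cong (_- ⟦ s ⟧ * ρ 7) (trans (eval-negative₀ s 8 r₁)
          (cong (_- ⟦ s ⟧ * ρ 8) (trans (eval-positive₀ s 9 r₂) (cong (⟦ s ⟧ * ρ 9 +_) (trans (eval-positive₀ h 10 r₃) (cong (⟦ h ⟧ * ρ 10 +_)
            (trans (eval-positive₀ h 11 r₄) (cong (⟦ h ⟧ * ρ 11 +_) (trans (eval-positive₀ h 12 b) (cong (⟦ h ⟧ * ρ 12 +_) (eval-bound z (variables (2 ∷ 3 ∷ [])) (variables (4 ∷ 5 ∷ 6 ∷ [])) (pair 2 3) (triple 4 5 6)))))))))))))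
          (solve 9 (λ s h a b q p p′ w u → (s :* q :+ (h :* p :+ (h :* p′ :+ (h :* w :+ u)))) :- s :* b :- s :* a := h :* (p :+ p′ :+ w) :+ u :- s :* (a :+ b :- q)) refl
            ⟦ s ⟧ ⟦ h ⟧ (ρ 7) (ρ 8) (ρ 9) (ρ 10) (ρ 11) (ρ 12) (boundR z (ρ 2 + ρ 3) (ρ 4 + (ρ 5 + ρ 6)))))
          where
          r₄ = (pos h , 0 , 12) ∷ b
          r₃ = (pos h , 0 , 11) ∷ r₄
          r₂ = (pos h , 0 , 10) ∷ r₃
          r₁ = (pos s , 0 , 9) ∷ r₂

      common-nonneg : (∀ i → 0r ≤ ρ i) → ρ 4 ≤ ρ 2 → ρ 5 ≤ ρ 3 → ρ 4 + (ρ 5 + ρ 6) ≤ K → ρ 2 ≤ ρ 3 → All (Nonneg ρ) common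
      common-nonneg h xa yb sk ab = one 1 ∷ one 2 ∷ one 3 ∷ one 4 ∷ one 5 ∷ one 6 ∷
        scaled (≤⇒0≤- xa) (solve 2 (λ a b → con (pos 100) :* (a :- b) := con (pos 100) :* a :+ (con -[1+ 99 ] :* b :+ con (pos 0))) refl (ρ 2) (ρ 4)) ∷
        scaled (≤⇒0≤- yb) (solve 2 (λ a b → con (pos 100) :* (a :- b) := con (pos 100) :* a :+ (con -[1+ 99 ] :* b :+ con (pos 0))) refl (ρ 3) (ρ 5)) ∷
        scaled (subst (λ κ → 0r ≤ κ - (ρ 4 + (ρ 5 + ρ 6))) (sym ρ₁) (≤⇒0≤- sk)) (solve 4 (λ x y z k → con (pos 100) :* (k :- (x :+ (y :+ z))) :=
          con -[1+ 99 ] :* x :+ (con -[1+ 99 ] :* y :+ (con -[1+ 99 ] :* z :+ (con (pos 100) :* k :+ con (pos 0))))) refl (ρ 4) (ρ 5) (ρ 6) (ρ 1)) ∷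
        scaled (≤⇒0≤- ab) (solve 2 (λ a b → con (pos 100) :* (b :- a) := con -[1+ 99 ] :* a :+ (con (pos 100) :* b :+ con (pos 0))) refl (ρ 2) (ρ 3)) ∷ []
        where
        scaled : ∀ {t u} → 0r ≤ t → ⟦ 100 ⟧ * t ≡ u → 0r ≤ u
        scaled p refl = 0≤-* (0≤ι 100) p
        one : ∀ i → Nonneg ρ ((pos 100 , i) ∷ [])
        one i = 0≤-+ (0≤-* (0≤ι 100) (h i)) ≤-refl

-- Alternative (3): the weighted bound passes from the sides to X

module Induction (R : RealField) where
  open Reals R
  open Cert R
  open Energy R
  open Three R

  nth-all : ∀ {xs} → All (0r ≤_) xs → ∀ i → 0r ≤ nth 0r i xs
  nth-all [] i = ≤-refl
  nth-all (p ∷ ps) zero = p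
  nth-all (p ∷ ps) (suc i) = nth-all ps i

  module _ {n : ℕ} (E : Rel n) (k : ℕ) (D : Carrier) (D-value : ⟦ 1000 ⟧ * D ≡ ⟦ 1109 ⟧) (pK : 0r < ⟦ k ⟧) where
    open Certificates E k D
    open Weighted E k D D-value

    module _ {X : VSet n} (sep : Separation E k X) (ab : size (Separation.A sep) ≤ size (Separation.B sep))
      (profile-A : Profile (size (Separation.A sep)) (f (Separation.A sep))) (profile-B : Profile (size (Separation.B sep)) (f (Separation.B sep)))
      (weight-A : All (λ z → Weight z (Separation.A sep)) zones) (weight-B : All (λ z → Weight z (Separation.B sep)) zones)
      (fA : 0r ≤ f (Separation.A sep)) (fB : 0r ≤ f (Separation.B sep)) (fX : 0r ≤ f X)
      where
      open Separation sep hiding (size)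

      private
        T′ = A ∩ B
        T⊆A : T′ ⊆ A
        T⊆A i p = proj₁ (∧-true {A i} p)
        T⊆B : T′ ⊆ B
        T⊆B i p = proj₂ (∧-true {A i} p)
        a′ = size A
        b′ = size B
        q = ⟦ within E T′ ⟧

        a≥0 : 0r ≤ a′
        a≥0 = ≤⇒0≤- (ι-mono-≤ (subst (ℕ._≤ countF A) order (countF-mono {n} {T′} {A} T⊆A)))

        b≥0 : 0r ≤ b′
        b≥0 = ≤-trans a≥0 ab

        m≡ : size X ≡ a′ + b′
        m≡ = trans (cong (_- K) (size-R sep)) (solve 3 (λ a b K → a :+ b :- K :- K := (a :- K) :+ (b :- K)) refl ⟦ countF A ⟧ ⟦ countF B ⟧ K)

        split-f : f X + q ≤ f A + f B
        split-f = excess-add sep (within E X) (within E T′) (within E A) (within E B) (within-sep sep)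

      module _ (S : VSet n) (S⊆X : S ⊆ X) (small : countF S ℕ.≤ k) where
        private
          sA = side A T′ S T⊆A order small profile-A weight-A
          sB = side B T′ S T⊆B order small profile-B weight-B
          z = ⟦ countF (S ∩ T′) ⟧
          x = ⟦ countF (S ∩ A) ⟧ - z
          y = ⟦ countF (S ∩ B) ⟧ - z
          w = ⟦ within E (S ∩ T′) ⟧
          p = ⟦ within E (S ∩ A) ⟧ - w
          p′ = ⟦ within E (S ∩ B) ⟧ - w

          -- Indices past the list get 0, so that all variables are nonnegative as the checker
          -- demands. This is also where f(A) ≥ 0 and f(B) ≥ 0 are needed.
          ρ : ℕ → Carrier
          ρ i = nth 0r i (1r ∷ K ∷ a′ ∷ b′ ∷ x ∷ y ∷ z ∷ f A ∷ f B ∷ q ∷ p ∷ p′ ∷ w ∷ [])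

          x≥0 : 0r ≤ x
          x≥0 = part-nonneg A T′ S T⊆A order small profile-A weight-A
          y≥0 : 0r ≤ y
          y≥0 = part-nonneg B T′ S T⊆B order small profile-B weight-B
          x≤a : x ≤ a′
          x≤a = part≤size A T′ S T⊆A order small profile-A weight-A
          y≤b : y ≤ b′
          y≤b = part≤size B T′ S T⊆B order small profile-B weight-B

          nonneg : ∀ i → 0r ≤ ρ i
          nonneg = nth-all (<⇒≤ 0<1 ∷ 0≤K ∷ a≥0 ∷ b≥0 ∷ x≥0 ∷ y≥0 ∷ 0≤ι (countF (S ∩ T′)) ∷ fA ∷ fB ∷ 0≤ι (within E T′) ∷
            pairs-nonneg A T′ S T⊆A order small profile-A weight-A ∷ pairs-nonneg B T′ S T⊆B order small profile-B weight-B ∷ 0≤ι (within E (S ∩ T′)) ∷ [])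

          both : ∀ i → ((S ∩ A) ∩ (S ∩ B)) i ≡ (S ∩ T′) i
          both i = bool-ext (mp (decide 3 (λ s a b → ((s ∧ a) ∧ (s ∧ b)) ⟹ (s ∧ (a ∧ b))) refl (S i) (A i) (B i)))
            (mp (decide 3 (λ s a b → (s ∧ (a ∧ b)) ⟹ ((s ∧ a) ∧ (s ∧ b))) refl (S i) (A i) (B i)))

          either : ∀ i → (S ∩ A) i ∨ (S ∩ B) i ≡ S i
          either i = bool-ext (mp (decide 3 (λ s a b → ((s ∧ a) ∨ (s ∧ b)) ⟹ s) refl (S i) (A i) (B i)))
            (mp (mp (decide 3 (λ s a b → (s ⟹ (a ∨ b)) ⟹ s ⟹ ((s ∧ a) ∨ (s ∧ b))) refl (S i) (A i) (B i)) (imp (λ h → trans (sym (covers i)) (S⊆X i h)))))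

          s≡ : ⟦ countF S ⟧ ≡ x + (y + z)
          s≡ = trans (solve 2 (λ s z → s := (s :+ z) :- z) refl ⟦ countF S ⟧ z) (trans (cong (_- z) (trans (sym (ι-+ (countF S) (countF (S ∩ T′))))
              (trans (cong ⟦_⟧ (trans (cong₂ ℕ._+_ (countF-cong (λ i → sym (either i))) (countF-cong (λ i → sym (both i)))) (countF-∪ (S ∩ A) (S ∩ B)))) (ι-+ (countF (S ∩ A)) (countF (S ∩ B))))))
            (solve 3 (λ s t z → s :+ t :- z := (s :- z) :+ ((t :- z) :+ z)) refl ⟦ countF (S ∩ A) ⟧ ⟦ countF (S ∩ B) ⟧ z))

          overlapping : p + p′ + w ≤ ⟦ within E S ⟧
          overlapping = by-difference (≤⇒0≤- (subst₂ _≤_ (ι-+ (within E (S ∩ A)) (within E (S ∩ B))) (trans (cong (λ t → ⟦ within E S ℕ.+ t ⟧) (within-cong E both)) (ι-+ (within E S) (within E (S ∩ T′))))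
              (ι-mono-≤ (within-overlap E (S ∩ A) (S ∩ B) S either))))
            (solve 4 (λ a b w s → (s :+ w) :- (a :+ b) := s :- ((a :- w) :+ (b :- w) :+ w)) refl ⟦ within E (S ∩ A) ⟧ ⟦ within E (S ∩ B) ⟧ w ⟦ within E S ⟧)

          rows-hold : All (Holds ρ) rows
          rows-hold = ++⁺ (sideRows-hold ρ refl refl sA) (++⁺ (sideRows-hold ρ refl refl sB) (separatorRows-hold ρ refl refl
              (subst (w ≤_) (ι-* (countF (S ∩ T′)) (countF (S ∩ T′))) (ι-mono-≤ (within≤square E (S ∩ T′))))
              (subst (q ≤_) (trans (ι-* (countF T′) (countF T′)) (cong (λ t → ⟦ t ⟧ * ⟦ t ⟧) order)) (ι-mono-≤ (within≤square E T′)))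
              (ι-mono-≤ (within-mono E (S ∩ T′) T′ ST⊆T))
              (subst₂ _≤_ (trans (ι-+ (within E T′) _) (cong (q +_) (ι-* (countF (S ∩ T′)) (countF (S ∩ T′)))))
                (trans (ι-+ (countF T′ ℕ.* countF T′) _) (cong (_+ w) (trans (ι-* (countF T′) (countF T′)) (cong (λ t → ⟦ t ⟧ * ⟦ t ⟧) order))))
                (ι-mono-≤ (within-gap E (S ∩ T′) T′ ST⊆T)))
              (≤-trans (by-difference fX (solve 2 (λ x q → x := (x :+ q) :- q) refl (f X) q)) split-f)))
            where
            open import Data.List.Relation.Unary.All.Properties using (++⁺)
            ST⊆T : (S ∩ T′) ⊆ T′
            ST⊆T i h = proj₂ (∧-true {S i} h)

          commons : All (Nonneg ρ) common
          commons = common-nonneg ρ refl refl nonneg x≤a y≤b (subst (_≤ K) s≡ (ι-mono-≤ small)) ab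

          finish : ∀ ζ → 0r ≤ evalQ ρ (goal ζ) → ⟦ scale ⟧ * f X ≤ ⟦ 5000 ⟧ * ⟦ within E S ⟧ + boundR ζ (size X) ⟦ countF S ⟧
          finish ζ h = subst₂ (λ m t → ⟦ scale ⟧ * f X ≤ ⟦ 5000 ⟧ * ⟦ within E S ⟧ + boundR ζ m t) (sym m≡) (sym s≡) (by-difference
            (0≤-+ (subst (0r ≤_) (goal-eval ρ refl refl ζ) h) (0≤-+ (0≤-* (0≤ι 10000) (≤⇒0≤- split-f)) (0≤-* (0≤ι 5000) (≤⇒0≤- overlapping))))
            (solve 7 (λ P u a b q g s → (con (pos 5000) :* P :+ u :- con (pos 10000) :* (a :+ b :- q)) :+ (con (pos 10000) :* ((a :+ b) :- (g :+ q)) :+ con (pos 5000) :* (s :- P))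
              := (con (pos 5000) :* s :+ u) :- con (pos 10000) :* g) refl (p + p′ + w) (boundR ζ (a′ + b′) (x + (y + z))) (f A) (f B) q (f X) ⟦ within E S ⟧))

          bounds-for : ∀ {b} → a′ ≤ ⟦ 2 ⟧ * K → (b ≡ true → b′ ≤ ⟦ 2 ⟧ * K) → Bounds b ρ
          bounds-for {flag} ha hb = record { nonneg = nonneg ; twice = twice ; face = x≤a }
            where
            K≤2K : K ≤ ⟦ 2 ⟧ * K
            K≤2K = by-difference 0≤K (solve 1 (λ K → K := con (pos 2) :* K :- K) refl K)
            part : ∀ {t u} → 0r ≤ u → t + u ≤ K → t ≤ ⟦ 2 ⟧ * K
            part {t} {u} pu h = ≤-trans (by-difference pu (solve 2 (λ t u → u := (t :+ u) :- t) refl t u)) (≤-trans h K≤2K)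
            sum≤K : x + (y + z) ≤ K
            sum≤K = subst (_≤ K) s≡ (ι-mono-≤ small)
            twice : ∀ i → bounded flag i ≡ true → ρ i ≤ ⟦ 2 ⟧ * K
            twice 1 _ = K≤2K
            twice 2 _ = ha
            twice 3 e = hb e
            twice 4 _ = part (0≤-+ y≥0 (0≤ι (countF (S ∩ T′)))) sum≤K
            twice 5 _ = part (0≤-+ x≥0 (0≤ι (countF (S ∩ T′)))) (subst (_≤ K) (solve 3 (λ x y z → x :+ (y :+ z) := y :+ (x :+ z)) refl x y z) sum≤K)
            twice 6 _ = part (0≤-+ x≥0 y≥0) (subst (_≤ K) (solve 3 (λ x y z → x :+ (y :+ z) := z :+ (x :+ y)) refl x y z) sum≤K)
            twice 0 ()
            twice (suc (suc (suc (suc (suc (suc (suc i))))))) ()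

          below : ∀ {c t} → c ℕ.≤ 200 → ⟦ 100 ⟧ * t ≤ ⟦ c ⟧ * K → t ≤ ⟦ 2 ⟧ * K
          below {c} {t} h q = 0≤-⇒≤ (0≤-*-cancel (0<ι 99) (subst (0r ≤_) (solve 3 (λ c K t → (c :* K :- con (pos 100) :* t) :+ (con (pos 200) :- c) :* K := con (pos 100) :* (con (pos 2) :* K :- t)) refl ⟦ c ⟧ K t)
            (0≤-+ (≤⇒0≤- q) (0≤-* (≤⇒0≤- (ι-mono-≤ h)) 0≤K))))

          bounds-nonneg : ∀ lo hi half → 2 ℕ.* half ℕ.≤ lo → ⟦ lo ⟧ * K ≤ ⟦ 100 ⟧ * (a′ + b′) → ⟦ 100 ⟧ * b′ ≤ ⟦ hi ⟧ * K → ∀ L → All (Nonneg ρ) L → All (Nonneg ρ) (bounds lo hi half ++ L)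
          bounds-nonneg lo hi half h l u L hL = atLeast-intro ρ refl refl {lo} {2 ∷ 3 ∷ []} (pair ρ refl refl 2 3) l ∷ atMost-intro ρ refl refl {hi} {3 ∷ []} (single ρ refl refl 3) u ∷
            atMost-intro ρ refl refl {hi} {2 ∷ []} (single ρ refl refl 2) (≤-trans (by-difference (0≤-* (0≤ι 100) (≤⇒0≤- ab)) (solve 2 (λ a b → con (pos 100) :* (b :- a) := con (pos 100) :* b :- con (pos 100) :* a) refl a′ b′)) u) ∷
            atLeast-intro ρ refl refl {half} {3 ∷ []} (single ρ refl refl 3) (0≤-⇒≤ (0≤-*-cancel (0<ι 1) (subst (0r ≤_)
              (trans (cong (λ t → (⟦ 100 ⟧ * (a′ + b′) - ⟦ lo ⟧ * K) + (⟦ 100 ⟧ * (b′ - a′) + (⟦ lo ⟧ - t) * K)) (ι-* 2 half))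
                (solve 5 (λ a b l h K → (con (pos 100) :* (a :+ b) :- l :* K) :+ (con (pos 100) :* (b :- a) :+ (l :- con (pos 2) :* h) :* K) := con (pos 2) :* (con (pos 100) :* b :- h :* K)) refl a′ b′ ⟦ lo ⟧ ⟦ half ⟧ K))
              (0≤-+ (≤⇒0≤- l) (0≤-+ (0≤-* (0≤ι 100) (≤⇒0≤- ab)) (0≤-* (≤⇒0≤- (ι-mono-≤ h)) 0≤K)))))) ∷ hL

          within-zone : ∀ lo hi half ζ t → 2 ℕ.* half ℕ.≤ lo → hi ℕ.≤ 200 → check true (goal ζ) rows (bounds lo hi half ++ atMost hi (2 ∷ 3 ∷ []) ∷ common) t ≡ true →
            (⟦ lo ⟧ * K ≤ ⟦ 100 ⟧ * size X) × (⟦ 100 ⟧ * size X ≤ ⟦ hi ⟧ * K) → ⟦ scale ⟧ * f X ≤ ⟦ 5000 ⟧ * ⟦ within E S ⟧ + boundR ζ (size X) ⟦ countF S ⟧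
          within-zone lo hi half ζ t h₁ h₂ sound (l , u) = finish ζ (check-sound (bounds-for {true} (≤-trans ab (below {hi} h₂ b≤hi)) (λ _ → below {hi} h₂ b≤hi)) (goal ζ) {rows} {bounds lo hi half ++ atMost hi (2 ∷ 3 ∷ []) ∷ common} rows-hold
              (bounds-nonneg lo hi half h₁ (subst (λ m → ⟦ lo ⟧ * K ≤ ⟦ 100 ⟧ * m) m≡ l) b≤hi (atMost hi (2 ∷ 3 ∷ []) ∷ common) (atMost-intro ρ refl refl {hi} {2 ∷ 3 ∷ []} (pair ρ refl refl 2 3) u′ ∷ commons)) t sound)
            where
            u′ : ⟦ 100 ⟧ * (a′ + b′) ≤ ⟦ hi ⟧ * K
            u′ = subst (λ m → ⟦ 100 ⟧ * m ≤ ⟦ hi ⟧ * K) m≡ u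
            b≤hi : ⟦ 100 ⟧ * b′ ≤ ⟦ hi ⟧ * K
            b≤hi = ≤-trans (by-difference (0≤-* (0≤ι 100) a≥0) (solve 2 (λ a b → con (pos 100) :* a := con (pos 100) :* (a :+ b) :- con (pos 100) :* b) refl a′ b′)) u′

          last-weighted : ∀ {C : Set} (P : Zone → Set) → All P zones → (P (nthZone 3) → C) → C
          last-weighted P (_ ∷ _ ∷ _ ∷ h ∷ []) g = g h

          -- Both sides beyond 1.17 k are impossible: with S = A ∩ B each has 10⁴ f ≤ 5000 e(A ∩ B)
          -- - 280 k², and adding up leaves 10⁴ f(X) ≤ -560 k², against f(X) ≥ 0.
          beyond : ⟦ 117 ⟧ * K ≤ ⟦ 100 ⟧ * size X → ⟦ scale ⟧ * f X ≤ ⟦ 5000 ⟧ * ⟦ within E S ⟧ + boundR (nthZone 3) (size X) ⟦ countF S ⟧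
          beyond l = [ near , (λ v → [ far v , (λ u → ⊥-elim (≤⇒≯ (contradiction u v) (<-* (0<ι 559) (<-* pK pK)))) ]′ (≤-total (⟦ 100 ⟧ * a′) (⟦ 117 ⟧ * K))) ]′ (≤-total (⟦ 100 ⟧ * b′) (⟦ 117 ⟧ * K))
            where
            h = ℕₚ.≤ᵇ⇒≤ 117 200 tt
            near : ⟦ 100 ⟧ * b′ ≤ ⟦ 117 ⟧ * K → ⟦ scale ⟧ * f X ≤ ⟦ 5000 ⟧ * ⟦ within E S ⟧ + boundR (nthZone 3) (size X) ⟦ countF S ⟧
            near u = finish (nthZone 3) (check-sound (bounds-for {true} (≤-trans ab (below {117} h u)) (λ _ → below {117} h u)) (goal (nthZone 3)) {rows} {base₃} rows-hold
              (bounds-nonneg 117 117 50 (ℕₚ.≤ᵇ⇒≤ 100 117 tt) (subst (λ m → ⟦ 117 ⟧ * K ≤ ⟦ 100 ⟧ * m) m≡ l) u common commons) tree₃ sound₃)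
            far : ⟦ 117 ⟧ * K ≤ ⟦ 100 ⟧ * b′ → ⟦ 100 ⟧ * a′ ≤ ⟦ 117 ⟧ * K → ⟦ scale ⟧ * f X ≤ ⟦ 5000 ⟧ * ⟦ within E S ⟧ + boundR (nthZone 3) (size X) ⟦ countF S ⟧
            far v u = finish (nthZone 3) (check-sound (bounds-for {false} (below {117} (ℕₚ.≤ᵇ⇒≤ 117 200 tt) u) (λ ())) (goal (nthZone 3)) {rows} {base₄} rows-hold
              (atLeast-intro ρ refl refl {117} {3 ∷ []} (single ρ refl refl 3) v ∷ atMost-intro ρ refl refl {117} {2 ∷ []} (single ρ refl refl 2) u ∷ commons) tree₄ sound₄)
            half-bound : ∀ {a x z y p} → Side a x z y p q w → ⟦ 117 ⟧ * K ≤ ⟦ 100 ⟧ * a → ⟦ 10000 ⟧ * y ≤ ⟦ 5000 ⟧ * q - ⟦ 280 ⟧ * (K * K)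
            half-bound {a} {x} {z} {y} {p} s h = last-weighted (λ ζ → InZone ζ a → (⟦ scale ⟧ * y ≤ ⟦ 5000 ⟧ * (p + w) + boundR ζ a (x + z)) × (⟦ scale ⟧ * y ≤ ⟦ 5000 ⟧ * q + boundR ζ a K)) (Side.weighted s) (λ g → ≤-trans (proj₂ (g h)) (≤-reflexive
              (solve 3 (λ q K a → con (pos 5000) :* q :+ (con (pos 4225) :* (K :* K) :- con (pos 0) :* (K :* a) :- con (pos 4505) :* (K :* K) :+ con (pos 0) :* (a :* K)) := con (pos 5000) :* q :- con (pos 280) :* (K :* K)) refl q K a)))
            contradiction : ⟦ 117 ⟧ * K ≤ ⟦ 100 ⟧ * a′ → ⟦ 117 ⟧ * K ≤ ⟦ 100 ⟧ * b′ → ⟦ 560 ⟧ * (K * K) ≤ 0r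
            contradiction u v = by-difference (0≤-+ (≤⇒0≤- (half-bound sA u)) (0≤-+ (≤⇒0≤- (half-bound sB v)) (0≤-+ (0≤-* (0≤ι 10000) (≤⇒0≤- split-f)) (0≤-* (0≤ι 10000) fX))))
              (solve 5 (λ q κ a b g → (con (pos 5000) :* q :- con (pos 280) :* κ :- con (pos 10000) :* a) :+ ((con (pos 5000) :* q :- con (pos 280) :* κ :- con (pos 10000) :* b) :+ (con (pos 10000) :* ((a :+ b) :- (g :+ q)) :+ con (pos 10000) :* g))
                := con (pos 0) :- con (pos 560) :* κ) refl q (K * K) (f A) (f B) (f X))

        weights-step : All (λ z → InZone z (size X) → ⟦ scale ⟧ * f X ≤ ⟦ 5000 ⟧ * ⟦ within E S ⟧ + boundR z (size X) ⟦ countF S ⟧) zones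
        weights-step = within-zone 50 75 25 (nthZone 0) tree₀ (ℕₚ.≤ᵇ⇒≤ 50 50 tt) (ℕₚ.≤ᵇ⇒≤ 75 200 tt) sound₀ ∷
          within-zone 75 100 25 (nthZone 1) tree₁ (ℕₚ.≤ᵇ⇒≤ 50 75 tt) (ℕₚ.≤ᵇ⇒≤ 100 200 tt) sound₁ ∷
          within-zone 100 117 50 (nthZone 2) tree₂ (ℕₚ.≤ᵇ⇒≤ 100 100 tt) (ℕₚ.≤ᵇ⇒≤ 117 200 tt) sound₂ ∷ beyond ∷ []

-- Alternative (3): flat sides and the end of the induction

module Bootstrap (R : RealField) where
  open Reals R
  open Energy R
  open Three R
  open Induction R
  open One R using (everything; 0≤a)

  module _ {n : ℕ} (E : Rel n) (k : ℕ) (D : Carrier) (D-value : ⟦ 1000 ⟧ * D ≡ ⟦ 1109 ⟧) (pK : 0r < ⟦ k ⟧) where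
    open Certificates E k D
    open Weighted E k D D-value

    private
      W = λ X → All (λ z → Weight z X) zones

      2≤2+D : ⟦ 2 ⟧ ≤ ⟦ 2 ⟧ + D
      2≤2+D = by-difference (0≤-*-cancel (0<ι 999) (subst (0r ≤_) (sym D-value) (0≤ι 1109))) (solve 1 (λ d → d := (con (pos 2) :+ d) :- con (pos 2)) refl D)

    early-or-late : ∀ X → W X → ⟦ 1109 ⟧ * K ≤ ⟦ 1000 ⟧ * size X → ∀ S → S ⊆ X → countF S ℕ.≤ k →
      ∃ λ z → (⟦ scale ⟧ * f X ≤ ⟦ 5000 ⟧ * ⟦ within E S ⟧ + boundR z (size X) ⟦ countF S ⟧) × (z ≡ nthZone 2 ⊎ z ≡ nthZone 3)
    early-or-late X (_ ∷ _ ∷ w₂ ∷ w₃ ∷ []) late S sub small =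
      [ (λ u → nthZone 2 , w₂ (l , u) S sub small , inj₁ refl) , (λ l → nthZone 3 , w₃ l S sub small , inj₂ refl) ]′ (≤-total (⟦ 100 ⟧ * size X) (⟦ 117 ⟧ * K))
      where
      l : ⟦ 100 ⟧ * K ≤ ⟦ 100 ⟧ * size X
      l = 0≤-⇒≤ (0≤-*-cancel (0<ι 9) (subst (0r ≤_) (solve 2 (λ m K → (con (pos 1000) :* m :- con (pos 1109) :* K) :+ con (pos 109) :* K := con (pos 10) :* (con (pos 100) :* m :- con (pos 100) :* K)) refl (size X) K)
        (0≤-+ (≤⇒0≤- late) (0≤-* (0≤ι 109) 0≤K))))

    -- Up to m = D k the pairs of X outside T number at most m² + 2km, which is at most δ k m.
    -- Beyond that, the weighted bound with S = T gives f(X) ≤ e(T) / 2 + L, and L is negative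
    -- there.
    separator-dominates : ∀ X T → T ⊆ X → countF T ≡ k → (⟦ 1109 ⟧ * K ≤ ⟦ 1000 ⟧ * size X → Flat X ⊎ W X) → f X ≤ ⟦ within E T ⟧
    separator-dominates X T T⊆X order h = [ early , later ]′ (≤-total (⟦ 1000 ⟧ * size X) (⟦ 1109 ⟧ * K))
      where
      m = size X
      x = ⟦ countF X ⟧
      w = ⟦ within E X ⟧
      q = ⟦ within E T ⟧
      0≤m : 0r ≤ m
      0≤m = ≤⇒0≤- (ι-mono-≤ (subst (ℕ._≤ countF X) order (countF-mono {n} {T} {X} T⊆X)))
      ≡-sym-gain : (⟦ 10 ⟧ * m) * (⟦ 1109 ⟧ * K - ⟦ 1000 ⟧ * m) ≡ ⟦ 11090 ⟧ * (K * m) - ⟦ 10000 ⟧ * (m * m)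
      ≡-sym-gain = solve 2 (λ K m → (con (pos 10) :* m) :* (con (pos 1109) :* K :- con (pos 1000) :* m) := con (pos 11090) :* (K :* m) :- con (pos 10000) :* (m :* m)) refl K m
      gap : w + K * K ≤ x * x + q
      gap = subst₂ _≤_ (trans (ι-+ (within E X) _) (cong (w +_) (trans (ι-* (countF T) (countF T)) (cong (λ t → ⟦ t ⟧ * ⟦ t ⟧) order))))
        (trans (ι-+ (countF X ℕ.* countF X) _) (cong (_+ q) (ι-* (countF X) (countF X)))) (ι-mono-≤ (within-gap E T X T⊆X))
      early : ⟦ 1000 ⟧ * m ≤ ⟦ 1109 ⟧ * K → f X ≤ q
      early u = 0≤-⇒≤ (0≤-*-cancel (0<ι 9999) (subst (0r ≤_)
        (trans (cong (λ t → ⟦ 10000 ⟧ * ((x * x + q) - (w + K * K)) + t) (trans (≡-sym-gain) (sym (gain-value m))))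
          (solve 5 (λ K D x w q → con (pos 10000) :* ((x :* x :+ q) :- (w :+ K :* K)) :+ con (pos 10000) :* ((x :- K) :* (D :* K :- (x :- K))) := con (pos 10000) :* (q :- (w :- (con (pos 2) :+ D) :* K :* (x :- K)))) refl K D x w q))
        (0≤-+ (0≤-* (0≤ι 10000) (≤⇒0≤- gap)) (0≤-* (0≤-* (0≤ι 10) 0≤m) (≤⇒0≤- u)))))
      finish : (∃ λ z → (⟦ scale ⟧ * f X ≤ ⟦ 5000 ⟧ * q + boundR z m ⟦ countF T ⟧) × (z ≡ nthZone 2 ⊎ z ≡ nthZone 3)) → ⟦ 1109 ⟧ * K ≤ ⟦ 1000 ⟧ * m → f X ≤ q
      -- L is negative from m = 1.109 k on: 20 (3150m - 3405K) = 63 (1000m - 1109K) + 1767K.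
      finish (z , p , inj₁ refl) l = 0≤-⇒≤ (0≤-*-cancel (0<ι 199999) (subst (0r ≤_)
        (solve 4 (λ K m q g → con (pos 20) :* ((con (pos 5000) :* q :+ (con (pos 12005) :* (K :* K) :- con (pos 6650) :* (K :* m) :- con (pos 8600) :* (K :* K) :+ con (pos 3500) :* (m :* K))) :- con (pos 10000) :* g) :+
            (con (pos 100000) :* q :+ K :* (con (pos 63) :* (con (pos 1000) :* m :- con (pos 1109) :* K) :+ con (pos 1767) :* K)) := con (pos 200000) :* (q :- g)) refl K m q (f X))
        (0≤-+ (0≤-* (0≤ι 20) (≤⇒0≤- (subst (λ t → ⟦ 10000 ⟧ * f X ≤ ⟦ 5000 ⟧ * q + boundR (nthZone 2) m ⟦ t ⟧) order p)))
          (0≤-+ (0≤-* (0≤ι 100000) (0≤ι (within E T))) (0≤-* 0≤K (0≤-+ (0≤-* (0≤ι 63) (≤⇒0≤- l)) (0≤-* (0≤ι 1767) 0≤K)))))))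
      finish (z , p , inj₂ refl) l = 0≤-⇒≤ (0≤-*-cancel (0<ι 9999) (subst (0r ≤_)
        (solve 4 (λ K m q g → ((con (pos 5000) :* q :+ (con (pos 4225) :* (K :* K) :- con (pos 0) :* (K :* m) :- con (pos 4505) :* (K :* K) :+ con (pos 0) :* (m :* K))) :- con (pos 10000) :* g) :+
            (con (pos 5000) :* q :+ con (pos 280) :* (K :* K)) := con (pos 10000) :* (q :- g)) refl K m q (f X))
        (0≤-+ (≤⇒0≤- (subst (λ t → ⟦ 10000 ⟧ * f X ≤ ⟦ 5000 ⟧ * q + boundR (nthZone 3) m ⟦ t ⟧) order p))
          (0≤-+ (0≤-* (0≤ι 5000) (0≤ι (within E T))) (0≤-* (0≤ι 280) (0≤-square K))))))
      later : ⟦ 1109 ⟧ * K ≤ ⟦ 1000 ⟧ * m → f X ≤ q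
      later l = [ (λ flat → ≤-trans flat (0≤ι (within E T))) , (λ w → finish (early-or-late X w l T T⊆X (ℕₚ.≤-reflexive order)) l) ]′ (h l)

    Claim : VSet n → Set
    Claim X = ⟦ 50 ⟧ * K ≤ ⟦ 100 ⟧ * size X → Flat X ⊎ W X

    private
      vacuous : ∀ X → ⟦ 100 ⟧ * size X < ⟦ 50 ⟧ * K → W X
      vacuous X h = (λ i → ⊥-elim (low (ℕₚ.≤ᵇ⇒≤ 50 50 tt) (proj₁ i))) ∷ (λ i → ⊥-elim (low (ℕₚ.≤ᵇ⇒≤ 50 75 tt) (proj₁ i))) ∷
          (λ i → ⊥-elim (low (ℕₚ.≤ᵇ⇒≤ 50 100 tt) (proj₁ i))) ∷ (λ i → ⊥-elim (low (ℕₚ.≤ᵇ⇒≤ 50 117 tt) i)) ∷ []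
        where
        low : ∀ {c} → 50 ℕ.≤ c → ⟦ c ⟧ * K ≤ ⟦ 100 ⟧ * size X → ⊥
        low {c} p q = ≤⇒≯ (≤-trans (by-difference (0≤-* (≤⇒0≤- (ι-mono-≤ p)) 0≤K) (solve 3 (λ a b c → (a :- b) :* c := a :* c :- b :* c) refl ⟦ c ⟧ ⟦ 50 ⟧ K)) q) h

      -- The certificates work with nonnegative f on both sides; a side with f ≤ 0 is flat. Below k
      -- / 2 no zone has begun and the weighted bound is vacuous.
      status : ∀ X → Claim X → Flat X ⊎ (W X × (0r ≤ f X))
      status X h = [ inj₁ , (λ p → [ (λ q → inj₂ (vacuous X q , p)) , (λ q → [ inj₁ , (λ w → inj₂ (w , p)) ]′ (h q)) ]′ (<-≤-connex (⟦ 100 ⟧ * size X) (⟦ 50 ⟧ * K))) ]′ (≤-total (f X) 0r)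

      late : ∀ {m} → ⟦ 1109 ⟧ * K ≤ ⟦ 1000 ⟧ * m → ⟦ 50 ⟧ * K ≤ ⟦ 100 ⟧ * m
      late {m} h = 0≤-⇒≤ (0≤-*-cancel (0<ι 9) (subst (0r ≤_) (solve 2 (λ m K → (con (pos 1000) :* m :- con (pos 1109) :* K) :+ con (pos 609) :* K := con (pos 10) :* (con (pos 100) :* m :- con (pos 50) :* K)) refl m K)
        (0≤-+ (≤⇒0≤- h) (0≤-* (0≤ι 609) 0≤K))))

      -- In f(X) ≤ f(A) + f(B) - e(A ∩ B) the first term is at most 0, and the separator dominates
      -- the second.
      flat-by : ∀ {X} (sep : Separation E k X) → Flat (Separation.A sep) → Claim (Separation.B sep) → Flat X
      flat-by {X} sep flat claim = by-difference (0≤-+ (≤⇒0≤- (excess-add sep (within E X) (within E (A ∩ B)) (within E A) (within E B) (within-sep sep)))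
          (0≤-+ (≤⇒0≤- flat) (≤⇒0≤- (separator-dominates B (A ∩ B) (λ i p → proj₂ (∧-true {A i} p)) order (λ l → claim (late l))))))
        (solve 4 (λ a b q x → ((a :+ b) :- (x :+ q)) :+ ((con (pos 0) :- a) :+ (q :- b)) := con (pos 0) :- x) refl (f A) (f B) ⟦ within E (A ∩ B) ⟧ (f X))
        where open Separation sep hiding (size)

    claim-step : ∀ {X} (sep : Separation E k X) → size (Separation.A sep) ≤ size (Separation.B sep) → (∀ Y → k ℕ.≤ countF Y → Profile (size Y) (f Y)) →
      Claim (Separation.A sep) → Claim (Separation.B sep) → Flat X ⊎ W X
    claim-step {X} sep ab profiles cA cB = cases (status A cA) (status B cB) (≤-total (f X) 0r)
      where
      open Separation sep hiding (size)
      size≥ : ∀ {m} → 0r ≤ ⟦ m ⟧ - K → k ℕ.≤ m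
      size≥ h = ι-cancel-≤ (0≤-⇒≤ h)
      assemble : (∀ S → S ⊆ X → countF S ℕ.≤ k → All (λ z → InZone z (size X) → ⟦ scale ⟧ * f X ≤ ⟦ 5000 ⟧ * ⟦ within E S ⟧ + boundR z (size X) ⟦ countF S ⟧) zones) → W X
      assemble h = (λ i S s c → pick₀ (h S s c) i) ∷ (λ i S s c → pick₁ (h S s c) i) ∷ (λ i S s c → pick₂ (h S s c) i) ∷ (λ i S s c → pick₃ (h S s c) i) ∷ []
        where
        pick₀ : ∀ {P : Zone → Set} → All P zones → P (nthZone 0)
        pick₀ (p ∷ _) = p
        pick₁ : ∀ {P : Zone → Set} → All P zones → P (nthZone 1)
        pick₁ (_ ∷ p ∷ _) = p
        pick₂ : ∀ {P : Zone → Set} → All P zones → P (nthZone 2)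
        pick₂ (_ ∷ _ ∷ p ∷ _) = p
        pick₃ : ∀ {P : Zone → Set} → All P zones → P (nthZone 3)
        pick₃ (_ ∷ _ ∷ _ ∷ p ∷ []) = p
      cases : Flat A ⊎ (W A × (0r ≤ f A)) → Flat B ⊎ (W B × (0r ≤ f B)) → f X ≤ 0r ⊎ 0r ≤ f X → Flat X ⊎ W X
      cases _ _ (inj₁ flat) = inj₁ flat
      cases (inj₁ flat) _ _ = inj₁ (flat-by sep flat cB)
      cases _ (inj₁ flat) _ = inj₁ (flat-by (flip-sep sep) flat cA)
      cases (inj₂ (wA , fA)) (inj₂ (wB , fB)) (inj₂ fX) = inj₂ (assemble (weights-step E k D D-value pK sep ab (profiles A (size≥ (0≤a E k D sep))) (profiles B (size≥ (0≤a E k D (flip-sep sep)))) wA wB fA fB fX))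

    module _ (separate : ∀ X → K < ⟦ 5 ⟧ * size X → Separation E k X) where
      -- The larger side carries the induction hypothesis; the smaller one enters only through the
      -- gain.
      profiles : ∀ s X → countF X ℕ.< s → k ℕ.≤ countF X → Profile (size X) (f X)
      profiles (suc s) X (s≤s lt) big = [ (λ large → separated (separate X large)) , (λ small → profile-small (≤⇒0≤- (ι-mono-≤ big)) small (base-bound X)) ]′ (<-≤-connex K (⟦ 5 ⟧ * size X))
        where
        by : (sep : Separation E k X) → size (Separation.A sep) ≤ size (Separation.B sep) → Profile (size X) (f X)
        by sep ab = subst (λ m → Profile m (f X)) (sym m≡) (profile-step (0≤a E k D sep) ab (excess-prune sep)
            (profiles s B (ℕₚ.<-≤-trans proper-B lt) (ι-cancel-≤ (0≤-⇒≤ (0≤a E k D (flip-sep sep))))) (subst (λ m → f X ≤ K * K - m * (D * K - m)) m≡ (base-bound X)))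
          where
          open Separation sep hiding (size)
          m≡ : size X ≡ size A + size B
          m≡ = trans (cong (_- K) (size-R sep)) (solve 3 (λ a b K → a :+ b :- K :- K := (a :- K) :+ (b :- K)) refl ⟦ countF A ⟧ ⟦ countF B ⟧ K)
        separated : Separation E k X → Profile (size X) (f X)
        separated sep = [ by sep , by (flip-sep sep) ]′ (≤-total (size (Separation.A sep)) (size (Separation.B sep)))

      claims : ∀ s X → countF X ℕ.< s → Claim X
      claims (suc s) X (s≤s lt) big = [ by sep , by (flip-sep sep) ]′ (≤-total (size (Separation.A sep)) (size (Separation.B sep)))
        where
        large : K < ⟦ 5 ⟧ * size X
        large = 0<-⇒< (<-≤-trans (<-* (0<ι 0) pK) (0≤-⇒≤ (0≤-*-cancel (0<ι 19) (subst (0r ≤_) (solve 2 (λ m K → (con (pos 100) :* m :- con (pos 50) :* K) :+ con (pos 10) :* K := con (pos 20) :* ((con (pos 5) :* m :- K) :- con (pos 1) :* K)) refl (size X) K)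
          (0≤-+ (≤⇒0≤- big) (0≤-* (0≤ι 10) 0≤K))))))
        sep = separate X large
        by : (sep : Separation E k X) → size (Separation.A sep) ≤ size (Separation.B sep) → Flat X ⊎ W X
        by sep ab = claim-step sep ab (λ Y → profiles (suc (countF Y)) Y ℕₚ.≤-refl) (claims s A (ℕₚ.<-≤-trans proper-A lt)) (claims s B (ℕₚ.<-≤-trans proper-B lt))
          where open Separation sep hiding (size)

      alternative-three : 1 ℕ.≤ n → ¬ ((⟦ 2 ⟧ + D) * K * ⟦ n ⟧ ≤ ⟦ within E (everything E k) ⟧)
      alternative-three pn h = ≤⇒≯ (impossible (<-≤-connex ⟦ n ⟧ K) (≤-total (⟦ 1000 ⟧ * size V) (⟦ 1109 ⟧ * K))) (<-* pK pK)
        where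
        V = everything E k
        total-size : countF V ≡ n
        total-size = sumF-1 n
        low : ⟦ 2 ⟧ * (K * K) ≤ f V
        low = subst (λ m → ⟦ 2 ⟧ * (K * K) ≤ ⟦ within E V ⟧ - (⟦ 2 ⟧ + D) * K * (⟦ m ⟧ - K)) (sym total-size)
          (by-difference (0≤-+ (≤⇒0≤- h) (0≤-* (≤⇒0≤- 2≤2+D) (0≤-square K))) (solve 4 (λ D K n e → (e :- (con (pos 2) :+ D) :* K :* n) :+ ((con (pos 2) :+ D) :- con (pos 2)) :* (K :* K) :=
            (e :- (con (pos 2) :+ D) :* K :* (n :- K)) :- con (pos 2) :* (K :* K)) refl D K ⟦ n ⟧ ⟦ within E V ⟧))
        high : ∀ c → c ℕ.≤ 19999 → ⟦ 10000 ⟧ * f V ≤ ⟦ c ⟧ * (K * K) → K * K ≤ 0r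
        high c le p = by-difference (0≤-+ (≤⇒0≤- p) (0≤-+ (0≤-* (0≤ι 10000) (≤⇒0≤- low)) (0≤-* (≤⇒0≤- (ι-mono-≤ le)) (0≤-square K))))
          (solve 3 (λ c κ x → (c :* κ :- con (pos 10000) :* x) :+ (con (pos 10000) :* (x :- con (pos 2) :* κ) :+ (con (pos 19999) :- c) :* κ) := con (pos 0) :- κ) refl ⟦ c ⟧ (K * K) (f V))
        empty : countF {n} (λ _ → false) ≡ 0
        empty = sumF-0 n
        late-case : Flat V ⊎ W V → ⟦ 1109 ⟧ * K ≤ ⟦ 1000 ⟧ * size V → K * K ≤ 0r
        late-case (inj₁ flat) l = high 0 z≤n (by-difference (0≤-* (0≤ι 10000) (≤⇒0≤- flat)) (solve 2 (λ x κ → con (pos 10000) :* (con (pos 0) :- x) := con (pos 0) :* κ :- con (pos 10000) :* x) refl (f V) (K * K)))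
        -- For the whole graph S is taken empty, and the bound becomes u₀ - u₁ m, at most 12005 in
        -- the two zones that can occur; density asks for at least 20000.
        late-case (inj₂ w) l = finish (early-or-late V w l (λ _ → false) (λ _ ()) (subst (ℕ._≤ k) (sym empty) z≤n))
          where
          m = size V
          0≤m : 0r ≤ m
          0≤m = 0≤-*-cancel (0<ι 999) (≤-trans (0≤-* (0≤ι 1109) 0≤K) l)
          no-pairs : within E (λ _ → false) ≡ 0
          no-pairs = ℕₚ.n≤0⇒n≡0 (subst (λ t → within E (λ _ → false) ℕ.≤ t ℕ.* t) empty (within≤square E (λ _ → false)))
          finish : (∃ λ z → (⟦ scale ⟧ * f V ≤ ⟦ 5000 ⟧ * ⟦ within E (λ _ → false) ⟧ + boundR z m ⟦ countF {n} (λ _ → false) ⟧) × (z ≡ nthZone 2 ⊎ z ≡ nthZone 3)) → K * K ≤ 0r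
          finish (z , p , inj₁ refl) = high 12005 (ℕₚ.≤ᵇ⇒≤ 12005 19999 tt) (by-difference (0≤-+ (≤⇒0≤- (subst₂ (λ e s → ⟦ 10000 ⟧ * f V ≤ ⟦ 5000 ⟧ * ⟦ e ⟧ + boundR z m ⟦ s ⟧) no-pairs empty p)) (0≤-* (0≤ι 6650) (0≤-* 0≤K 0≤m)))
            (solve 3 (λ K m x → ((con (pos 5000) :* con (pos 0) :+ (con (pos 12005) :* (K :* K) :- con (pos 6650) :* (K :* m) :- con (pos 8600) :* (K :* con (pos 0)) :+ con (pos 3500) :* (m :* con (pos 0)))) :- con (pos 10000) :* x) :+ con (pos 6650) :* (K :* m)
              := con (pos 12005) :* (K :* K) :- con (pos 10000) :* x) refl K m (f V)))
          finish (z , p , inj₂ refl) = high 4225 (ℕₚ.≤ᵇ⇒≤ 4225 19999 tt) (by-difference (≤⇒0≤- (subst₂ (λ e s → ⟦ 10000 ⟧ * f V ≤ ⟦ 5000 ⟧ * ⟦ e ⟧ + boundR z m ⟦ s ⟧) no-pairs empty p))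
            (solve 3 (λ K m x → (con (pos 5000) :* con (pos 0) :+ (con (pos 4225) :* (K :* K) :- con (pos 0) :* (K :* m) :- con (pos 4505) :* (K :* con (pos 0)) :+ con (pos 0) :* (m :* con (pos 0)))) :- con (pos 10000) :* x
              := con (pos 4225) :* (K :* K) :- con (pos 10000) :* x) refl K m (f V)))
        impossible : ⟦ n ⟧ < K ⊎ K ≤ ⟦ n ⟧ → ⟦ 1000 ⟧ * size V ≤ ⟦ 1109 ⟧ * K ⊎ ⟦ 1109 ⟧ * K ≤ ⟦ 1000 ⟧ * size V → K * K ≤ 0r
        impossible (inj₁ p) _ = ⊥-elim (≤⇒≯ (≤-trans h (≤-trans (ι-mono-≤ (within≤square E V)) (≤-reflexive (trans (ι-* (countF V) (countF V)) (cong (λ t → ⟦ t ⟧ * ⟦ t ⟧) total-size)))))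
          (0<-⇒< (subst (0r <_) (solve 3 (λ D K n → n :* (K :- n) :+ ((((con (pos 2) :+ D) :- con (pos 2)) :+ con (pos 1)) :* (K :* n)) := (con (pos 2) :+ D) :* K :* n :- n :* n) refl D K ⟦ n ⟧)
            (0<-+-≤ (<-* (ι-mono-< pn) (<⇒0<- p)) (0≤-* (0≤-+ (≤⇒0≤- 2≤2+D) (0≤ι 1)) (0≤-* 0≤K (0≤ι n)))))))
        impossible (inj₂ p) (inj₂ l) = late-case (claims (suc n) V (s≤s (ℕₚ.≤-reflexive total-size)) (late l)) l
        impossible (inj₂ p) (inj₁ u) = high 10000 (ℕₚ.≤ᵇ⇒≤ 10000 19999 tt) (by-difference (0≤-+ (0≤-* (0≤ι 10000) (≤⇒0≤- (base-bound V))) (0≤-* (0≤-* (0≤ι 10) 0≤m) (≤⇒0≤- u)))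
            (trans (cong (λ t → ⟦ 10000 ⟧ * ((K * K - g) - f V) + t) (trans (solve 2 (λ K m → (con (pos 10) :* m) :* (con (pos 1109) :* K :- con (pos 1000) :* m) := con (pos 11090) :* (K :* m) :- con (pos 10000) :* (m :* m)) refl K m) (sym (gain-value m))))
              (solve 3 (λ κ g x → con (pos 10000) :* ((κ :- g) :- x) :+ con (pos 10000) :* g := con (pos 10000) :* κ :- con (pos 10000) :* x) refl (K * K) g (f V))))
          where
          m = size V
          g = m * (D * K - m)
          0≤m : 0r ≤ m
          0≤m = ≤⇒0≤- (subst (λ t → K ≤ ⟦ t ⟧) (sym total-size) p)

-- Tables for small k

-- For k ≤ 4 the sets of k + 1 vertices are larger than (1 + σ) k; the entries bound 1000 f for sets of
-- k, k + 1, … vertices, and 1000 k bounds it beyond the table.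
table : ℕ → List ℕ
table 2 = 4000 ∷ 2782 ∷ []
table 3 = 9000 ∷ 6673 ∷ 4346 ∷ []
table 4 = 16000 ∷ 12564 ∷ 9128 ∷ 5692 ∷ 4256 ∷ []
table _ = []

entry : ℕ → ℕ → ℕ
entry k m = nth (1000 ℕ.* k) m (table k)

width : ℕ → ℕ
width k = length (table k)

allBelow : ℕ → (ℕ → Bool) → Bool
allBelow zero p = true
allBelow (suc n) p = p n ∧ allBelow n p

allBelow-sound : ∀ {n p} → allBelow n p ≡ true → ∀ {i} → i ℕ.< n → p i ≡ true
allBelow-sound {suc n} {p} e {i} (s≤s le) with ℕₚ.m≤n⇒m<n∨m≡n le
... | inj₁ lt = allBelow-sound (proj₂ (∧-true {p n} e)) lt
... | inj₂ refl = proj₁ (∧-true e)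

nth-beyond : ∀ {A : Set} (d : A) i xs → length xs ℕ.≤ i → nth d i xs ≡ d
nth-beyond d i [] _ = refl
nth-beyond d (suc i) (x ∷ xs) (s≤s p) = nth-beyond d i xs p

-- Attaching a vertices to a set of k + b lowers 1000 f by 1109ka - 1000a². The last entry 4256 for
-- k = 4 is of this kind: a = b = 2, and 9128 - 4872.
prunable : ℕ → ℕ → ℕ → Bool
prunable k a b = (1000 ℕ.* (a ℕ.* a) ℕ.+ entry k b) ℕ.≤ᵇ (1109 ℕ.* (k ℕ.* a) ℕ.+ entry k (a ℕ.+ b))

-- All that the induction asks of a table: complete sets of k and k + 1 vertices, for which no
-- separation is available; entries below 2000k², to contradict density; and pruning of every side
-- shorter than the table.
suitable : ℕ → Bool
suitable k = (1000 ℕ.* (k ℕ.* k) ℕ.≤ᵇ entry k 0) ∧ ((1000 ℕ.* (k ℕ.* k) ℕ.+ 1000 ℕ.≤ᵇ 1109 ℕ.* k ℕ.+ entry k 1) ∧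
  ((allBelow (suc (width k)) (λ m → entry k m ℕ.<ᵇ 2000 ℕ.* (k ℕ.* k))) ∧
  allBelow (width k) (λ a → allBelow (suc (width k)) (λ b → ((a ℕ.≤ᵇ b) ∧ not (a ℕ.≡ᵇ 0)) ⟹ prunable k a b))))

prunable-tabled : ∀ k → suitable k ≡ true → ∀ a b → suc a ℕ.< width k → suc a ℕ.≤ b → b ℕ.≤ width k → prunable k (suc a) b ≡ true
prunable-tabled k h a b a<w a≤b b≤w = mp (allBelow-sound {suc (width k)} {λ b → ((suc a ℕ.≤ᵇ b) ∧ true) ⟹ prunable k (suc a) b} (allBelow-sound (proj₂ (∧-true {allBelow (suc (width k)) (λ m → entry k m ℕ.<ᵇ 2000 ℕ.* (k ℕ.* k))}
      (proj₂ (∧-true {1000 ℕ.* (k ℕ.* k) ℕ.+ 1000 ℕ.≤ᵇ 1109 ℕ.* k ℕ.+ entry k 1} (proj₂ (∧-true {1000 ℕ.* (k ℕ.* k) ℕ.≤ᵇ entry k 0} h)))))) a<w) (s≤s b≤w))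
    (∧-intro (≤ᵇ-complete a≤b) refl)
  where
  ≤ᵇ-complete : ∀ {m n} → m ℕ.≤ n → (m ℕ.≤ᵇ n) ≡ true
  ≤ᵇ-complete {m} {n} p with m ℕ.≤ᵇ n | ℕₚ.≤⇒≤ᵇ p
  ... | true | _ = refl
-- Past the table the entries are constant, so the larger side may be replaced by one of length
-- `width k`.
prunable-all : ∀ k → suitable k ≡ true → ∀ a b → 1 ℕ.≤ a → a ℕ.< width k → a ℕ.≤ b → prunable k a b ≡ true
prunable-all k h (suc a) b _ a<w a≤b with b ℕ.≤? width k
... | yes b≤w = prunable-tabled k h a b a<w a≤b b≤w
... | no b>w = subst₂ (λ s t → ((1000 ℕ.* (suc a ℕ.* suc a) ℕ.+ s) ℕ.≤ᵇ (1109 ℕ.* (k ℕ.* suc a) ℕ.+ t)) ≡ true)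
    (beyond (width k) b ℕₚ.≤-refl w≤b) (beyond (suc a ℕ.+ width k) (suc a ℕ.+ b) (ℕₚ.m≤n+m (width k) (suc a)) (ℕₚ.≤-trans w≤b (ℕₚ.m≤n+m b (suc a))))
    (prunable-tabled k h a (width k) a<w (ℕₚ.<⇒≤ a<w) ℕₚ.≤-refl)
  where
  w≤b = ℕₚ.<⇒≤ (ℕₚ.≰⇒> b>w)
  beyond : ∀ i j → width k ℕ.≤ i → width k ℕ.≤ j → entry k i ≡ entry k j
  beyond i j p q = trans (nth-beyond (1000 ℕ.* k) i (table k) p) (sym (nth-beyond (1000 ℕ.* k) j (table k) q))

countF≤within : ∀ {n} (E : Rel n) → (∀ i → E i i ≡ true) → ∀ T → countF T ℕ.≤ within E T
countF≤within E E-refl T = sumF-mono loop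
  where
  loop : ∀ i → [ T i ]₀₁ ℕ.≤ countF (inside E T i)
  loop i with T i in e
  ... | false = z≤n
  ... | true = countF-pos {f = λ j → T j ∧ E i j} i (∧-intro e (E-refl i))

module Small (R : RealField) where
  open Reals R
  open Energy R
  open One R using (everything)

  module _ {n : ℕ} (E : Rel n) (E-refl : ∀ i → E i i ≡ true) (k : ℕ) (D : Carrier) (D-value : ⟦ 1000 ⟧ * D ≡ ⟦ 1109 ⟧) (suits : suitable k ≡ true)
    (separate : ∀ X → suc (suc k) ℕ.≤ countF X → Separation E k X) where
    open Certificates E k D

    private
      f : VSet n → Carrier
      f X = excess (within E X) (countF X)

      gain-value : ∀ a → ⟦ 1000 ⟧ * (a * (D * K - a)) ≡ ⟦ 1109 ⟧ * (K * a) - ⟦ 1000 ⟧ * (a * a)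
      gain-value a = trans (solve 3 (λ a K D → con (pos 1000) :* (a :* (D :* K :- a)) := (con (pos 1000) :* D) :* (K :* a) :- con (pos 1000) :* (a :* a)) refl a K D)
        (cong (λ t → t * (K * a) - ⟦ 1000 ⟧ * (a * a)) D-value)

      size-value : ∀ {m s} → s ≡ k ℕ.+ m → ⟦ s ⟧ ≡ K + ⟦ m ⟧
      size-value {m} refl = ι-+ k m

    complete-bound : ∀ X m → countF X ≡ k ℕ.+ m → ⟦ 1000 ⟧ * f X ≤ ⟦ 1000 ⟧ * (K * K) + ⟦ 1000 ⟧ * (⟦ m ⟧ * ⟦ m ⟧) - ⟦ 1109 ⟧ * (K * ⟦ m ⟧)
    complete-bound X m e = by-difference (0≤-* (0≤ι 1000) (≤⇒0≤- (≤-trans (ι-mono-≤ (within≤square E X)) (≤-reflexive (ι-* (countF X) (countF X))))))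
      (trans (cong (λ s → ⟦ 1000 ⟧ * (s * s - ⟦ within E X ⟧)) (size-value e))
        (trans (solve 4 (λ K m w D → con (pos 1000) :* ((K :+ m) :* (K :+ m) :- w) := con (pos 1000) :* (K :* K) :- con (pos 1000) :* (m :* (D :* K :- m)) :- con (pos 1000) :* (w :- (con (pos 2) :+ D) :* K :* ((K :+ m) :- K))) refl K ⟦ m ⟧ ⟦ within E X ⟧ D)
          (trans (cong₂ (λ g s → ⟦ 1000 ⟧ * (K * K) - g - ⟦ 1000 ⟧ * (⟦ within E X ⟧ - (⟦ 2 ⟧ + D) * K * (s - K))) (gain-value ⟦ m ⟧) (sym (size-value e)))
            (solve 4 (λ a b c d → a :- (b :- c) :- d := a :+ c :- b :- d) refl (⟦ 1000 ⟧ * (K * K)) (⟦ 1109 ⟧ * (K * ⟦ m ⟧)) (⟦ 1000 ⟧ * (⟦ m ⟧ * ⟦ m ⟧)) (⟦ 1000 ⟧ * f X)))))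

    claim : ∀ s X m → countF X ℕ.< s → countF X ≡ k ℕ.+ m → ⟦ 1000 ⟧ * f X ≤ ⟦ entry k m ⟧
    claim s X 0 _ e = ≤-trans (complete-bound X 0 e) (≤-trans (≤-reflexive (solve 1 (λ K → con (pos 1000) :* (K :* K) :+ con (pos 1000) :* (con (pos 0) :* con (pos 0)) :- con (pos 1109) :* (K :* con (pos 0)) := con (pos 1000) :* (K :* K)) refl K))
      (subst (_≤ ⟦ entry k 0 ⟧) (trans (ι-* 1000 (k ℕ.* k)) (cong (⟦ 1000 ⟧ *_) (ι-* k k))) (ι-mono-≤ (≤ᵇ-true {1000 ℕ.* (k ℕ.* k)} {entry k 0} (proj₁ (∧-true {1000 ℕ.* (k ℕ.* k) ℕ.≤ᵇ entry k 0} suits))))))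
    claim s X 1 _ e = ≤-trans (complete-bound X 1 e) (by-difference (≤⇒0≤- (subst₂ _≤_ (trans (ι-+ (1000 ℕ.* (k ℕ.* k)) 1000) (cong (_+ ⟦ 1000 ⟧) (trans (ι-* 1000 (k ℕ.* k)) (cong (⟦ 1000 ⟧ *_) (ι-* k k)))))
          (trans (ι-+ (1109 ℕ.* k) (entry k 1)) (cong (_+ ⟦ entry k 1 ⟧) (ι-* 1109 k)))
          (ι-mono-≤ (≤ᵇ-true {1000 ℕ.* (k ℕ.* k) ℕ.+ 1000} (proj₁ (∧-true {1000 ℕ.* (k ℕ.* k) ℕ.+ 1000 ℕ.≤ᵇ 1109 ℕ.* k ℕ.+ entry k 1} (proj₂ (∧-true {1000 ℕ.* (k ℕ.* k) ℕ.≤ᵇ entry k 0} suits))))))))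
      (solve 2 (λ K t → (con (pos 1109) :* K :+ t) :- (con (pos 1000) :* (K :* K) :+ con (pos 1000)) := t :- (con (pos 1000) :* (K :* K) :+ con (pos 1000) :* (con (pos 1) :* con (pos 1)) :- con (pos 1109) :* (K :* con (pos 1)))) refl K ⟦ entry k 1 ⟧))
    claim (suc s) X (suc (suc m′)) (s≤s lt) e = [ by sep , by (flip-sep sep) ]′ (ℕₚ.≤-total (countF (Separation.A sep)) (countF (Separation.B sep)))
      where
      m = suc (suc m′)
      sep : Separation E k X
      sep = separate X (subst (suc (suc k) ℕ.≤_) (trans (sym (trans (ℕₚ.+-suc k (suc m′)) (cong suc (ℕₚ.+-suc k m′)))) (sym e)) (s≤s (s≤s (ℕₚ.m≤m+n k m′))))
      by : (sep : Separation E k X) → countF (Separation.A sep) ℕ.≤ countF (Separation.B sep) → ⟦ 1000 ⟧ * f X ≤ ⟦ entry k m ⟧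
      by sep ab = cases (a′ ℕ.<? width k)
        where
        open Separation sep
        T⊆A : countF (A ∩ B) ℕ.≤ countF A
        T⊆A = countF-mono {n} {A ∩ B} {A} (λ i p → proj₁ (∧-true {A i} p))
        T⊆B : countF (A ∩ B) ℕ.≤ countF B
        T⊆B = countF-mono {n} {A ∩ B} {B} (λ i p → proj₂ (∧-true {A i} p))
        a′ = countF A ℕ.∸ k
        b′ = countF B ℕ.∸ k
        eA : countF A ≡ k ℕ.+ a′
        eA = sym (ℕₚ.m+[n∸m]≡n (subst (ℕ._≤ countF A) order T⊆A))
        eB : countF B ≡ k ℕ.+ b′
        eB = sym (ℕₚ.m+[n∸m]≡n (subst (ℕ._≤ countF B) order T⊆B))
        m≡ : a′ ℕ.+ b′ ≡ m
        m≡ = ℕₚ.+-cancelˡ-≡ (k ℕ.+ k) (a′ ℕ.+ b′) m (trans (+-interchange k k a′ b′) (trans (sym (cong₂ ℕ._+_ eA eB)) (trans (sym size) (trans (cong (ℕ._+ k) e)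
          (trans (ℕₚ.+-assoc k m k) (trans (cong (k ℕ.+_) (ℕₚ.+-comm m k)) (sym (ℕₚ.+-assoc k k m))))))))
        1≤a : 1 ℕ.≤ a′
        1≤a = ℕₚ.+-cancelʳ-< b′ 0 a′ (ℕₚ.+-cancelˡ-< k b′ (a′ ℕ.+ b′) (subst₂ ℕ._<_ eB (trans e (cong (k ℕ.+_) (sym m≡))) proper-B))
        size-a : a sep ≡ ⟦ a′ ⟧
        size-a = trans (cong (_- K) (size-value eA)) (solve 2 (λ K a → (K :+ a) :- K := a) refl K ⟦ a′ ⟧)
        IH-A = claim s A a′ (ℕₚ.<-≤-trans proper-A lt) eA
        IH-B = claim s B b′ (ℕₚ.<-≤-trans proper-B lt) eB
        a≤b : a′ ℕ.≤ b′
        a≤b = ℕₚ.∸-monoˡ-≤ k ab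
        table-bound : a′ ℕ.< width k → ⟦ 1000 ⟧ * (⟦ a′ ⟧ * ⟦ a′ ⟧) + ⟦ entry k b′ ⟧ ≤ ⟦ 1109 ⟧ * (K * ⟦ a′ ⟧) + ⟦ entry k m ⟧
        table-bound lt = subst₂ _≤_ (trans (ι-+ (1000 ℕ.* (a′ ℕ.* a′)) (entry k b′)) (cong (_+ ⟦ entry k b′ ⟧) (trans (ι-* 1000 (a′ ℕ.* a′)) (cong (⟦ 1000 ⟧ *_) (ι-* a′ a′)))))
          (trans (ι-+ (1109 ℕ.* (k ℕ.* a′)) (entry k (a′ ℕ.+ b′))) (cong₂ _+_ (trans (ι-* 1109 (k ℕ.* a′)) (cong (⟦ 1109 ⟧ *_) (ι-* k a′))) (cong (λ j → ⟦ entry k j ⟧) m≡)))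
          (ι-mono-≤ (≤ᵇ-true {1000 ℕ.* (a′ ℕ.* a′) ℕ.+ entry k b′} (prunable-all k suits a′ b′ 1≤a lt a≤b)))
        default : ∀ j → width k ℕ.≤ j → ⟦ entry k j ⟧ ≡ ⟦ 1000 ⟧ * K
        default j p = trans (cong ⟦_⟧ (nth-beyond (1000 ℕ.* k) j (table k) p)) (ι-* 1000 k)
        cases : Dec (a′ ℕ.< width k) → ⟦ 1000 ⟧ * f X ≤ ⟦ entry k m ⟧
        cases (yes small) = by-difference (0≤-+ (0≤-* (0≤ι 1000) (≤⇒0≤- (subst (λ t → f X ≤ f B - t * (D * K - t)) size-a (excess-prune sep)))) (0≤-+ (≤⇒0≤- IH-B) (≤⇒0≤- (table-bound small))))
          (trans (solve 8 (λ x y g eb em κ α t → con (pos 1000) :* ((y :- g) :- x) :+ ((eb :- con (pos 1000) :* y) :+ ((κ :+ em) :- (α :+ eb))) := (κ :- α) :- con (pos 1000) :* g :+ (em :- con (pos 1000) :* x)) refl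
              (f X) (f B) (⟦ a′ ⟧ * (D * K - ⟦ a′ ⟧)) ⟦ entry k b′ ⟧ ⟦ entry k m ⟧ (⟦ 1109 ⟧ * (K * ⟦ a′ ⟧)) (⟦ 1000 ⟧ * (⟦ a′ ⟧ * ⟦ a′ ⟧)) 0r)
            (trans (cong (λ g → (⟦ 1109 ⟧ * (K * ⟦ a′ ⟧) - ⟦ 1000 ⟧ * (⟦ a′ ⟧ * ⟦ a′ ⟧)) - g + (⟦ entry k m ⟧ - ⟦ 1000 ⟧ * f X)) (gain-value ⟦ a′ ⟧))
              (solve 2 (λ g r → g :- g :+ r := r) refl (⟦ 1109 ⟧ * (K * ⟦ a′ ⟧) - ⟦ 1000 ⟧ * (⟦ a′ ⟧ * ⟦ a′ ⟧)) (⟦ entry k m ⟧ - ⟦ 1000 ⟧ * f X))))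
        -- Both sides lie past the table, so each has f ≤ k. The loops alone give e(A ∩ B) ≥ k, and
        -- the sum is at most k again.
        cases (no ¬small) = by-difference (0≤-+ (0≤-* (0≤ι 1000) (≤⇒0≤- (excess-add sep (within E X) (within E (A ∩ B)) (within E A) (within E B) (within-sep sep))))
            (0≤-+ (≤⇒0≤- (≤-trans IH-A (≤-reflexive (default a′ w≤a)))) (0≤-+ (≤⇒0≤- (≤-trans IH-B (≤-reflexive (default b′ (ℕₚ.≤-trans w≤a a≤b)))))
              (0≤-* (0≤ι 1000) (≤⇒0≤- (subst (λ t → ⟦ t ⟧ ≤ ⟦ within E (A ∩ B) ⟧) order (ι-mono-≤ (countF≤within E E-refl (A ∩ B)))))))))
          (trans (solve 5 (λ x q y z K → con (pos 1000) :* ((y :+ z) :- (x :+ q)) :+ ((con (pos 1000) :* K :- con (pos 1000) :* y) :+ ((con (pos 1000) :* K :- con (pos 1000) :* z) :+ con (pos 1000) :* (q :- K))) := con (pos 1000) :* K :- con (pos 1000) :* x) refl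
              (f X) ⟦ within E (A ∩ B) ⟧ (f A) (f B) K)
            (cong (_- ⟦ 1000 ⟧ * f X) (sym (default m (ℕₚ.≤-trans w≤a (subst (a′ ℕ.≤_) m≡ (ℕₚ.m≤m+n a′ b′)))))))
          where
          w≤a = ℕₚ.≮⇒≥ ¬small

    small-order : 1 ℕ.≤ k → 1 ℕ.≤ n → ¬ ((⟦ 2 ⟧ + D) * K * ⟦ n ⟧ ≤ ⟦ within E (everything E k) ⟧)
    small-order pk pn h with n ℕ.<? k
    ... | yes n<k = ≤⇒≯ (≤-trans h (≤-trans (ι-mono-≤ (within≤square E (everything E k))) (≤-reflexive (trans (ι-* (countF (everything E k)) (countF (everything E k))) (cong (λ t → ⟦ t ⟧ * ⟦ t ⟧) (sumF-1 n))))))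
        (0<-⇒< (subst (0r <_) (solve 3 (λ D K n → n :* (K :- n) :+ (D :+ con (pos 1)) :* (K :* n) := (con (pos 2) :+ D) :* K :* n :- n :* n) refl D K ⟦ n ⟧)
          (0<-+-≤ (<-* (ι-mono-< pn) (<⇒0<- (ι-mono-< n<k))) (0≤-* (0≤-+ 0≤D (0≤ι 1)) (0≤-* (0≤ι k) (0≤ι n))))))
      where
      0≤D : 0r ≤ D
      0≤D = 0≤-*-cancel (0<ι 999) (subst (0r ≤_) (sym D-value) (0≤ι 1109))
    ... | no k≤n = ≤⇒≯ (by-difference (0≤-+ (≤⇒0≤- (claim (suc n) V m (s≤s (ℕₚ.≤-reflexive total-size)) (trans total-size (sym n≡)))) (0≤-+ (0≤-* (0≤ι 1000) (≤⇒0≤- h)) (0≤-* (0≤-* (0≤ι 1000) 0≤D) (0≤-square K))))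
          (trans (cong (λ s → (⟦ entry k m ⟧ - ⟦ 1000 ⟧ * (⟦ within E V ⟧ - (⟦ 2 ⟧ + D) * K * (⟦ s ⟧ - K))) + (⟦ 1000 ⟧ * (⟦ within E V ⟧ - (⟦ 2 ⟧ + D) * K * ⟦ n ⟧) + ⟦ 1000 ⟧ * D * (K * K))) total-size)
            (solve 5 (λ t D K n w → (t :- con (pos 1000) :* (w :- (con (pos 2) :+ D) :* K :* (n :- K))) :+ (con (pos 1000) :* (w :- (con (pos 2) :+ D) :* K :* n) :+ con (pos 1000) :* D :* (K :* K)) := t :- con (pos 2000) :* (K :* K)) refl ⟦ entry k m ⟧ D K ⟦ n ⟧ ⟦ within E V ⟧)))
        (subst (⟦ entry k m ⟧ <_) (trans (ι-* 2000 (k ℕ.* k)) (cong (⟦ 2000 ⟧ *_) (ι-* k k))) (ι-mono-< below))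
      where
      V = everything E k
      m = n ℕ.∸ k
      n≡ : k ℕ.+ m ≡ n
      n≡ = ℕₚ.m+[n∸m]≡n (ℕₚ.≮⇒≥ k≤n)
      total-size : countF V ≡ n
      total-size = sumF-1 n
      0≤D : 0r ≤ D
      0≤D = 0≤-*-cancel (0<ι 999) (subst (0r ≤_) (sym D-value) (0≤ι 1109))
      tabled : ∀ j → j ℕ.< suc (width k) → entry k j ℕ.< 2000 ℕ.* (k ℕ.* k)
      tabled j lt = ℕₚ.<ᵇ⇒< (entry k j) _ (subst T (sym (allBelow-sound {suc (width k)} {λ m → entry k m ℕ.<ᵇ 2000 ℕ.* (k ℕ.* k)} (proj₁ (∧-true (proj₂ (∧-true {1000 ℕ.* (k ℕ.* k) ℕ.+ 1000 ℕ.≤ᵇ 1109 ℕ.* k ℕ.+ entry k 1} (proj₂ (∧-true {1000 ℕ.* (k ℕ.* k) ℕ.≤ᵇ entry k 0} suits)))))) lt)) tt)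
      below : entry k m ℕ.< 2000 ℕ.* (k ℕ.* k)
      below with m ℕ.≤? width k
      ... | yes p = tabled m (s≤s p)
      ... | no p = subst (ℕ._< 2000 ℕ.* (k ℕ.* k)) (trans (nth-beyond (1000 ℕ.* k) (width k) (table k) ℕₚ.≤-refl) (sym (nth-beyond (1000 ℕ.* k) m (table k) (ℕₚ.<⇒≤ (ℕₚ.≰⇒> p))))) (tabled (width k) ℕₚ.≤-refl)

-- Alternative (2): refutations in the sizes of the pieces

-- Variables: 1 = s = σ k, 3 = the root, 2, 4, 5 = the three largest pieces, 6 = the total of the others.
energyQ : Quadratic
energyQ = (pos 18 , 1 , 1) ∷ gainQ 2 (gainQ 3 (gainQ 4 (gainQ 5 ((-[1+ 10 ] , 1 , 6) ∷ (pos 5 , 5 , 6) ∷ []))))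
  where
  gainQ : ℕ → Quadratic → Quadratic
  gainQ v q = (-[1+ 10 ] , 1 , v) ∷ (pos 5 , v , v) ∷ q

total-at-least total-at-most : ℕ → List ℕ → Linear
total-at-least c v = map (λ i → (pos 1000 , i)) v ++ ((ℤ.- pos c , 1) ∷ [])
total-at-most c v = negate (total-at-least c v)

-- The failure of the colouring with N colours whose uncoloured part is the sum of v; here k < 1.8978 s.
failureQ : ℕ → List ℕ → Quadratic
failureQ N v = scaleBy (pos (6000 ℕ.* N)) energyQ ++ ((-[1+ 71999 ] , 1 , 1) ∷ []) ++ (((pos 75912 , 1) ∷ []) ⊛ variables v) ++ scaleBy -[1+ 19999 ] (variables v ⊛ variables v)

-- If the energy were negative, X would be flat. One colour is useful only if 3(k - d)² ≤ k², that
-- is d ≥ (1 - 1/√3) k ≈ 0.802 s, whence 803; and d ≤ 1.897 s secures d ≤ k.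
failures : List Conditional
failures = ([] , scaleBy (pos 2000) energyQ) ∷
  (total-at-least 803 (2 ∷ 4 ∷ 5 ∷ 6 ∷ []) ∷ total-at-most 1897 (2 ∷ 4 ∷ 5 ∷ 6 ∷ []) ∷ [] , failureQ 1 (2 ∷ 4 ∷ 5 ∷ 6 ∷ [])) ∷
  (total-at-most 1897 (4 ∷ 5 ∷ 6 ∷ []) ∷ [] , failureQ 2 (4 ∷ 5 ∷ 6 ∷ [])) ∷
  (total-at-most 1897 (5 ∷ 6 ∷ []) ∷ [] , failureQ 3 (5 ∷ 6 ∷ [])) ∷
  (total-at-most 1897 (6 ∷ []) ∷ [] , failureQ 4 (6 ∷ [])) ∷ []

-- The certificates are refutations: the failure of all colourings would make -s² nonnegative.
absurdQ : Quadratic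
absurdQ = (-[1+ 0 ] , 1 , 1) ∷ []

-- All pieces are at most s, but those after the largest total at least 0.42 s. This keeps away from
-- the shape h = p = s, q = t = r = 0, where two colours hold with equality and a rounded
-- certificate would have no slack.
region-A : List Linear
region-A = ((pos 1 , 1) ∷ []) ∷ ((pos 1 , 2) ∷ []) ∷ ((pos 1 , 3) ∷ []) ∷ ((pos 1 , 4) ∷ []) ∷ ((pos 1 , 5) ∷ []) ∷ ((pos 1 , 6) ∷ []) ∷ ((pos 1 , 2) ∷ (-[1+ 0 ] , 4) ∷ []) ∷ ((pos 1 , 4) ∷ (-[1+ 0 ] , 5) ∷ []) ∷ ((-[1+ 0 ] , 3) ∷ (pos 1 , 1) ∷ []) ∷ ((pos 2 , 3) ∷ (-[1+ 0 ] , 1) ∷ []) ∷ ((-[1+ 0 ] , 2) ∷ (pos 1 , 1) ∷ []) ∷ ((pos 1 , 2) ∷ (pos 1 , 3) ∷ (pos 1 , 4) ∷ (pos 1 , 5) ∷ (pos 1 , 6) ∷ (-[1+ 1 ] , 1) ∷ []) ∷ ((pos 50 , 4) ∷ (pos 50 , 5) ∷ (pos 50 , 6) ∷ (-[1+ 20 ] , 1) ∷ []) ∷ ((-[1+ 999 ] , 6) ∷ (pos 1897 , 1) ∷ []) ∷ []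

-- The case of a piece between s and 2s. Regions B and C are where one of the two deficits limited
-- in `three-colours` is large; they avoid the tight shape h = q = s, p = 2s, t = r = 0.
shared : List Linear
shared = ((pos 1 , 1) ∷ []) ∷ ((pos 1 , 2) ∷ []) ∷ ((pos 1 , 3) ∷ []) ∷ ((pos 1 , 4) ∷ []) ∷ ((pos 1 , 5) ∷ []) ∷ ((pos 1 , 6) ∷ []) ∷ ((pos 1 , 2) ∷ (-[1+ 0 ] , 4) ∷ []) ∷ ((pos 1 , 4) ∷ (-[1+ 0 ] , 5) ∷ []) ∷ ((-[1+ 0 ] , 3) ∷ (pos 1 , 1) ∷ []) ∷ ((pos 2 , 3) ∷ (-[1+ 0 ] , 1) ∷ []) ∷ ((pos 1 , 2) ∷ (-[1+ 0 ] , 1) ∷ []) ∷ ((-[1+ 0 ] , 2) ∷ (pos 2 , 1) ∷ []) ∷ ((-[1+ 0 ] , 4) ∷ (pos 1 , 1) ∷ []) ∷ ((-[1+ 0 ] , 2) ∷ (pos 1 , 3) ∷ (pos 1 , 4) ∷ (pos 1 , 5) ∷ (pos 1 , 6) ∷ []) ∷ []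

region-B : List Linear
region-B = shared ++ ((-[1+ 49 ] , 3) ∷ (-[1+ 49 ] , 4) ∷ (pos 50 , 5) ∷ (pos 43 , 1) ∷ []) ∷ ((-[1+ 999 ] , 6) ∷ (pos 1897 , 1) ∷ []) ∷ ((pos 50 , 4) ∷ (pos 50 , 5) ∷ (pos 50 , 6) ∷ (-[1+ 20 ] , 1) ∷ []) ∷ []

region-C : List Linear
region-C = shared ++ ((-[1+ 49 ] , 2) ∷ (-[1+ 49 ] , 3) ∷ (-[1+ 49 ] , 4) ∷ (pos 122 , 1) ∷ []) ∷ ((-[1+ 999 ] , 6) ∷ (pos 1897 , 1) ∷ []) ∷ ((pos 50 , 4) ∷ (pos 50 , 5) ∷ (pos 50 , 6) ∷ (-[1+ 20 ] , 1) ∷ []) ∷ []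

tree-A : Tree
tree-A =
  (split ((pos 1000 , 2) ∷ (pos 1000 , 4) ∷ (pos 1000 , 5) ∷ (pos 1000 , 6) ∷ (-[1+ 802 ] , 1) ∷ [])
   (split ((pos 1000 , 2) ∷ (pos 1000 , 4) ∷ (pos 1000 , 5) ∷ (pos 1000 , 6) ∷ (-[1+ 1896 ] , 1) ∷ [])
    (leaf false 9999999 (2742340012 ∷ 2742343150609 ∷ 246301115 ∷ 688800715 ∷ 497497090707 ∷ 2742340008 ∷ 246297181113 ∷ 1086380007 ∷ 1296720615 ∷ 738891531112 ∷ 492594360811 ∷ 148901215 ∷ 246297180911 ∷ 1617468751011 ∷ 797260010712 ∷ 2093982100709 ∷ 2742343150812 ∷ 440015 ∷ 22859904 ∷ []))
    (split ((pos 1000 , 4) ∷ (pos 1000 , 5) ∷ (pos 1000 , 6) ∷ (-[1+ 1896 ] , 1) ∷ [])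
     (leaf false 999999 (3370816 ∷ 9960916 ∷ 11301216 ∷ 14057630914 ∷ 7030112 ∷ 42172890910 ∷ 23723830809 ∷ 21086451112 ∷ 34700010 ∷ 992951015 ∷ 30016 ∷ 3514411012 ∷ 10540012 ∷ 7780980812 ∷ 42172890913 ∷ 56230110 ∷ 52260008 ∷ 6879490810 ∷ 709901 ∷ 189904 ∷ []))
     (split ((pos 1000 , 5) ∷ (pos 1000 , 6) ∷ (-[1+ 1896 ] , 1) ∷ [])
      (leaf false 9999999 (76295220709 ∷ 1221017 ∷ 145261317 ∷ 726521117 ∷ 250303 ∷ 393659711213 ∷ 354290211 ∷ 3570116 ∷ 39365971011 ∷ 330017 ∷ 290523770915 ∷ 409990009 ∷ 629855531014 ∷ 726519230911 ∷ 30217 ∷ 747950011 ∷ 2909902 ∷ 20459901 ∷ []))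
      (split ((pos 1000 , 2) ∷ (-[1+ 649 ] , 1) ∷ [])
       (leaf false 999999 (64081418 ∷ 80888431117 ∷ 8891718 ∷ 4453433191314 ∷ 8381790015 ∷ 1497133071116 ∷ 151180918 ∷ 123910821017 ∷ 8171461417 ∷ 1415177361014 ∷ 262540014 ∷ 1351099101214 ∷ 3907263320916 ∷ 8364914950912 ∷ 1497131618 ∷ 8018347901012 ∷ 2022210316 ∷ 5404396390915 ∷ 195384371010 ∷ 67169902 ∷ 54209903 ∷ []))
       (leaf false 99999 (222284401213 ∷ 333871371112 ∷ 60626621117 ∷ 2990378371012 ∷ 674183511113 ∷ 697472491116 ∷ 233928881216 ∷ 4784200013 ∷ 1067630416 ∷ 118031318 ∷ 129671618 ∷ 1055981771316 ∷ 4819137201516 ∷ 235981071010 ∷ 1227839921314 ∷ 3198891670912 ∷ 438128020911 ∷ 22889901 ∷ 14659902 ∷ 19809903 ∷ 1379904 ∷ []))))))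
   (leaf false 999999 (28911230506 ∷ 28910006 ∷ 28911230206 ∷ 438951214 ∷ 31414 ∷ 440014 ∷ 28911230406 ∷ 438950914 ∷ [])))

tree-B : Tree
tree-B =
  (split ((pos 1000 , 2) ∷ (pos 1000 , 4) ∷ (pos 1000 , 5) ∷ (pos 1000 , 6) ∷ (-[1+ 802 ] , 1) ∷ [])
   (split ((pos 1000 , 2) ∷ (pos 1000 , 4) ∷ (pos 1000 , 5) ∷ (pos 1000 , 6) ∷ (-[1+ 1896 ] , 1) ∷ [])
    (leaf false 99999 (5620917 ∷ 16180014 ∷ 4400009 ∷ 3921517 ∷ 43916001415 ∷ 1218471116 ∷ 585120816 ∷ 44037200613 ∷ 79808700709 ∷ 45501410815 ∷ 10680007 ∷ 85872270911 ∷ 6161117 ∷ 13520517 ∷ 13835240511 ∷ 8122761115 ∷ 10842250707 ∷ 1348570916 ∷ 60100013 ∷ 33776090915 ∷ 889904 ∷ []))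
    (split ((pos 1000 , 4) ∷ (pos 1000 , 5) ∷ (pos 1000 , 6) ∷ (-[1+ 1896 ] , 1) ∷ [])
     (leaf false 9999999 (16897180810 ∷ 14977171216 ∷ 70341661016 ∷ 200001 ∷ 55140391012 ∷ 160018 ∷ 70340210 ∷ 289989521316 ∷ 100405740816 ∷ 3271718 ∷ 100118 ∷ 281370009 ∷ 195599611112 ∷ 3612451017 ∷ 70008840812 ∷ 230080016 ∷ 202071218 ∷ 130020112 ∷ 42393640808 ∷ 2129904 ∷ 3569901 ∷ []))
     (leaf false 99999 (40217 ∷ 551884501012 ∷ 7460007 ∷ 236911318 ∷ 122540221316 ∷ 357200113 ∷ 38940112 ∷ 505591540608 ∷ 1101718 ∷ 75310208 ∷ 37321617 ∷ 7941351217 ∷ 6155361017 ∷ 90232201216 ∷ 252795770808 ∷ 15451218 ∷ 135800216 ∷ 137537440813 ∷ 234660016 ∷ 24071618 ∷ 10269902 ∷ []))))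
   (leaf false 999999 (70015 ∷ 79661116 ∷ 6560002 ∷ 262241010 ∷ 581516 ∷ 13120013 ∷ 6560014 ∷ 1900009 ∷ 203441415 ∷ 4561601014 ∷ 18322800611 ∷ 20344370812 ∷ 1231617 ∷ 28920416 ∷ 28923970506 ∷ 13411016 ∷ 6135070810 ∷ 2097960510 ∷ 70016 ∷ [])))

tree-C : Tree
tree-C =
  (split ((pos 1000 , 2) ∷ (pos 1000 , 4) ∷ (pos 1000 , 5) ∷ (pos 1000 , 6) ∷ (-[1+ 802 ] , 1) ∷ [])
   (split ((pos 1000 , 2) ∷ (pos 1000 , 4) ∷ (pos 1000 , 5) ∷ (pos 1000 , 6) ∷ (-[1+ 1896 ] , 1) ∷ [])
    (leaf false 999999 (11970016 ∷ 804310013 ∷ 16502531116 ∷ 191807930608 ∷ 1875440009 ∷ 446774561015 ∷ 426130008 ∷ 143855941515 ∷ 1173661360611 ∷ 239630007 ∷ 57961517 ∷ 4301617 ∷ 46120917 ∷ 1120441520815 ∷ 221584760609 ∷ 36549810916 ∷ 593230617 ∷ 2193249370911 ∷ 484580011 ∷ 7377950716 ∷ 16289904 ∷ []))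
    (split ((pos 1000 , 4) ∷ (pos 1000 , 5) ∷ (pos 1000 , 6) ∷ (-[1+ 1896 ] , 1) ∷ [])
     (leaf false 9999999 (31047230912 ∷ 187008771112 ∷ 3052201317 ∷ 256000009 ∷ 130727091012 ∷ 120018 ∷ 219051318 ∷ 67580209 ∷ 260002 ∷ 346610010 ∷ 224175490910 ∷ 3725751017 ∷ 37581218 ∷ 364451217 ∷ 46310210 ∷ 37580212 ∷ 134850208 ∷ 51794090916 ∷ 13689901 ∷ []))
     (split ((pos 1000 , 5) ∷ (pos 1000 , 6) ∷ (-[1+ 1896 ] , 1) ∷ [])
      (leaf false 999999 (1595071217 ∷ 540018 ∷ 3610117 ∷ 20782151115 ∷ 1910313 ∷ 192371318 ∷ 13656131417 ∷ 20003 ∷ 3261719 ∷ 10229171113 ∷ 24300013 ∷ 22060011 ∷ 170317 ∷ 10214630709 ∷ 12233451011 ∷ 8601319 ∷ 5280311 ∷ 179902 ∷ 359901 ∷ []))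
      (leaf false 999999 (9908961313 ∷ 510171419 ∷ 58564270817 ∷ 51069841718 ∷ 61461820 ∷ 27345091320 ∷ 177480317 ∷ 204851719 ∷ 1042615180813 ∷ 2357063990811 ∷ 2278667800911 ∷ 78396190909 ∷ 51196031418 ∷ 1174321711113 ∷ 2382323671417 ∷ 95050108 ∷ 246760309 ∷ 52254801014 ∷ 7670320 ∷ 15689903 ∷ 18389902 ∷ [])))))
   (leaf false 9999999 (760017 ∷ 20247970814 ∷ 44011731114 ∷ 3971016 ∷ 47360670410 ∷ 15341617 ∷ 11881880910 ∷ 81616 ∷ 1039111115 ∷ 92080008 ∷ 2810015 ∷ 101406710510 ∷ 68410007 ∷ 6268450515 ∷ 20790816 ∷ 2458270815 ∷ 804661116 ∷ 57561830508 ∷ 66330010 ∷ 730016 ∷ 209904 ∷ [])))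

sound-A : check true absurdQ failures region-A tree-A ≡ true
sound-A = refl

sound-B : check true absurdQ failures region-B tree-B ≡ true
sound-B = refl

sound-C : check true absurdQ failures region-C tree-C ≡ true
sound-C = refl

-- Alternative (2): colourings along a chain of pieces

module Two (R : RealField) where
  open Reals R
  open Cert R
  open Energy R
  open One R using (everything; 0≤a; no-certificate)

  module _ {n : ℕ} (E : Rel n) (k : ℕ) (D s : Carrier) (pK : 0r < ⟦ k ⟧) (ps : 0r < s)
    (D-value : ⟦ 5 ⟧ * (D * ⟦ k ⟧) ≡ ⟦ 11 ⟧ * s) (K-value : ⟦ 5 ⟧ * (⟦ k ⟧ * ⟦ k ⟧) ≡ ⟦ 18 ⟧ * (s * s)) where
    open Certificates E k D

    size : VSet n → Carrier
    size X = ⟦ countF X ⟧ - K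

    private
      0≤s : 0r ≤ s
      0≤s = <⇒≤ ps
      0≤K : 0r ≤ K
      0≤K = <⇒≤ pK
      K²-low : 0r ≤ ⟦ 5 ⟧ * (K * K) - ⟦ 18 ⟧ * (s * s)
      K²-low = ≤⇒0≤- (≤-reflexive (sym K-value))
      K²-high : 0r ≤ ⟦ 18 ⟧ * (s * s) - ⟦ 5 ⟧ * (K * K)
      K²-high = ≤⇒0≤- (≤-reflexive K-value)

    -- K / s is √(18/5) = 1.89736...; it is enclosed between 1.897 and 1.8978 by comparing squares.
    K-upper : ⟦ 5000 ⟧ * K ≤ ⟦ 9489 ⟧ * s
    K-upper = square-cancel-≤ (0≤-* (0≤ι 9489) 0≤s) (by-difference (0≤-+ (0≤-* (0≤ι 5000000) K²-high) (0≤-* (0≤ι 41121) (0≤-square s)))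
      (solve 2 (λ K s → con (pos 5000000) :* (con (pos 18) :* (s :* s) :- con (pos 5) :* (K :* K)) :+ con (pos 41121) :* (s :* s) :=
        (con (pos 9489) :* s) :* (con (pos 9489) :* s) :- (con (pos 5000) :* K) :* (con (pos 5000) :* K)) refl K s))

    K-lower : ⟦ 1897 ⟧ * s ≤ ⟦ 1000 ⟧ * K
    K-lower = square-cancel-≤ (0≤-* (0≤ι 1000) 0≤K) (by-difference (0≤-+ (0≤-* (0≤ι 200000) K²-low) (0≤-* (0≤ι 1391) (0≤-square s)))
      (solve 2 (λ K s → con (pos 200000) :* (con (pos 5) :* (K :* K) :- con (pos 18) :* (s :* s)) :+ con (pos 1391) :* (s :* s) :=
        (con (pos 1000) :* K) :* (con (pos 1000) :* K) :- (con (pos 1897) :* s) :* (con (pos 1897) :* s)) refl K s))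

    g : Carrier → Carrier
    g a = a * (⟦ 11 ⟧ * s - ⟦ 5 ⟧ * a)

    gain-value : ∀ a → ⟦ 5 ⟧ * (a * (D * K - a)) ≡ g a
    gain-value a = trans (solve 2 (λ a d → con (pos 5) :* (a :* (d :- a)) := a :* (con (pos 5) :* d :- con (pos 5) :* a)) refl a (D * K))
      (cong (λ t → a * (t - ⟦ 5 ⟧ * a)) D-value)

    -- The price of one more colour: with a gain of K² / 9 the energy passes from M to M + 1 colours
    -- at the same u precisely if 2u² / (3M) - 2u² / (3(M + 1)) ≤ K² / 9.
    Good : ∀ {X} → Coloured X → Set
    Good C = ⟦ 6 ⟧ * (Coloured.u C * Coloured.u C) ≤ ⟦ suc (Coloured.N C) ⟧ * ((⟦ 1 ⟧ + ⟦ suc (Coloured.N C) ⟧) * (K * K))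

    Claim : VSet n → Set
    Claim X = Flat X ⊎ Σ (Coloured X) Good

    -- From two colours on the price is always affordable, since M (M + 1) ≥ 6 and u ≤ K.
    good : ∀ {u} N → 0r ≤ u → u ≤ K → ⟦ 6 ⟧ * (u * u) ≤ ⟦ suc (suc N) ⟧ * ((⟦ 1 ⟧ + ⟦ suc (suc N) ⟧) * (K * K))
    good {u} N pu u≤K = by-difference (0≤-+ (0≤-* (0≤-* (0≤ι 6) (≤⇒0≤- u≤K)) (0≤-+ 0≤K pu)) (0≤-* (0≤-* (≤⇒0≤- (ι-mono-≤ {2} {suc (suc N)} (s≤s (s≤s z≤n)))) (0≤-+ (0≤ι (suc (suc N))) (0≤ι 3))) (0≤-square K)))
      (solve 3 (λ M K u → (con (pos 6) :* (K :- u)) :* (K :+ u) :+ ((M :- con (pos 2)) :* (M :+ con (pos 3))) :* (K :* K) := M :* ((con (pos 1) :+ M) :* (K :* K)) :- con (pos 6) :* (u :* u)) refl ⟦ suc (suc N) ⟧ K u)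

    u≤K : ∀ {X} (C : Coloured X) → Coloured.u C ≤ K
    u≤K {X} C = by-difference (0≤ι (countF (X ∩ uncoloured (Coloured.c C)))) (solve 2 (λ K d → d := K :- (K :- d)) refl K ⟦ countF (X ∩ uncoloured (Coloured.c C)) ⟧)

    module _ {X : VSet n} (sep : Separation E k X) where
      open Separation sep hiding (size)
      private
        α = a sep

      -- For α ≤ s / 5 the gain is at least 2sα, which covers 4αu / (3M) as soon as 2u ≤ 3Ms; this
      -- is a weak consequence of `Good`.
      prune-uncoloured : ⟦ 5 ⟧ * α ≤ s → Σ (Coloured B) Good → Claim X
      prune-uncoloured h (C , gd) = [ inj₁ , (λ { (C′ , eN , eu) → inj₂ (C′ , subst₂ (λ N v → ⟦ 6 ⟧ * (v * v) ≤ ⟦ suc N ⟧ * ((⟦ 1 ⟧ + ⟦ suc N ⟧) * (K * K))) (sym eN) (sym eu)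
          (≤-trans (by-difference (0≤-* (0≤-* (0≤ι 6) (0≤a E k D sep)) (0≤-+ 0≤u (subst (0r ≤_) eu (Coloured.0≤u C′)))) (solve 2 (λ u a → (con (pos 6) :* a) :* (u :+ (u :- a)) := con (pos 6) :* (u :* u) :- con (pos 6) :* ((u :- a) :* (u :- a))) refl u α)) gd)) }) ]′
          (extend-uncoloured sep C (0≤a E k D sep) enough)
        where
        open Coloured C
        M = ⟦ suc N ⟧
        0≤M = 0≤ι (suc N)
        0≤M-1 : 0r ≤ M - ⟦ 1 ⟧
        0≤M-1 = ≤⇒0≤- (ι-mono-≤ {1} {suc N} (s≤s z≤n))
        u-bound : ⟦ 2 ⟧ * u ≤ ⟦ 3 ⟧ * (M * s)
        u-bound = square-cancel-≤ (0≤-* (0≤ι 3) (0≤-* 0≤M 0≤s)) (0≤-⇒≤ (0≤-*-cancel (0<ι 29) (subst (0r ≤_)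
          (solve 4 (λ M K s u → con (pos 20) :* (M :* ((con (pos 1) :+ M) :* (K :* K)) :- con (pos 6) :* (u :* u)) :+ ((con (pos 4) :* (M :* (con (pos 1) :+ M))) :* (con (pos 18) :* (s :* s) :- con (pos 5) :* (K :* K)) :+
              (con (pos 72) :* (M :* (M :- con (pos 1))) :* (s :* s) :+ con (pos 126) :* ((M :* s) :* (M :* s))))
            := con (pos 30) :* ((con (pos 3) :* (M :* s)) :* (con (pos 3) :* (M :* s)) :- (con (pos 2) :* u) :* (con (pos 2) :* u))) refl M K s u)
          (0≤-+ (0≤-* (0≤ι 20) (≤⇒0≤- gd)) (0≤-+ (0≤-* (0≤-* (0≤ι 4) (0≤-* 0≤M (0≤-+ (0≤ι 1) 0≤M))) K²-high)
            (0≤-+ (0≤-* (0≤-* (0≤ι 72) (0≤-* 0≤M 0≤M-1)) (0≤-square s)) (0≤-* (0≤ι 126) (0≤-square (M * s)))))))))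
        enough : ⟦ 4 ⟧ * (α * u) ≤ ⟦ 3 ⟧ * (M * gain sep)
        enough = 0≤-⇒≤ (0≤-*-cancel (0<ι 4) (subst (0r ≤_)
          (trans (solve 4 (λ a M s u → a :* ((con (pos 3) :* M) :* (s :- con (pos 5) :* a) :+ con (pos 10) :* (con (pos 3) :* (M :* s) :- con (pos 2) :* u)) := con (pos 3) :* (M :* (a :* (con (pos 11) :* s :- con (pos 5) :* a))) :- con (pos 20) :* (a :* u)) refl α M s u)
            (trans (cong (λ t → ⟦ 3 ⟧ * (M * t) - ⟦ 20 ⟧ * (α * u)) (sym (gain-value α)))
              (solve 4 (λ M γ a u → con (pos 3) :* (M :* (con (pos 5) :* γ)) :- con (pos 20) :* (a :* u) := con (pos 5) :* (con (pos 3) :* (M :* γ) :- con (pos 4) :* (a :* u))) refl M (gain sep) α u)))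
          (0≤-* (0≤a E k D sep) (0≤-+ (0≤-* (0≤-* (0≤ι 3) 0≤M) (≤⇒0≤- h)) (0≤-* (0≤ι 10) (≤⇒0≤- u-bound))))))

      -- The product (5α - s) (2s - α) is nonnegative, which says that 5 times the gain is at least
      -- 2s², so the gain is at least K² / 9: the price of a new colour for the attached part.
      prune-coloured : s ≤ ⟦ 5 ⟧ * α → α ≤ ⟦ 2 ⟧ * s → Σ (Coloured B) Good → Claim X
      prune-coloured l h (C , gd) = extended (extend-coloured sep c bound)
        where
        open Coloured C
        M = ⟦ suc N ⟧
        0≤M = 0≤ι (suc N)
        y = excess (within (E ⊔ c) B) (countF B)
        big-gain : K * K ≤ ⟦ 9 ⟧ * gain sep
        big-gain = 0≤-⇒≤ (0≤-*-cancel (0<ι 4) (subst (0r ≤_)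
          (trans (solve 3 (λ a s K → con (pos 9) :* ((con (pos 5) :* a :- s) :* (con (pos 2) :* s :- a)) :+ (con (pos 18) :* (s :* s) :- con (pos 5) :* (K :* K)) := con (pos 9) :* (a :* (con (pos 11) :* s :- con (pos 5) :* a)) :- con (pos 5) :* (K :* K)) refl α s K)
            (trans (cong (λ t → ⟦ 9 ⟧ * t - ⟦ 5 ⟧ * (K * K)) (sym (gain-value α))) (solve 2 (λ γ κ → con (pos 9) :* (con (pos 5) :* γ) :- con (pos 5) :* κ := con (pos 5) :* (con (pos 9) :* γ :- κ)) refl (gain sep) (K * K))))
          (0≤-+ (0≤-* (0≤ι 9) (0≤-* (≤⇒0≤- l) (≤⇒0≤- h))) K²-high)))
        extended : (Σ (Colouring n) λ c′ → (∀ i → c′ i ℕ.≤ suc (suc N)) × (countF (X ∩ uncoloured c′) ≡ countF (B ∩ uncoloured c)) ×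
          (excess (within (E ⊔ c′) X) (countF X) ≤ y - gain sep)) → Claim X
        extended (c′ , bound′ , count , ex) = inj₂ (record { N = suc N ; c = c′ ; bound = bound′ ; d≤k = subst (ℕ._≤ k) (sym count) d≤k
          ; energy = subst (λ d → ⟦ 3 ⟧ * (⟦ suc (suc N) ⟧ * x) ≤ ⟦ 2 ⟧ * ((K - ⟦ d ⟧) * (K - ⟦ d ⟧))) (sym count)
              (subst (λ M′ → ⟦ 3 ⟧ * (M′ * x) ≤ ⟦ 2 ⟧ * (u * u)) (sym (ι-+ 1 (suc N))) bounded-energy) } ,
          subst (λ d → ⟦ 6 ⟧ * ((K - ⟦ d ⟧) * (K - ⟦ d ⟧)) ≤ ⟦ suc (suc N) ⟧ * ((⟦ 1 ⟧ + ⟦ suc (suc N) ⟧) * (K * K))) (sym count) (good N 0≤u (u≤K C)))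
          where
          x = excess (within (E ⊔ c′) X) (countF X)
          bounded-energy : ⟦ 3 ⟧ * ((⟦ 1 ⟧ + M) * x) ≤ ⟦ 2 ⟧ * (u * u)
          bounded-energy = 0≤-⇒≤ (0≤-*-cancel (<-* (0<ι 2) (0<ι N)) (subst (0r ≤_)
            (solve 6 (λ M x y γ u K → (con (pos 3) :* (con (pos 1) :+ M)) :* (con (pos 2) :* (u :* u) :- con (pos 3) :* (M :* y)) :+ ((con (pos 9) :* (M :* (con (pos 1) :+ M))) :* ((y :- γ) :- x) :+
                ((M :* ((con (pos 1) :+ M) :* (K :* K)) :- con (pos 6) :* (u :* u)) :+ (M :* (con (pos 1) :+ M)) :* (con (pos 9) :* γ :- K :* K)))
              := (con (pos 3) :* M) :* (con (pos 2) :* (u :* u) :- con (pos 3) :* ((con (pos 1) :+ M) :* x))) refl M x y (gain sep) u K)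
            (0≤-+ (0≤-* (0≤-* (0≤ι 3) 0≤1+M) (≤⇒0≤- energy)) (0≤-+ (0≤-* (0≤-* (0≤ι 9) (0≤-* 0≤M 0≤1+M)) (≤⇒0≤- ex)) (0≤-+ (≤⇒0≤- gd) (0≤-* (0≤-* 0≤M 0≤1+M) (≤⇒0≤- big-gain)))))))
            where
            0≤1+M = 0≤-+ (0≤ι 1) 0≤M

      prune-two : α ≤ ⟦ 2 ⟧ * s → Claim B → Claim X
      prune-two h (inj₁ flat) = inj₁ (flat-extend sep (0≤-*-cancel (0<ι 4) (subst (0r ≤_) (sym (gain-value α)) (0≤-* (0≤a E k D sep)
        (subst (0r ≤_) (solve 2 (λ s a → con (pos 5) :* (con (pos 2) :* s :- a) :+ s := con (pos 11) :* s :- con (pos 5) :* a) refl s α) (0≤-+ (0≤-* (0≤ι 5) (≤⇒0≤- h)) 0≤s))))) flat)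
      prune-two h (inj₂ C) = [ (λ q → prune-uncoloured q C) , (λ q → prune-coloured q h C) ]′ (≤-total (⟦ 5 ⟧ * α) s)

      join-two : Claim A → Claim B → Claim X
      join-two (inj₁ f) (inj₁ f′) = inj₁ (flat-flat sep f f′)
      join-two (inj₁ f) (inj₂ (C , _)) = inj₁ (coloured-flat (flip-sep sep) C f)
      join-two (inj₂ (C , _)) (inj₁ f) = inj₁ (coloured-flat sep C f)
      join-two (inj₂ (C , _)) (inj₂ (C′ , _)) = [ inj₁ , (λ { (C″ , p) → inj₂ (C″ , several C″ p) }) ]′ (glue sep C C′)
        where
        several : (C : Coloured X) → 1 ℕ.≤ Coloured.N C → Good C
        several C p = subst (λ N → ⟦ 6 ⟧ * (Coloured.u C * Coloured.u C) ≤ ⟦ suc N ⟧ * ((⟦ 1 ⟧ + ⟦ suc N ⟧) * (K * K))) (ℕₚ.m+[n∸m]≡n p) (good (Coloured.N C ℕ.∸ 1) (Coloured.0≤u C) (u≤K C))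

    -- A colouring whose energy has not yet been compared with its uncoloured part. The factor 5
    -- clears the denominator of D K = 11s / 5.
    record Stage (X : VSet n) (N : ℕ) (d F : Carrier) : Set where
      field
        c      : Colouring n
        bound  : ∀ i → c i ℕ.≤ N
        count  : ⟦ countF (X ∩ uncoloured c) ⟧ ≡ d
        energy : ⟦ 5 ⟧ * excess (within (E ⊔ c) X) (countF X) ≤ F

    recast : ∀ {X N d d′ F F′} → Stage X N d F → d ≡ d′ → F ≤ F′ → Stage X N d′ F′
    recast S refl p = record { c = c ; bound = bound ; count = count ; energy = ≤-trans energy p }
      where open Stage S

    recolour-bound : ∀ {N} (B : VSet n) (c c′ : Colouring n) → (∀ i → c i ℕ.≤ N) → (∀ i → c′ i ℕ.≤ N) → ∀ i → recolour B c c′ i ℕ.≤ N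
    recolour-bound B c c′ p q i with B i
    ... | true = p i
    ... | false = q i

    module _ {X : VSet n} (sep : Separation E k X) where
      open Separation sep hiding (size)

      leave : ∀ {N d F} → Stage B N d F → Stage X N (a sep + d) (F - g (a sep))
      leave {F = F} S = record
        { c = c′ ; bound = recolour-bound B c (λ _ → 0) bound (λ _ → z≤n)
        ; count = trans (unhidden-R sep c) (cong (λ t → a sep + t) count)
        ; energy = subst (λ t → ⟦ 5 ⟧ * excess (within (E ⊔ c′) X) (countF X) ≤ F - t) (gain-value (a sep)) (lower (excess-extend sep 0 c bound (inj₁ refl)) energy) }
        where
        open Stage S
        c′ = recolour B c (λ _ → 0)
        lower : ∀ {x y g F} → x ≤ y - g → ⟦ 5 ⟧ * y ≤ F → ⟦ 5 ⟧ * x ≤ F - ⟦ 5 ⟧ * g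
        lower {x} {y} {g} {F} p q = by-difference (0≤-+ (0≤-* (0≤ι 5) (≤⇒0≤- p)) (≤⇒0≤- q)) (solve 4 (λ x y g F → con (pos 5) :* ((y :- g) :- x) :+ (F :- con (pos 5) :* y) := (F :- con (pos 5) :* g) :- con (pos 5) :* x) refl x y g F)

      paint : ∀ {N d F} → Stage B N d F → Stage X (suc N) d (F - g (a sep))
      paint {N} {d} {F} S = build (extend-coloured sep c bound)
        where
        open Stage S
        build : (Σ (Colouring n) λ c′ → (∀ i → c′ i ℕ.≤ suc N) × (countF (X ∩ uncoloured c′) ≡ countF (B ∩ uncoloured c)) ×
          (excess (within (E ⊔ c′) X) (countF X) ≤ excess (within (E ⊔ c) B) (countF B) - gain sep)) → Stage X (suc N) d (F - g (a sep))
        build (c′ , bound′ , count′ , ex) = record { c = c′ ; bound = bound′ ; count = trans (cong ⟦_⟧ count′) count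
          ; energy = subst (λ t → ⟦ 5 ⟧ * x ≤ F - t) (gain-value (a sep)) (by-difference (0≤-+ (0≤-* (0≤ι 5) (≤⇒0≤- ex)) (≤⇒0≤- energy))
            (solve 4 (λ x y g F → con (pos 5) :* ((y :- g) :- x) :+ (F :- con (pos 5) :* y) := (F :- con (pos 5) :* g) :- con (pos 5) :* x) refl x (excess (within (E ⊔ c) B) (countF B)) (gain sep) F)) }
          where x = excess (within (E ⊔ c′) X) (countF X)

    -- Five times the complete bound k² is 18s². Root and pieces each subtract their `g`, five times
    -- the gain; the remaining pieces are at most t each, so together they subtract at least r (11s
    -- - 5t).
    Φ : Carrier → Carrier → Carrier → Carrier → Carrier → Carrier
    Φ h p q t r = ⟦ 18 ⟧ * (s * s) - g h - g p - g q - g t - r * (⟦ 11 ⟧ * s - ⟦ 5 ⟧ * t)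

    -- A sequence of separations cuts X into a root and pieces; p ≥ q ≥ t are the sizes of the largest pieces, and
    -- r is the total of the others.  The N-th colouring gives one colour to the root and one to each of the N - 1 largest pieces.
    record Chain (X : VSet n) : Set where
      field
        h p q t r : Carrier
        0≤t : 0r ≤ t
        t≤q : t ≤ q
        q≤p : q ≤ p
        0≤r : 0r ≤ r
        s≤2h : s ≤ ⟦ 2 ⟧ * h
        h≤s : h ≤ s
        total-size : size X ≡ h + (p + (q + (t + r)))
        stage₁ : Stage X 1 (p + (q + (t + r))) (Φ h p q t r)
        stage₂ : Stage X 2 (q + (t + r)) (Φ h p q t r)
        stage₃ : Stage X 3 (t + r) (Φ h p q t r)
        stage₄ : Stage X 4 r (Φ h p q t r)

    -- Up to size s no separation is at hand, so all pairs are counted and a single colour serves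
    -- every stage.
    root : ∀ X → s ≤ ⟦ 2 ⟧ * size X → size X ≤ s → Chain X
    root X l u = record
      { h = m ; p = 0r ; q = 0r ; t = 0r ; r = 0r ; 0≤t = ≤-refl ; t≤q = ≤-refl ; q≤p = ≤-refl ; 0≤r = ≤-refl ; s≤2h = l ; h≤s = u
      ; total-size = solve 1 (λ m → m := m :+ (con (pos 0) :+ (con (pos 0) :+ (con (pos 0) :+ con (pos 0))))) refl m
      ; stage₁ = recast (mono 1 (s≤s z≤n)) (solve 0 (con (pos 0) := con (pos 0) :+ (con (pos 0) :+ (con (pos 0) :+ con (pos 0)))) refl) ≤-refl
      ; stage₂ = recast (mono 2 (s≤s z≤n)) (solve 0 (con (pos 0) := con (pos 0) :+ (con (pos 0) :+ con (pos 0))) refl) ≤-refl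
      ; stage₃ = recast (mono 3 (s≤s z≤n)) (solve 0 (con (pos 0) := con (pos 0) :+ con (pos 0)) refl) ≤-refl
      ; stage₄ = mono 4 (s≤s z≤n) }
      where
      m = size X
      w = within (E ⊔ (λ _ → 1)) X
      none : countF (X ∩ uncoloured (λ _ → 1)) ≡ 0
      none = trans (countF-cong {n} {X ∩ uncoloured (λ _ → 1)} {λ _ → false} (λ i → ∧-zeroʳ (X i))) (sumF-0 n)
        where open import Data.Bool.Properties using (∧-zeroʳ)
      mono : ∀ N → 1 ℕ.≤ N → Stage X N 0r (Φ m 0r 0r 0r 0r)
      mono N le = record { c = λ _ → 1 ; bound = λ _ → le ; count = cong ⟦_⟧ none ; energy = by-difference
        (0≤-+ (0≤-* (0≤ι 5) (≤⇒0≤- (≤-trans (ι-mono-≤ (within≤square (E ⊔ (λ _ → 1)) X)) (≤-reflexive (ι-* (countF X) (countF X)))))) K²-high)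
        (trans (solve 5 (λ x w K D s → con (pos 5) :* (x :* x :- w) :+ (con (pos 18) :* (s :* s) :- con (pos 5) :* (K :* K)) :=
            (con (pos 18) :* (s :* s) :- con (pos 5) :* ((x :- K) :* (D :* K :- (x :- K)))) :- con (pos 5) :* (w :- (con (pos 2) :+ D) :* K :* (x :- K))) refl ⟦ countF X ⟧ ⟦ w ⟧ K D s)
          (trans (cong (λ t → (⟦ 18 ⟧ * (s * s) - t) - ⟦ 5 ⟧ * excess w (countF X)) (gain-value m))
            (solve 3 (λ m s e → (con (pos 18) :* (s :* s) :- m :* (con (pos 11) :* s :- con (pos 5) :* m)) :- e :=
              (con (pos 18) :* (s :* s) :- m :* (con (pos 11) :* s :- con (pos 5) :* m) :- con (pos 0) :* (con (pos 11) :* s :- con (pos 5) :* con (pos 0)) :- con (pos 0) :* (con (pos 11) :* s :- con (pos 5) :* con (pos 0))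
                :- con (pos 0) :* (con (pos 11) :* s :- con (pos 5) :* con (pos 0)) :- con (pos 0) :* (con (pos 11) :* s :- con (pos 5) :* con (pos 0))) :- e) refl m s (⟦ 5 ⟧ * excess w (countF X))))) }

    module _ {X : VSet n} (sep : Separation E k X) (C : Chain (Separation.B sep)) where
      open Separation sep hiding (size)
      open Chain C
      private
        α = a sep
        0≤α = 0≤a E k D sep
        G = λ y → y * (⟦ 11 ⟧ * s - ⟦ 5 ⟧ * y)

        size≡ : size X ≡ α + (h + (p + (q + (t + r))))
        size≡ = trans (cong (_- K) (size-R sep)) (trans (solve 3 (λ a b K → a :+ b :- K :- K := (a :- K) :+ (b :- K)) refl ⟦ countF A ⟧ ⟦ countF B ⟧ K) (cong (λ z → α + z) total-size))

        p≥0 : 0r ≤ p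
        p≥0 = ≤-trans 0≤t (≤-trans t≤q q≤p)

        lose : ∀ a b c d e f → a + (b + (c + (d + (e + f)))) ≡ b + (a + (c + (d + (e + f))))
        lose = solve 6 (λ a b c d e f → a :+ (b :+ (c :+ (d :+ (e :+ f)))) := b :+ (a :+ (c :+ (d :+ (e :+ f))))) refl

        -- The piece t is demoted to the rest. The rest is now measured against the third largest
        -- size y ≥ t, which weakens the bound by 5 (t + r) (y - t).
        push : ∀ F x y → 0r ≤ (t + r) * (y - t) → (F - r * (⟦ 11 ⟧ * s - ⟦ 5 ⟧ * t)) - G t - x ≤ F - x - (t + r) * (⟦ 11 ⟧ * s - ⟦ 5 ⟧ * y)
        push F x y p = by-difference (0≤-* (0≤ι 5) p) (solve 6 (λ F x y t r s → con (pos 5) :* ((t :+ r) :* (y :- t)) :=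
          (F :- x :- (t :+ r) :* (con (pos 11) :* s :- con (pos 5) :* y)) :- ((F :- r :* (con (pos 11) :* s :- con (pos 5) :* t)) :- t :* (con (pos 11) :* s :- con (pos 5) :* t) :- x)) refl F x y t r s)

        Fits : Chain X → Set
        Fits C′ = (Chain.r C′ ≤ t + r) × (Chain.p C′ ≡ p ⊎ (Chain.p C′ ≡ α × Chain.q C′ ≡ p))

        0≤t+r : 0r ≤ t + r
        0≤t+r = 0≤-+ 0≤t 0≤r

        rearrange₁ : Φ h p q t r - G α ≤ Φ h α p q (t + r)
        rearrange₁ = subst₂ _≤_ (solve 7 (λ S h p q t w a → (S :- h :- p :- q :- w) :- t :- a := (S :- h :- p :- q :- t :- w) :- a) refl (⟦ 18 ⟧ * (s * s)) (G h) (G p) (G q) (G t) (r * (⟦ 11 ⟧ * s - ⟦ 5 ⟧ * t)) (G α))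
          (solve 6 (λ S h p q a w → (S :- h :- p :- q) :- a :- w := S :- h :- a :- p :- q :- w) refl (⟦ 18 ⟧ * (s * s)) (G h) (G p) (G q) (G α) ((t + r) * (⟦ 11 ⟧ * s - ⟦ 5 ⟧ * q)))
          (push (⟦ 18 ⟧ * (s * s) - G h - G p - G q) (G α) q (0≤-* 0≤t+r (≤⇒0≤- t≤q)))

        rearrange₂ : Φ h p q t r - G α ≤ Φ h p α q (t + r)
        rearrange₂ = ≤-trans rearrange₁ (≤-reflexive (solve 6 (λ S h p q a w → S :- h :- a :- p :- q :- w := S :- h :- p :- a :- q :- w) refl (⟦ 18 ⟧ * (s * s)) (G h) (G p) (G q) (G α) ((t + r) * (⟦ 11 ⟧ * s - ⟦ 5 ⟧ * q))))

        rearrange₃ : t ≤ α → Φ h p q t r - G α ≤ Φ h p q α (t + r)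
        rearrange₃ l = subst₂ _≤_ (solve 7 (λ S h p q t w a → (S :- h :- p :- q :- w) :- t :- a := (S :- h :- p :- q :- t :- w) :- a) refl (⟦ 18 ⟧ * (s * s)) (G h) (G p) (G q) (G t) (r * (⟦ 11 ⟧ * s - ⟦ 5 ⟧ * t)) (G α))
          refl (push (⟦ 18 ⟧ * (s * s) - G h - G p - G q) (G α) α (0≤-* 0≤t+r (≤⇒0≤- l)))

        rearrange₄ : α ≤ t → Φ h p q t r - G α ≤ Φ h p q t (α + r)
        rearrange₄ l = by-difference (0≤-* (0≤-* (0≤ι 5) 0≤α) (≤⇒0≤- l)) (solve 5 (λ F a t r s → (con (pos 5) :* a) :* (t :- a) :=
          (F :- (a :+ r) :* (con (pos 11) :* s :- con (pos 5) :* t)) :- ((F :- r :* (con (pos 11) :* s :- con (pos 5) :* t)) :- a :* (con (pos 11) :* s :- con (pos 5) :* a))) refl (⟦ 18 ⟧ * (s * s) - G h - G p - G q - G t) α t r s)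

      -- The four cases are the possible ranks of the new piece α. Stages that do not reach its rank
      -- leave α uncoloured; each later stage is the preceding old stage with α painted in a new
      -- colour.
      insert-piece : Σ (Chain X) Fits
      insert-piece = [ third , (λ l → [ (λ u → second u l) , (λ l′ → [ (λ u → first u l′) , zeroth ]′ (≤-total α p)) ]′ (≤-total α q)) ]′ (≤-total α t)
        where
        zeroth : p ≤ α → Σ (Chain X) Fits
        zeroth l = record { h = h ; p = α ; q = p ; t = q ; r = t + r ; 0≤t = ≤-trans 0≤t t≤q ; t≤q = q≤p ; q≤p = l ; 0≤r = 0≤t+r ; s≤2h = s≤2h ; h≤s = h≤s
          ; total-size = trans size≡ (lose α h p q t r)
          ; stage₁ = recast (leave sep stage₁) refl rearrange₁ ; stage₂ = recast (paint sep stage₁) refl rearrange₁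
          ; stage₃ = recast (paint sep stage₂) refl rearrange₁ ; stage₄ = recast (paint sep stage₃) refl rearrange₁ } , ≤-refl , inj₂ (refl , refl)
        first : α ≤ p → q ≤ α → Σ (Chain X) Fits
        first u l = record { h = h ; p = p ; q = α ; t = q ; r = t + r ; 0≤t = ≤-trans 0≤t t≤q ; t≤q = l ; q≤p = u ; 0≤r = 0≤t+r ; s≤2h = s≤2h ; h≤s = h≤s
          ; total-size = trans size≡ (solve 6 (λ a b c d e f → a :+ (b :+ (c :+ (d :+ (e :+ f)))) := b :+ (c :+ (a :+ (d :+ (e :+ f))))) refl α h p q t r)
          ; stage₁ = recast (leave sep stage₁) (solve 5 (λ a c d e f → a :+ (c :+ (d :+ (e :+ f))) := c :+ (a :+ (d :+ (e :+ f)))) refl α p q t r) rearrange₂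
          ; stage₂ = recast (leave sep stage₂) refl rearrange₂
          ; stage₃ = recast (paint sep stage₂) refl rearrange₂ ; stage₄ = recast (paint sep stage₃) refl rearrange₂ } , ≤-refl , inj₁ refl
        second : α ≤ q → t ≤ α → Σ (Chain X) Fits
        second u l = record { h = h ; p = p ; q = q ; t = α ; r = t + r ; 0≤t = 0≤α ; t≤q = u ; q≤p = q≤p ; 0≤r = 0≤t+r ; s≤2h = s≤2h ; h≤s = h≤s
          ; total-size = trans size≡ (solve 6 (λ a b c d e f → a :+ (b :+ (c :+ (d :+ (e :+ f)))) := b :+ (c :+ (d :+ (a :+ (e :+ f))))) refl α h p q t r)
          ; stage₁ = recast (leave sep stage₁) (solve 5 (λ a c d e f → a :+ (c :+ (d :+ (e :+ f))) := c :+ (d :+ (a :+ (e :+ f)))) refl α p q t r) (rearrange₃ l)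
          ; stage₂ = recast (leave sep stage₂) (solve 4 (λ a d e f → a :+ (d :+ (e :+ f)) := d :+ (a :+ (e :+ f))) refl α q t r) (rearrange₃ l)
          ; stage₃ = recast (leave sep stage₃) refl (rearrange₃ l) ; stage₄ = recast (paint sep stage₃) refl (rearrange₃ l) } , ≤-refl , inj₁ refl
        third : α ≤ t → Σ (Chain X) Fits
        third u = record { h = h ; p = p ; q = q ; t = t ; r = α + r ; 0≤t = 0≤t ; t≤q = t≤q ; q≤p = q≤p ; 0≤r = 0≤-+ 0≤α 0≤r ; s≤2h = s≤2h ; h≤s = h≤s
          ; total-size = trans size≡ (solve 6 (λ a b c d e f → a :+ (b :+ (c :+ (d :+ (e :+ f)))) := b :+ (c :+ (d :+ (e :+ (a :+ f))))) refl α h p q t r)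
          ; stage₁ = recast (leave sep stage₁) (solve 5 (λ a c d e f → a :+ (c :+ (d :+ (e :+ f))) := c :+ (d :+ (e :+ (a :+ f)))) refl α p q t r) (rearrange₄ u)
          ; stage₂ = recast (leave sep stage₂) (solve 4 (λ a d e f → a :+ (d :+ (e :+ f)) := d :+ (e :+ (a :+ f))) refl α q t r) (rearrange₄ u)
          ; stage₃ = recast (leave sep stage₃) (solve 3 (λ a e f → a :+ (e :+ f) := e :+ (a :+ f)) refl α t r) (rearrange₄ u) ; stage₄ = recast (leave sep stage₄) refl (rearrange₄ u) } ,
          +-monoʳ-≤ r u , inj₁ refl

    private
      K-crude : 0r ≤ ⟦ 19 ⟧ * s - ⟦ 10 ⟧ * K
      K-crude = ≤⇒0≤- (square-cancel-≤ (0≤-* (0≤ι 19) 0≤s) (by-difference (0≤-+ (0≤-* (0≤ι 20) K²-high) (0≤-square s))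
        (solve 2 (λ K s → con (pos 20) :* (con (pos 18) :* (s :* s) :- con (pos 5) :* (K :* K)) :+ s :* s := (con (pos 19) :* s) :* (con (pos 19) :* s) :- (con (pos 10) :* K) :* (con (pos 10) :* K)) refl K s)))

      -- An exact certificate, since two colours are tight at h = p = s with nothing left over.
      -- Under the hypotheses of `two-colours` every summand on the left is nonnegative; the right
      -- side is the slack of the energy.
      two-identity : ∀ K s h p q t r → ⟦ 2 ⟧ * (⟦ 5 ⟧ * (K * K) - ⟦ 18 ⟧ * (s * s)) + ((⟦ 2 ⟧ * (q + (t + r))) * (⟦ 19 ⟧ * s - ⟦ 10 ⟧ * K) + ((⟦ 6 ⟧ * s) * ((q + (t + r)) - ((s - h) + (s - p))) + (⟦ 30 ⟧ * (((q + (t + r)) - ((s - h) + (s - p))) * ((q + (t + r)) - ((s - h) + (p - s)))) + ((⟦ 30 ⟧ * (s - h)) * (((q + (t + r)) - ((s - h) + (s - p))) + ((q + (t + r)) - ((s - h) + (p - s)))) + ((⟦ 30 ⟧ * (q + (t + r))) * (t + r) + ((⟦ 30 ⟧ * (t + r)) * (q - t) + ((q + (t + r)) * (⟦ 21 ⟧ * s - ⟦ 50 ⟧ * (q + (t + r))) + s * (q + (t + r))))))))) ≡ ⟦ 10 ⟧ * ((K - (q + (t + r))) * (K - (q + (t + r)))) - ⟦ 3 ⟧ * (⟦ 2 ⟧ * (⟦ 18 ⟧ * (s * s) - (h * (⟦ 11 ⟧ * s - ⟦ 5 ⟧ * h)) - (p * (⟦ 11 ⟧ * s - ⟦ 5 ⟧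 * p)) - (q * (⟦ 11 ⟧ * s - ⟦ 5 ⟧ * q)) - (t * (⟦ 11 ⟧ * s - ⟦ 5 ⟧ * t)) - r * (⟦ 11 ⟧ * s - ⟦ 5 ⟧ * t)))
      two-identity = solve 7 (λ K s h p q t r → con (pos 2) :* (con (pos 5) :* (K :* K) :- con (pos 18) :* (s :* s)) :+ ((con (pos 2) :* (q :+ (t :+ r))) :* (con (pos 19) :* s :- con (pos 10) :* K) :+ ((con (pos 6) :* s) :* ((q :+ (t :+ r)) :- ((s :- h) :+ (s :- p))) :+ (con (pos 30) :* (((q :+ (t :+ r)) :- ((s :- h) :+ (s :- p))) :* ((q :+ (t :+ r)) :- ((s :- h) :+ (p :- s)))) :+ ((con (pos 30) :* (s :- h)) :* (((q :+ (t :+ r)) :- ((s :- h) :+ (s :- p))) :+ ((q :+ (t :+ r)) :- ((s :- h) :+ (p :- s)))) :+ ((con (pos 30) :* (q :+ (t :+ r))) :* (t :+ r) :+ ((con (pos 30) :* (t :+ r)) :* (q :- t) :+ ((q :+ (t :+ r)) :* (con (pos 21) :* s :- con (pos 50) :* (q :+ (t :+ r))) :+ s :* (q :+ (t :+ r))))))))) := con (pos 10) :* ((K :- (q :+ (t :+ r))) :* (K :- (q :+ (t :+ r)))) :- con (pos 3) :* (con (pos 2) :* (con (pos 18) :* (s :* s) :- (h :* (con (pos 11) :* s :- con (pos 5) :* h)) :- (p :* (con (pos 11) :* s :- con (pos 5) :* p)) :- (q :* (con (pos 11) :* s :- con (pos 5) :* q)) :- (t :* (con (pos 11) :* s :- con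 (pos 5) :* t)) :- r :* (con (pos 11) :* s :- con (pos 5) :* t)))) refl

      three-identity : ∀ K s h p q t r → ⟦ 20 ⟧ * (⟦ 5 ⟧ * (K * K) - ⟦ 18 ⟧ * (s * s)) + ((⟦ 20 ⟧ * (t + r)) * (⟦ 19 ⟧ * s - ⟦ 10 ⟧ * K) + ((⟦ 90 ⟧ * s) * ((h + (q + (t + r))) - p) + (⟦ 900 ⟧ * ((s - h) * (s - q)) + ((⟦ 450 ⟧ * ((s - h) + (s - q))) * ((h + (q + (t + r))) - p) + ((⟦ 9 ⟧ * (⟦ 2 ⟧ * s - p)) * (⟦ 78 ⟧ * s - ⟦ 50 ⟧ * ((s - h) + (s - q) + (⟦ 2 ⟧ * s - p))) + ((⟦ 18 ⟧ * s) * (⟦ 2 ⟧ * s - p) + ((⟦ 9 ⟧ * (t + r)) * (⟦ 57 ⟧ * s - ⟦ 50 ⟧ * ((s - h) + (s - q) + t)) + ((⟦ 7 ⟧ * s) * (t + r) + ⟦ 100 ⟧ * ((t + r) * (t + r)))))))))) ≡ ⟦ 10 ⟧ * (⟦ 10 ⟧ * ((K - (t + r)) * (K - (t + r))) - ⟦ 3 ⟧ * (⟦ 3 ⟧ * (⟦ 18 ⟧ * (s * s) - (h * (⟦ 11 ⟧ * s - ⟦ 5 ⟧ * h)) - (p * (⟦ 11 ⟧ * s - ⟦ 5 ⟧ * p)) - (q * (⟦ 11 ⟧ * s - ⟦ 5 ⟧ * q)) - (t * (⟦ 11 ⟧ * s - ⟦ 5 ⟧ * t)) - r * (⟦ 11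 ⟧ * s - ⟦ 5 ⟧ * t))))
      three-identity = solve 7 (λ K s h p q t r → con (pos 20) :* (con (pos 5) :* (K :* K) :- con (pos 18) :* (s :* s)) :+ ((con (pos 20) :* (t :+ r)) :* (con (pos 19) :* s :- con (pos 10) :* K) :+ ((con (pos 90) :* s) :* ((h :+ (q :+ (t :+ r))) :- p) :+ (con (pos 900) :* ((s :- h) :* (s :- q)) :+ ((con (pos 450) :* ((s :- h) :+ (s :- q))) :* ((h :+ (q :+ (t :+ r))) :- p) :+ ((con (pos 9) :* (con (pos 2) :* s :- p)) :* (con (pos 78) :* s :- con (pos 50) :* ((s :- h) :+ (s :- q) :+ (con (pos 2) :* s :- p))) :+ ((con (pos 18) :* s) :* (con (pos 2) :* s :- p) :+ ((con (pos 9) :* (t :+ r)) :* (con (pos 57) :* s :- con (pos 50) :* ((s :- h) :+ (s :- q) :+ t)) :+ ((con (pos 7) :* s) :* (t :+ r) :+ con (pos 100) :* ((t :+ r) :* (t :+ r)))))))))) := con (pos 10) :* (con (pos 10) :* ((K :- (t :+ r)) :* (K :- (t :+ r))) :- con (pos 3) :* (con (pos 3) :* (con (pos 18) :* (s :* s) :- (h :* (con (pos 11) :* s :- con (pos 5) :* h)) :- (p :* (con (pos 11) :* s :- con (pos 5) :* p)) :- (q :* (con (pos 11) :* s :- con (pos 5) :* q)) :- (t :* (con (pos 11) :* s :- con (pos 5) :* t)) :- r :* (con (pos 11) :* s :- con (pos 5) :* t))))) refl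

      -- One colour needs y ≤ K / √3 ≈ 1.0954 s, and 23/21 ≈ 1.0952 is a rational value just below.
      one-identity : ∀ K s y → ⟦ 30 ⟧ * ((⟦ 23 ⟧ * s - ⟦ 21 ⟧ * y) * (⟦ 23 ⟧ * s + ⟦ 21 ⟧ * y)) + (⟦ 882 ⟧ * (⟦ 5 ⟧ * (K * K) - ⟦ 18 ⟧ * (s * s)) + ⟦ 6 ⟧ * (s * s)) ≡ ⟦ 2205 ⟧ * (⟦ 1 ⟧ * ((⟦ 1 ⟧ + ⟦ 1 ⟧) * (K * K)) - ⟦ 6 ⟧ * (y * y))
      one-identity = solve 3 (λ K s y → con (pos 30) :* ((con (pos 23) :* s :- con (pos 21) :* y) :* (con (pos 23) :* s :+ con (pos 21) :* y)) :+ (con (pos 882) :* (con (pos 5) :* (K :* K) :- con (pos 18) :* (s :* s)) :+ con (pos 6) :* (s :* s)) := con (pos 2205) :* (con (pos 1) :* ((con (pos 1) :+ con (pos 1)) :* (K :* K)) :- con (pos 6) :* (y :* y))) refl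

    use : ∀ {X N d F} → Stage X (suc N) d F → d ≤ K → ⟦ 3 ⟧ * (⟦ suc N ⟧ * F) ≤ ⟦ 10 ⟧ * ((K - d) * (K - d)) →
      ⟦ 6 ⟧ * ((K - d) * (K - d)) ≤ ⟦ suc N ⟧ * ((⟦ 1 ⟧ + ⟦ suc N ⟧) * (K * K)) → Claim X
    use {X} {N} {d} {F} S d≤K h gd = inj₂ (record { N = N ; c = c ; bound = bound ; d≤k = ι-cancel-≤ (subst (_≤ K) (sym count) d≤K)
        ; energy = subst (λ d → ⟦ 3 ⟧ * (⟦ suc N ⟧ * x) ≤ ⟦ 2 ⟧ * ((K - d) * (K - d))) (sym count) bounded-energy } ,
        subst (λ d → ⟦ 6 ⟧ * ((K - d) * (K - d)) ≤ ⟦ suc N ⟧ * ((⟦ 1 ⟧ + ⟦ suc N ⟧) * (K * K))) (sym count) gd)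
      where
      open Stage S
      x = excess (within (E ⊔ c) X) (countF X)
      bounded-energy : ⟦ 3 ⟧ * (⟦ suc N ⟧ * x) ≤ ⟦ 2 ⟧ * ((K - d) * (K - d))
      bounded-energy = 0≤-⇒≤ (0≤-*-cancel (0<ι 4) (subst (0r ≤_) (solve 4 (λ M x F v → (con (pos 10) :* v :- con (pos 3) :* (M :* F)) :+ (con (pos 3) :* M) :* (F :- con (pos 5) :* x) :=
        con (pos 5) :* (con (pos 2) :* v :- con (pos 3) :* (M :* x))) refl ⟦ suc N ⟧ x F ((K - d) * (K - d))) (0≤-+ (≤⇒0≤- h) (0≤-* (0≤-* (0≤ι 3) (0≤ι (suc N))) (≤⇒0≤- energy)))))

    below-K : ∀ {d} → ⟦ 1000 ⟧ * d ≤ ⟦ 1897 ⟧ * s → d ≤ K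
    below-K {d} h = 0≤-⇒≤ (0≤-*-cancel (0<ι 999) (subst (0r ≤_) (solve 3 (λ d s K → (con (pos 1897) :* s :- con (pos 1000) :* d) :+ (con (pos 1000) :* K :- con (pos 1897) :* s) := con (pos 1000) :* (K :- d)) refl d s K)
      (0≤-+ (≤⇒0≤- h) (≤⇒0≤- K-lower))))

    module _ {X : VSet n} (C : Chain X) where
      open Chain C
      private
        F = Φ h p q t r
        0≤q = ≤-trans 0≤t t≤q
        0≤p = ≤-trans 0≤q q≤p
        0≤h : 0r ≤ h
        0≤h = 0≤-*-cancel (0<ι 1) (≤-trans 0≤s s≤2h)
        0≤t+r : 0r ≤ t + r
        0≤t+r = 0≤-+ 0≤t 0≤r
        0≤d₂ : 0r ≤ q + (t + r)
        0≤d₂ = 0≤-+ 0≤q 0≤t+r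

        good′ : ∀ {d} N → 0r ≤ d → d ≤ K → ⟦ 6 ⟧ * ((K - d) * (K - d)) ≤ ⟦ suc (suc N) ⟧ * ((⟦ 1 ⟧ + ⟦ suc (suc N) ⟧) * (K * K))
        good′ {d} N pd h = good N (≤⇒0≤- h) (by-difference pd (solve 2 (λ K d → d := K :- (K :- d)) refl K d))

        small-K : ∀ {d} → 0r ≤ d → ⟦ 50 ⟧ * d ≤ ⟦ 57 ⟧ * s → d ≤ K
        small-K {d} pd h = below-K (0≤-⇒≤ (subst (0r ≤_) (solve 2 (λ d s → con (pos 20) :* (con (pos 57) :* s :- con (pos 50) :* d) :+ con (pos 757) :* s := con (pos 1897) :* s :- con (pos 1000) :* d) refl d s)
          (0≤-+ (0≤-* (0≤ι 20) (≤⇒0≤- h)) (0≤-* (0≤ι 757) 0≤s))))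

        K-slack : 0r ≤ ⟦ 9489 ⟧ * s - ⟦ 5000 ⟧ * K
        K-slack = ≤⇒0≤- K-upper

      two-colours : (s - h) + (s - p) ≤ q + (t + r) → (s - h) + (p - s) ≤ q + (t + r) → ⟦ 50 ⟧ * (q + (t + r)) ≤ ⟦ 21 ⟧ * s → Claim X
      two-colours h₁ h₂ small = use stage₂ d≤K (by-difference
          (0≤-+ (0≤-* (0≤ι 2) K²-low) (0≤-+ (0≤-* (0≤-* (0≤ι 2) 0≤d₂) K-crude) (0≤-+ (0≤-* (0≤-* (0≤ι 6) 0≤s) x₁) (0≤-+ (0≤-* (0≤ι 30) (0≤-* x₁ x₂))
            (0≤-+ (0≤-* (0≤-* (0≤ι 30) (≤⇒0≤- h≤s)) (0≤-+ x₁ x₂)) (0≤-+ (0≤-* (0≤-* (0≤ι 30) 0≤d₂) 0≤t+r) (0≤-+ (0≤-* (0≤-* (0≤ι 30) 0≤t+r) (≤⇒0≤- t≤q))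
              (0≤-+ (0≤-* 0≤d₂ (≤⇒0≤- small)) (0≤-* 0≤s 0≤d₂)))))))))
          (two-identity K s h p q t r)) (good′ 0 0≤d₂ d≤K)
        where
        x₁ = ≤⇒0≤- h₁
        x₂ = ≤⇒0≤- h₂
        d≤K : q + (t + r) ≤ K
        d≤K = small-K 0≤d₂ (≤-trans small (by-difference (0≤-* (0≤ι 36) 0≤s) (solve 1 (λ s → con (pos 36) :* s := con (pos 57) :* s :- con (pos 21) :* s) refl s)))

      -- The tight shape is h = q = s, p = 2s with nothing left over: there Φ is 4s², and 3 · 3 ·
      -- 4s² = 36s² = 10K². The two numerical hypotheses limit the distance from it.
      three-colours : q ≤ s → p ≤ ⟦ 2 ⟧ * s → p ≤ h + (q + (t + r)) → ⟦ 50 ⟧ * ((s - h) + (s - q) + t) ≤ ⟦ 57 ⟧ * s →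
        ⟦ 50 ⟧ * ((s - h) + (s - q) + (⟦ 2 ⟧ * s - p)) ≤ ⟦ 78 ⟧ * s → t + r ≤ K → Claim X
      three-colours q≤s p≤2s balanced h₁ h₂ d≤K = use stage₃ d≤K (0≤-⇒≤ (0≤-*-cancel (0<ι 9) (subst (0r ≤_) (three-identity K s h p q t r)
          (0≤-+ (0≤-* (0≤ι 20) K²-low) (0≤-+ (0≤-* (0≤-* (0≤ι 20) 0≤t+r) K-crude) (0≤-+ (0≤-* (0≤-* (0≤ι 90) 0≤s) x) (0≤-+ (0≤-* (0≤ι 900) (0≤-* 0≤α 0≤β)) (0≤-+ (0≤-* (0≤-* (0≤ι 450) (0≤-+ 0≤α 0≤β)) x)
            (0≤-+ (0≤-* (0≤-* (0≤ι 9) 0≤γ) (≤⇒0≤- h₂)) (0≤-+ (0≤-* (0≤-* (0≤ι 18) 0≤s) 0≤γ) (0≤-+ (0≤-* (0≤-* (0≤ι 9) 0≤t+r) (≤⇒0≤- h₁)) (0≤-+ (0≤-* (0≤-* (0≤ι 7) 0≤s) 0≤t+r) (0≤-* (0≤ι 100) (0≤-square (t + r))))))))))))))) (good′ 1 0≤t+r d≤K)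
        where
        x = ≤⇒0≤- balanced
        0≤α = ≤⇒0≤- h≤s
        0≤β = ≤⇒0≤- q≤s
        0≤γ = ≤⇒0≤- p≤2s

      private
        ρ : ℕ → Carrier
        ρ i = nth 0r i (1r ∷ s ∷ p ∷ h ∷ q ∷ t ∷ r ∷ [])

        eval-energy : evalQ ρ energyQ ≡ F
        eval-energy = solve 6 (λ s p h q t r → con (pos 18) :* (s :* s) :+ (con -[1+ 10 ] :* (s :* p) :+ (con (pos 5) :* (p :* p) :+ (con -[1+ 10 ] :* (s :* h) :+ (con (pos 5) :* (h :* h) :+
            (con -[1+ 10 ] :* (s :* q) :+ (con (pos 5) :* (q :* q) :+ (con -[1+ 10 ] :* (s :* t) :+ (con (pos 5) :* (t :* t) :+ (con -[1+ 10 ] :* (s :* r) :+ (con (pos 5) :* (t :* r) :+ con (pos 0)))))))))))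
          := con (pos 18) :* (s :* s) :- h :* (con (pos 11) :* s :- con (pos 5) :* h) :- p :* (con (pos 11) :* s :- con (pos 5) :* p) :- q :* (con (pos 11) :* s :- con (pos 5) :* q) :- t :* (con (pos 11) :* s :- con (pos 5) :* t) :- r :* (con (pos 11) :* s :- con (pos 5) :* t)) refl s p h q t r

        eval-variables : ∀ i v → evalL ρ (variables (i ∷ v)) ≡ ρ i + evalL ρ (variables v)
        eval-variables i v = cong (_+ evalL ρ (variables v)) (trans (cong (_* ρ i) ι-1) (*-identˡ (ρ i)))

        eval-total : ∀ c v → evalL ρ (total-at-least c v) ≡ ⟦ 1000 ⟧ * evalL ρ (variables v) - ⟦ c ⟧ * s
        eval-total c [] = trans (cong (λ z → z * s + 0r) (⟪⟫-neg (pos c))) (solve 2 (λ c s → (:- c) :* s :+ con (pos 0) := con (pos 1000) :* con (pos 0) :- c :* s) refl ⟦ c ⟧ s)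
        eval-total c (i ∷ v) = trans (cong (λ z → ⟦ 1000 ⟧ * ρ i + z) (eval-total c v)) (trans
          (solve 3 (λ x y c → con (pos 1000) :* x :+ (con (pos 1000) :* y :- c) := con (pos 1000) :* (x :+ y) :- c) refl (ρ i) (evalL ρ (variables v)) (⟦ c ⟧ * s))
          (cong (λ z → ⟦ 1000 ⟧ * z - ⟦ c ⟧ * s) (sym (eval-variables i v))))

        at-most : ∀ c v {d} → evalL ρ (variables v) ≡ d → Nonneg ρ (total-at-most c v) → ⟦ 1000 ⟧ * d ≤ ⟦ c ⟧ * s
        at-most c v {d} refl z = 0≤-⇒≤ (subst (0r ≤_) (trans (evalL-negate ρ (total-at-least c v)) (trans (cong (λ z → 0r - z) (eval-total c v))
          (solve 2 (λ x y → con (pos 0) :- (x :- y) := y :- x) refl (⟦ 1000 ⟧ * d) (⟦ c ⟧ * s)))) z)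

        at-least : ∀ c v {d} → evalL ρ (variables v) ≡ d → Nonneg ρ (total-at-least c v) → ⟦ c ⟧ * s ≤ ⟦ 1000 ⟧ * d
        at-least c v refl z = 0≤-⇒≤ (subst (0r ≤_) (eval-total c v) z)

        eval-failure : ∀ N v {d} → evalL ρ (variables v) ≡ d → evalQ ρ (failureQ N v) ≡ ⟦ 6000 ℕ.* N ⟧ * F + (- ⟦ 72000 ⟧ * (s * s) + ((⟦ 75912 ⟧ * s) * d + - ⟦ 20000 ⟧ * (d * d)))
        eval-failure N v {d} refl = trans (evalQ-++ ρ (scaleBy (pos (6000 ℕ.* N)) energyQ) rest₁) (cong₂ _+_
          (trans (evalQ-scaleBy ρ (pos (6000 ℕ.* N)) energyQ) (cong (λ z → ⟦ 6000 ℕ.* N ⟧ * z) eval-energy))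
          (cong (λ z → - ⟦ 72000 ⟧ * (s * s) + z) (trans (evalQ-++ ρ (((pos 75912 , 1) ∷ []) ⊛ variables v) rest₂) (cong₂ _+_
            (trans (evalQ-⊛ ρ ((pos 75912 , 1) ∷ []) (variables v)) (cong (_* d) (+-identʳ (⟦ 75912 ⟧ * s))))
            (trans (evalQ-scaleBy ρ -[1+ 19999 ] (variables v ⊛ variables v)) (cong (λ z → - ⟦ 20000 ⟧ * z) (evalQ-⊛ ρ (variables v) (variables v))))))))
          where
          rest₂ = scaleBy -[1+ 19999 ] (variables v ⊛ variables v)
          rest₁ = ((-[1+ 71999 ] , 1 , 1) ∷ []) ++ (((pos 75912 , 1) ∷ []) ⊛ variables v) ++ rest₂

        -- Either this colouring gives a certificate, or its failure becomes a hypothesis of the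
        -- refutation. K is eliminated through 5K² = 18s² and, in the mixed term with d, through K ≤
        -- 1.8978 s.
        attempt : ∀ N v {d} (conds : List Linear) → Stage X (suc N) d F → 0r ≤ d → evalL ρ (variables v) ≡ d →
          (All (Nonneg ρ) conds → ⟦ 1000 ⟧ * d ≤ ⟦ 1897 ⟧ * s) →
          (d ≤ K → ⟦ 6 ⟧ * ((K - d) * (K - d)) ≤ ⟦ suc N ⟧ * ((⟦ 1 ⟧ + ⟦ suc N ⟧) * (K * K))) ⊎ (All (Nonneg ρ) conds → ⊥) →
          Claim X ⊎ Holds ρ (conds , failureQ (suc N) v)
        attempt N v conds S pd e _ (inj₂ absurd) = inj₂ (λ cs → ⊥-elim (absurd cs))
        attempt N v {d} conds S pd e low (inj₁ gd) = [ (λ big → inj₂ (λ cs → ⊥-elim (≤⇒≯ (low cs) big))) , fits ]′ (<-≤-connex (⟦ 1897 ⟧ * s) (⟦ 1000 ⟧ * d))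
          where
          M = ⟦ suc N ⟧
          fits : ⟦ 1000 ⟧ * d ≤ ⟦ 1897 ⟧ * s → Claim X ⊎ Holds ρ (conds , failureQ (suc N) v)
          fits l = [ (λ ok → inj₁ (use S (below-K l) ok (gd (below-K l)))) , (λ bad → inj₂ (λ _ → subst (0r ≤_)
              (trans (solve 5 (λ M F K s d → con (pos 2000) :* (con (pos 3) :* (M :* F) :- con (pos 10) :* ((K :- d) :* (K :- d))) :+ (con (pos 4000) :* (con (pos 5) :* (K :* K) :- con (pos 18) :* (s :* s)) :+ (con (pos 8) :* d) :* (con (pos 9489) :* s :- con (pos 5000) :* K))
                  := (con (pos 6000) :* M) :* F :+ (:- con (pos 72000) :* (s :* s) :+ ((con (pos 75912) :* s) :* d :+ :- con (pos 20000) :* (d :* d)))) refl M F K s d)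
                (trans (cong (λ z → z * F + (- ⟦ 72000 ⟧ * (s * s) + ((⟦ 75912 ⟧ * s) * d + - ⟦ 20000 ⟧ * (d * d)))) (sym (ι-* 6000 (suc N)))) (sym (eval-failure (suc N) v e))))
              (0≤-+ (0≤-* (0≤ι 2000) (≤⇒0≤- bad)) (0≤-+ (0≤-* (0≤ι 4000) K²-low) (0≤-* (0≤-* (0≤ι 8) pd) K-slack))))) ]′ (≤-total (⟦ 3 ⟧ * (M * F)) (⟦ 10 ⟧ * ((K - d) * (K - d))))

        sum₁ : evalL ρ (variables (6 ∷ [])) ≡ r
        sum₁ = trans (eval-variables 6 []) (+-identʳ r)
        sum₂ : evalL ρ (variables (5 ∷ 6 ∷ [])) ≡ t + r
        sum₂ = trans (eval-variables 5 (6 ∷ [])) (cong (λ z → t + z) sum₁)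
        sum₃ : evalL ρ (variables (4 ∷ 5 ∷ 6 ∷ [])) ≡ q + (t + r)
        sum₃ = trans (eval-variables 4 (5 ∷ 6 ∷ [])) (cong (λ z → q + z) sum₂)
        sum₄ : evalL ρ (variables (2 ∷ 4 ∷ 5 ∷ 6 ∷ [])) ≡ p + (q + (t + r))
        sum₄ = trans (eval-variables 2 (4 ∷ 5 ∷ 6 ∷ [])) (cong (λ z → p + z) sum₃)

        one-colour-good : let d = p + (q + (t + r)) in ⟦ 803 ⟧ * s ≤ ⟦ 1000 ⟧ * d → d ≤ K → ⟦ 6 ⟧ * ((K - d) * (K - d)) ≤ ⟦ 1 ⟧ * ((⟦ 1 ⟧ + ⟦ 1 ⟧) * (K * K))
        one-colour-good l d≤K = 0≤-⇒≤ (0≤-*-cancel (0<ι 2204) (subst (0r ≤_) (one-identity K s (K - (p + (q + (t + r)))))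
          (0≤-+ (0≤-* (0≤ι 30) (0≤-* x (0≤-+ (0≤-* (0≤ι 23) 0≤s) (0≤-* (0≤ι 21) (≤⇒0≤- d≤K))))) (0≤-+ (0≤-* (0≤ι 882) K²-low) (0≤-* (0≤ι 6) (0≤-square s))))))
          where
          x : 0r ≤ ⟦ 23 ⟧ * s - ⟦ 21 ⟧ * (K - (p + (q + (t + r))))
          x = 0≤-*-cancel (0<ι 4999) (subst (0r ≤_) (solve 3 (λ K s d → con (pos 21) :* (con (pos 9489) :* s :- con (pos 5000) :* K) :+ (con (pos 105) :* (con (pos 1000) :* d :- con (pos 803) :* s) :+ con (pos 46) :* s) := con (pos 5000) :* (con (pos 23) :* s :- con (pos 21) :* (K :- d))) refl K s (p + (q + (t + r))))
            (0≤-+ (0≤-* (0≤ι 21) K-slack) (0≤-+ (0≤-* (0≤ι 105) (≤⇒0≤- l)) (0≤-* (0≤ι 46) 0≤s))))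

        flat-case : F ≤ 0r → Claim X
        flat-case f = inj₁ (flat-from c X (0≤-⇒≤ (0≤-*-cancel (0<ι 4) (subst (0r ≤_) (solve 1 (λ x → con (pos 0) :- con (pos 5) :* x := con (pos 5) :* (con (pos 0) :- x)) refl (excess (within (E ⊔ c) X) (countF X)))
          (≤⇒0≤- (≤-trans energy f))))))
          where open Stage stage₁

      refute : ∀ L T → check true absurdQ failures L T ≡ true → h ≤ ⟦ 2 ⟧ * s → p ≤ ⟦ 2 ⟧ * s → q ≤ ⟦ 2 ⟧ * s → t ≤ ⟦ 2 ⟧ * s → r ≤ ⟦ 2 ⟧ * s → All (Nonneg ρ) L → Claim X
      refute L T sound hh hp hq ht hr HL = [ flat-case , (λ f → collect f a₁ a₂ a₃ a₄) ]′ (≤-total F 0r)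
        where
        d₁ = p + (q + (t + r))
        a₁ = attempt 0 (2 ∷ 4 ∷ 5 ∷ 6 ∷ []) (total-at-least 803 (2 ∷ 4 ∷ 5 ∷ 6 ∷ []) ∷ total-at-most 1897 (2 ∷ 4 ∷ 5 ∷ 6 ∷ []) ∷ []) stage₁ (0≤-+ 0≤p 0≤d₂) sum₄
          (λ { (_ ∷ c ∷ []) → at-most 1897 (2 ∷ 4 ∷ 5 ∷ 6 ∷ []) sum₄ c })
          ([ (λ lt → inj₂ (λ { (c ∷ _) → ≤⇒≯ (at-least 803 (2 ∷ 4 ∷ 5 ∷ 6 ∷ []) sum₄ c) lt })) , (λ l → inj₁ (one-colour-good l)) ]′ (<-≤-connex (⟦ 1000 ⟧ * d₁) (⟦ 803 ⟧ * s)))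
        a₂ = attempt 1 (4 ∷ 5 ∷ 6 ∷ []) (total-at-most 1897 (4 ∷ 5 ∷ 6 ∷ []) ∷ []) stage₂ 0≤d₂ sum₃ (λ { (c ∷ []) → at-most 1897 (4 ∷ 5 ∷ 6 ∷ []) sum₃ c }) (inj₁ (good′ 0 0≤d₂))
        a₃ = attempt 2 (5 ∷ 6 ∷ []) (total-at-most 1897 (5 ∷ 6 ∷ []) ∷ []) stage₃ 0≤t+r sum₂ (λ { (c ∷ []) → at-most 1897 (5 ∷ 6 ∷ []) sum₂ c }) (inj₁ (good′ 1 0≤t+r))
        a₄ = attempt 3 (6 ∷ []) (total-at-most 1897 (6 ∷ []) ∷ []) stage₄ 0≤r sum₁ (λ { (c ∷ []) → at-most 1897 (6 ∷ []) sum₁ c }) (inj₁ (good′ 2 0≤r))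
        nonneg : ∀ {xs} → All (0r ≤_) xs → ∀ i → 0r ≤ nth 0r i xs
        nonneg [] i = ≤-refl
        nonneg (x ∷ xs) zero = x
        nonneg (x ∷ xs) (suc i) = nonneg xs i
        twice : ∀ i → bounded true i ≡ true → ρ i ≤ ⟦ 2 ⟧ * s
        twice 1 _ = by-difference 0≤s (solve 1 (λ s → s := con (pos 2) :* s :- s) refl s)
        twice 2 _ = hp
        twice 3 _ = hh
        twice 4 _ = hq
        twice 5 _ = ht
        twice 6 _ = hr
        twice 0 ()
        twice (suc (suc (suc (suc (suc (suc (suc i))))))) ()
        collect : 0r ≤ F → _ → _ → _ → _ → Claim X
        collect f (inj₁ c) _ _ _ = c
        collect f _ (inj₁ c) _ _ = c
        collect f _ _ (inj₁ c) _ = c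
        collect f _ _ _ (inj₁ c) = c
        collect f (inj₂ h₁) (inj₂ h₂) (inj₂ h₃) (inj₂ h₄) = ⊥-elim (≤⇒≯ (0≤-⇒≤ (subst (0r ≤_) (solve 1 (λ s → con -[1+ 0 ] :* (s :* s) :+ con (pos 0) := con (pos 0) :- s :* s) refl s)
          (check-sound {true} {ρ} (record { nonneg = nonneg (<⇒≤ 0<1 ∷ 0≤s ∷ 0≤p ∷ 0≤h ∷ 0≤q ∷ 0≤t ∷ 0≤r ∷ []) ; twice = twice ; face = q≤p }) absurdQ {failures} {L}
            ((λ _ → subst (0r ≤_) (sym (trans (evalQ-scaleBy ρ (pos 2000) energyQ) (cong (λ z → ⟦ 2000 ⟧ * z) eval-energy))) (0≤-* (0≤ι 2000) f)) ∷ h₁ ∷ h₂ ∷ h₃ ∷ h₄ ∷ []) HL T sound))) (<-* ps ps))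

      private
        linear : ∀ {x y} → 0r ≤ x → x ≡ y → 0r ≤ y
        linear z refl = z
        c₁ : ∀ {x} → 0r ≤ x → 0r ≤ ⟦ 1 ⟧ * x + 0r
        c₁ {x} z = linear z (solve 1 (λ x → x := con (pos 1) :* x :+ con (pos 0)) refl x)
        difference : ∀ {x y} → x ≤ y → 0r ≤ ⟦ 1 ⟧ * y + (- ⟦ 1 ⟧ * x + 0r)
        difference {x} {y} z = linear (≤⇒0≤- z) (solve 2 (λ x y → y :- x := con (pos 1) :* y :+ (:- con (pos 1) :* x :+ con (pos 0))) refl x y)
        difference′ : ∀ {x y} → x ≤ y → 0r ≤ - ⟦ 1 ⟧ * x + (⟦ 1 ⟧ * y + 0r)
        difference′ {x} {y} z = linear (≤⇒0≤- z) (solve 2 (λ x y → y :- x := :- con (pos 1) :* x :+ (con (pos 1) :* y :+ con (pos 0))) refl x y)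
        twice-h : 0r ≤ ⟦ 2 ⟧ * h + (- ⟦ 1 ⟧ * s + 0r)
        twice-h = linear (≤⇒0≤- s≤2h) (solve 2 (λ h s → con (pos 2) :* h :- s := con (pos 2) :* h :+ (:- con (pos 1) :* s :+ con (pos 0))) refl h s)
        crowd : ⟦ 21 ⟧ * s ≤ ⟦ 50 ⟧ * (q + (t + r)) → 0r ≤ ⟦ 50 ⟧ * q + (⟦ 50 ⟧ * t + (⟦ 50 ⟧ * r + (- ⟦ 21 ⟧ * s + 0r)))
        crowd z = linear (≤⇒0≤- z) (solve 4 (λ q t r s → con (pos 50) :* (q :+ (t :+ r)) :- con (pos 21) :* s := con (pos 50) :* q :+ (con (pos 50) :* t :+ (con (pos 50) :* r :+ (:- con (pos 21) :* s :+ con (pos 0))))) refl q t r s)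
        rest : ⟦ 2 ⟧ * r ≤ ⟦ 3 ⟧ * s → 0r ≤ - ⟦ 1000 ⟧ * r + (⟦ 1897 ⟧ * s + 0r)
        rest z = linear (0≤-+ (0≤-* (0≤ι 500) (≤⇒0≤- z)) (0≤-* (0≤ι 397) 0≤s)) (solve 2 (λ r s → con (pos 500) :* (con (pos 3) :* s :- con (pos 2) :* r) :+ con (pos 397) :* s := :- con (pos 1000) :* r :+ (con (pos 1897) :* s :+ con (pos 0))) refl r s)
        s≤2s : s ≤ ⟦ 2 ⟧ * s
        s≤2s = by-difference 0≤s (solve 1 (λ s → s := con (pos 2) :* s :- s) refl s)
        r≤2s : ⟦ 2 ⟧ * r ≤ ⟦ 3 ⟧ * s → r ≤ ⟦ 2 ⟧ * s
        r≤2s z = 0≤-⇒≤ (0≤-*-cancel (0<ι 1) (subst (0r ≤_) (solve 2 (λ r s → (con (pos 3) :* s :- con (pos 2) :* r) :+ s := con (pos 2) :* (con (pos 2) :* s :- r)) refl r s) (0≤-+ (≤⇒0≤- z) 0≤s)))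

      small-pieces : p ≤ s → ⟦ 2 ⟧ * s ≤ size X → ⟦ 2 ⟧ * r ≤ ⟦ 3 ⟧ * s → Claim X
      small-pieces p≤s big hr = [ two-colours near (≤-trans (by-difference (0≤-* (0≤ι 2) (≤⇒0≤- p≤s)) (solve 3 (λ s h p → con (pos 2) :* (s :- p) := ((s :- h) :+ (s :- p)) :- ((s :- h) :+ (p :- s))) refl s h p)) near) ,
          (λ l → refute region-A tree-A sound-A (≤-trans h≤s s≤2s) (≤-trans p≤s s≤2s) (≤-trans (≤-trans q≤p p≤s) s≤2s) (≤-trans (≤-trans t≤q (≤-trans q≤p p≤s)) s≤2s) (r≤2s hr)
            (c₁ 0≤s ∷ c₁ 0≤p ∷ c₁ 0≤h ∷ c₁ 0≤q ∷ c₁ 0≤t ∷ c₁ 0≤r ∷ difference q≤p ∷ difference t≤q ∷ difference′ h≤s ∷ twice-h ∷ difference′ p≤s ∷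
              linear (≤⇒0≤- (subst (⟦ 2 ⟧ * s ≤_) total-size big)) (solve 6 (λ s h p q t r → (h :+ (p :+ (q :+ (t :+ r)))) :- con (pos 2) :* s :=
                con (pos 1) :* p :+ (con (pos 1) :* h :+ (con (pos 1) :* q :+ (con (pos 1) :* t :+ (con (pos 1) :* r :+ (:- con (pos 2) :* s :+ con (pos 0))))))) refl s h p q t r) ∷ crowd l ∷ rest hr ∷ [])) ]′
          (≤-total (⟦ 50 ⟧ * (q + (t + r))) (⟦ 21 ⟧ * s))
        where
        near : (s - h) + (s - p) ≤ q + (t + r)
        near = by-difference (≤⇒0≤- (subst (⟦ 2 ⟧ * s ≤_) total-size big)) (solve 4 (λ s h p d → (h :+ (p :+ d)) :- con (pos 2) :* s := d :- ((s :- h) :+ (s :- p))) refl s h p (q + (t + r)))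

      -- A piece larger than s can only be the smaller side of the outermost separation, so it is
      -- balanced by the root and the other pieces together.
      large-piece : s ≤ p → p ≤ ⟦ 2 ⟧ * s → q ≤ s → p ≤ h + (q + (t + r)) → ⟦ 2 ⟧ * (q + (t + r)) ≤ ⟦ 3 ⟧ * s → Claim X
      large-piece s≤p p≤2s q≤s balanced hd = [ two-colours near′ near , (λ l → [ (λ b → refute region-B tree-B sound-B hh p≤2s hq ht (r≤2s hr) (basis (linear (≤⇒0≤- b)
            (solve 4 (λ s h q t → con (pos 50) :* ((s :- h) :+ (s :- q) :+ t) :- con (pos 57) :* s := :- con (pos 50) :* h :+ (:- con (pos 50) :* q :+ (con (pos 50) :* t :+ (con (pos 43) :* s :+ con (pos 0))))) refl s h q t) ∷ rest hr ∷ crowd l ∷ []))) ,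
          (λ b → [ (λ c → refute region-C tree-C sound-C hh p≤2s hq ht (r≤2s hr) (basis (linear (≤⇒0≤- c)
            (solve 4 (λ s h q p → con (pos 50) :* ((s :- h) :+ (s :- q) :+ (con (pos 2) :* s :- p)) :- con (pos 78) :* s := :- con (pos 50) :* p :+ (:- con (pos 50) :* h :+ (:- con (pos 50) :* q :+ (con (pos 122) :* s :+ con (pos 0))))) refl s h q p) ∷ rest hr ∷ crowd l ∷ []))) ,
            (λ c → three-colours q≤s p≤2s balanced b c d≤K) ]′ (≤-total (⟦ 78 ⟧ * s) (⟦ 50 ⟧ * ((s - h) + (s - q) + (⟦ 2 ⟧ * s - p)))) ) ]′
            (≤-total (⟦ 57 ⟧ * s) (⟦ 50 ⟧ * ((s - h) + (s - q) + t)))) ]′ (≤-total (⟦ 50 ⟧ * (q + (t + r))) (⟦ 21 ⟧ * s))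
        where
        hh = ≤-trans h≤s s≤2s
        hq = ≤-trans q≤s s≤2s
        ht = ≤-trans t≤q hq
        near : (s - h) + (p - s) ≤ q + (t + r)
        near = by-difference (≤⇒0≤- balanced) (solve 4 (λ s h p d → (h :+ d) :- p := d :- ((s :- h) :+ (p :- s))) refl s h p (q + (t + r)))
        near′ : (s - h) + (s - p) ≤ q + (t + r)
        near′ = ≤-trans (by-difference (0≤-* (0≤ι 2) (≤⇒0≤- s≤p)) (solve 3 (λ s h p → con (pos 2) :* (p :- s) := ((s :- h) :+ (p :- s)) :- ((s :- h) :+ (s :- p))) refl s h p)) near
        d≤K : t + r ≤ K
        d≤K = below-K (0≤-⇒≤ (subst (0r ≤_) (solve 3 (λ q d s → con (pos 500) :* (con (pos 3) :* s :- con (pos 2) :* (q :+ d)) :+ (con (pos 1000) :* q :+ con (pos 397) :* s) := con (pos 1897) :* s :- con (pos 1000) :* d) refl q (t + r) s)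
          (0≤-+ (0≤-* (0≤ι 500) (≤⇒0≤- hd)) (0≤-+ (0≤-* (0≤ι 1000) 0≤q) (0≤-* (0≤ι 397) 0≤s)))))
        hr : ⟦ 2 ⟧ * r ≤ ⟦ 3 ⟧ * s
        hr = ≤-trans (by-difference (0≤-* (0≤ι 2) (0≤-+ 0≤q 0≤t)) (solve 3 (λ q t r → con (pos 2) :* (q :+ t) := con (pos 2) :* (q :+ (t :+ r)) :- con (pos 2) :* r) refl q t r)) hd
        basis : ∀ {L} → All (Nonneg ρ) L → All (Nonneg ρ) (shared ++ L)
        basis L = c₁ 0≤s ∷ c₁ 0≤p ∷ c₁ 0≤h ∷ c₁ 0≤q ∷ c₁ 0≤t ∷ c₁ 0≤r ∷ difference q≤p ∷ difference t≤q ∷ difference′ h≤s ∷ twice-h ∷ difference s≤p ∷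
          linear (≤⇒0≤- p≤2s) (solve 2 (λ p s → con (pos 2) :* s :- p := :- con (pos 1) :* p :+ (con (pos 2) :* s :+ con (pos 0))) refl p s) ∷ difference′ q≤s ∷
          linear (≤⇒0≤- balanced) (solve 5 (λ h p q t r → (h :+ (q :+ (t :+ r))) :- p := :- con (pos 1) :* p :+ (con (pos 1) :* h :+ (con (pos 1) :* q :+ (con (pos 1) :* t :+ (con (pos 1) :* r :+ con (pos 0)))))) refl h p q t r) ∷ L

    module _ (separate : ∀ X → s < size X → Separation E k X) where
      private
        s<2s : s < ⟦ 2 ⟧ * s
        s<2s = 0<-⇒< (subst (0r <_) (solve 1 (λ s → s := con (pos 2) :* s :- s) refl s) ps)

      sizes : ∀ {X} (sep : Separation E k X) → size X ≡ a sep + size (Separation.B sep)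
      sizes sep = trans (cong (_- K) (size-R sep)) (solve 3 (λ a b K → a :+ b :- K :- K := (a :- K) :+ (b :- K)) refl ⟦ countF (Separation.A sep) ⟧ ⟦ countF (Separation.B sep) ⟧ K)

      larger : ∀ {X} (sep : Separation E k X) → a sep ≤ size (Separation.B sep) → ∀ {l} → l ≤ size X → l ≤ ⟦ 2 ⟧ * size (Separation.B sep)
      larger sep ab {l} h = by-difference (0≤-+ (≤⇒0≤- (subst (l ≤_) (sizes sep) h)) (≤⇒0≤- ab)) (solve 3 (λ l a b → ((a :+ b) :- l) :+ (b :- a) := con (pos 2) :* b :- l) refl l (a sep) (size (Separation.B sep)))

      ordered : ∀ {X} {P : Set} (sep : Separation E k X) → ((sep : Separation E k X) → a sep ≤ size (Separation.B sep) → P) → P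
      ordered sep f = [ f sep , f (flip-sep sep) ]′ (≤-total (a sep) (size (Separation.B sep)))

      -- Above size s a separation exists. Its larger side keeps more than s / 2, enough to contain
      -- a root, and its smaller side is a piece of at most half of 2s.
      chain : ∀ z X → countF X ℕ.< z → s ≤ ⟦ 2 ⟧ * size X → size X ≤ ⟦ 2 ⟧ * s → Σ (Chain X) λ C → Chain.p C ≤ s
      chain (suc z) X (s≤s lt) l u = [ (λ large → ordered (separate X large) (by large)) , (λ small → root X l small , 0≤s) ]′ (<-≤-connex s (size X))
        where
        by : s < size X → (sep : Separation E k X) → a sep ≤ size (Separation.B sep) → Σ (Chain X) λ C → Chain.p C ≤ s
        by large sep ab = extend (chain z B (ℕₚ.<-≤-trans proper-B lt) (larger sep ab (<⇒≤ large))
            (≤-trans (by-difference (0≤a E k D sep) (solve 2 (λ a b → a := (a :+ b) :- b) refl (a sep) (size B))) (subst (_≤ ⟦ 2 ⟧ * s) (sizes sep) u)))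
          where
          open Separation sep hiding (size)
          a≤s : a sep ≤ s
          a≤s = 0≤-⇒≤ (0≤-*-cancel (0<ι 1) (subst (0r ≤_) (solve 3 (λ s a b → (con (pos 2) :* s :- (a :+ b)) :+ (b :- a) := con (pos 2) :* (s :- a)) refl s (a sep) (size B))
            (0≤-+ (≤⇒0≤- (subst (_≤ ⟦ 2 ⟧ * s) (sizes sep) u)) (≤⇒0≤- ab))))
          extend : (Σ (Chain B) λ C → Chain.p C ≤ s) → Σ (Chain X) λ C → Chain.p C ≤ s
          extend (C , p≤s) = extended (insert-piece sep C)
            where
            extended : (Σ (Chain X) λ C′ → (Chain.r C′ ≤ Chain.t C + Chain.r C) × (Chain.p C′ ≡ Chain.p C ⊎ (Chain.p C′ ≡ a sep × Chain.q C′ ≡ Chain.p C))) → Σ (Chain X) λ C → Chain.p C ≤ s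
            extended (C′ , _ , inj₁ e) = C′ , ≤-trans (≤-reflexive e) p≤s
            extended (C′ , _ , inj₂ (e , _)) = C′ , ≤-trans (≤-reflexive e) a≤s

      -- Here X has just passed 2s while both sides are still at most 2s and need not carry
      -- certificates. The larger side is resolved into a chain and the smaller one inserted as a
      -- last piece.
      base-case : ∀ {X} (sep : Separation E k X) → a sep ≤ size (Separation.B sep) → ⟦ 2 ⟧ * s ≤ size X → size (Separation.B sep) ≤ ⟦ 2 ⟧ * s → Claim X
      base-case {X} sep ab big b≤2s = conclude (chain (suc (countF B)) B ℕₚ.≤-refl (larger sep ab (≤-trans (<⇒≤ s<2s) big)) b≤2s)
        where
        open Separation sep hiding (size)
        conclude : (Σ (Chain B) λ C → Chain.p C ≤ s) → Claim X
        conclude (C , p≤s) = finish (insert-piece sep C)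
          where
          open Chain C
          -- The root takes at least s / 2 of the size of B, which is at most 2s. What is left, 3s /
          -- 2, stays below 1.897 s and hence below k.
          rest-bound : ⟦ 2 ⟧ * (t + r) ≤ ⟦ 3 ⟧ * s
          rest-bound = by-difference (0≤-+ (0≤-* (0≤ι 2) (≤⇒0≤- (subst (_≤ ⟦ 2 ⟧ * s) total-size b≤2s))) (0≤-+ (≤⇒0≤- s≤2h) (0≤-* (0≤ι 2) (0≤-+ (≤-trans 0≤t (≤-trans t≤q q≤p)) (≤-trans 0≤t t≤q)))))
            (solve 5 (λ s h p q d → con (pos 2) :* (con (pos 2) :* s :- (h :+ (p :+ (q :+ d)))) :+ ((con (pos 2) :* h :- s) :+ con (pos 2) :* (p :+ q)) := con (pos 3) :* s :- con (pos 2) :* d) refl s h p q (t + r))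
          hr : ∀ {y} → y ≤ t + r → ⟦ 2 ⟧ * y ≤ ⟦ 3 ⟧ * s
          hr {y} z = ≤-trans (by-difference (0≤-* (0≤ι 2) (≤⇒0≤- z)) (solve 2 (λ y d → con (pos 2) :* (d :- y) := con (pos 2) :* d :- con (pos 2) :* y) refl y (t + r))) rest-bound
          finish : (Σ (Chain X) λ C′ → (Chain.r C′ ≤ t + r) × (Chain.p C′ ≡ p ⊎ (Chain.p C′ ≡ a sep × Chain.q C′ ≡ p))) → Claim X
          finish (C′ , r≤ , inj₁ e) = small-pieces C′ (≤-trans (≤-reflexive e) p≤s) big (hr r≤)
          finish (C′ , r≤ , inj₂ (e , e′)) = [ (λ small → small-pieces C′ small big (hr r≤)) ,
              (λ large → large-piece C′ large (≤-trans (≤-reflexive e) (≤-trans ab b≤2s)) (≤-trans (≤-reflexive e′) p≤s)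
                (subst₂ _≤_ (sym e) b≡ ab) (by-difference (0≤-+ (0≤-* (0≤ι 2) (≤⇒0≤- (subst (_≤ ⟦ 2 ⟧ * s) b≡ b≤2s))) (≤⇒0≤- (Chain.s≤2h C′)))
                  (solve 3 (λ s h d → con (pos 2) :* (con (pos 2) :* s :- (h :+ d)) :+ (con (pos 2) :* h :- s) := con (pos 3) :* s :- con (pos 2) :* d) refl s (Chain.h C′) (Chain.q C′ + (Chain.t C′ + Chain.r C′))))) ]′ (≤-total (Chain.p C′) s)
            where
            b≡ : size B ≡ Chain.h C′ + (Chain.q C′ + (Chain.t C′ + Chain.r C′))
            b≡ = trans (solve 2 (λ a b → b := (a :+ b) :- a) refl (a sep) (size B)) (trans (cong₂ (λ u v → u - v) (trans (sym (sizes sep)) (Chain.total-size C′)) (sym e))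
              (solve 3 (λ h p d → (h :+ (p :+ d)) :- p := h :+ d) refl (Chain.h C′) (Chain.p C′) (Chain.q C′ + (Chain.t C′ + Chain.r C′))))

      claims : ∀ z X → countF X ℕ.< z → ⟦ 2 ⟧ * s ≤ size X → Claim X
      claims (suc z) X (s≤s lt) big = ordered (separate X (<-≤-trans s<2s big)) by
        where
        by : (sep : Separation E k X) → a sep ≤ size (Separation.B sep) → Claim X
        by sep ab = [ base-case sep ab big , (λ b-big → [ (λ a-small → prune-two sep a-small (claims z B (ℕₚ.<-≤-trans proper-B lt) b-big)) ,
            (λ a-big → join-two sep (claims z A (ℕₚ.<-≤-trans proper-A lt) a-big) (claims z B (ℕₚ.<-≤-trans proper-B lt) b-big)) ]′ (≤-total (a sep) (⟦ 2 ⟧ * s))) ]′ (≤-total (size B) (⟦ 2 ⟧ * s))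
          where open Separation sep hiding (size)

      alternative-two : 1 ℕ.≤ n → ¬ ((⟦ 2 ⟧ + D) * K * ⟦ n ⟧ ≤ ⟦ within E (everything E k) ⟧)
      alternative-two pn many = [ (λ big → no-certificate E k D pK 0≤D many (forget (claims (suc n) V (s≤s (ℕₚ.≤-reflexive size-V)) big))) , small ]′ (≤-total (⟦ 2 ⟧ * s) (size V))
        where
        V = everything E k
        size-V : countF V ≡ n
        size-V = sumF-1 n
        forget : Claim V → Flat V ⊎ Coloured V
        forget (inj₁ f) = inj₁ f
        forget (inj₂ (C , _)) = inj₂ C
        0≤D : 0r ≤ D
        0≤D = 0≤-*-cancel pK (0≤-*-cancel (0<ι 4) (subst (0r ≤_) (trans (sym D-value) (cong (⟦ 5 ⟧ *_) (*-comm D K))) (0≤-* (0≤ι 11) 0≤s)))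
        -- With n ≤ k + 2s, the n² possible pairs are fewer than δ k n, because δ k = 2k + 11s / 5.
        small : size V ≤ ⟦ 2 ⟧ * s → ⊥
        small u = ≤⇒≯ (≤-trans many (≤-trans (ι-mono-≤ (within≤square E V)) (≤-reflexive (trans (ι-* (countF V) (countF V)) (cong (λ z → ⟦ z ⟧ * ⟦ z ⟧) size-V)))))
          (0<-⇒< (0<-cancel (subst (0r <_) (trans (solve 3 (λ K s n → n :* (con (pos 5) :* (con (pos 2) :* s :- (n :- K)) :+ (con (pos 5) :* K :+ s)) := (con (pos 10) :* K :+ con (pos 11) :* s) :* n :- con (pos 5) :* (n :* n)) refl K s ⟦ n ⟧)
              (trans (cong (λ z → (⟦ 10 ⟧ * K + z) * ⟦ n ⟧ - ⟦ 5 ⟧ * (⟦ n ⟧ * ⟦ n ⟧)) (sym D-value)) (solve 3 (λ K D n → (con (pos 10) :* K :+ con (pos 5) :* (D :* K)) :* n :- con (pos 5) :* (n :* n) := con (pos 5) :* ((con (pos 2) :+ D) :* K :* n :- n :* n)) refl K D ⟦ n ⟧)))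
            (<-* (ι-mono-< pn) (<-≤-trans (0<-+-≤ (<-* (0<ι 4) pK) 0≤s) (by-difference (0≤-* (0≤ι 5) (≤⇒0≤- (subst (λ z → ⟦ z ⟧ - K ≤ ⟦ 2 ⟧ * s) size-V u)))
              (solve 3 (λ K s n → con (pos 5) :* (con (pos 2) :* s :- (n :- K)) := (con (pos 5) :* (con (pos 2) :* s :- (n :- K)) :+ (con (pos 5) :* K :+ s)) :- (con (pos 5) :* K :+ s)) refl K s ⟦ n ⟧)))))))
          where
          0<-cancel : ∀ {x} → 0r < ⟦ 5 ⟧ * x → 0r < x
          0<-cancel {x} p = [ (λ q → q) , (λ q → ⊥-elim (≤⇒≯ (by-difference (0≤-* (0≤ι 5) (≤⇒0≤- q)) (solve 1 (λ x → con (pos 5) :* (con (pos 0) :- x) := con (pos 0) :- con (pos 5) :* x) refl x)) p)) ]′ (<-≤-connex 0r x)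

-- Counting edges with loops and searching for the subgraph

module _ {n : ℕ} (G : Graph n) where
  -- The loops raise the count over all vertices from 2|E| to n + 2|E|, which absorbs the -1 of the
  -- degree hypothesis.
  touching : Rel n
  touching i j = ≡ᶠ i j ∨ adj G i j

  touching-adj : ∀ i j → i ≢ j → adj G i j ≡ false → touching i j ≡ false
  touching-adj i j i≢j e = bool-ext {b = false} (λ p → ⊥-elim (cases (≡ᶠ i j) refl (trans (cong (≡ᶠ i j ∨_) (sym e)) p))) (λ ())
    where
    cases : ∀ b → ≡ᶠ i j ≡ b → b ∨ false ≡ true → ⊥
    cases true h _ = i≢j (≡ᶠ-sound i j h)
    cases false _ ()

  touching-refl : ∀ i → touching i i ≡ true
  touching-refl i = cong (_∨ adj G i i) (≡ᶠ-refl i)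

  twice-edges : n ℕ.+ 2 ℕ.* numEdges G ℕ.≤ within touching (λ _ → true)
  twice-edges = ℕₚ.≤-trans (ℕₚ.+-mono-≤ loops (ℕₚ.≤-reflexive (cong (numEdges G ℕ.+_) (cong (ℕ._+ 0) (sym swapped)))))
      (ℕₚ.≤-trans (total-mono (≡ᶠ ∷ up ∷ down ∷ []) (touching ∷ []) (λ i j → ≤ᵇ-true (mp (decide 4
          (λ e l g x → ((e ⟹ (not l ∧ not g)) ∧ not (l ∧ g)) ⟹ (([ e ]₀₁ ℕ.+ ([ l ∧ x ]₀₁ ℕ.+ ([ g ∧ x ]₀₁ ℕ.+ 0))) ℕ.≤ᵇ ([ e ∨ x ]₀₁ ℕ.+ 0))) refl
          (≡ᶠ i j) (toℕ i ℕ.<ᵇ toℕ j) (toℕ j ℕ.<ᵇ toℕ i) (adj G i j))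
        (∧-intro (imp (λ e → apart i j (≡ᶠ-sound i j e))) (cong not (bool-ext {b = false} (λ p → ⊥-elim (asymmetric i j p)) (λ ())))))))
        (ℕₚ.≤-reflexive (ℕₚ.+-identityʳ (pairs touching))))
    where
    up down : Rel n
    up i j = (toℕ i ℕ.<ᵇ toℕ j) ∧ adj G i j
    down i j = (toℕ j ℕ.<ᵇ toℕ i) ∧ adj G i j
    swapped : pairs down ≡ numEdges G
    swapped = trans (pairs-cong (λ i j → cong ((toℕ j ℕ.<ᵇ toℕ i) ∧_) (Graph.sym G i j))) (sumF-swap (λ i j → [ (toℕ j ℕ.<ᵇ toℕ i) ∧ adj G j i ]₀₁))
    loops : n ℕ.≤ pairs {n} ≡ᶠ
    loops = ℕₚ.≤-trans (ℕₚ.≤-reflexive (sym (sumF-1 n))) (sumF-mono {n} {λ _ → 1} {λ i → countF (≡ᶠ i)} (λ i → countF-pos {f = ≡ᶠ i} i (≡ᶠ-refl i)))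
    irreflexive : ∀ m → (m ℕ.<ᵇ m) ≡ false
    irreflexive zero = refl
    irreflexive (suc m) = irreflexive m
    apart : ∀ i j → i ≡ j → not (toℕ i ℕ.<ᵇ toℕ j) ∧ not (toℕ j ℕ.<ᵇ toℕ i) ≡ true
    apart i j refl = cong (λ b → not b ∧ not b) (irreflexive (toℕ i))
    asymmetric : ∀ i j → (toℕ i ℕ.<ᵇ toℕ j) ∧ (toℕ j ℕ.<ᵇ toℕ i) ≡ true → ⊥
    asymmetric i j p = ℕₚ.<-asym (ℕₚ.<ᵇ⇒< (toℕ i) (toℕ j) (subst T (sym (proj₁ (∧-true p))) tt)) (ℕₚ.<ᵇ⇒< (toℕ j) (toℕ i) (subst T (sym (proj₂ (∧-true {toℕ i ℕ.<ᵇ toℕ j} p))) tt))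

  separation-cong : ∀ {E : Rel n} {k X Y} → (∀ i → X i ≡ Y i) → Separation E k X → Separation E k Y
  separation-cong e S = record
    { A = A ; B = B ; covers = λ i → trans (sym (e i)) (covers i) ; order = order
    ; proper-A = subst (countF A ℕ.<_) (countF-cong e) proper-A ; proper-B = subst (countF B ℕ.<_) (countF-cong e) proper-B
    ; no-edge = no-edge ; no-edge′ = no-edge′ }
    where open Separation S

  -- The only link between the graph and the counting: without a suitable subgraph every big vertex
  -- set has a separation, and all else is arithmetic about such sets.
  search : ∀ k (Big : ℕ → Set) → (∀ m → Big m ⊎ ¬ Big m) → (∀ {m} → Big m → suc (suc k) ℕ.≤ m) →
    (Σ ℕ λ m → Σ (Graph m) λ H → Σ (Fin m → Fin n) λ f → SubgraphVia H G f × Connected (suc k) H × Big m) ⊎ (∀ X → Big (countF X) → Separation touching k X)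
  search k Big big? large = [ (λ { (_ , found) → inj₁ found }) , (λ none → inj₂ (λ X big → separation-cong (λ i → Vecₚ.lookup∘tabulate X i)
      (none (tabulate X) (subst Big (countF-cong (λ i → sym (Vecₚ.lookup∘tabulate X i))) big)))) ]′
      (searchSubset n {λ _ → Σ ℕ λ m → Σ (Graph m) λ H → Σ (Fin m → Fin n) λ f → SubgraphVia H G f × Connected (suc k) H × Big m} {λ Y → Big (countF (lookup Y)) → Separation touching k (lookup Y)} test)
    where
    test : ∀ Y → (Σ ℕ λ m → Σ (Graph m) λ H → Σ (Fin m → Fin n) λ f → SubgraphVia H G f × Connected (suc k) H × Big m) ⊎ (Big (countF (lookup Y)) → Separation touching k (lookup Y))
    test Y = [ (λ big → [ (λ { (H , sub , conn) → inj₁ (_ , H , _ , sub , conn , subst Big (Enumeration.size (enumerate (lookup Y))) big) }) , (λ sep → inj₂ (λ _ → sep)) ]′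
        (connected-or-separated G touching touching-adj k (lookup Y) (large big))) , (λ ¬big → inj₂ (λ big → ⊥-elim (¬big big))) ]′ (big? (countF (lookup Y)))

-- From the three alternatives to their arithmetic cores

module Assembly (R : RealField) where
  open Reals R
  open Energy R

  inverse : ∀ {x} → 0r < x → x * x ⁻¹ ≡ 1r
  inverse {x} p = *-invʳ x (λ e → <-irrefl 0r (subst (0r <_) e p))

  average : ∀ {x y w} → 0r < w → x ≤ y * w ⁻¹ → x * w ≤ y
  average {x} {y} {w} p h = by-difference (0≤-* (≤⇒0≤- h) (<⇒≤ p)) (trans (solve 4 (λ x y w v → (y :* v :- x) :* w := y :* (w :* v) :- x :* w) refl x y w (w ⁻¹))
    (trans (cong (λ z → y * z - x * w) (inverse p)) (cong (_- x * w) (*-identʳ y))))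

  antisym : ∀ {x y} → x ≤ y → y ≤ x → x ≡ y
  antisym (inj₂ e) _ = e
  antisym (inj₁ p) q = ⊥-elim (≤⇒≯ q p)

  0<-root : ∀ {x y} → 0r ≤ x → 0r < y → x * x ≡ y → 0r < x
  0<-root (inj₁ p) _ _ = p
  0<-root (inj₂ refl) q e = ⊥-elim (<-irrefl 0r (subst (0r <_) (trans (sym e) (zeroˡ 0r)) q))

  0≤-inverse : ∀ {x} → 0r < x → 0r ≤ x ⁻¹
  0≤-inverse p = 0≤-*-cancel p (subst (0r ≤_) (sym (inverse p)) (<⇒≤ 0<1))

  root : ∀ x → 0r ≤ x → (0r ≤ sqrt x) × (sqrt x * sqrt x ≡ x)
  root x p = sqrt-nonneg x p , sqrt-sq x p

  module _ {k n : ℕ} (pk : 1 ℕ.≤ k) (pn : 1 ℕ.≤ n) (G : Graph n) where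
    private
      K = ⟦ k ⟧
      pK : 0r < K
      pK = ι-mono-< pk
      E = touching G
      ē = ⟦ within E (λ _ → true) ⟧

      Result : Carrier → Set
      Result θ = Σ ℕ λ m → Σ (Graph m) λ H → Σ (Fin m → Fin n) λ f → SubgraphVia H G f × Connected (suc k) H × (θ < ⟦ m ⟧)

    dense : ∀ {δ} → δ * K - 1r ≤ ⟦ 2 ℕ.* numEdges G ⟧ * ⟦ n ⟧ ⁻¹ → δ * K * ⟦ n ⟧ ≤ ē
    dense {δ} h = ≤-trans (by-difference (≤⇒0≤- (average (ι-mono-< pn) h)) (trans (solve 4 (λ d n e o → e :- (d :- o) :* n := (o :* n :+ e) :- d :* n) refl (δ * K) ⟦ n ⟧ ⟦ 2 ℕ.* numEdges G ⟧ 1r)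
      (cong (λ z → (z + ⟦ 2 ℕ.* numEdges G ⟧) - δ * K * ⟦ n ⟧) (*-identˡ ⟦ n ⟧)))) (subst (_≤ ē) (ι-+ n (2 ℕ.* numEdges G)) (ι-mono-≤ (twice-edges G)))

    by-size : ∀ θ → (∀ {m} → θ < ⟦ m ⟧ → suc (suc k) ℕ.≤ m) → ¬ (∀ X → θ < ⟦ countF X ⟧ → Separation E k X) → Result θ
    by-size θ large absurd = [ (λ r → r) , (λ sep → ⊥-elim (absurd sep)) ]′
      (search G k (λ m → θ < ⟦ m ⟧) (λ m → [ inj₁ , (λ p → inj₂ (≤⇒≯ p)) ]′ (<-≤-connex θ ⟦ m ⟧)) large)

    -- When θ < k + 2, any subgraph with k + 2 vertices is large enough, so separations may be
    -- assumed for all sets from that size on.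
    by-order : ∀ θ → θ < ⟦ suc (suc k) ⟧ → ¬ (∀ X → suc (suc k) ℕ.≤ countF X → Separation E k X) → Result θ
    by-order θ small absurd = [ (λ { (m , H , f , sub , conn , le) → m , H , f , sub , conn , <-≤-trans small (ι-mono-≤ le) }) , (λ sep → ⊥-elim (absurd sep)) ]′
      (search G k (λ m → suc (suc k) ℕ.≤ m) (λ m → [ inj₁ , inj₂ ]′ (decided (suc (suc k) ℕ.≤? m))) (λ le → le))
      where
      decided : ∀ {P : Set} → Dec P → P ⊎ ¬ P
      decided (yes p) = inj₁ p
      decided (no p) = inj₂ p

    -- More than (1 + σ) k ≥ k + 1 vertices means at least k + 2, the least order of a
    -- (k+1)-connected graph.
    threshold : ∀ {σ} → ⟦ 1 ⟧ ≤ σ * K → ∀ {m} → (1r + σ) * K < ⟦ m ⟧ → suc (suc k) ℕ.≤ m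
    threshold {σ} h {m} p = ι-cancel-< {suc k} {m} (≤-<-trans (by-difference (≤⇒0≤- h) (trans (solve 3 (λ o s K → s :* K :- con (pos 1) := (K :+ s :* K) :- (con (pos 1) :+ K)) refl 1r σ K)
      (cong₂ (λ y z → (y + σ * K) - (z + K)) (sym (*-identˡ K)) ι-1))) (subst (_< ⟦ m ⟧) (distribʳ K 1r σ) p))

    excess-size : ∀ {σ x} → σ * K < x - K → (1r + σ) * K < x
    excess-size {σ} {x} p = 0<-⇒< (subst (0r <_) (trans (solve 3 (λ x K y → (x :- K) :- y := x :- (K :+ y)) refl x K (σ * K))
      (cong (λ z → x - z) (sym (trans (distribʳ K 1r σ) (cong (_+ σ * K) (*-identˡ K)))))) (<⇒0<- p))

    case-one : ∀ {σ} → (sqrt ⟦ 2 ⟧ + 1r) * sqrt ⟦ 3 ⟧ ⁻¹ ≤ σ → (⟦ 2 ⟧ + σ + (⟦ 3 ⟧ * σ) ⁻¹) * K * ⟦ n ⟧ ≤ ē → Result ((1r + σ) * K)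
    case-one {σ} h many = by-size ((1r + σ) * K) (threshold σK) (λ sep → One.alternative-one R E k σ-large σe sep pK pn (subst (λ z → z * K * ⟦ n ⟧ ≤ ē) (+-assoc _ _ _) many))
      where
      r₂ = sqrt ⟦ 2 ⟧
      r₃ = sqrt ⟦ 3 ⟧
      h₂ = root ⟦ 2 ⟧ (0≤ι 2)
      h₃ = root ⟦ 3 ⟧ (0≤ι 3)
      p₃ : 0r < r₃
      p₃ = 0<-root (proj₁ h₃) (0<ι 2) (proj₂ h₃)
      -- A rational route to σ ≥ 4/3: √2 ≥ 7/5 gives σ √3 ≥ 12/5, and σ² ≥ 48/25 exceeds 16/9.
      r₂-low : ⟦ 7 ⟧ ≤ ⟦ 5 ⟧ * r₂
      r₂-low = square-cancel-≤ (0≤-* (0≤ι 5) (proj₁ h₂)) (by-difference (0≤ι 1) (trans (solve 0 (con (pos 1) := con (pos 25) :* con (pos 2) :- con (pos 7) :* con (pos 7)) refl)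
        (trans (cong (λ z → ⟦ 25 ⟧ * z - ⟦ 7 ⟧ * ⟦ 7 ⟧) (sym (proj₂ h₂))) (solve 1 (λ r → con (pos 25) :* (r :* r) :- con (pos 7) :* con (pos 7) := (con (pos 5) :* r) :* (con (pos 5) :* r) :- con (pos 7) :* con (pos 7)) refl r₂))))
      product : ⟦ 12 ⟧ ≤ ⟦ 5 ⟧ * (σ * r₃)
      product = by-difference (0≤-+ (0≤-* (0≤ι 5) (0≤-* (≤⇒0≤- h) (<⇒≤ p₃))) (≤⇒0≤- r₂-low))
        (trans (cong (λ z → ⟦ 5 ⟧ * ((σ - z) * r₃) + (⟦ 5 ⟧ * r₂ - ⟦ 7 ⟧)) refl) (trans (solve 5 (λ r₂ r₃ v σ o → con (pos 5) :* ((σ :- (r₂ :+ o) :* v) :* r₃) :+ (con (pos 5) :* r₂ :- con (pos 7)) :=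
            con (pos 5) :* (σ :* r₃) :- con (pos 5) :* ((r₂ :+ o) :* (r₃ :* v)) :+ (con (pos 5) :* r₂ :- con (pos 7))) refl r₂ r₃ (r₃ ⁻¹) σ 1r)
          (trans (cong (λ z → ⟦ 5 ⟧ * (σ * r₃) - ⟦ 5 ⟧ * z + (⟦ 5 ⟧ * r₂ - ⟦ 7 ⟧)) (trans (cong ((r₂ + 1r) *_) (inverse p₃)) (trans (*-identʳ _) (cong (r₂ +_) (sym ι-1)))))
            (solve 2 (λ x r → con (pos 5) :* x :- con (pos 5) :* (r :+ con (pos 1)) :+ (con (pos 5) :* r :- con (pos 7)) := con (pos 5) :* x :- con (pos 12)) refl (σ * r₃) r₂))))
      0≤σ : 0r ≤ σ
      0≤σ = 0≤-*-cancel p₃ (subst (0r ≤_) (*-comm σ r₃) (0≤-*-cancel (0<ι 4) (≤-trans (0≤ι 12) product)))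
      σ-large : ⟦ 4 ⟧ ≤ ⟦ 3 ⟧ * σ
      σ-large = square-cancel-≤ (0≤-* (0≤ι 3) 0≤σ) (0≤-⇒≤ (0≤-*-cancel (0<ι 24) (subst (0r ≤_)
        (trans (solve 2 (λ σ r → con (pos 3) :* ((con (pos 5) :* (σ :* r) :- con (pos 12)) :* (con (pos 5) :* (σ :* r) :+ con (pos 12))) :+ con (pos 32) := con (pos 75) :* ((σ :* σ) :* (r :* r)) :- con (pos 400)) refl σ r₃)
          (trans (cong (λ z → ⟦ 75 ⟧ * ((σ * σ) * z) - ⟦ 400 ⟧) (proj₂ h₃)) (solve 1 (λ σ → con (pos 75) :* ((σ :* σ) :* con (pos 3)) :- con (pos 400) := con (pos 25) :* ((con (pos 3) :* σ) :* (con (pos 3) :* σ) :- con (pos 4) :* con (pos 4))) refl σ)))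
        (0≤-+ (0≤-* (0≤ι 3) (0≤-* (≤⇒0≤- product) (0≤-+ (≤-trans (0≤ι 12) product) (0≤ι 12)))) (0≤ι 32)))))
      0<3σ : 0r < ⟦ 3 ⟧ * σ
      0<3σ = <-≤-trans (0<ι 3) σ-large
      σe : ⟦ 3 ⟧ * (σ * (⟦ 3 ⟧ * σ) ⁻¹) ≡ 1r
      σe = trans (sym (*-assoc _ _ _)) (inverse 0<3σ)
      σK : ⟦ 1 ⟧ ≤ σ * K
      σK = 0≤-⇒≤ (0≤-*-cancel (0<ι 2) (subst (0r ≤_) (solve 2 (λ σ K → (con (pos 3) :* σ :- con (pos 4)) :* K :+ (con (pos 4) :* (K :- con (pos 1)) :+ con (pos 1)) := con (pos 3) :* (σ :* K :- con (pos 1))) refl σ K)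
        (0≤-+ (0≤-* (≤⇒0≤- σ-large) (<⇒≤ pK)) (0≤-+ (0≤-* (0≤ι 4) (≤⇒0≤- (ι-mono-≤ pk))) (0≤ι 1)))))

    private
      D₃ : Carrier
      D₃ = ⟦ 3109 ⟧ * ⟦ 1000 ⟧ ⁻¹ - ⟦ 2 ⟧
      D₃-value : ⟦ 1000 ⟧ * D₃ ≡ ⟦ 1109 ⟧
      D₃-value = trans (solve 1 (λ v → con (pos 1000) :* (con (pos 3109) :* v :- con (pos 2)) := con (pos 3109) :* (con (pos 1000) :* v) :- con (pos 2000)) refl (⟦ 1000 ⟧ ⁻¹))
        (trans (cong (λ z → ⟦ 3109 ⟧ * z - ⟦ 2000 ⟧) (trans (inverse (0<ι 999)) (sym ι-1))) (solve 0 (con (pos 3109) :* con (pos 1) :- con (pos 2000) := con (pos 1109)) refl))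
      small-θ : ∀ {σ} → σ * K < ⟦ 2 ⟧ → (1r + σ) * K < ⟦ suc (suc k) ⟧
      small-θ {σ} p = excess-size (<-≤-trans p (≤-reflexive (trans (solve 1 (λ K → con (pos 2) := (con (pos 2) :+ K) :- K) refl K) (cong (_- K) (sym (ι-+ 2 k))))))

    case-three : ∀ {σ} → ⟦ 5 ⟧ * σ ≡ 1r → (⟦ 3109 ⟧ * ⟦ 1000 ⟧ ⁻¹) * K * ⟦ n ⟧ ≤ ē → Result ((1r + σ) * K)
    case-three {σ} 5σ many = [ small , large ]′ (cases k pk)
      where
      many′ : (⟦ 2 ⟧ + D₃) * K * ⟦ n ⟧ ≤ ē
      many′ = subst (λ z → z * K * ⟦ n ⟧ ≤ ē) (solve 1 (λ d → d := con (pos 2) :+ (d :- con (pos 2))) refl (⟦ 3109 ⟧ * ⟦ 1000 ⟧ ⁻¹)) many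
      5σK : ⟦ 5 ⟧ * (σ * K) ≡ K
      5σK = trans (sym (*-assoc _ _ _)) (trans (cong (_* K) 5σ) (*-identˡ K))
      -- From k = 5 on, σ k is at least 1, so exceeding (1 + σ) k means having k + 2 vertices. Below
      -- that, sets of k + 1 vertices are large but no separation of them is available.
      cases : ∀ k → 1 ℕ.≤ k → (k ℕ.≤ 4 × suitable k ≡ true) ⊎ 5 ℕ.≤ k
      cases 1 _ = inj₁ (s≤s z≤n , refl)
      cases 2 _ = inj₁ (s≤s (s≤s z≤n) , refl)
      cases 3 _ = inj₁ (s≤s (s≤s (s≤s z≤n)) , refl)
      cases 4 _ = inj₁ (s≤s (s≤s (s≤s (s≤s z≤n))) , refl)
      cases (suc (suc (suc (suc (suc k))))) _ = inj₂ (s≤s (s≤s (s≤s (s≤s (s≤s z≤n)))))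
      small : k ℕ.≤ 4 × suitable k ≡ true → Result ((1r + σ) * K)
      small (k≤4 , suits) = by-order ((1r + σ) * K) (small-θ below) (λ sep → Small.small-order R E (touching-refl G) k D₃ D₃-value suits sep pk pn many′)
        where
        below : σ * K < ⟦ 2 ⟧
        below = 0<-⇒< (<-≤-trans (0<ι 0) (0≤-⇒≤ (0≤-*-cancel (0<ι 4) (subst (0r ≤_) (trans (cong (λ z → (⟦ 4 ⟧ - z) + ⟦ 1 ⟧) (sym 5σK)) (solve 1 (λ y → (con (pos 4) :- con (pos 5) :* y) :+ con (pos 1) := con (pos 5) :* ((con (pos 2) :- y) :- con (pos 1))) refl (σ * K)))
          (0≤-+ (≤⇒0≤- (ι-mono-≤ k≤4)) (0≤ι 1))))))
      large : 5 ℕ.≤ k → Result ((1r + σ) * K)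
      large 5≤k = by-size ((1r + σ) * K) (threshold (0≤-⇒≤ (0≤-*-cancel (0<ι 4) (subst (0r ≤_) (trans (cong (_- ⟦ 5 ⟧) (sym 5σK)) (solve 1 (λ y → con (pos 5) :* y :- con (pos 5) := con (pos 5) :* (y :- con (pos 1))) refl (σ * K)))
          (≤⇒0≤- (ι-mono-≤ 5≤k))))))
        (λ sep → Bootstrap.alternative-three R E k D₃ D₃-value pK (λ X big → sep X (excess-size (0<-⇒< (0<-cancel (subst (0r <_) (trans (cong (λ z → ⟦ 5 ⟧ * (⟦ countF X ⟧ - K) - z) (sym 5σK))
          (solve 2 (λ x y → con (pos 5) :* x :- con (pos 5) :* y := con (pos 5) :* (x :- y)) refl (⟦ countF X ⟧ - K) (σ * K))) (<⇒0<- big)))))) pn many′)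
        where
        0<-cancel : ∀ {x} → 0r < ⟦ 5 ⟧ * x → 0r < x
        0<-cancel {x} p = [ (λ q → q) , (λ q → ⊥-elim (≤⇒≯ (by-difference (0≤-* (0≤ι 5) (≤⇒0≤- q)) (solve 1 (λ x → con (pos 5) :* (con (pos 0) :- x) := con (pos 0) :- con (pos 5) :* x) refl x)) p)) ]′ (<-≤-connex 0r x)

    case-two : ∀ {σ τ} → 0r ≤ σ → ⟦ 18 ⟧ * (σ * σ) ≡ ⟦ 5 ⟧ → ⟦ 5 ⟧ * τ ≡ ⟦ 11 ⟧ * σ → (⟦ 2 ⟧ + τ) * K * ⟦ n ⟧ ≤ ē → Result ((1r + σ) * K)
    case-two {σ} {τ} 0≤σ σ² τσ many = [ large , small ]′ (cases k pk)
      where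
      cases : ∀ k → 1 ℕ.≤ k → 2 ℕ.≤ k ⊎ k ≡ 1
      cases 1 _ = inj₂ refl
      cases (suc (suc k)) _ = inj₁ (s≤s (s≤s z≤n))
      0<σ : 0r < σ
      0<σ = 0<-root 0≤σ (subst (0r <_) (solve 1 (λ y → y := y) refl (σ * σ)) (positive (subst (0r <_) (sym σ²) (0<ι 4)))) refl
        where
        positive : ∀ {y} → 0r < ⟦ 18 ⟧ * y → 0r < y
        positive {y} p = [ (λ q → q) , (λ q → ⊥-elim (≤⇒≯ (by-difference (0≤-* (0≤ι 18) (≤⇒0≤- q)) (solve 1 (λ x → con (pos 18) :* (con (pos 0) :- x) := con (pos 0) :- con (pos 18) :* x) refl y)) p)) ]′ (<-≤-connex 0r y)
      K² : ⟦ 5 ⟧ * (K * K) ≡ ⟦ 18 ⟧ * ((σ * K) * (σ * K))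
      K² = trans (cong (_* (K * K)) (sym σ²)) (solve 2 (λ σ K → (con (pos 18) :* (σ :* σ)) :* (K :* K) := con (pos 18) :* ((σ :* K) :* (σ :* K))) refl σ K)
      large : 2 ℕ.≤ k → Result ((1r + σ) * K)
      large 2≤k = by-size ((1r + σ) * K) (threshold σK) (λ sep → Two.alternative-two R E k τ (σ * K) pK (<-* 0<σ pK)
          (trans (sym (*-assoc _ _ _)) (trans (cong (_* K) τσ) (*-assoc _ _ _))) K² (λ X big → sep X (excess-size big)) pn many)
        where
        -- From k = 2 on, 5k² / 18 is at least 1.
        σK : ⟦ 1 ⟧ ≤ σ * K
        σK = square-cancel-≤ (0≤-* 0≤σ (<⇒≤ pK)) (0≤-⇒≤ (0≤-*-cancel (0<ι 17) (subst (0r ≤_) (trans (solve 1 (λ K → con (pos 5) :* ((K :- con (pos 2)) :* (K :+ con (pos 2))) :+ con (pos 2) := con (pos 5) :* (K :* K) :- con (pos 18)) refl K)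
            (trans (cong (_- ⟦ 18 ⟧) K²) (solve 1 (λ y → con (pos 18) :* y :- con (pos 18) := con (pos 18) :* (y :- con (pos 1) :* con (pos 1))) refl ((σ * K) * (σ * K)))))
          (0≤-+ (0≤-* (0≤ι 5) (0≤-* (≤⇒0≤- (ι-mono-≤ 2≤k)) (0≤-+ (<⇒≤ pK) (0≤ι 2)))) (0≤ι 2)))))
      -- For k = 1 the table of alternative (3) is used: δ is at least 3.109 here as well, since 11σ
      -- / 5 ≥ 1.109, and σ ≤ 1 keeps the threshold below k + 2.
      small : k ≡ 1 → Result ((1r + σ) * K)
      small k≡1 = by-order ((1r + σ) * K) (small-θ (≤-<-trans σK≤1 (ι-mono-< {1} {2} (s≤s (s≤s z≤n))))) (λ sep → Small.small-order R E (touching-refl G) k D₃ D₃-value (subst (λ j → suitable j ≡ true) (sym k≡1) refl) sep pk pn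
          (≤-trans (by-difference (0≤-* (0≤-* (≤⇒0≤- D₃≤τ) (<⇒≤ pK)) (0≤ι n)) (solve 4 (λ d t K n → ((t :- d) :* K) :* n := (con (pos 2) :+ t) :* K :* n :- (con (pos 2) :+ d) :* K :* n) refl D₃ τ K ⟦ n ⟧)) many))
        where
        σ≤1 : σ ≤ ⟦ 1 ⟧
        σ≤1 = square-cancel-≤ (0≤ι 1) (0≤-⇒≤ (0≤-*-cancel (0<ι 17) (subst (0r ≤_) (trans (solve 0 (con (pos 13) := con (pos 18) :- con (pos 5)) refl) (trans (cong (λ z → ⟦ 18 ⟧ - z) (sym σ²))
          (solve 1 (λ y → con (pos 18) :- con (pos 18) :* y := con (pos 18) :* (con (pos 1) :* con (pos 1) :- y)) refl (σ * σ)))) (0≤ι 13))))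
        σK≤1 : σ * K ≤ ⟦ 1 ⟧
        σK≤1 = ≤-trans (≤-reflexive (trans (cong (σ *_) (trans (cong ⟦_⟧ k≡1) ι-1)) (*-identʳ σ))) σ≤1
        σ-low : ⟦ 1109 ⟧ ≤ ⟦ 2200 ⟧ * σ
        σ-low = square-cancel-≤ (0≤-* (0≤ι 2200) 0≤σ) (0≤-⇒≤ (0≤-*-cancel (0<ι 17) (subst (0r ≤_) (trans (solve 0 (con (pos 2062142) := con (pos 4840000) :* con (pos 5) :- con (pos 22137858)) refl) (trans (cong (λ z → ⟦ 4840000 ⟧ * z - ⟦ 22137858 ⟧) (sym σ²))
          (solve 1 (λ y → con (pos 4840000) :* (con (pos 18) :* (y :* y)) :- con (pos 22137858) := con (pos 18) :* ((con (pos 2200) :* y) :* (con (pos 2200) :* y) :- con (pos 1109) :* con (pos 1109))) refl σ))) (0≤ι 2062142))))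
        D₃≤τ : D₃ ≤ τ
        D₃≤τ = 0≤-⇒≤ (0≤-*-cancel (0<ι 999) (subst (0r ≤_) (trans (solve 1 (λ y → con (pos 2200) :* y :- con (pos 1109) := con (pos 200) :* (con (pos 11) :* y) :- con (pos 1109)) refl σ)
          (trans (cong₂ (λ y z → ⟦ 200 ⟧ * y - z) (sym τσ) (sym D₃-value)) (solve 2 (λ t d → con (pos 200) :* (con (pos 5) :* t) :- con (pos 1000) :* d := con (pos 1000) :* (t :- d)) refl τ D₃))) (≤⇒0≤- σ-low)))

    module Surd where
      v₂ = ⟦ 2 ⟧ ⁻¹
      v₃ = ⟦ 3 ⟧ ⁻¹
      v₁₀ = ⟦ 10 ⟧ ⁻¹
      u = sqrt (⟦ 5 ⟧ * v₂)
      w = sqrt v₁₀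
      one : ∀ m → ⟦ suc m ⟧ * ⟦ suc m ⟧ ⁻¹ ≡ ⟦ 1 ⟧
      one m = trans (inverse (0<ι m)) (sym ι-1)
      hu = root (⟦ 5 ⟧ * v₂) (0≤-* (0≤ι 5) (0≤-inverse (0<ι 1)))
      hw = root v₁₀ (0≤-inverse (0<ι 9))
      u² : ⟦ 2 ⟧ * (u * u) ≡ ⟦ 5 ⟧
      u² = trans (cong (⟦ 2 ⟧ *_) (proj₂ hu)) (trans (solve 1 (λ v → con (pos 2) :* (con (pos 5) :* v) := con (pos 5) :* (con (pos 2) :* v)) refl v₂) (trans (cong (⟦ 5 ⟧ *_) (one 1)) (solve 0 (con (pos 5) :* con (pos 1) := con (pos 5)) refl)))
      w² : ⟦ 10 ⟧ * (w * w) ≡ ⟦ 1 ⟧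
      w² = trans (cong (⟦ 10 ⟧ *_) (proj₂ hw)) (one 9)
      squares : ⟦ 2 ⟧ * (u * u) ≡ ⟦ 2 ⟧ * ((⟦ 5 ⟧ * w) * (⟦ 5 ⟧ * w))
      squares = trans u² (trans (solve 0 (con (pos 5) := con (pos 5) :* con (pos 1)) refl) (trans (cong (⟦ 5 ⟧ *_) (sym w²)) (solve 1 (λ w → con (pos 5) :* (con (pos 10) :* (w :* w)) := con (pos 2) :* ((con (pos 5) :* w) :* (con (pos 5) :* w))) refl w)))
      half : ∀ {x y} → ⟦ 2 ⟧ * x ≡ ⟦ 2 ⟧ * y → x ≤ y
      half {x} {y} e = 0≤-⇒≤ (0≤-*-cancel (0<ι 1) (subst (0r ≤_) (solve 2 (λ x y → con (pos 2) :* y :- con (pos 2) :* x := con (pos 2) :* (y :- x)) refl x y) (≤⇒0≤- (≤-reflexive e))))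
      -- Both are nonnegative with square 5/2. This links the two surds of alternative (2) and turns
      -- δ - 2 into 11σ / 5, which is σ + 1 / (3σ).
      u≡5w : u ≡ ⟦ 5 ⟧ * w
      u≡5w = antisym (square-cancel-≤ (0≤-* (0≤ι 5) (proj₁ hw)) (half squares)) (square-cancel-≤ (proj₁ hu) (half (sym squares)))
      σ = v₃ * u
      0≤σ : 0r ≤ σ
      0≤σ = 0≤-* (0≤-inverse (0<ι 2)) (proj₁ hu)
      σ² : ⟦ 18 ⟧ * (σ * σ) ≡ ⟦ 5 ⟧
      σ² = trans (solve 2 (λ v u → con (pos 18) :* ((v :* u) :* (v :* u)) := ((con (pos 3) :* v) :* (con (pos 3) :* v)) :* (con (pos 2) :* (u :* u))) refl v₃ u)
        (trans (cong₂ (λ y z → (y * y) * z) (one 2) u²) (solve 0 ((con (pos 1) :* con (pos 1)) :* con (pos 5) := con (pos 5)) refl))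
      τσ : ⟦ 5 ⟧ * (⟦ 11 ⟧ * v₃ * w) ≡ ⟦ 11 ⟧ * σ
      τσ = trans (solve 2 (λ v w → con (pos 5) :* (con (pos 11) :* v :* w) := con (pos 11) :* (v :* (con (pos 5) :* w))) refl v₃ w) (cong (λ z → ⟦ 11 ⟧ * (v₃ * z)) (sym u≡5w))

    alternatives : ∀ {σ δ} → Alternatives R σ δ → δ * K * ⟦ n ⟧ ≤ ē → Result ((1r + σ) * K)
    alternatives (inj₁ (h , refl)) many = case-one h many
    alternatives (inj₂ (inj₁ (refl , refl))) many = case-two Surd.0≤σ Surd.σ² Surd.τσ many
    alternatives (inj₂ (inj₂ (refl , refl))) many = case-three (inverse (0<ι 4)) many

open import Data.Nat using (ℕ; suc; _≤_; _*_)

theorem1 : (R : RealField) → (k : ℕ) → 1 ≤ k →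
    (σ δ : RealField.Carrier R) → Alternatives R σ δ →
    {n : ℕ} → (G : Graph n) → 1 ≤ n →
    AvgDegreeAtLeast R (2 * numEdges G) n (_-r_ R (RealField._*_ R δ (ι R k)) (RealField.1r R)) →
    Σ ℕ λ m → Σ (Graph m) λ H → Σ (Fin m → Fin n) λ f →
      SubgraphVia H G f × Connected (suc k) H ×
      RealField._<_ R (RealField._*_ R (RealField._+_ R (RealField.1r R) σ) (ι R k)) (ι R m)
theorem1 R k pk σ δ alt G pn h = Assembly.alternatives R pk pn G alt (Assembly.dense R pk pn G h)
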